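{- Let $G$ be a quartic planar graph. Then $G$ has a 4-locally self-avoiding Eulerian circuit if and only if $G$ is connected and does not contain the graph $F_6$ as a subgraph.
   Context: All graphs are finite and simple; quartic means 4-regular. A trail is a sequence of vertices $v_0v_1\ldots v_\ell$ with $v_{i-1}v_i\in E(G)$ for each $i$ and no edge repeated; it is a circuit if $v_\ell=v_0$, and Eulerian if it traverses every edge of the graph. A subcycle of a trail or circuit $x_1x_2\ldots x_n$ is a subtrail $x_ix_{i+1}\ldots x_j$ of consecutive vertices (read cyclically for a circuit) with $x_i=x_j$ and $x_i,\ldots,x_{j-1}$ pairwise distinct; its length is its number of edges. A trail or circuit is $k$-locally self-avoiding if it contains no subcycle of length at most $k$. $F_6$ is the complement of $P_2\cup P_4$ (disjoint union of a path on 2 vertices and a path on 4 vertices); explicitly, it has vertices $x,a,b,c,d,y$ and the 11 edges $xa,xb,xc,ya,yc,yd,ab,ad,bc,bd,cd$. -}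

module Defs where

open import Data.Nat using (ℕ; zero; suc; _+_; _*_; _≤_; _<_; _%_; _≤ᵇ_)
open import Data.Nat.DivMod using (m%n<n)
open import Data.Bool using (Bool; true; false; _∧_; _∨_; if_then_else_; not)
open import Data.Fin using (Fin; zero; suc; toℕ; fromℕ<)
open import Data.Fin.Properties using () renaming (_≟_ to _≟F_)

open import Data.Product using (Σ; _×_; _,_; ∃; proj₁; proj₂)
open import Data.Sum using (_⊎_)
open import Relation.Nullary using (¬_)
open import Relation.Nullary.Decidable using (⌊_⌋)
open import Relation.Binary.PropositionalEquality using (_≡_)
open import Relation.Binary.Construct.Closure.ReflexiveTransitive using (Star)
open import Function using (_∘_)
open import Function.Definitions using (Injective)

record Graph (n : ℕ) : Set where
  field
    adj    : Fin n → Fin n → Bool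
    sym    : ∀ u v → adj u v ≡ adj v u
    irrefl : ∀ u → adj u u ≡ false
open Graph public

Adj : ∀ {n} → Graph n → Fin n → Fin n → Set
Adj G u v = adj G u v ≡ true

countF : ∀ {n} → (Fin n → Bool) → ℕ
countF {zero}  p = 0
countF {suc n} p = (if p zero then 1 else 0) + countF (p ∘ suc)

anyF : ∀ {n} → (Fin n → Bool) → Bool
anyF {zero}  p = false
anyF {suc n} p = p zero ∨ anyF (p ∘ suc)

allF : ∀ {n} → (Fin n → Bool) → Bool
allF {zero}  p = true
allF {suc n} p = p zero ∧ allF (p ∘ suc)

anyBelow : ℕ → (ℕ → Bool) → Bool
anyBelow zero    p = false
anyBelow (suc N) p = anyBelow N p ∨ p N

allBelow : ℕ → (ℕ → Bool) → Bool
allBelow zero    p = true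
allBelow (suc N) p = allBelow N p ∧ p N

iter : ∀ {A : Set} → ℕ → (A → A) → A → A
iter zero    f a = a
iter (suc k) f a = f (iter k f a)

eqF : ∀ {n} → Fin n → Fin n → Bool
eqF u v = ⌊ u ≟F v ⌋

degree : ∀ {n} → Graph n → Fin n → ℕ
degree G u = countF (adj G u)

Quartic : ∀ {n} → Graph n → Set
Quartic G = ∀ u → degree G u ≡ 4

numEdges : ∀ {n} → Graph n → ℕ
numEdges {n} G = sumF (λ u → countF (λ v → adj G u v ∧ (toℕ u <ᵇ' toℕ v)))
  where
  _<ᵇ'_ : ℕ → ℕ → Bool
  a <ᵇ' b = suc a ≤ᵇ b
  sumF : ∀ {m} → (Fin m → ℕ) → ℕ
  sumF {zero}  f = 0
  sumF {suc m} f = f zero + sumF (f ∘ suc)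

Connected : ∀ {n} → Graph n → Set
Connected {n} G = Fin n × (∀ u v → Star (Adj G) u v)

-- Subgraph containment of F₆ = complement of P₂ ∪ P₄.
-- Vertices: x = 0, a = 1, b = 2, c = 3, d = 4, y = 5.
-- Edges: xa, xb, xc, ya, yc, yd, ab, ad, bc, bd, cd.

F6edges : Fin 6 → Fin 6 → Bool
F6edges zero (suc zero) = true
F6edges zero (suc (suc zero)) = true
F6edges zero (suc (suc (suc zero))) = true
F6edges (suc (suc (suc (suc (suc zero))))) (suc zero) = true
F6edges (suc (suc (suc (suc (suc zero))))) (suc (suc (suc zero))) = true
F6edges (suc (suc (suc (suc (suc zero))))) (suc (suc (suc (suc zero)))) = true
F6edges (suc zero) (suc (suc zero)) = true
F6edges (suc zero) (suc (suc (suc (suc zero)))) = true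
F6edges (suc (suc zero)) (suc (suc (suc zero))) = true
F6edges (suc (suc zero)) (suc (suc (suc (suc zero)))) = true
F6edges (suc (suc (suc zero))) (suc (suc (suc (suc zero)))) = true
F6edges _ _ = false

ContainsF6 : ∀ {n} → Graph n → Set
ContainsF6 {n} G =
  Σ (Fin 6 → Fin n) λ f →
    Injective _≡_ _≡_ f ×
    (∀ i j → F6edges i j ≡ true → Adj G (f i) (f j))

-- Circuits.  A circuit with m = suc m' edges is given cyclically by its
-- vertex sequence x₀ x₁ … x_{m-1} (the closing edge is x_{m-1} x₀);
-- position k ∈ ℕ is read modulo m.

record Circuit {n} (G : Graph n) : Set where
  field
    len  : ℕ                       -- number of edges is suc len
    vert : Fin (suc len) → Fin n
  at : ℕ → Fin n
  at k = vert (fromℕ< (m%n<n k (suc len)))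
  field
    walk    : ∀ i → i < suc len → Adj G (at i) (at (suc i))
    trail   : ∀ i j → i < suc len → j < suc len →
              ((at i ≡ at j × at (suc i) ≡ at (suc j)) ⊎
               (at i ≡ at (suc j) × at (suc i) ≡ at j)) → i ≡ j
open Circuit public

Eulerian : ∀ {n} {G : Graph n} → Circuit G → Set
Eulerian {n} {G} C = ∀ u v → Adj G u v →
  Σ ℕ λ i → i < suc (len C) ×
    ((at C i ≡ u × at C (suc i) ≡ v) ⊎ (at C i ≡ v × at C (suc i) ≡ u))

-- A subcycle of length L starting at position i (read cyclically):
-- x_i … x_{i+L} with x_i = x_{i+L} and x_i, …, x_{i+L-1} pairwise distinct.
-- Since it is a subtrail of the circuit, 1 ≤ L ≤ number of edges.
SubcycleAt : ∀ {n} {G : Graph n} → Circuit G → ℕ → ℕ → Set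
SubcycleAt C i L =
  1 ≤ L × L ≤ suc (len C) ×
  at C i ≡ at C (i + L) ×
  (∀ p q → p < L → q < L → at C (i + p) ≡ at C (i + q) → p ≡ q)

LocallySelfAvoiding : ℕ → ∀ {n} {G : Graph n} → Circuit G → Set
LocallySelfAvoiding k C =
  ∀ i L → i < suc (len C) → L ≤ k → ¬ SubcycleAt C i L

-- Planarity, combinatorially: existence of a rotation system of Euler
-- genus 0 on every component (Heffter–Edmonds).
--
-- A rotation system: rot u : Fin n → Fin n permutes the neighbours of u
-- cyclically.  Darts are ordered pairs (u , v) with u ~ v; the face
-- permutation is φ (u , v) = (v , rot v u).  Faces = orbits of φ.

record Rotation {n} (G : Graph n) : Set where
  field
    rot      : Fin n → Fin n → Fin n
    rot-adj  : ∀ u v → Adj G u v → Adj G u (rot u v)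
    rot-inj  : ∀ u v w → Adj G u v → Adj G u w → rot u v ≡ rot u w → v ≡ w
    rot-cyc  : ∀ u v w → Adj G u v → Adj G u w →
               Σ ℕ λ k → iter k (rot u) v ≡ w
open Rotation public

module _ {n} (G : Graph n) (R : Rotation G) where
  Dart : Set
  Dart = Fin n × Fin n

  φ : Dart → Dart
  φ (u , v) = (v , rot R v u)

  dartLeq : Dart → Dart → Bool
  dartLeq (u , v) (u' , v') =
    (suc (toℕ u) ≤ᵇ toℕ u') ∨ (eqF u u' ∧ (toℕ v ≤ᵇ toℕ v'))

  -- a dart is the representative of its face if it is lexicographically
  -- minimal in its φ-orbit (orbits have size ≤ n * n)
  faceRep : Fin n → Fin n → Bool
  faceRep u v = adj G u v ∧
    allBelow (n * n) (λ k → dartLeq (u , v) (iter k φ (u , v)))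

  numFaces : ℕ
  numFaces = countSum (λ u → countF (faceRep u))
    where
    countSum : ∀ {m} → (Fin m → ℕ) → ℕ
    countSum {zero}  f = 0
    countSum {suc m} f = f zero + countSum (f ∘ suc)

reachB : ∀ {n} → Graph n → ℕ → Fin n → Fin n → Bool
reachB G zero    u v = eqF u v
reachB G (suc k) u v = reachB G k u v ∨ anyF (λ w → reachB G k u w ∧ adj G w v)

numComponents : ∀ {n} → Graph n → ℕ
numComponents {n} G =
  countF (λ u → allF (λ w → not (reachB G n u w) ∨ (toℕ u ≤ᵇ toℕ w)))

numIsolated : ∀ {n} → Graph n → ℕ
numIsolated G = countF (λ u → not (anyF (adj G u)))

-- Planar: some rotation system satisfies Euler's formula
--   V − E + F = 2·(#components) − (#isolated vertices)
-- (an isolated vertex is a component with no darts, hence no φ-orbit;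
-- for every rotation system each component with an edge has
-- V − E + F = 2 − 2g ≤ 2, so equality means genus 0 everywhere).
Planar : ∀ {n} → Graph n → Set
Planar {n} G = Σ (Rotation G) λ R →
  n + numFaces G R + numIsolated G ≡ 2 * numComponents G + numEdges G

{-# OPTIONS --safe #-}
module Submission where

open import Defs hiding (sym; len; vert; at; walk; trail; Dart)
open import Data.Nat using (ℕ; zero; suc; _+_; _*_; _∸_; _≤_; _<_; z≤n; s≤s; _≡ᵇ_; _<ᵇ_; _/_; _%_; _≤ᵇ_)
open import Data.Nat.Properties
open import Data.Product.Properties using (≡-dec)
open import Data.Bool using (Bool; true; false; _∧_; _∨_; if_then_else_; not; T)
open import Data.Bool.Properties using (T-≡) renaming (_≟_ to _≟B_)
open import Data.Empty using (⊥; ⊥-elim)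
open import Data.Fin using (Fin; zero; suc; toℕ; fromℕ<; combine; remQuot; punchIn; punchOut)
open import Data.Fin.Permutation using (permutation)
open import Data.Fin.Properties using (injective⇒≤)
open import Data.List using (List; []; _∷_; _++_; map; length; upTo; null)
open import Data.List.Membership.Propositional using (_∈_; _∉_)
open import Data.List.Membership.Propositional.Properties using (∈-map⁺; ∈-map⁻; ∈-++⁺ˡ; ∈-++⁺ʳ; ∈-upTo⁺; ∈-upTo⁻)
open import Data.List.Properties using (length-map; length-++)
open import Data.List.Relation.Unary.All using (All; []; _∷_)
open import Data.List.Relation.Unary.Any using (here; there)
open import Data.Maybe using (Maybe; just; nothing; is-nothing; _>>=_; is-just)
open import Data.Nat.DivMod using (m%n<n; m≡m%n+[m/n]*n; [m+kn]%n≡m%n; [m+n]%n≡m%n; %-distribˡ-+; m%n%n≡m%n)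
open import Data.Nat.Induction using (<-wellFounded)
open import Data.Product using (Σ; _×_; _,_; ∃; ∃-syntax; proj₁; proj₂)
open import Data.Sum using (_⊎_; inj₁; inj₂; [_,_]′)
open import Data.Unit using (⊤; tt)
open import Function using (_∘_; case_of_; Equivalence)
open import Function.Bundles using (_⇔_; mk⇔)
open import Function.Definitions using (Injective)
open import Induction.WellFounded using (Acc; acc)
open import Relation.Binary using (DecidableEquality; tri<; tri≈; tri>)
open import Relation.Binary.Construct.Closure.ReflexiveTransitive using (Star; ε; _◅_; _◅◅_)
open import Relation.Binary.PropositionalEquality
open import Relation.Nullary using (¬_; Dec; yes; no)
open import Relation.Nullary.Decidable using (⌊_⌋; toWitness; ¬?; _→-dec_; _⊎-dec_; _×-dec_; map′)
open import Algebra.Properties.CommutativeMonoid.Sum +-0-commutativeMonoid using (sum; ∑-distrib-+; ∑-comm; sum-permute)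
open import Data.List.Membership.DecPropositional (≡-dec _≟_ _≟_) using () renaming (_∈?_ to _∈ᵉ?_)
import Data.Fin.Properties as FP
import Data.List.Relation.Unary.All as All
import Relation.Binary.Construct.Closure.ReflexiveTransitive as Star

-- A dart is an edge with a direction. An Eulerian circuit of a quartic graph amounts to a
-- transition system, a pairing of the four darts at each vertex, whose trails form one single
-- circuit (`Trans`, `Eul`). In a simple graph such a circuit has no subcycles of length one or two,
-- so being 4-locally self-avoiding means that no trail returns to its first vertex after three or
-- four edges: `bad3` and `bad4` are nowhere true.
--
-- Necessity. The circuit visits every vertex, so the graph is connected. If the graph contains F₆,
-- the transitions at its six vertices are one of 3^6 choices; each of them produces a closed trail
-- of length three or four, or a closed trail inside F₆, which cannot be the whole circuit because
-- the vertex x has a fourth edge (`all-flawed`, `Flawed.absurd`).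
--
-- Sufficiency. Connectedness gives some Eulerian transition system, by merging circuits that meet
-- at a vertex (`eulerian-exists`). A descent then removes the closed trails of length three, and
-- afterwards those of length four without creating new ones of length three (`triangle-free`,
-- `quad-free`). For one step of the descent, a short closed trail and its surroundings are
-- described by a finite `State`: some vertices, some of their edges, and the order in which the
-- circuit returns to a chosen set of them. Changing transitions inside that set so that the circuit
-- stays single and more short trails vanish than are seen to appear either lowers the number of
-- short trails, or else a further short trail exists that was not seen. The latter reveals more of
-- the graph and leads to larger states. The case trees `triangleProof` and `quadProof` are finite
-- because all branches end in such an improvement, in a state already treated, in a contradiction
-- with triangle-freeness of the circuit, or in one of the subgraphs K₃₃, K₅ minus an edge, and F₆.
-- The trees are data evaluated by `check`; the mathematical content is `check-sound`.
--
-- Planarity excludes the first two subgraphs. Given Euler's formula, a Jordan curve property is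
-- proved by counting: a cycle extends to a spanning tree plus one edge, and there are too few
-- identifications along face boundaries and across the remaining edges to connect all darts, so the
-- darts fall into two sides. The two sides differ exactly across the cycle (`Cut`). Two vertices
-- with three common neighbours then see them in opposite cyclic orders (`reverse-orient`), which is
-- impossible for three vertices (`no-K₃₃`). In K₅ minus an edge, the triangle of the vertices of
-- degree four separates the other two, so that exactly three edges leave a set of vertices, against
-- the parity of its degree sum (`no-K₅⁻`).

-- Labels of the four darts at a vertex, and exhaustive checks over them.

data Q : Set where
  q0 q1 q2 q3 : Q

-- The three pairings of four darts, as involutions of Q.
data P : Set where
  p1 p2 p3 : P

xr : P → Q → Q
xr p1 q0 = q1
xr p1 q1 = q0
xr p1 q2 = q3
xr p1 q3 = q2
xr p2 q0 = q2
xr p2 q1 = q3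
xr p2 q2 = q0
xr p2 q3 = q1
xr p3 q0 = q3
xr p3 q1 = q2
xr p3 q2 = q1
xr p3 q3 = q0

allQ? : {A : Q → Set} → (∀ q → Dec (A q)) → Dec (∀ q → A q)
allQ? A? = map′ (λ { (a , b , c , d) → λ { q0 → a ; q1 → b ; q2 → c ; q3 → d } })
                (λ f → f q0 , f q1 , f q2 , f q3)
                (A? q0 ×-dec A? q1 ×-dec A? q2 ×-dec A? q3)

anyQ? : {A : Q → Set} → (∀ q → Dec (A q)) → Dec (∃ A)
anyQ? A? = map′ (λ { (inj₁ a) → _ , a ; (inj₂ (inj₁ a)) → _ , a
                   ; (inj₂ (inj₂ (inj₁ a))) → _ , a ; (inj₂ (inj₂ (inj₂ a))) → _ , a })
                (λ { (q0 , a) → inj₁ a ; (q1 , a) → inj₂ (inj₁ a)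
                   ; (q2 , a) → inj₂ (inj₂ (inj₁ a)) ; (q3 , a) → inj₂ (inj₂ (inj₂ a)) })
                (A? q0 ⊎-dec A? q1 ⊎-dec A? q2 ⊎-dec A? q3)

codeQ : Q → ℕ
codeQ q0 = 0
codeQ q1 = 1
codeQ q2 = 2
codeQ q3 = 3

codeQ-injective : ∀ i j → codeQ i ≡ codeQ j → i ≡ j
codeQ-injective q0 q0 _ = refl
codeQ-injective q1 q1 _ = refl
codeQ-injective q2 q2 _ = refl
codeQ-injective q3 q3 _ = refl

infix 4 _≟Q_
_≟Q_ : DecidableEquality Q
i ≟Q j = map′ (codeQ-injective i j) (cong codeQ) (codeQ i ≟ codeQ j)

eqQ : Q → Q → Bool
eqQ i j = codeQ i ≡ᵇ codeQ j

xr-involutive : ∀ p i → xr p (xr p i) ≡ i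
xr-involutive p1 = toWitness {a? = allQ? λ i → xr p1 (xr p1 i) ≟Q i} _
xr-involutive p2 = toWitness {a? = allQ? λ i → xr p2 (xr p2 i) ≟Q i} _
xr-involutive p3 = toWitness {a? = allQ? λ i → xr p3 (xr p3 i) ≟Q i} _

xr-irreflexive : ∀ p i → xr p i ≢ i
xr-irreflexive p1 = toWitness {a? = allQ? λ i → ¬? (xr p1 i ≟Q i)} _
xr-irreflexive p2 = toWitness {a? = allQ? λ i → ¬? (xr p2 i ≟Q i)} _
xr-irreflexive p3 = toWitness {a? = allQ? λ i → ¬? (xr p3 i ≟Q i)} _

pickQ? : Dec (∀ i j → ∃[ k ] (k ≢ i × k ≢ j))
pickQ? = allQ? λ i → allQ? λ j → anyQ? λ k → ¬? (k ≟Q i) ×-dec ¬? (k ≟Q j)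

-- Four distinct labels exhaust `Q`; this is how four distinct darts are recognised as all the darts
-- at a vertex.
Cover : Q → Q → Q → Q → Q → Set
Cover i j k l m = i ≢ j → k ≢ i → k ≢ j → l ≢ i → l ≢ j → l ≢ k → (m ≡ i ⊎ m ≡ j) ⊎ (m ≡ k ⊎ m ≡ l)

coverQ? : Dec (∀ i j k l m → Cover i j k l m)
coverQ? = allQ? λ i → allQ? λ j → allQ? λ k → allQ? λ l → allQ? λ m →
  ¬? (i ≟Q j) →-dec ¬? (k ≟Q i) →-dec ¬? (k ≟Q j) →-dec ¬? (l ≟Q i) →-dec ¬? (l ≟Q j) →-dec
  ¬? (l ≟Q k) →-dec ((m ≟Q i ⊎-dec m ≟Q j) ⊎-dec (m ≟Q k ⊎-dec m ≟Q l))

abstract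
  pickQ : (i j : Q) → Σ Q λ k → k ≢ i × k ≢ j
  pickQ = toWitness {a? = pickQ?} _

  coverQ : (i j k l m : Q) → Cover i j k l m
  coverQ = toWitness {a? = coverQ?} _

-- Counting over finite sets.

bit : Bool → ℕ
bit b = if b then 1 else 0

∧-true : ∀ {a b} → a ∧ b ≡ true → a ≡ true × b ≡ true
∧-true {true} {true} _ = refl , refl

true≢false : ∀ {b : Bool} → b ≡ true → b ≡ false → ⊥
true≢false refl ()

sum-mono : ∀ {n} (f g : Fin n → ℕ) → (∀ i → f i ≤ g i) → sum f ≤ sum g
sum-mono {zero} f g h = z≤n
sum-mono {suc n} f g h = +-mono-≤ (h zero) (sum-mono (f ∘ suc) (g ∘ suc) (h ∘ suc))

sum-cong : ∀ {n} (f g : Fin n → ℕ) → (∀ i → f i ≡ g i) → sum f ≡ sum g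
sum-cong {zero} f g h = refl
sum-cong {suc n} f g h = cong₂ _+_ (h zero) (sum-cong (f ∘ suc) (g ∘ suc) (h ∘ suc))

sum-zero : ∀ n → sum {n} (λ _ → 0) ≡ 0
sum-zero zero = refl
sum-zero (suc n) = sum-zero n

sum-single : ∀ {n} (i : Fin n) → sum (λ j → bit ⌊ i FP.≟ j ⌋) ≡ 1
sum-single {suc n} zero = cong suc (sum-zero n)
sum-single {suc n} (suc i) =
  trans (sum-cong _ (λ j → bit ⌊ i FP.≟ j ⌋) (λ j → cong bit (lem j))) (sum-single i)
  where
  lem : ∀ j → ⌊ Fin.suc i FP.≟ suc j ⌋ ≡ ⌊ i FP.≟ j ⌋
  lem j with i FP.≟ j
  ... | yes _ = refl
  ... | no _ = refl

occ : ∀ {n} → List (Fin n) → Fin n → ℕ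
occ [] d = 0
occ (x ∷ xs) d = bit ⌊ x FP.≟ d ⌋ + occ xs d

sum-occ : ∀ {n} (xs : List (Fin n)) → sum (occ xs) ≡ length xs
sum-occ {n} [] = sum-zero n
sum-occ (x ∷ xs) = trans (∑-distrib-+ (λ d → bit ⌊ x FP.≟ d ⌋) (occ xs))
                         (cong₂ _+_ (sum-single x) (sum-occ xs))

occ-∈ : ∀ {n} {xs : List (Fin n)} {d} → d ∈ xs → 1 ≤ occ xs d
occ-∈ {xs = x ∷ xs} {d} m with x FP.≟ d
... | yes _ = s≤s z≤n
occ-∈ (here px) | no ¬p = ⊥-elim (¬p (sym px))
occ-∈ (there m) | no ¬p = occ-∈ m

occ-∉ : ∀ {n} {xs : List (Fin n)} {d} → d ∉ xs → occ xs d ≡ 0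
occ-∉ {xs = []} _ = refl
occ-∉ {xs = x ∷ xs} {d} m with x FP.≟ d
... | yes p = ⊥-elim (m (here (sym p)))
... | no _ = occ-∉ (m ∘ there)

data Distinct {A : Set} : List A → Set where
  []  : Distinct []
  _∷_ : ∀ {x xs} → x ∉ xs → Distinct xs → Distinct (x ∷ xs)

occ-distinct : ∀ {n} {xs : List (Fin n)} → Distinct xs → ∀ d → occ xs d ≤ 1
occ-distinct [] d = z≤n
occ-distinct {xs = x ∷ xs} (p ∷ ps) d with x FP.≟ d
... | yes refl rewrite occ-∉ p = ≤-refl
... | no _ = occ-distinct ps d

-- If at least |R| elements leave the set f and it does not shrink, then more than |A| enter it.
newcomer : ∀ {n} (f g ag : Fin n → Bool) (R A : List (Fin n)) →
  (∀ d → ag d ≡ true → f d ≡ g d) →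
  (∀ {d} → d ∈ R → f d ≡ true × ag d ≡ false) → Distinct R → length A < length R →
  sum (bit ∘ g) < sum (bit ∘ f) ⊎ (∃[ d ] (g d ≡ true × ag d ≡ false × d ∉ A))
newcomer {n} f g ag R A agree hR dR A<R with FP.any? (λ d → dec d)
  where
  open import Data.List.Membership.DecPropositional (FP._≟_ {n}) using (_∈?_)
  open import Data.Bool.Properties using () renaming (_≟_ to _≟B_)
  dec : ∀ d → Dec (g d ≡ true × ag d ≡ false × d ∉ A)
  dec d = (g d ≟B true) ×-dec (ag d ≟B false) ×-dec ¬? (d ∈? A)
... | yes p = inj₂ p
-- Without a newcomer, `g` together with the leavers `R` is dominated pointwise by `f` together with
-- `A`; summing and using that `A` is shorter gives the strict decrease.
... | no ¬p = inj₁ (+-cancelʳ-< (length R) _ _ (begin-strict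
    sum (bit ∘ g) + length R               ≡⟨ cong (sum (bit ∘ g) +_) (sum-occ R) ⟨
    sum (bit ∘ g) + sum (occ R)            ≡⟨ ∑-distrib-+ (bit ∘ g) (occ R) ⟨
    sum (λ d → bit (g d) + occ R d)        ≤⟨ sum-mono _ _ pt ⟩
    sum (λ d → bit (f d) + occ A d)        ≡⟨ ∑-distrib-+ (bit ∘ f) (occ A) ⟩
    sum (bit ∘ f) + sum (occ A)            ≡⟨ cong (sum (bit ∘ f) +_) (sum-occ A) ⟩
    sum (bit ∘ f) + length A               <⟨ +-monoʳ-< (sum (bit ∘ f)) A<R ⟩
    sum (bit ∘ f) + length R               ∎))
  where
  open ≤-Reasoning
  open import Data.List.Membership.DecPropositional (FP._≟_ {n}) using (_∈?_)
  pt : ∀ d → bit (g d) + occ R d ≤ bit (f d) + occ A d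
  pt d with ag d in eq
  ... | true rewrite agree d eq | occ-∉ {xs = R} {d} (λ m → true≢false eq (proj₂ (hR m))) =
          +-monoʳ-≤ (bit (g d)) z≤n
  ... | false with d ∈? R
  pt d | false | no d∉R rewrite occ-∉ d∉R with g d in eqg
  ...   | false = z≤n
  ...   | true with d ∈? A
  ...     | yes m = m≤n⇒m≤o+n (bit (f d)) (occ-∈ m)
  ...     | no ¬m = ⊥-elim (¬p (d , eqg , eq , ¬m))
  pt d | false | yes d∈R rewrite proj₁ (hR d∈R) with g d in eqg
  ...   | false = ≤-trans (occ-distinct dR d) (m≤m+n 1 _)
  ...   | true with d ∈? A
  ...     | yes m = s≤s (≤-trans (occ-distinct dR d) (occ-∈ m))
  ...     | no ¬m = ⊥-elim (¬p (d , eqg , eq , ¬m))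

-- Dart systems, transition systems and the trails they define.

-- A simple 4-regular graph given by its darts: `glue` reverses a dart, `glue-vert` excludes loops
-- and `glue-multi` parallel edges. Planarity will enter through the patterns that it excludes.
record System (n : ℕ) : Set where
  field
    N          : ℕ
    vert       : Fin N → Fin n
    glue       : Fin N → Fin N
    glue-inv   : ∀ d → glue (glue d) ≡ d
    glue-vert  : ∀ d → vert (glue d) ≢ vert d
    glue-multi : ∀ {d e} → vert d ≡ vert e → vert (glue d) ≡ vert (glue e) → d ≡ e
    star       : Fin n → Q → Fin N
    star-vert  : ∀ v i → vert (star v i) ≡ v
    star-inj   : ∀ v {i j} → star v i ≡ star v j → i ≡ j
    star-onto  : ∀ d → ∃[ i ] star (vert d) i ≡ d

module Transitions {n : ℕ} (Sy : System n) where
  open System Sy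
  open import Data.List.Membership.DecPropositional (FP._≟_ {n}) using (_∈?_)

  D : Set
  D = Fin N

  glue-irr : ∀ d → glue d ≢ d
  glue-irr d e = glue-vert d (cong vert e)

  -- All darts point away from their vertex: a trail that comes in along the reverse of d goes out
  -- along `turn d`. Freedom from fixed points means that no trail turns straight back.
  record Trans : Set where
    field
      turn      : D → D
      turn-vert : ∀ d → vert (turn d) ≡ vert d
      turn-inv  : ∀ d → turn (turn d) ≡ d
      turn-irr  : ∀ d → turn d ≢ d
  open Trans public

  data Step (t : Trans) : D → D → Set where
    across : ∀ {d} → Step t d (glue d)
    around : ∀ {d} → Step t d (turn t d)

  Conn : Trans → D → D → Set
  Conn t = Star (Step t)

  -- With all darts connected, the transition system t describes a single Eulerian circuit.
  Eul : Trans → Set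
  Eul t = ∀ d e → Conn t d e

  conn-sym : ∀ t {d e} → Conn t d e → Conn t e d
  conn-sym t = Star.reverse back
    where
    back : ∀ {d e} → Step t d e → Step t e d
    back {d} across = subst (Step t (glue d)) (glue-inv d) across
    back {d} around = subst (Step t (turn t d)) (turn-inv t d) around

  -- A trail is represented by the darts along which it leaves its successive vertices, and `nx`
  -- leads from each to the next.
  module Orbit (t : Trans) where
    nx : D → D
    nx d = turn t (glue d)

    it : ℕ → D → D
    it zero d = d
    it (suc k) d = nx (it k d)

    it-nx : ∀ k d → it k (nx d) ≡ it (suc k) d
    it-nx zero d = refl
    it-nx (suc k) d = cong nx (it-nx k d)

    it-+ : ∀ j k d → it (j + k) d ≡ it j (it k d)
    it-+ zero k d = refl
    it-+ (suc j) k d = cong nx (it-+ j k d)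

    nx-vert : ∀ d → vert (nx d) ≡ vert (glue d)
    nx-vert d = turn-vert t (glue d)

    glue-injective : ∀ {d e} → glue d ≡ glue e → d ≡ e
    glue-injective {d} {e} p = trans (sym (glue-inv d)) (trans (cong glue p) (glue-inv e))

    nx-injective : ∀ {d e} → nx d ≡ nx e → d ≡ e
    nx-injective {d} {e} p = glue-injective
      (trans (sym (turn-inv t (glue d))) (trans (cong (turn t) p) (turn-inv t (glue e))))

    it-cancel : ∀ j k d → it j d ≡ it (j + k) d → d ≡ it k d
    it-cancel zero k d p = p
    it-cancel (suc j) k d p = it-cancel j k d (nx-injective p)

    -- Reversal conjugates nx to its inverse, so a collision of an orbit with its own reversal
    -- propagates inwards until some glue or turn has a fixed point.
    noRev< : ∀ m j d → it (m + j) d ≢ glue (it j d)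
    noRev< zero j d p = glue-irr _ (sym p)
    noRev< (suc zero) j d p = turn-irr t _ p
    noRev< (suc (suc m)) j d p = noRev< m (suc j) d
      (trans (cong (λ x → it x d) (+-suc m j))
        (glue-injective (trans (trans (sym (turn-inv t _)) (cong (turn t) p)) (sym (glue-inv _)))))

    noRev : ∀ k j d → it k d ≢ glue (it j d)
    noRev k j d p with ≤-total j k
    ... | inj₁ j≤k = noRev< (k ∸ j) j d (trans (cong (λ x → it x d) (m∸n+n≡m j≤k)) p)
    ... | inj₂ k≤j = noRev< (j ∸ k) k d (trans (cong (λ x → it x d) (m∸n+n≡m k≤j))
                       (trans (sym (glue-inv _)) (cong glue (sym p))))

    period : ∀ d → ∃[ m ] (it (suc m) d ≡ d)
    period d with FP.pigeonhole (n<1+n N) (λ i → it (toℕ i) d)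
    ... | i , j , i<j , p = toℕ j ∸ suc (toℕ i) , sym (it-cancel (toℕ i) _ d
          (trans p (cong (λ x → it x d) (sym (trans (+-suc (toℕ i) _) (m+[n∸m]≡n i<j))))))

    -- The darts of an orbit together with their reversals are closed under both kinds of step, so a
    -- connection by undirected steps already lies on one orbit.
    reaches : ∀ {d e} → Conn t d e → ∃[ k ] (it k d ≡ e ⊎ it k d ≡ glue e)
    reaches {d} {e} path = go path (0 , inj₁ refl)
      where
      step : ∀ {x y} → Step t x y → ∃[ k ] (it k d ≡ x ⊎ it k d ≡ glue x) →
             ∃[ k ] (it k d ≡ y ⊎ it k d ≡ glue y)
      step across (k , inj₁ p) = k , inj₂ (trans p (sym (glue-inv _)))
      step across (k , inj₂ p) = k , inj₁ p
      step {x} around (k , inj₂ p) = suc k , inj₁ (cong (turn t) (trans (cong glue p) (glue-inv x)))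
      step {x} around (k , inj₁ p) = pre k p
        where
        pred : ∀ {z} → nx z ≡ x → z ≡ glue (turn t x)
        pred q = nx-injective (trans q (sym (trans (cong (turn t) (glue-inv _)) (turn-inv t x))))
        pre : ∀ k → it k d ≡ x → ∃[ k ] (it k d ≡ turn t x ⊎ it k d ≡ glue (turn t x))
        pre (suc k) p = k , inj₂ (pred p)
        -- The predecessor of the first dart is the last dart of the period.
        pre zero p with period d
        ... | m , q = m , inj₂ (pred (trans q p))
      go : ∀ {x y} → Conn t x y → ∃[ k ] (it k d ≡ x ⊎ it k d ≡ glue x) →
           ∃[ k ] (it k d ≡ y ⊎ it k d ≡ glue y)
      go ε h = h
      go (s ◅ ss) h = go ss (step s h)

    covers : Eul t → ∀ d e → ∃[ k ] (it k d ≡ e ⊎ it k d ≡ glue e)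
    covers eul d e = reaches (eul d e)

    -- The trail leaving through d first comes back to the vertex set S through e, after l further vertices.
    data Path (S : List (Fin n)) : ℕ → D → D → Set where
      stop : ∀ {d} → vert (glue d) ∈ S → Path S 0 d (glue d)
      go   : ∀ {l d e} → vert (glue d) ∉ S → Path S l (nx d) e → Path S (suc l) d e

    module _ {S : List (Fin n)} where
      path-det : ∀ {l l' d e e'} → Path S l d e → Path S l' d e' → l ≡ l' × e ≡ e'
      path-det (stop _) (stop _) = refl , refl
      path-det (stop p) (go q _) = ⊥-elim (q p)
      path-det (go q _) (stop p) = ⊥-elim (q p)
      path-det (go _ a) (go _ b) with path-det a b
      ... | refl , refl = refl , refl

      path-end : ∀ {l d e} → Path S l d e → vert e ∈ S
      path-end (stop p) = p
      path-end (go _ a) = path-end a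

      path-rev : ∀ {l l' x e y} → Path S l x e → vert x ∉ S → Path S l' (turn t x) y → ∃[ k ] Path S k e y
      path-rev {x = x} (stop p) x∉ b =
        _ , go (x∉ ∘ subst (λ z → vert z ∈ S) (glue-inv x))
               (subst (λ z → Path S _ z _) (sym (cong (turn t) (glue-inv x))) b)
      path-rev {x = x} (go q a) x∉ b =
        path-rev a (q ∘ subst (_∈ S) (nx-vert x))
          (subst (λ z → Path S _ z _) (sym (turn-inv t (glue x)))
            (go (x∉ ∘ subst (λ z → vert z ∈ S) (glue-inv x))
                (subst (λ z → Path S _ z _) (sym (cong (turn t) (glue-inv x))) b)))

      -- Reversing an excursion from S gives an excursion from S. Return maps can therefore be
      -- stored as lists of unordered pairs.
      path-sym : ∀ {l d e} → vert d ∈ S → Path S l d e → ∃[ k ] Path S k e d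
      path-sym {d = d} d∈ a = lem a
        where
        back : Path S 0 (glue d) d
        back = subst (Path S 0 (glue d)) (glue-inv d) (stop (subst (λ z → vert z ∈ S) (sym (glue-inv d)) d∈))
        lem : ∀ {l e} → Path S l d e → ∃[ k ] Path S k e d
        lem (stop _) = 0 , back
        lem (go q b) = path-rev b (q ∘ subst (_∈ S) (nx-vert d))
                         (subst (λ z → Path S 0 z d) (sym (turn-inv t (glue d))) back)

      path-from : ∀ k x → vert (glue (it k x)) ∈ S → ∃[ l ] ∃[ e ] Path S l x e
      path-from k x h with vert (glue x) ∈? S
      ... | yes p = _ , _ , stop p
      path-from zero x h | no ¬p = ⊥-elim (¬p h)
      path-from (suc k) x h | no ¬p with path-from k (nx x) (subst (λ z → vert (glue z) ∈ S) (sym (it-nx k x)) h)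
      ... | _ , _ , a = _ , _ , go ¬p a

      before : ∀ {s x} k → vert s ∈ S → it (suc k) x ≡ s → vert (glue (it k x)) ∈ S
      before {x = x} k s∈ p = subst (_∈ S) (trans (cong vert (sym p)) (nx-vert (it k x))) s∈

      path-home : ∀ {x} → vert x ∈ S → ∃[ l ] ∃[ e ] Path S l x e
      path-home {x} x∈ with period x
      ... | m , q = path-from m x (before m x∈ q)

      path-exists : Eul t → ∀ {s} → vert s ∈ S → ∀ x → ∃[ l ] ∃[ e ] Path S l x e
      path-exists eul {s} s∈ x with covers eul x s
      ... | k , inj₂ p = path-from k x (subst (λ z → vert z ∈ S) (sym (trans (cong glue p) (glue-inv s))) s∈)
      ... | suc k , inj₁ p = path-from k x (before k s∈ p)
      ... | zero , inj₁ refl = path-home s∈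

      path-conn : ∀ (t' : Trans) → (∀ y → vert y ∉ S → turn t' y ≡ turn t y) →
                  ∀ {l d e} → Path S l d e → Conn t' d e
      path-conn t' off (stop _) = across ◅ ε
      path-conn t' off {d = d} (go q a) =
        across ◅ subst (Step t' (glue d)) (off (glue d) q) around ◅ path-conn t' off a

      -- An orbit that is at S at a positive time has completed its first excursion by then and goes
      -- on from the turn at its end with less time left. Inductions over successive returns rest on
      -- this.
      path-skip : ∀ {l x e} k → Path S l x e → vert (it k x) ∈ S →
                  k ≡ 0 ⊎ (∃[ k' ] (k' < k × it k x ≡ it k' (turn t e)))
      path-skip zero _ _ = inj₁ refl
      path-skip {x = x} (suc k) (stop p) _ = inj₂ (k , n<1+n k , sym (it-nx k x))
      path-skip {x = x} (suc k) (go q a) h with path-skip k a (subst (λ z → vert z ∈ S) (sym (it-nx k x)) h)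
      ... | inj₁ refl = ⊥-elim (q (subst (_∈ S) (nx-vert x) h))
      ... | inj₂ (k' , k'<k , p) = inj₂ (k' , m<n⇒m<1+n k'<k , trans (sym (it-nx k x)) p)

      -- W is the part of one direction of the circuit that leaves S.
      closed-covers : Eul t → (W : List D) → ∀ {x} → x ∈ W →
        (∀ {y} → y ∈ W → ∃[ l ] ∃[ e ] (Path S l y e × turn t e ∈ W)) →
        ∀ s → vert s ∈ S → s ∈ W ⊎ turn t s ∈ W
      closed-covers eul W {x} x∈ step s s∈ = result (covers eul x s)
        where
        -- Induction on time, one excursion after another: each of them starts in `W`, and the turn
        -- at its end is again in `W`.
        inW : ∀ k → Acc _<_ k → ∀ {x} → x ∈ W → vert (it k x) ∈ S → it k x ∈ W
        inW k (acc rs) {x} x∈ h with step x∈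
        ... | l , e , a , te∈ with path-skip k a h
        ...   | inj₁ refl = x∈
        ...   | inj₂ (k' , k'<k , q) = subst (_∈ W) (sym q) (inW k' (rs k'<k) te∈ (subst (λ z → vert z ∈ S) q h))
        arrive : ∀ {y} k → it k x ≡ y → vert y ∈ S → y ∈ W
        arrive k refl y∈ = inW k (<-wellFounded k) x∈ y∈
        result : ∃[ k ] (it k x ≡ s ⊎ it k x ≡ glue s) → s ∈ W ⊎ turn t s ∈ W
        result (k , inj₁ p) = inj₁ (arrive k p s∈)
        result (k , inj₂ p) = inj₂ (arrive (suc k) (cong (turn t) (trans (cong glue p) (glue-inv s)))
                                      (subst (_∈ S) (sym (turn-vert t s)) s∈))

    path-shrink : ∀ {u S l x e} → Path (u ∷ S) l x e → vert e ∈ S → Path S l x e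
    path-shrink (stop _) h = stop h
    path-shrink (go q a) h = go (q ∘ there) (path-shrink a h)

    -- An excursion from S is a chain of excursions from `u ∷ S` joined at the visits to u.
    path-compose : ∀ {u S l l' x y e} → Path (u ∷ S) l x y → vert y ∉ S → Path S l' (turn t y) e →
                   ∃[ k ] Path S k x e
    path-compose (stop _) h b = _ , go h b
    path-compose (go q a) h b with path-compose a h b
    ... | _ , c = _ , go (q ∘ there) c

    -- Excursions from S use only transitions off S, so they survive a change inside S and carry
    -- every dart to S. Only the darts at S then have to be connected with one another.
    eul-transfer : Eul t → (t' : Trans) (S : List (Fin n)) (s₀ : D) → vert s₀ ∈ S →
      (∀ y → vert y ∉ S → turn t' y ≡ turn t y) →
      (∀ s → vert s ∈ S → Conn t' s s₀) → Eul t'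
    eul-transfer eul t' S s₀ s∈ off inside d e = toS d ◅◅ conn-sym t' (toS e)
      where
      toS : ∀ d → Conn t' d s₀
      toS d with path-exists eul s∈ d
      ... | _ , e , a = path-conn t' off a ◅◅ inside e (path-end a)

-- Symbolic states: partial maps of a transition system, and the operations on them.

Dart : Set
Dart = ℕ × Q

-- A partial map of a transition system: k distinct vertices named 0 … k-1, whose darts are labelled so
-- that the system pairs them by p1; the known edges g; and, for the named vertices in S, the way m in
-- which the circuit leaving S at a dart returns to S.
record State : Set where
  constructor state
  field
    k : ℕ
    g : List (Dart × Dart)
    S : List ℕ
    m : List (Dart × Dart)
open State public

every : {A : Set} → (A → Bool) → List A → Bool
every p [] = true
every p (x ∷ xs) = p x ∧ every p xs

gather : {A B : Set} → (A → List B) → List A → List B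
gather f [] = []
gather f (x ∷ xs) = f x ++ gather f xs

keep : {A : Set} → (A → Bool) → List A → List A
keep p [] = []
keep p (x ∷ xs) = if p x then x ∷ keep p xs else keep p xs

eqD : Dart → Dart → Bool
eqD (a , i) (b , j) = (a ≡ᵇ b) ∧ eqQ i j

mem : ℕ → List ℕ → Bool
mem a [] = false
mem a (b ∷ bs) = (a ≡ᵇ b) ∨ mem a bs

memD : Dart → List Dart → Bool
memD d [] = false
memD d (e ∷ es) = eqD d e ∨ memD d es

distinctD : List Dart → Bool
distinctD [] = true
distinctD (d ∷ ds) = not (memD d ds) ∧ distinctD ds

-- Pairs are unordered, since both edges and returns can be read in either direction.
look : List (Dart × Dart) → Dart → Maybe Dart
look [] d = nothing
look ((x , y) ∷ r) d = if eqD x d then just y else if eqD y d then just x else look r d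

Changes : Set
Changes = List (ℕ × P)

pairing : Changes → ℕ → P
pairing [] a = p1
pairing ((b , p) ∷ f) a = if b ≡ᵇ a then p else pairing f a

mate : Changes → Dart → Dart
mate f (a , i) = a , xr (pairing f a) i

flip1 : Dart → Dart
flip1 (a , i) = a , xr p1 i

data End : Set where
  inside : Dart → End
  open′  : Dart → End
  unknown : End

-- Follows the circuit from its arrival at y through known edges, turning by `p1`, until it meets S
-- (`inside`) or leaves along a dart whose edge is not known (`open′`). When the fuel is used up the
-- result is `unknown`, which all tests accept.
strand : ℕ → List (Dart × Dart) → List ℕ → Dart → End
strand-next : ℕ → List (Dart × Dart) → List ℕ → Dart → Maybe Dart → End
strand zero g S y = unknown
strand (suc n) g S y = if mem (proj₁ y) S then inside y else strand-next n g S (flip1 y) (look g (flip1 y))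
strand-next n g S z nothing = open′ z
strand-next n g S z (just y) = strand n g S y

darts : ℕ → List Dart
darts a = (a , q0) ∷ (a , q1) ∷ (a , q2) ∷ (a , q3) ∷ []

allDarts : ℕ → List Dart
allDarts k = gather darts (upTo k)

adjacent : List (Dart × Dart) → ℕ → ℕ → Bool
adjacent [] a b = false
adjacent (((x , _) , (y , _)) ∷ g) a b =
  ((x ≡ᵇ a) ∧ (y ≡ᵇ b)) ∨ (((x ≡ᵇ b) ∧ (y ≡ᵇ a)) ∨ adjacent g a b)

agrees : Maybe Dart → Dart → Bool
agrees nothing e = true
agrees (just d) e = eqD d e

-- An edge from x to y joins two strands. If both end in S, their ends must be partners in the
-- return map. If the strand through y runs on to x itself, the edge would close a circuit that
-- misses S, which a single circuit permits for empty S alone.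
compatible : State → Dart → End → End → Bool
compatible s x (inside p) (inside q) = agrees (look (m s) p) q
compatible s x (open′ _) (open′ z) = null (S s) ∨ not (eqD z x)
compatible s x _ _ = true

okGlue : State → Dart → Dart → Bool
okGlue s x y =
  not (proj₁ x ≡ᵇ proj₁ y) ∧ (is-nothing (look (g s) y) ∧ (not (adjacent (g s) (proj₁ x) (proj₁ y)) ∧
    compatible s x (strand (suc (k s)) (g s) (S s) x) (strand (suc (k s)) (g s) (S s) y)))

join : State → Dart → Dart → State
join s x y = state (k s) ((x , y) ∷ g s) (S s) (m s)

fresh : State → Dart → State
fresh s x = state (suc (k s)) ((x , (k s , q0)) ∷ g s) (S s) (m s)

-- The possible other ends of an edge: the known one, an admissible dart of a named vertex, or a
-- dart of a new vertex. In the last case it may be called `q0`, because the labels at a new vertex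
-- are still free.
resolve′ : State → Dart → Maybe Dart → List (State × Dart)
resolve′ s d (just e) = (s , e) ∷ []
resolve′ s d nothing =
  map (λ e → join s d e , e) (keep (okGlue s d) (allDarts (k s))) ++ (fresh s d , (k s , q0)) ∷ []

resolve : State → Dart → List (State × Dart)
resolve s d = resolve′ s d (look (g s) d)

resolveAt′ : State → Dart → ℕ → Maybe Dart → List State
resolveAt′ s d b (just e) = if proj₁ e ≡ᵇ b then s ∷ [] else []
resolveAt′ s d b nothing = map (join s d) (keep (okGlue s d) (darts b))

resolveAt : State → Dart → ℕ → List State
resolveAt s d b = resolveAt′ s d b (look (g s) d)

arrive₁ arrive₂ arrive₃ : Changes → Dart → State × Dart → List State
arrive₁ f d₀ (s , y) = resolveAt s (mate f y) (proj₁ d₀)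
arrive₂ f d₀ (s , y) = gather (arrive₁ f d₀) (resolve s (mate f y))
arrive₃ f d₀ (s , y) = gather (arrive₂ f d₀) (resolve s (mate f y))

-- The ways in which the trail that starts with the dart d₀ can return after three or four edges.
close3 close4 : Changes → Dart → State → List State
close3 f d₀ s = gather (arrive₂ f d₀) (resolve s d₀)
close4 f d₀ s = gather (arrive₃ f d₀) (resolve s d₀)

unless : Bool → List State → List State
unless b xs = if b then [] else xs

-- The trails that start with a dart in `A` have been counted already.
closeNew : (Dart → State → List State) → List Dart → State × Dart → List State
closeNew close A (s , d₀) = unless (memD d₀ A) (close d₀ s)

-- Here y is the dart at which the first edge arrives, so the start of the trail is the other end of
-- that edge.
via₁ : (Dart → State → List State) → List Dart → State → Dart → List State
via₁ close A s y = gather (closeNew close A) (resolve s y)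

via₁′ : Changes → List Dart → State × Dart → List State
via₁′ f A (s , d₁) = via₁ (close4 f) A s (mate f d₁)

-- Here y is the dart at which the second edge arrives. One edge back lies `d₁`, and its mate under
-- `f` is where the first edge arrives.
via₂ : Changes → List Dart → State → Dart → List State
via₂ f A s y = gather (via₁′ f A) (resolve s y)

-- A new short closed trail has a changed transition at an intermediate vertex, and it may be
-- reversed. For length three this vertex is then the first one. For length four it is the first or
-- the middle one; in the middle it is enough to arrive at `q0` or `q1`, because a changed pairing
-- matches these with `q2` and `q3`.
new3-at new4-at : Changes → List Dart → State → ℕ × P → List State
new3-at f A s (a , _) = gather (via₁ (close3 f) A s) (darts a)
new4-at f A s (a , _) = gather (via₁ (close4 f) A s) (darts a) ++ gather (via₂ f A s) ((a , q0) ∷ (a , q1) ∷ [])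

new3 new4 : Changes → List Dart → State → List State
new3 f A s = gather (new3-at f A s) f
new4 f A s = gather (new4-at f A s) f

-- The result consists of the arrival darts at the intermediate vertices and of the final arrival
-- dart, with which the reversed trail starts.
Walk : Set
Walk = State → Changes → Dart → Maybe (List Dart × Dart)

returning : ℕ → List Dart → Dart → Maybe (List Dart × Dart)
returning a ys y = if proj₁ y ≡ᵇ a then just (ys , y) else nothing

walk3 walk4 : Walk
walk3 s f d =
  look (g s) d >>= λ y₁ → look (g s) (mate f y₁) >>= λ y₂ → look (g s) (mate f y₂) >>= λ y₃ →
  returning (proj₁ d) (y₁ ∷ y₂ ∷ []) y₃
walk4 s f d =
  look (g s) d >>= λ y₁ → look (g s) (mate f y₁) >>= λ y₂ → look (g s) (mate f y₂) >>= λ y₃ →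
  look (g s) (mate f y₃) >>= λ y₄ → returning (proj₁ d) (y₁ ∷ y₂ ∷ y₃ ∷ []) y₄

changed : Changes → List Dart → Bool
changed f [] = false
changed f (y ∷ ys) = mem (proj₁ y) (map proj₁ f) ∨ changed f ys

affected′ : Changes → Maybe (List Dart × Dart) → Bool
affected′ f nothing = false
affected′ f (just (ys , _)) = changed f ys

-- With `f′ = []` these are the starts of the known closed trails of the old system that meet a
-- changed vertex; with `f′ = f` those of the new system.
affected : Walk → State → Changes → Changes → List Dart
affected w s f f′ = keep (λ d → affected′ f (w s f′ d)) (allDarts (k s))

endIn : List Dart → Maybe (List Dart × Dart) → Bool
endIn A nothing = false
endIn A (just (_ , y)) = memD y A

reversible : Walk → State → Changes → List Dart → Bool
reversible w s f A = every (λ d → endIn A (w s f d)) A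

-- The trails lost outnumber the trails known to appear. The known new starts are also closed under
-- reversal, so that an unknown new trail remains unknown when it is reversed.
gains : Walk → State → Changes → Bool
gains w s f = distinctD R ∧ (reversible w s f A ∧ (length A <ᵇ length R))
  where
  R A : List Dart
  R = affected w s f []
  A = affected w s f f

-- The darts met when the trail of the changed system is followed from x, using m outside S.
tour : ℕ → Changes → List (Dart × Dart) → Dart → List Dart
tour′ : ℕ → Changes → List (Dart × Dart) → Maybe Dart → List Dart
tour zero f m x = x ∷ []
tour (suc n) f m x = x ∷ tour′ n f m (look m x)
tour′ n f m nothing = []
tour′ n f m (just y) = y ∷ tour n f m (mate f y)

dartsOf : List ℕ → List Dart
dartsOf = gather darts

-- The circuit passes each vertex twice, so it makes `2 * |S|` excursions from S. If a tour of that
-- length meets all darts at S, the changed system is still a single circuit.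
single : Changes → State → Bool
single f (state k g [] m) = false
single f (state k g (a ∷ S) m) = every (λ d → memD d t) (dartsOf (a ∷ S))
  where
  t : List Dart
  t = tour (2 * length (a ∷ S)) f m (a , q0)

distinctN : List ℕ → Bool
distinctN [] = true
distinctN (a ∷ as) = not (mem a as) ∧ distinctN as

isP1 : P → Bool
isP1 p1 = true
isP1 p2 = false
isP1 p3 = false

-- Excluding `p1` makes sure that each listed vertex really changes its transitions.
okChange : State → Changes → Bool
okChange s f = every (λ { (a , p) → mem a (S s) ∧ not (isP1 p) }) f

-- Extending the return map to a further vertex u.
ends : State → ℕ → List (Dart × Dart) → List Dart → Dart → List (List (Dart × Dart))
ends s u m [] x = []
ends s u m (e ∷ es) x = if eqD e x ∨ not (is-nothing (look m e)) then ends s u m es x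
                        else ((x , e) ∷ m) ∷ ends s u m es x

candidates : State → ℕ → End → List Dart
candidates s u (inside e) = e ∷ []
candidates s u _ = dartsOf (u ∷ S s)

end : State → ℕ → Maybe Dart → End
end s u nothing = unknown
end s u (just y) = strand (suc (k s)) (g s) (u ∷ S s) y

extend′ : State → ℕ → List (Dart × Dart) → Dart → Maybe Dart → List (List (Dart × Dart))
extend′ s u m x (just _) = m ∷ []
extend′ s u m x nothing = ends s u m (candidates s u (end s u (look (g s) x))) x

extend : State → ℕ → Dart → List (Dart × Dart) → List (List (Dart × Dart))
extend s u x m = extend′ s u m x (look m x)

-- m′ : return map of the darts of u; old pairs not touching it persist
persist : State → List (Dart × Dart) → List (Dart × Dart) → List (Dart × Dart)
persist s m′ [] = m′
persist s m′ ((x , y) ∷ m) =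
  if is-nothing (look m′ x) ∧ is-nothing (look m′ y) then (x , y) ∷ persist s m′ m else persist s m′ m

-- follow a return map through u until it leaves u
through : ℕ → ℕ → List (Dart × Dart) → Maybe Dart → Maybe Dart
through zero u m y = nothing
through (suc n) u m nothing = nothing
through (suc n) u m (just y) = if proj₁ y ≡ᵇ u then through n u m (look m (flip1 y)) else just y

sameMaybe : Maybe Dart → Maybe Dart → Bool
sameMaybe (just x) (just y) = eqD x y
sameMaybe _ _ = true

sameEnd : End → Maybe Dart → Bool
sameEnd (inside x) (just y) = eqD x y
sameEnd _ _ = true

-- A proposed return map for `u ∷ S` must give back the old one when the visits to u are skipped,
-- and must agree with the known strands. The fuel 3 allows for two visits to u followed by a dart
-- at S.
coherent : State → ℕ → List (Dart × Dart) → Bool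
coherent s u m′ =
  every (λ d → sameMaybe (through 3 u m′ (look m′ d)) (look (m s) d)) (dartsOf (S s)) ∧
  every (λ d → sameEnd (end s u (look (g s) d)) (look m′ d)) (dartsOf (u ∷ S s))

-- the darts through which the circuit, followed from x, leaves the named vertices before it is back at x₀
loop : ℕ → List (Dart × Dart) → Dart → Dart → List Dart → Maybe (List Dart)
loop′ : ℕ → List (Dart × Dart) → Dart → List Dart → Maybe Dart → Maybe (List Dart)
loop zero m x₀ x W = nothing
loop (suc n) m x₀ x W = loop′ n m x₀ (x ∷ W) (look m x)
loop′ n m x₀ W nothing = nothing
loop′ n m x₀ W (just y) = if eqD (flip1 y) x₀ then just W else loop n m x₀ (flip1 y) W

covering : List ℕ → Maybe (List Dart) → Bool
covering S nothing = true
covering S (just W) = every (λ d → memD d W ∨ memD (flip1 d) W) (dartsOf S)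

-- Rejects return maps under which the circuit would close before it has passed all darts at S.
oneCycle : List ℕ → List (Dart × Dart) → Bool
oneCycle [] m = true
oneCycle (a ∷ S) m = covering (a ∷ S) (loop (2 * length (a ∷ S)) m (a , q0) (a , q0) [])

admit : State → ℕ → List (Dart × Dart) → List State
admit s u m′ =
  if coherent s u full ∧ oneCycle (u ∷ S s) full then state (k s) (g s) (u ∷ S s) full ∷ [] else []
  where
  full : List (Dart × Dart)
  full = persist s m′ (m s)

enlarge : State → ℕ → List State
enlarge s u =
  gather (admit s u)
    (gather (extend s u (u , q3)) (gather (extend s u (u , q2))
      (gather (extend s u (u , q1)) (extend s u (u , q0) []))))

-- `K₅⁻` is the complete graph on 0, 1, 2, 3, 4 without the edge between 0 and 1.
data Pattern : Set where
  K₃₃ K₅⁻ F₆ : Pattern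

edges : Pattern → List (ℕ × ℕ)
edges K₃₃ = (0 , 3) ∷ (0 , 4) ∷ (0 , 5) ∷ (1 , 3) ∷ (1 , 4) ∷ (1 , 5) ∷ (2 , 3) ∷ (2 , 4) ∷ (2 , 5) ∷ []
edges K₅⁻ = (0 , 2) ∷ (0 , 3) ∷ (0 , 4) ∷ (1 , 2) ∷ (1 , 3) ∷ (1 , 4) ∷ (2 , 3) ∷ (2 , 4) ∷ (3 , 4) ∷ []
edges F₆ = (0 , 1) ∷ (0 , 2) ∷ (0 , 3) ∷ (5 , 1) ∷ (5 , 3) ∷ (5 , 4) ∷
           (1 , 2) ∷ (1 , 4) ∷ (2 , 3) ∷ (2 , 4) ∷ (3 , 4) ∷ []

order : Pattern → ℕ
order K₃₃ = 6
order K₅⁻ = 5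
order F₆ = 6

nth : {A : Set} → A → List A → ℕ → A
nth z [] _ = z
nth z (x ∷ xs) zero = x
nth z (x ∷ xs) (suc i) = nth z xs i

hasPattern : State → Pattern → List ℕ → Bool
hasPattern s p vs =
  (length vs ≡ᵇ order p) ∧ (distinctN vs ∧ (every (λ a → a <ᵇ k s) vs ∧
    every (λ { (i , j) → adjacent (g s) (nth 0 vs i) (nth 0 vs j) }) (edges p)))

Renaming : Set
Renaming = List ℕ

-- The eight relabellings that respect the pairing `p1`: the image of `q0` is arbitrary, the image
-- of `q2` lies in the other pair, and the remaining images are forced.
code : ℕ → Q × Q
code 0 = q0 , q2
code 1 = q0 , q3
code 2 = q1 , q2
code 3 = q1 , q3
code 4 = q2 , q0
code 5 = q2 , q1
code 6 = q3 , q0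
code _ = q3 , q1

-- An entry 8 b + c sends a name to b and its darts q0, q2 to the darts of b given by code c.
decode : ℕ → ℕ × Q × Q
decode e = e / 8 , code (e % 8)

relabel : Q → Q → Q → Q
relabel x y q0 = x
relabel x y q1 = xr p1 x
relabel x y q2 = y
relabel x y q3 = xr p1 y

renameN : Renaming → ℕ → ℕ
renameN r a = proj₁ (decode (nth 0 r a))

renameD : Renaming → Dart → Dart
renameD r (a , i) = renameN r a , relabel (proj₁ xy) (proj₂ xy) i
  where
  xy : Q × Q
  xy = proj₂ (decode (nth 0 r a))

isJustD : Maybe Dart → Dart → Bool
isJustD nothing _ = false
isJustD (just d) e = eqD d e

preserves : ℕ → Renaming → List (Dart × Dart) → List (Dart × Dart) → Bool
preserves k r h h′ = every (λ { (d , e) →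
  (proj₁ d <ᵇ k) ∧ ((proj₁ e <ᵇ k) ∧ isJustD (look h′ (renameD r d)) (renameD r e)) }) h

over : List ℕ → List (Dart × Dart) → Bool
over S = every (λ { (d , e) → mem (proj₁ d) S ∧ mem (proj₁ e) S })

-- The sets S must correspond exactly, since a return map depends on the whole of S; for edges it is
-- enough that they are preserved.
embeds : State → State → Renaming → Bool
embeds s s′ r =
  (k s ≡ᵇ length r) ∧ (distinctN (map (λ e → proj₁ (decode e)) r) ∧
  (every (λ e → proj₁ (decode e) <ᵇ k s′) r ∧ (preserves (k s) r (g s) (g s′) ∧
  (preserves (k s) r (m s) (m s′) ∧ (over (S s) (m s) ∧ (every (λ a → a <ᵇ k s) (S s) ∧
  (every (λ a → mem (renameN r a) (S s′)) (S s) ∧ every (λ b → mem b (map (renameN r) (S s))) (S s′))))))))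

-- Case trees and their checker.

data Goal : Set where
  triangles quads : Goal

-- The ways to deal with a state: change transitions and treat each unforeseen short trail; split
-- into cases by adding a vertex to S; point out a forbidden subgraph; point out a closed trail of
-- length three in a circuit known to have none; or find inside it a state treated before.
data Proof : Set where
  switch   : Changes → List Proof → Proof
  include  : ℕ → List Proof → Proof
  contains : Pattern → List ℕ → Proof
  triangle : Dart → Proof
  earlier  : ℕ → Renaming → Proof

isReturn : Maybe (List Dart × Dart) → Bool
isReturn nothing = false
isReturn (just _) = true

switchable : Goal → State → Changes → Bool
switchable triangles s f = okChange s f ∧ (single f s ∧ gains walk3 s f)
switchable quads s f = okChange s f ∧ (single f s ∧ gains walk4 s f)

-- In the second phase a change must not create any closed trail of length three, so all of these
-- are listed as cases, with nothing exempted.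
news : Goal → State → Changes → List State
news triangles s f = new3 f (affected walk3 s f f) s
news quads s f = new3 f [] s ++ new4 f (affected walk4 s f f) s

isQuads : Goal → Bool
isQuads triangles = false
isQuads quads = true

nthState : List State → ℕ → Maybe State
nthState [] _ = nothing
nthState (s ∷ ss) zero = just s
nthState (s ∷ ss) (suc i) = nthState ss i

embeds′ : Maybe State → State → Renaming → Bool
embeds′ nothing s r = false
embeds′ (just s′) s r = embeds s′ s r

-- The refuted states are collected, the latest first, for later references.
check : Goal → List State → State → Proof → Maybe (List State)
checkAll : Goal → List State → List State → List Proof → Maybe (List State)
checkRest : Goal → List State → List Proof → Maybe (List State) → Maybe (List State)
checkIf : Bool → Goal → List State → State → List State → List Proof → Maybe (List State)
add : State → Maybe (List State) → Maybe (List State)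
add s nothing = nothing
add s (just tbl) = just (s ∷ tbl)
check G tbl s (switch f ps) = checkIf (switchable G s f) G tbl s (news G s f) ps
check G tbl s (include u ps) = checkIf ((u <ᵇ k s) ∧ not (mem u (S s))) G tbl s (enlarge s u) ps
check G tbl s (contains p vs) = if hasPattern s p vs then just tbl else nothing
check G tbl s (triangle d) = if isQuads G ∧ (proj₁ d <ᵇ k s) ∧ isReturn (walk3 s [] d) then just tbl else nothing
check G tbl s (earlier i r) = if embeds′ (nthState tbl i) s r then just tbl else nothing
checkIf false G tbl s ss ps = nothing
checkIf true G tbl s ss ps = add s (checkAll G tbl ss ps)
checkAll G tbl [] [] = just tbl
checkAll G tbl [] (_ ∷ _) = nothing
checkAll G tbl (s ∷ ss) [] = nothing
checkAll G tbl (s ∷ ss) (p ∷ ps) = checkRest G ss ps (check G tbl s p)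
checkRest G ss ps nothing = nothing
checkRest G ss ps (just tbl) = checkAll G tbl ss ps

point : State
point = state 1 [] [] []

-- A short closed trail that starts with `(0 , q0)`, with the vertex 0 already in S.
starts : Goal → State → List State
starts triangles s = gather (close3 [] (0 , q0)) (enlarge s 0)
starts quads s = gather (close4 [] (0 , q0)) (enlarge s 0)

-- Pure data, as is `quadProof`: which changes and which case splits to make. Correctness does not
-- rest on the trees but on their evaluation by `check` and on `check-sound`.
triangleProof : List Proof
triangleProof = ((include 1 ((switch ((1 , p3) ∷ []) ((include 2 ((switch ((2 , p2) ∷ []) ((switch ((1 , p2) ∷ (2 , p3) ∷ []) ((include 3 ((switch ((2 , p3) ∷ (3 , p2) ∷ []) ((contains K₅⁻ (3 ∷ 4 ∷ 0 ∷ 1 ∷ 2 ∷ [])) ∷ (contains K₅⁻ (3 ∷ 4 ∷ 0 ∷ 1 ∷ 2 ∷ [])) ∷ (contains K₅⁻ (2 ∷ 3 ∷ 0 ∷ 1 ∷ 4 ∷ [])) ∷ [])) ∷ (earlier 0 (0 ∷ 8 ∷ 16 ∷ 25 ∷ 32 ∷ [])) ∷ [])) ∷ (earlier 0 (0 ∷ 8 ∷ 16 ∷ 24 ∷ 33 ∷ [])) ∷ (include 3 ((include 4 ((switch ((2 , p3) ∷ (4 , p2) ∷ []) ((contains K₅⁻ (0 ∷ 4 ∷ 1 ∷ 2 ∷ 3 ∷ [])) ∷ (contains K₅⁻ (3 ∷ 4 ∷ 0 ∷ 1 ∷ 2 ∷ [])) ∷ [])) ∷ (earlier 0 (0 ∷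 8 ∷ 16 ∷ 24 ∷ 33 ∷ [])) ∷ [])) ∷ [])) ∷ (earlier 0 (0 ∷ 8 ∷ 16 ∷ 25 ∷ 32 ∷ [])) ∷ (earlier 0 (0 ∷ 8 ∷ 16 ∷ 24 ∷ 32 ∷ [])) ∷ (earlier 0 (0 ∷ 8 ∷ 16 ∷ 25 ∷ 32 ∷ [])) ∷ [])) ∷ (switch ((1 , p2) ∷ (2 , p3) ∷ []) ((include 3 ((switch ((1 , p3) ∷ (3 , p3) ∷ []) ((contains K₅⁻ (2 ∷ 3 ∷ 0 ∷ 1 ∷ 4 ∷ [])) ∷ (contains K₅⁻ (3 ∷ 4 ∷ 0 ∷ 1 ∷ 2 ∷ [])) ∷ [])) ∷ (earlier 0 (0 ∷ 8 ∷ 16 ∷ 25 ∷ 32 ∷ [])) ∷ [])) ∷ (earlier 0 (0 ∷ 8 ∷ 16 ∷ 24 ∷ 33 ∷ [])) ∷ (earlier 0 (4 ∷ 18 ∷ 10 ∷ 32 ∷ 24 ∷ [])) ∷ (earlier 0 (4 ∷ 18 ∷ 10 ∷ 32 ∷ 25 ∷ [])) ∷ [])) ∷ (switch ((0 , p2) ∷ (1 , p2) ∷ (2 , p2) ∷ []) ((include 3 ((include 4 ((switch ((2 , p3) ∷ (4 , p2) ∷ []) ((contains K₅⁻ (1 ∷ 4 ∷ 0 ∷ 2 ∷ 3 ∷ [])) ∷ (contains K₅⁻ (1 ∷ 4 ∷ 0 ∷ 2 ∷ 3 ∷ [])) ∷ (contains K₅⁻ (2 ∷ 4 ∷ 0 ∷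 1 ∷ 3 ∷ [])) ∷ [])) ∷ (earlier 0 (0 ∷ 8 ∷ 16 ∷ 24 ∷ 33 ∷ [])) ∷ [])) ∷ [])) ∷ (earlier 7 (0 ∷ 8 ∷ 16 ∷ 24 ∷ 32 ∷ [])) ∷ [])) ∷ (earlier 0 (0 ∷ 8 ∷ 16 ∷ 25 ∷ [])) ∷ [])) ∷ (earlier 0 (0 ∷ 8 ∷ 17 ∷ 24 ∷ [])) ∷ [])) ∷ (include 2 ((switch ((0 , p3) ∷ (1 , p2) ∷ []) ((earlier 9 (0 ∷ 8 ∷ 16 ∷ 34 ∷ 26 ∷ [])) ∷ (earlier 9 (4 ∷ 18 ∷ 10 ∷ 34 ∷ 24 ∷ [])) ∷ (switch ((0 , p3) ∷ (2 , p3) ∷ []) ((earlier 13 (4 ∷ 18 ∷ 10 ∷ 34 ∷ 24 ∷ [])) ∷ [])) ∷ (earlier 0 (0 ∷ 8 ∷ 16 ∷ 25 ∷ [])) ∷ (earlier 0 (0 ∷ 8 ∷ 16 ∷ 24 ∷ [])) ∷ (earlier 0 (0 ∷ 8 ∷ 16 ∷ 25 ∷ [])) ∷ [])) ∷ [])) ∷ (earlier 0 (0 ∷ 8 ∷ 17 ∷ 24 ∷ [])) ∷ (include 2 ((switch ((0 , p3) ∷ (2 , p3) ∷ []) ((earlier 5 (4 ∷ 18 ∷ 10 ∷ 30 ∷ [])) ∷ [])) ∷ (switch ((2 , p3) ∷ []) ((switch ((0 , p3) ∷ (1 , p2) ∷ []) []) ∷ (earlier 0 (0 ∷ 8 ∷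 16 ∷ 24 ∷ 33 ∷ [])) ∷ [])) ∷ (earlier 2 (0 ∷ 8 ∷ 17 ∷ 24 ∷ [])) ∷ (earlier 0 (0 ∷ 8 ∷ 17 ∷ 24 ∷ [])) ∷ [])) ∷ (earlier 0 (0 ∷ 8 ∷ 16 ∷ 25 ∷ [])) ∷ [])) ∷ (earlier 0 (0 ∷ 9 ∷ 16 ∷ [])) ∷ [])) ∷ (earlier 0 (1 ∷ 8 ∷ 16 ∷ [])) ∷ [])
quadProof : List Proof
quadProof = ((include 1 ((include 2 ((include 3 ((switch ((2 , p2) ∷ []) ((triangle (2 , q0)) ∷ (switch ((0 , p3) ∷ (1 , p2) ∷ []) ((triangle (4 , q1)) ∷ (triangle (4 , q1)) ∷ (include 4 ((switch ((1 , p2) ∷ (2 , p2) ∷ []) ((switch ((0 , p2) ∷ (2 , p2) ∷ (3 , p3) ∷ (4 , p3) ∷ []) ((triangle (4 , q0)) ∷ (triangle (4 , q0)) ∷ (triangle (4 , q0)) ∷ (contains F₆ (4 ∷ 0 ∷ 3 ∷ 2 ∷ 1 ∷ 5 ∷ [])) ∷ (contains F₆ (4 ∷ 0 ∷ 3 ∷ 2 ∷ 1 ∷ 5 ∷ [])) ∷ (contains F₆ (4 ∷ 0 ∷ 3 ∷ 2 ∷ 1 ∷ 5 ∷ [])) ∷ (contains F₆ (4 ∷ 0 ∷ 3 ∷ 2 ∷ 1 ∷ 5 ∷ [])) ∷ (triangle (4 , q0)) ∷ (triangle (4 , q0)) ∷ (triangle (4 , q0)) ∷ [])) ∷ (switch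 ((2 , p3) ∷ (4 , p3) ∷ []) ((contains F₆ (4 ∷ 0 ∷ 3 ∷ 2 ∷ 1 ∷ 5 ∷ [])) ∷ (contains F₆ (4 ∷ 0 ∷ 3 ∷ 2 ∷ 1 ∷ 5 ∷ [])) ∷ (triangle (4 , q0)) ∷ (contains F₆ (4 ∷ 0 ∷ 3 ∷ 2 ∷ 1 ∷ 5 ∷ [])) ∷ [])) ∷ (earlier 0 (0 ∷ 8 ∷ 16 ∷ 24 ∷ 32 ∷ 41 ∷ [])) ∷ [])) ∷ (earlier 0 (0 ∷ 8 ∷ 16 ∷ 24 ∷ 33 ∷ 40 ∷ [])) ∷ [])) ∷ (triangle (2 , q0)) ∷ (include 4 ((switch ((3 , p2) ∷ (4 , p2) ∷ []) ((triangle (2 , q0)) ∷ (contains F₆ (1 ∷ 0 ∷ 3 ∷ 2 ∷ 4 ∷ 5 ∷ [])) ∷ (contains F₆ (1 ∷ 0 ∷ 3 ∷ 2 ∷ 4 ∷ 5 ∷ [])) ∷ (include 5 []) ∷ [])) ∷ [])) ∷ (earlier 0 (0 ∷ 8 ∷ 16 ∷ 24 ∷ 33 ∷ 40 ∷ [])) ∷ (triangle (4 , q1)) ∷ (triangle (4 , q1)) ∷ (switch ((2 , p2) ∷ (3 , p3) ∷ []) ((include 4 ((include 5 ((include 6 ((switch ((0 , p3) ∷ (1 , p2) ∷ (5 , p2) ∷ []) ((switch ((0 , p3) ∷ (1 , p2) ∷ (6 , p3) ∷ []) ((contains K₃₃ (0 ∷ 2 ∷ 6 ∷ 1 ∷ 4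 ∷ 5 ∷ [])) ∷ [])) ∷ (earlier 0 (0 ∷ 8 ∷ 16 ∷ 24 ∷ 32 ∷ 40 ∷ 48 ∷ [])) ∷ [])) ∷ (switch ((0 , p3) ∷ (3 , p2) ∷ (4 , p2) ∷ (5 , p3) ∷ []) []) ∷ (earlier 1 (0 ∷ 8 ∷ 16 ∷ 24 ∷ 32 ∷ 40 ∷ 49 ∷ [])) ∷ (earlier 0 (0 ∷ 8 ∷ 16 ∷ 24 ∷ 32 ∷ 40 ∷ 49 ∷ [])) ∷ [])) ∷ (earlier 0 (0 ∷ 8 ∷ 16 ∷ 24 ∷ 32 ∷ 41 ∷ 48 ∷ [])) ∷ [])) ∷ [])) ∷ (earlier 0 (0 ∷ 8 ∷ 16 ∷ 24 ∷ 33 ∷ 40 ∷ 48 ∷ [])) ∷ (include 4 ((switch ((2 , p3) ∷ (4 , p3) ∷ []) ((include 5 ((switch ((1 , p2) ∷ (2 , p2) ∷ (3 , p3) ∷ (5 , p3) ∷ []) []) ∷ (earlier 0 (0 ∷ 8 ∷ 16 ∷ 24 ∷ 32 ∷ 41 ∷ 48 ∷ [])) ∷ [])) ∷ (earlier 0 (0 ∷ 8 ∷ 16 ∷ 24 ∷ 32 ∷ 40 ∷ 48 ∷ [])) ∷ (triangle (4 , q0)) ∷ (earlier 0 (0 ∷ 8 ∷ 16 ∷ 24 ∷ 32 ∷ 40 ∷ 48 ∷ [])) ∷ [])) ∷ (earlier 0 (0 ∷ 8 ∷ 16 ∷ 24 ∷ 33 ∷ 40 ∷ 48 ∷ [])) ∷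 [])) ∷ (earlier 0 (0 ∷ 8 ∷ 16 ∷ 24 ∷ 32 ∷ 40 ∷ 49 ∷ [])) ∷ (triangle (2 , q0)) ∷ (triangle (2 , q0)) ∷ (earlier 0 (0 ∷ 8 ∷ 16 ∷ 24 ∷ 32 ∷ 40 ∷ 48 ∷ [])) ∷ (earlier 0 (0 ∷ 8 ∷ 16 ∷ 24 ∷ 32 ∷ 40 ∷ 49 ∷ [])) ∷ [])) ∷ (triangle (2 , q0)) ∷ (switch ((0 , p3) ∷ (1 , p2) ∷ (2 , p2) ∷ (3 , p3) ∷ []) ((triangle (4 , q1)) ∷ (triangle (2 , q0)) ∷ (triangle (4 , q1)) ∷ (triangle (2 , q0)) ∷ (triangle (4 , q1)) ∷ (earlier 11 (0 ∷ 8 ∷ 16 ∷ 24 ∷ 32 ∷ 40 ∷ [])) ∷ (triangle (2 , q0)) ∷ (switch ((0 , p3) ∷ (1 , p2) ∷ (2 , p2) ∷ (3 , p3) ∷ []) ((triangle (4 , q1)) ∷ (triangle (4 , q1)) ∷ (triangle (4 , q1)) ∷ (contains F₆ (1 ∷ 0 ∷ 3 ∷ 2 ∷ 4 ∷ 5 ∷ [])) ∷ (contains F₆ (1 ∷ 0 ∷ 3 ∷ 2 ∷ 4 ∷ 5 ∷ [])) ∷ (include 5 []) ∷ (contains F₆ (1 ∷ 0 ∷ 3 ∷ 2 ∷ 4 ∷ 5 ∷ [])) ∷ (contains F₆ (1 ∷ 0 ∷ 3 ∷ 2 ∷ 4 ∷ 5 ∷ [])) ∷ (earlier 0 (0 ∷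 8 ∷ 16 ∷ 24 ∷ 32 ∷ 40 ∷ 50 ∷ [])) ∷ (contains F₆ (1 ∷ 0 ∷ 3 ∷ 2 ∷ 4 ∷ 5 ∷ [])) ∷ (contains F₆ (1 ∷ 0 ∷ 3 ∷ 2 ∷ 4 ∷ 5 ∷ [])) ∷ (earlier 0 (0 ∷ 8 ∷ 16 ∷ 24 ∷ 32 ∷ 40 ∷ 50 ∷ [])) ∷ [])) ∷ (triangle (2 , q0)) ∷ (earlier 13 (0 ∷ 8 ∷ 16 ∷ 24 ∷ 32 ∷ 42 ∷ [])) ∷ (earlier 0 (0 ∷ 8 ∷ 16 ∷ 24 ∷ 32 ∷ 42 ∷ [])) ∷ (earlier 13 (0 ∷ 8 ∷ 16 ∷ 24 ∷ 32 ∷ 42 ∷ [])) ∷ (triangle (2 , q0)) ∷ (triangle (2 , q0)) ∷ (triangle (2 , q0)) ∷ [])) ∷ (earlier 0 (0 ∷ 8 ∷ 16 ∷ 24 ∷ 33 ∷ [])) ∷ (include 4 ((switch ((0 , p3) ∷ (1 , p2) ∷ []) ((triangle (4 , q1)) ∷ (contains F₆ (1 ∷ 0 ∷ 3 ∷ 2 ∷ 4 ∷ 5 ∷ [])) ∷ (contains F₆ (1 ∷ 0 ∷ 3 ∷ 2 ∷ 4 ∷ 5 ∷ [])) ∷ (earlier 16 (0 ∷ 8 ∷ 16 ∷ 24 ∷ 33 ∷ 48 ∷ 42 ∷ [])) ∷ (triangle (4 , q1)) ∷ (switch ((0 , p3) ∷ (1 , p2) ∷ (2 , p2) ∷ (3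 , p3) ∷ []) ((triangle (4 , q1)) ∷ (triangle (4 , q1)) ∷ (triangle (4 , q1)) ∷ (contains F₆ (1 ∷ 0 ∷ 3 ∷ 2 ∷ 4 ∷ 5 ∷ [])) ∷ (contains F₆ (1 ∷ 0 ∷ 3 ∷ 2 ∷ 4 ∷ 5 ∷ [])) ∷ (earlier 16 (0 ∷ 8 ∷ 16 ∷ 24 ∷ 33 ∷ 48 ∷ 42 ∷ [])) ∷ (contains F₆ (1 ∷ 0 ∷ 3 ∷ 2 ∷ 4 ∷ 5 ∷ [])) ∷ (contains F₆ (1 ∷ 0 ∷ 3 ∷ 2 ∷ 4 ∷ 5 ∷ [])) ∷ (earlier 16 (0 ∷ 8 ∷ 16 ∷ 24 ∷ 33 ∷ 50 ∷ 42 ∷ [])) ∷ (contains F₆ (1 ∷ 0 ∷ 3 ∷ 2 ∷ 4 ∷ 5 ∷ [])) ∷ (contains F₆ (1 ∷ 0 ∷ 3 ∷ 2 ∷ 4 ∷ 5 ∷ [])) ∷ (earlier 16 (0 ∷ 8 ∷ 16 ∷ 24 ∷ 33 ∷ 50 ∷ 42 ∷ [])) ∷ [])) ∷ (earlier 0 (0 ∷ 8 ∷ 16 ∷ 24 ∷ 32 ∷ 40 ∷ [])) ∷ [])) ∷ (earlier 0 (0 ∷ 8 ∷ 16 ∷ 24 ∷ 33 ∷ 40 ∷ [])) ∷ [])) ∷ (earlier 3 (0 ∷ 8 ∷ 16 ∷ 24 ∷ 32 ∷ [])) ∷ (earlier 3 (0 ∷ 8 ∷ 16 ∷ 24 ∷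 33 ∷ [])) ∷ [])) ∷ (include 4 ((switch ((2 , p3) ∷ (4 , p3) ∷ []) ((triangle (4 , q0)) ∷ (switch ((2 , p3) ∷ (4 , p3) ∷ []) ((switch ((2 , p2) ∷ (3 , p3) ∷ []) ((switch ((0 , p3) ∷ (1 , p2) ∷ []) ((contains F₆ (4 ∷ 0 ∷ 3 ∷ 2 ∷ 1 ∷ 6 ∷ [])) ∷ (switch ((2 , p3) ∷ (3 , p3) ∷ (4 , p2) ∷ []) []) ∷ [])) ∷ (earlier 0 (0 ∷ 8 ∷ 16 ∷ 24 ∷ 32 ∷ 40 ∷ 49 ∷ [])) ∷ (earlier 0 (0 ∷ 8 ∷ 16 ∷ 24 ∷ 32 ∷ 40 ∷ 48 ∷ [])) ∷ (earlier 0 (0 ∷ 8 ∷ 16 ∷ 24 ∷ 32 ∷ 40 ∷ 49 ∷ [])) ∷ [])) ∷ [])) ∷ (switch ((0 , p3) ∷ (1 , p2) ∷ []) ((earlier 28 (0 ∷ 8 ∷ 16 ∷ 24 ∷ 33 ∷ 40 ∷ [])) ∷ (earlier 17 (0 ∷ 8 ∷ 16 ∷ 24 ∷ 32 ∷ 40 ∷ 48 ∷ [])) ∷ [])) ∷ [])) ∷ [])) ∷ (earlier 0 (0 ∷ 8 ∷ 16 ∷ 24 ∷ 33 ∷ [])) ∷ (switch ((2 , p2) ∷ (3 , p3) ∷ []) ((include 4 ((include 5 ((switch ((2 , p3) ∷ (5 , p3) ∷ []) ((triangle (5 , q0)) ∷ (switch ((2 , p3) ∷ (5 , p3) ∷ [])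 ((switch ((2 , p2) ∷ (3 , p3) ∷ []) ((contains F₆ (4 ∷ 0 ∷ 1 ∷ 2 ∷ 3 ∷ 5 ∷ [])) ∷ (contains F₆ (4 ∷ 0 ∷ 1 ∷ 2 ∷ 3 ∷ 5 ∷ [])) ∷ [])) ∷ [])) ∷ (switch ((0 , p3) ∷ (1 , p2) ∷ []) ((contains F₆ (4 ∷ 0 ∷ 1 ∷ 2 ∷ 3 ∷ 5 ∷ [])) ∷ (include 6 ((earlier 26 (0 ∷ 8 ∷ 16 ∷ 24 ∷ 40 ∷ 37 ∷ 49 ∷ [])) ∷ (earlier 26 (0 ∷ 8 ∷ 16 ∷ 24 ∷ 40 ∷ 37 ∷ 48 ∷ [])) ∷ [])) ∷ [])) ∷ [])) ∷ [])) ∷ [])) ∷ (earlier 0 (0 ∷ 8 ∷ 16 ∷ 24 ∷ 32 ∷ 41 ∷ [])) ∷ (include 4 ((switch ((0 , p3) ∷ (1 , p2) ∷ (2 , p2) ∷ (4 , p2) ∷ []) ((triangle (5 , q0)) ∷ (triangle (5 , q0)) ∷ (switch ((1 , p2) ∷ (4 , p2) ∷ []) ((contains F₆ (4 ∷ 0 ∷ 1 ∷ 2 ∷ 3 ∷ 5 ∷ [])) ∷ (contains F₆ (4 ∷ 0 ∷ 1 ∷ 2 ∷ 3 ∷ 5 ∷ [])) ∷ (triangle (5 , q0)) ∷ (triangle (5 , q0)) ∷ (include 5 []) ∷ [])) ∷ (triangle (5 , q0)) ∷ (triangle (5 , q0)) ∷ (triangle (5 , q0)) ∷ (triangle (5 ,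 q0)) ∷ [])) ∷ [])) ∷ (switch ((3 , p3) ∷ []) ((switch ((0 , p3) ∷ (1 , p2) ∷ []) ((contains K₃₃ (0 ∷ 2 ∷ 6 ∷ 1 ∷ 3 ∷ 4 ∷ [])) ∷ [])) ∷ (earlier 0 (0 ∷ 8 ∷ 16 ∷ 24 ∷ 32 ∷ 40 ∷ 49 ∷ [])) ∷ (contains K₃₃ (0 ∷ 2 ∷ 5 ∷ 1 ∷ 3 ∷ 4 ∷ [])) ∷ [])) ∷ (earlier 0 (0 ∷ 8 ∷ 16 ∷ 24 ∷ 32 ∷ 41 ∷ [])) ∷ (switch ((0 , p3) ∷ (1 , p2) ∷ []) ((contains K₃₃ (0 ∷ 2 ∷ 5 ∷ 1 ∷ 3 ∷ 4 ∷ [])) ∷ [])) ∷ (earlier 0 (0 ∷ 8 ∷ 16 ∷ 24 ∷ 32 ∷ 41 ∷ [])) ∷ (earlier 1 (0 ∷ 8 ∷ 16 ∷ 24 ∷ 32 ∷ 40 ∷ [])) ∷ (earlier 1 (0 ∷ 8 ∷ 16 ∷ 24 ∷ 32 ∷ 41 ∷ [])) ∷ (earlier 3 (0 ∷ 8 ∷ 16 ∷ 24 ∷ 32 ∷ [])) ∷ [])) ∷ (earlier 0 (0 ∷ 8 ∷ 16 ∷ 24 ∷ 33 ∷ [])) ∷ (include 4 ((switch ((1 , p2) ∷ (2 , p3) ∷ []) ((switch ((4 , p2) ∷ []) []) ∷ (triangle (4 , q0)) ∷ (switch ((4 , p2) ∷ []) ((switch ((2 , p2) ∷ (4 , p3)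 ∷ []) []) ∷ (earlier 0 (0 ∷ 8 ∷ 16 ∷ 24 ∷ 32 ∷ 40 ∷ 49 ∷ [])) ∷ [])) ∷ (earlier 0 (0 ∷ 8 ∷ 16 ∷ 24 ∷ 32 ∷ 41 ∷ [])) ∷ [])) ∷ (switch ((0 , p2) ∷ (1 , p2) ∷ []) ((switch ((4 , p3) ∷ []) ((switch ((1 , p3) ∷ []) ((contains F₆ (3 ∷ 0 ∷ 4 ∷ 2 ∷ 1 ∷ 5 ∷ [])) ∷ (switch ((0 , p2) ∷ (1 , p2) ∷ (4 , p3) ∷ []) ((switch ((0 , p2) ∷ (2 , p3) ∷ (3 , p3) ∷ []) []) ∷ (earlier 0 (0 ∷ 8 ∷ 16 ∷ 24 ∷ 32 ∷ 40 ∷ 49 ∷ [])) ∷ (earlier 0 (0 ∷ 8 ∷ 16 ∷ 24 ∷ 32 ∷ 40 ∷ 48 ∷ [])) ∷ (earlier 0 (0 ∷ 8 ∷ 16 ∷ 24 ∷ 32 ∷ 40 ∷ 49 ∷ [])) ∷ [])) ∷ [])) ∷ (earlier 0 (0 ∷ 8 ∷ 16 ∷ 24 ∷ 32 ∷ 41 ∷ [])) ∷ [])) ∷ (switch ((4 , p3) ∷ []) ((switch ((3 , p3) ∷ []) ((switch ((1 , p3) ∷ []) ((contains K₃₃ (0 ∷ 2 ∷ 7 ∷ 1 ∷ 3 ∷ 5 ∷ [])) ∷ [])) ∷ (earlier 0 (0 ∷ 8 ∷ 16 ∷ 24 ∷ 32 ∷ 40 ∷ 48 ∷ 57 ∷ []))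 ∷ (contains K₃₃ (0 ∷ 2 ∷ 6 ∷ 3 ∷ 4 ∷ 5 ∷ [])) ∷ [])) ∷ (earlier 0 (0 ∷ 8 ∷ 16 ∷ 24 ∷ 32 ∷ 40 ∷ 49 ∷ [])) ∷ (switch ((0 , p2) ∷ (1 , p2) ∷ (4 , p3) ∷ []) ((contains F₆ (1 ∷ 0 ∷ 4 ∷ 2 ∷ 3 ∷ 5 ∷ [])) ∷ (contains F₆ (1 ∷ 0 ∷ 4 ∷ 2 ∷ 3 ∷ 5 ∷ [])) ∷ [])) ∷ [])) ∷ (earlier 0 (0 ∷ 8 ∷ 16 ∷ 24 ∷ 32 ∷ 41 ∷ [])) ∷ (earlier 4 (0 ∷ 8 ∷ 16 ∷ 24 ∷ 32 ∷ [])) ∷ [])) ∷ (earlier 9 (0 ∷ 8 ∷ 16 ∷ 24 ∷ 33 ∷ [])) ∷ (earlier 0 (0 ∷ 8 ∷ 16 ∷ 24 ∷ 33 ∷ [])) ∷ (switch ((1 , p3) ∷ []) ((switch ((0 , p3) ∷ (1 , p2) ∷ []) ((switch ((1 , p2) ∷ (2 , p2) ∷ []) ((contains F₆ (3 ∷ 0 ∷ 1 ∷ 2 ∷ 4 ∷ 5 ∷ [])) ∷ (contains F₆ (3 ∷ 0 ∷ 1 ∷ 2 ∷ 4 ∷ 5 ∷ [])) ∷ (contains F₆ (1 ∷ 0 ∷ 3 ∷ 2 ∷ 5 ∷ 4 ∷ [])) ∷ (contains F₆ (1 ∷ 0 ∷ 3 ∷ 2 ∷ 5 ∷ 4 ∷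 [])) ∷ (include 5 []) ∷ (contains F₆ (3 ∷ 0 ∷ 1 ∷ 2 ∷ 4 ∷ 5 ∷ [])) ∷ (contains F₆ (3 ∷ 0 ∷ 1 ∷ 2 ∷ 4 ∷ 5 ∷ [])) ∷ [])) ∷ (switch ((0 , p3) ∷ (2 , p2) ∷ (3 , p3) ∷ []) ((contains F₆ (2 ∷ 3 ∷ 1 ∷ 4 ∷ 0 ∷ 5 ∷ [])) ∷ (switch ((0 , p3) ∷ (1 , p2) ∷ (2 , p2) ∷ (3 , p3) ∷ []) ((contains F₆ (1 ∷ 0 ∷ 3 ∷ 2 ∷ 5 ∷ 4 ∷ [])) ∷ (contains F₆ (1 ∷ 0 ∷ 3 ∷ 2 ∷ 5 ∷ 4 ∷ [])) ∷ (contains F₆ (1 ∷ 0 ∷ 3 ∷ 2 ∷ 5 ∷ 4 ∷ [])) ∷ [])) ∷ (earlier 0 (0 ∷ 8 ∷ 16 ∷ 24 ∷ 32 ∷ 40 ∷ [])) ∷ (switch ((0 , p3) ∷ (3 , p2) ∷ []) ((contains F₆ (4 ∷ 0 ∷ 1 ∷ 2 ∷ 3 ∷ 5 ∷ [])) ∷ (contains F₆ (2 ∷ 3 ∷ 1 ∷ 4 ∷ 0 ∷ 5 ∷ [])) ∷ (switch ((1 , p2) ∷ (2 , p2) ∷ []) ((switch ((2 , p2) ∷ (4 , p2) ∷ []) []) ∷ (earlier 0 (0 ∷ 8 ∷ 16 ∷ 24 ∷ 32 ∷ 40 ∷ 49 ∷ [])) ∷ (earlier 0 (0 ∷ 8 ∷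 16 ∷ 24 ∷ 32 ∷ 40 ∷ 48 ∷ [])) ∷ (earlier 0 (0 ∷ 8 ∷ 16 ∷ 24 ∷ 32 ∷ 40 ∷ 49 ∷ [])) ∷ [])) ∷ [])) ∷ (earlier 0 (0 ∷ 8 ∷ 16 ∷ 24 ∷ 32 ∷ 40 ∷ [])) ∷ [])) ∷ (earlier 0 (0 ∷ 8 ∷ 16 ∷ 24 ∷ 32 ∷ 41 ∷ [])) ∷ (earlier 0 (0 ∷ 8 ∷ 16 ∷ 24 ∷ 32 ∷ 40 ∷ [])) ∷ (earlier 0 (0 ∷ 8 ∷ 16 ∷ 24 ∷ 32 ∷ 41 ∷ [])) ∷ [])) ∷ (earlier 0 (17 ∷ 11 ∷ 1 ∷ 35 ∷ 27 ∷ [])) ∷ (switch ((1 , p2) ∷ (2 , p2) ∷ []) ((earlier 5 (17 ∷ 11 ∷ 1 ∷ 35 ∷ 27 ∷ 44 ∷ [])) ∷ (earlier 5 (17 ∷ 11 ∷ 1 ∷ 35 ∷ 27 ∷ 46 ∷ [])) ∷ (contains F₆ (1 ∷ 0 ∷ 3 ∷ 2 ∷ 5 ∷ 4 ∷ [])) ∷ (contains F₆ (1 ∷ 0 ∷ 3 ∷ 2 ∷ 5 ∷ 4 ∷ [])) ∷ (earlier 7 (0 ∷ 8 ∷ 16 ∷ 24 ∷ 32 ∷ 42 ∷ 48 ∷ [])) ∷ (earlier 5 (17 ∷ 11 ∷ 1 ∷ 35 ∷ 27 ∷ 44 ∷ [])) ∷ (earlier 5 (17 ∷ 11 ∷ 1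 ∷ 35 ∷ 27 ∷ 46 ∷ [])) ∷ [])) ∷ (earlier 0 (17 ∷ 11 ∷ 1 ∷ 35 ∷ 27 ∷ 40 ∷ [])) ∷ (switch ((1 , p2) ∷ (2 , p2) ∷ []) ((switch ((0 , p3) ∷ (4 , p3) ∷ []) ((switch ((0 , p3) ∷ (2 , p2) ∷ (4 , p3) ∷ []) []) ∷ (earlier 0 (0 ∷ 8 ∷ 16 ∷ 24 ∷ 32 ∷ 40 ∷ 49 ∷ [])) ∷ [])) ∷ (earlier 0 (0 ∷ 8 ∷ 16 ∷ 24 ∷ 32 ∷ 41 ∷ [])) ∷ (earlier 0 (0 ∷ 8 ∷ 16 ∷ 24 ∷ 32 ∷ 40 ∷ [])) ∷ (earlier 0 (0 ∷ 8 ∷ 16 ∷ 24 ∷ 32 ∷ 41 ∷ [])) ∷ (switch ((0 , p3) ∷ (3 , p2) ∷ []) ((contains K₃₃ (0 ∷ 2 ∷ 5 ∷ 1 ∷ 3 ∷ 4 ∷ [])) ∷ [])) ∷ (earlier 0 (0 ∷ 8 ∷ 16 ∷ 24 ∷ 32 ∷ 41 ∷ 48 ∷ [])) ∷ (triangle (5 , q0)) ∷ (triangle (5 , q0)) ∷ (switch ((0 , p3) ∷ (1 , p2) ∷ (2 , p2) ∷ (3 , p3) ∷ []) []) ∷ (earlier 1 (0 ∷ 8 ∷ 16 ∷ 24 ∷ 32 ∷ 40 ∷ 48 ∷ [])) ∷ (earlier 1 (0 ∷ 8 ∷ 16 ∷ 24 ∷ 32 ∷ 41 ∷ 48 ∷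 [])) ∷ [])) ∷ (earlier 0 (17 ∷ 11 ∷ 1 ∷ 35 ∷ 27 ∷ 40 ∷ [])) ∷ [])) ∷ (earlier 0 (0 ∷ 8 ∷ 16 ∷ 24 ∷ 33 ∷ [])) ∷ [])) ∷ [])) ∷ (switch ((1 , p2) ∷ (3 , p3) ∷ []) ((include 4 ((switch ((2 , p3) ∷ (4 , p3) ∷ []) ((switch ((1 , p3) ∷ (4 , p3) ∷ []) ((switch ((0 , p2) ∷ (1 , p2) ∷ (2 , p3) ∷ (4 , p3) ∷ []) ((switch ((2 , p3) ∷ (3 , p3) ∷ []) ((contains K₃₃ (0 ∷ 2 ∷ 5 ∷ 1 ∷ 3 ∷ 4 ∷ [])) ∷ (contains K₃₃ (0 ∷ 2 ∷ 5 ∷ 1 ∷ 3 ∷ 4 ∷ [])) ∷ [])) ∷ (earlier 0 (0 ∷ 8 ∷ 16 ∷ 24 ∷ 32 ∷ 40 ∷ [])) ∷ [])) ∷ (include 5 ((switch ((1 , p3) ∷ (2 , p3) ∷ (4 , p3) ∷ (5 , p3) ∷ []) ((switch ((1 , p3) ∷ (3 , p3) ∷ (4 , p3) ∷ (5 , p3) ∷ []) ((contains K₃₃ (0 ∷ 2 ∷ 5 ∷ 1 ∷ 3 ∷ 6 ∷ [])) ∷ (contains K₃₃ (0 ∷ 2 ∷ 5 ∷ 1 ∷ 3 ∷ 6 ∷ [])) ∷ [])) ∷ (earlier 0 (0 ∷ 8 ∷ 16 ∷ 24 ∷ 32 ∷ 40 ∷ 49 ∷ [])) ∷ (switch ((0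 , p2) ∷ (1 , p2) ∷ (3 , p3) ∷ (4 , p3) ∷ []) ((contains K₃₃ (0 ∷ 2 ∷ 5 ∷ 1 ∷ 4 ∷ 6 ∷ [])) ∷ (contains K₃₃ (0 ∷ 2 ∷ 5 ∷ 1 ∷ 4 ∷ 6 ∷ [])) ∷ (contains K₃₃ (0 ∷ 2 ∷ 5 ∷ 1 ∷ 3 ∷ 4 ∷ [])) ∷ (contains K₃₃ (0 ∷ 2 ∷ 5 ∷ 1 ∷ 3 ∷ 4 ∷ [])) ∷ (contains K₃₃ (0 ∷ 2 ∷ 5 ∷ 1 ∷ 4 ∷ 6 ∷ [])) ∷ (contains K₃₃ (0 ∷ 2 ∷ 5 ∷ 1 ∷ 4 ∷ 6 ∷ [])) ∷ [])) ∷ (earlier 0 (0 ∷ 8 ∷ 16 ∷ 24 ∷ 32 ∷ 40 ∷ 48 ∷ [])) ∷ [])) ∷ [])) ∷ [])) ∷ (earlier 0 (0 ∷ 8 ∷ 16 ∷ 24 ∷ 32 ∷ 41 ∷ [])) ∷ (switch ((2 , p3) ∷ (3 , p3) ∷ []) ((contains K₃₃ (0 ∷ 2 ∷ 4 ∷ 1 ∷ 3 ∷ 5 ∷ [])) ∷ (switch ((2 , p2) ∷ []) ((include 5 ((switch ((2 , p3) ∷ (3 , p3) ∷ (5 , p3) ∷ []) []) ∷ [])) ∷ (include 5 ((switch ((2 , p3) ∷ (3 , p3) ∷ (5 , p3) ∷ []) []) ∷ [])) ∷ [])) ∷ (earlier 0 (0 ∷ 8 ∷ 16 ∷ 24 ∷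 32 ∷ 40 ∷ 49 ∷ [])) ∷ (switch ((0 , p3) ∷ (1 , p2) ∷ (4 , p3) ∷ []) ((contains K₃₃ (0 ∷ 2 ∷ 6 ∷ 1 ∷ 3 ∷ 5 ∷ [])) ∷ [])) ∷ (earlier 0 (0 ∷ 8 ∷ 16 ∷ 24 ∷ 32 ∷ 40 ∷ 49 ∷ [])) ∷ (contains K₃₃ (0 ∷ 2 ∷ 4 ∷ 1 ∷ 3 ∷ 5 ∷ [])) ∷ (earlier 1 (0 ∷ 8 ∷ 16 ∷ 24 ∷ 32 ∷ 40 ∷ 48 ∷ [])) ∷ (earlier 1 (0 ∷ 8 ∷ 16 ∷ 24 ∷ 32 ∷ 40 ∷ 49 ∷ [])) ∷ [])) ∷ (earlier 0 (0 ∷ 8 ∷ 16 ∷ 24 ∷ 32 ∷ 41 ∷ [])) ∷ (switch ((1 , p3) ∷ (4 , p3) ∷ []) ((switch ((0 , p2) ∷ (1 , p2) ∷ (3 , p3) ∷ (4 , p3) ∷ []) ((include 5 ((switch ((2 , p3) ∷ (5 , p2) ∷ []) ((contains F₆ (3 ∷ 0 ∷ 4 ∷ 2 ∷ 1 ∷ 5 ∷ [])) ∷ (contains F₆ (3 ∷ 0 ∷ 4 ∷ 2 ∷ 1 ∷ 5 ∷ [])) ∷ (contains F₆ (3 ∷ 0 ∷ 4 ∷ 2 ∷ 1 ∷ 5 ∷ [])) ∷ (contains F₆ (2 ∷ 1 ∷ 4 ∷ 3 ∷ 0 ∷ 5 ∷ [])) ∷ [])) ∷ (earlier 0 (0 ∷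 8 ∷ 16 ∷ 24 ∷ 32 ∷ 41 ∷ [])) ∷ [])) ∷ (switch ((0 , p2) ∷ (1 , p2) ∷ []) ((contains F₆ (1 ∷ 0 ∷ 4 ∷ 2 ∷ 3 ∷ 5 ∷ [])) ∷ [])) ∷ (earlier 0 (0 ∷ 8 ∷ 16 ∷ 24 ∷ 32 ∷ 41 ∷ [])) ∷ (switch ((2 , p3) ∷ (3 , p3) ∷ []) ((contains K₃₃ (0 ∷ 2 ∷ 5 ∷ 1 ∷ 3 ∷ 4 ∷ [])) ∷ (contains K₃₃ (0 ∷ 2 ∷ 5 ∷ 1 ∷ 3 ∷ 4 ∷ [])) ∷ [])) ∷ (earlier 0 (0 ∷ 8 ∷ 16 ∷ 24 ∷ 32 ∷ 41 ∷ [])) ∷ (earlier 2 (0 ∷ 8 ∷ 16 ∷ 24 ∷ 32 ∷ 40 ∷ [])) ∷ (earlier 0 (0 ∷ 8 ∷ 16 ∷ 24 ∷ 32 ∷ 40 ∷ [])) ∷ (earlier 0 (0 ∷ 8 ∷ 16 ∷ 24 ∷ 32 ∷ 41 ∷ [])) ∷ (earlier 2 (0 ∷ 8 ∷ 16 ∷ 24 ∷ 32 ∷ 40 ∷ [])) ∷ (earlier 2 (0 ∷ 8 ∷ 16 ∷ 24 ∷ 32 ∷ 40 ∷ [])) ∷ (earlier 2 (0 ∷ 8 ∷ 16 ∷ 24 ∷ 32 ∷ 40 ∷ [])) ∷ (earlier 1 (0 ∷ 8 ∷ 16 ∷ 24 ∷ 32 ∷ 40 ∷ [])) ∷ (earlier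 1 (0 ∷ 8 ∷ 16 ∷ 24 ∷ 32 ∷ 41 ∷ [])) ∷ [])) ∷ (include 5 ((switch ((2 , p3) ∷ (3 , p3) ∷ []) ((switch ((2 , p3) ∷ (5 , p3) ∷ []) ((switch ((0 , p2) ∷ (1 , p2) ∷ (3 , p3) ∷ (4 , p3) ∷ []) ((contains K₃₃ (0 ∷ 2 ∷ 5 ∷ 1 ∷ 4 ∷ 6 ∷ [])) ∷ (contains K₃₃ (0 ∷ 2 ∷ 5 ∷ 1 ∷ 3 ∷ 4 ∷ [])) ∷ (contains K₃₃ (0 ∷ 2 ∷ 5 ∷ 1 ∷ 3 ∷ 4 ∷ [])) ∷ (contains K₃₃ (0 ∷ 2 ∷ 5 ∷ 1 ∷ 4 ∷ 6 ∷ [])) ∷ [])) ∷ [])) ∷ (earlier 0 (0 ∷ 8 ∷ 16 ∷ 24 ∷ 32 ∷ 40 ∷ 49 ∷ [])) ∷ (contains K₃₃ (0 ∷ 2 ∷ 5 ∷ 1 ∷ 3 ∷ 4 ∷ [])) ∷ (contains K₃₃ (0 ∷ 2 ∷ 5 ∷ 1 ∷ 3 ∷ 4 ∷ [])) ∷ (switch ((2 , p3) ∷ (5 , p3) ∷ []) ((switch ((3 , p2) ∷ []) ((contains K₃₃ (0 ∷ 2 ∷ 5 ∷ 1 ∷ 4 ∷ 6 ∷ [])) ∷ (contains K₃₃ (0 ∷ 2 ∷ 5 ∷ 1 ∷ 3 ∷ 4 ∷ [])) ∷ (contains K₃₃ (0 ∷ 2 ∷ 5 ∷ 1 ∷ 3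 ∷ 4 ∷ [])) ∷ [])) ∷ [])) ∷ (earlier 0 (0 ∷ 8 ∷ 16 ∷ 24 ∷ 32 ∷ 40 ∷ 49 ∷ 56 ∷ [])) ∷ [])) ∷ (switch ((2 , p3) ∷ (5 , p2) ∷ []) ((switch ((2 , p3) ∷ (5 , p3) ∷ []) ((switch ((0 , p2) ∷ (1 , p2) ∷ (3 , p3) ∷ (4 , p3) ∷ []) ((include 6 ((switch ((2 , p3) ∷ (6 , p3) ∷ []) ((contains K₃₃ (0 ∷ 2 ∷ 5 ∷ 1 ∷ 3 ∷ 6 ∷ [])) ∷ (contains K₃₃ (0 ∷ 2 ∷ 5 ∷ 1 ∷ 3 ∷ 6 ∷ [])) ∷ [])) ∷ [])) ∷ (contains K₃₃ (0 ∷ 2 ∷ 5 ∷ 1 ∷ 3 ∷ 6 ∷ [])) ∷ (earlier 0 (0 ∷ 8 ∷ 16 ∷ 24 ∷ 32 ∷ 40 ∷ 48 ∷ 56 ∷ [])) ∷ (earlier 0 (0 ∷ 8 ∷ 16 ∷ 24 ∷ 32 ∷ 40 ∷ 48 ∷ 56 ∷ [])) ∷ (earlier 0 (0 ∷ 8 ∷ 16 ∷ 24 ∷ 32 ∷ 40 ∷ 48 ∷ 56 ∷ [])) ∷ (earlier 0 (0 ∷ 8 ∷ 16 ∷ 24 ∷ 32 ∷ 40 ∷ 48 ∷ 56 ∷ [])) ∷ (contains K₃₃ (0 ∷ 2 ∷ 5 ∷ 1 ∷ 3 ∷ 6 ∷ [])) ∷ [])) ∷ [])) ∷ (earlier 0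 (0 ∷ 8 ∷ 16 ∷ 24 ∷ 32 ∷ 40 ∷ 49 ∷ 56 ∷ [])) ∷ (switch ((2 , p3) ∷ (5 , p3) ∷ []) ((switch ((0 , p2) ∷ (1 , p2) ∷ (3 , p3) ∷ (4 , p3) ∷ []) ((include 6 ((switch ((2 , p3) ∷ (6 , p3) ∷ []) ((contains K₃₃ (0 ∷ 2 ∷ 5 ∷ 1 ∷ 3 ∷ 6 ∷ [])) ∷ (contains K₃₃ (0 ∷ 2 ∷ 5 ∷ 1 ∷ 3 ∷ 6 ∷ [])) ∷ [])) ∷ [])) ∷ (contains K₃₃ (0 ∷ 2 ∷ 5 ∷ 1 ∷ 3 ∷ 6 ∷ [])) ∷ (earlier 0 (0 ∷ 8 ∷ 16 ∷ 24 ∷ 32 ∷ 40 ∷ 48 ∷ 56 ∷ 64 ∷ [])) ∷ (earlier 0 (0 ∷ 8 ∷ 16 ∷ 24 ∷ 32 ∷ 40 ∷ 48 ∷ 56 ∷ 64 ∷ [])) ∷ (earlier 0 (0 ∷ 8 ∷ 16 ∷ 24 ∷ 32 ∷ 40 ∷ 48 ∷ 56 ∷ 64 ∷ [])) ∷ (earlier 0 (0 ∷ 8 ∷ 16 ∷ 24 ∷ 32 ∷ 40 ∷ 48 ∷ 56 ∷ 64 ∷ [])) ∷ (contains K₃₃ (0 ∷ 2 ∷ 5 ∷ 1 ∷ 3 ∷ 6 ∷ [])) ∷ [])) ∷ [])) ∷ (earlier 0 (0 ∷ 8 ∷ 16 ∷ 24 ∷ 32 ∷ 40 ∷ 49 ∷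 56 ∷ 64 ∷ [])) ∷ (include 6 ((switch ((2 , p3) ∷ (6 , p3) ∷ []) ((contains K₃₃ (0 ∷ 2 ∷ 5 ∷ 1 ∷ 3 ∷ 6 ∷ [])) ∷ (contains K₃₃ (0 ∷ 2 ∷ 5 ∷ 1 ∷ 3 ∷ 6 ∷ [])) ∷ [])) ∷ (earlier 0 (0 ∷ 8 ∷ 16 ∷ 24 ∷ 32 ∷ 40 ∷ 49 ∷ [])) ∷ [])) ∷ [])) ∷ (earlier 11 (0 ∷ 8 ∷ 16 ∷ 24 ∷ 32 ∷ 41 ∷ 48 ∷ [])) ∷ (earlier 0 (0 ∷ 8 ∷ 16 ∷ 24 ∷ 32 ∷ 41 ∷ 48 ∷ [])) ∷ [])) ∷ (switch ((0 , p3) ∷ (2 , p2) ∷ (4 , p2) ∷ []) ((earlier 20 (0 ∷ 8 ∷ 16 ∷ 24 ∷ 32 ∷ 42 ∷ [])) ∷ (switch ((0 , p2) ∷ (2 , p3) ∷ []) ((contains F₆ (1 ∷ 0 ∷ 4 ∷ 2 ∷ 3 ∷ 5 ∷ [])) ∷ (contains F₆ (1 ∷ 0 ∷ 4 ∷ 2 ∷ 3 ∷ 5 ∷ [])) ∷ (include 5 []) ∷ (contains F₆ (1 ∷ 0 ∷ 4 ∷ 2 ∷ 3 ∷ 5 ∷ [])) ∷ (contains F₆ (1 ∷ 0 ∷ 4 ∷ 2 ∷ 3 ∷ 5 ∷ [])) ∷ [])) ∷ (include 6 ((switch ((2 , p3) ∷ (6 , p3) ∷ []) ((switch ((2 ,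 p3) ∷ (6 , p2) ∷ []) ((earlier 12 (0 ∷ 8 ∷ 16 ∷ 24 ∷ 32 ∷ 50 ∷ 42 ∷ 56 ∷ [])) ∷ [])) ∷ (earlier 0 (0 ∷ 8 ∷ 16 ∷ 24 ∷ 32 ∷ 41 ∷ 48 ∷ 56 ∷ [])) ∷ (switch ((2 , p3) ∷ (6 , p2) ∷ []) ((earlier 9 (0 ∷ 8 ∷ 16 ∷ 24 ∷ 32 ∷ 50 ∷ 42 ∷ 56 ∷ 64 ∷ [])) ∷ [])) ∷ (earlier 0 (0 ∷ 8 ∷ 16 ∷ 24 ∷ 32 ∷ 41 ∷ 48 ∷ 56 ∷ 64 ∷ [])) ∷ (earlier 6 (0 ∷ 8 ∷ 16 ∷ 24 ∷ 32 ∷ 50 ∷ 42 ∷ [])) ∷ [])) ∷ (earlier 0 (0 ∷ 8 ∷ 16 ∷ 24 ∷ 32 ∷ 40 ∷ 49 ∷ [])) ∷ [])) ∷ (include 5 ((include 6 ((switch ((2 , p3) ∷ (5 , p2) ∷ []) ((switch ((2 , p3) ∷ (6 , p3) ∷ []) ((contains K₃₃ (0 ∷ 2 ∷ 6 ∷ 1 ∷ 3 ∷ 5 ∷ [])) ∷ (contains K₃₃ (0 ∷ 2 ∷ 6 ∷ 1 ∷ 3 ∷ 5 ∷ [])) ∷ [])) ∷ [])) ∷ (switch ((2 , p3) ∷ (5 , p3) ∷ []) []) ∷ (earlier 1 (0 ∷ 8 ∷ 16 ∷ 24 ∷ 32 ∷ 40 ∷ 49 ∷ [])) ∷ (earlier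 0 (0 ∷ 8 ∷ 16 ∷ 24 ∷ 32 ∷ 40 ∷ 49 ∷ [])) ∷ [])) ∷ (earlier 0 (0 ∷ 8 ∷ 16 ∷ 24 ∷ 32 ∷ 41 ∷ 48 ∷ [])) ∷ [])) ∷ (earlier 9 (0 ∷ 8 ∷ 16 ∷ 24 ∷ 32 ∷ 42 ∷ [])) ∷ (earlier 31 (0 ∷ 8 ∷ 16 ∷ 24 ∷ 32 ∷ 40 ∷ [])) ∷ [])) ∷ (earlier 0 (0 ∷ 8 ∷ 16 ∷ 24 ∷ 32 ∷ [])) ∷ [])) ∷ (earlier 0 (0 ∷ 8 ∷ 16 ∷ 24 ∷ 32 ∷ [])) ∷ (earlier 0 (0 ∷ 8 ∷ 16 ∷ 24 ∷ 32 ∷ [])) ∷ (switch ((1 , p3) ∷ (4 , p3) ∷ []) ((switch ((0 , p2) ∷ (1 , p2) ∷ (3 , p3) ∷ (4 , p3) ∷ []) ((triangle (6 , q0)) ∷ (triangle (6 , q0)) ∷ (switch ((2 , p3) ∷ (3 , p3) ∷ []) ((switch ((0 , p2) ∷ (1 , p2) ∷ (2 , p3) ∷ (4 , p3) ∷ []) []) ∷ (earlier 0 (0 ∷ 8 ∷ 16 ∷ 24 ∷ 32 ∷ 40 ∷ 48 ∷ 57 ∷ [])) ∷ (earlier 0 (0 ∷ 8 ∷ 16 ∷ 24 ∷ 32 ∷ 40 ∷ 48 ∷ 56 ∷ [])) ∷ (earlier 0 (0 ∷ 8 ∷ 16 ∷ 24 ∷ 32 ∷ 40 ∷ 48 ∷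 57 ∷ [])) ∷ [])) ∷ (earlier 0 (0 ∷ 8 ∷ 16 ∷ 24 ∷ 32 ∷ 40 ∷ 49 ∷ [])) ∷ (earlier 0 (0 ∷ 8 ∷ 16 ∷ 24 ∷ 32 ∷ 40 ∷ 48 ∷ [])) ∷ (earlier 0 (0 ∷ 8 ∷ 16 ∷ 24 ∷ 32 ∷ 40 ∷ 49 ∷ [])) ∷ (triangle (6 , q0)) ∷ (triangle (6 , q0)) ∷ [])) ∷ (triangle (6 , q0)) ∷ (triangle (6 , q0)) ∷ (triangle (6 , q0)) ∷ (triangle (6 , q0)) ∷ [])) ∷ (earlier 0 (0 ∷ 8 ∷ 16 ∷ 24 ∷ 32 ∷ 41 ∷ 48 ∷ [])) ∷ (switch ((0 , p3) ∷ (1 , p2) ∷ (4 , p3) ∷ []) ((include 5 ((switch ((2 , p2) ∷ []) ((contains F₆ (2 ∷ 1 ∷ 4 ∷ 3 ∷ 0 ∷ 5 ∷ [])) ∷ (contains F₆ (2 ∷ 1 ∷ 5 ∷ 3 ∷ 0 ∷ 4 ∷ [])) ∷ (include 6 ((switch ((2 , p3) ∷ (6 , p2) ∷ []) ((contains K₃₃ (1 ∷ 3 ∷ 6 ∷ 2 ∷ 4 ∷ 5 ∷ [])) ∷ (contains K₃₃ (1 ∷ 3 ∷ 6 ∷ 2 ∷ 4 ∷ 5 ∷ [])) ∷ [])) ∷ (earlier 0 (0 ∷ 8 ∷ 16 ∷ 24 ∷ 32 ∷ 40 ∷ 49 ∷ [])) ∷ [])) ∷ (earlier 0 (4 ∷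 26 ∷ 19 ∷ 10 ∷ 45 ∷ 38 ∷ 48 ∷ [])) ∷ (contains F₆ (2 ∷ 1 ∷ 4 ∷ 3 ∷ 0 ∷ 5 ∷ [])) ∷ (contains F₆ (2 ∷ 1 ∷ 5 ∷ 3 ∷ 0 ∷ 4 ∷ [])) ∷ [])) ∷ [])) ∷ (include 5 ((include 6 ((switch ((2 , p3) ∷ (6 , p2) ∷ []) ((contains K₃₃ (0 ∷ 2 ∷ 5 ∷ 1 ∷ 3 ∷ 6 ∷ [])) ∷ (contains K₃₃ (0 ∷ 2 ∷ 5 ∷ 1 ∷ 3 ∷ 6 ∷ [])) ∷ [])) ∷ (switch ((1 , p3) ∷ (6 , p3) ∷ []) ((contains K₃₃ (0 ∷ 2 ∷ 5 ∷ 1 ∷ 3 ∷ 6 ∷ [])) ∷ (contains K₃₃ (0 ∷ 4 ∷ 5 ∷ 1 ∷ 3 ∷ 6 ∷ [])) ∷ [])) ∷ (earlier 0 (0 ∷ 8 ∷ 16 ∷ 24 ∷ 32 ∷ 40 ∷ 49 ∷ [])) ∷ (earlier 1 (0 ∷ 8 ∷ 16 ∷ 24 ∷ 32 ∷ 40 ∷ 49 ∷ [])) ∷ [])) ∷ [])) ∷ (switch ((0 , p3) ∷ (2 , p2) ∷ (4 , p2) ∷ []) ((contains F₆ (2 ∷ 1 ∷ 4 ∷ 3 ∷ 0 ∷ 5 ∷ [])) ∷ (contains F₆ (0 ∷ 1 ∷ 4 ∷ 3 ∷ 2 ∷ 5 ∷ [])) ∷ (include 5 ((earlier 27 (0 ∷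 8 ∷ 16 ∷ 24 ∷ 32 ∷ 40 ∷ 50 ∷ [])) ∷ [])) ∷ (include 5 ((include 6 ((switch ((2 , p3) ∷ (6 , p2) ∷ []) ((contains K₃₃ (0 ∷ 2 ∷ 5 ∷ 1 ∷ 3 ∷ 6 ∷ [])) ∷ [])) ∷ (earlier 0 (0 ∷ 8 ∷ 16 ∷ 24 ∷ 32 ∷ 40 ∷ 49 ∷ [])) ∷ [])) ∷ [])) ∷ (contains F₆ (0 ∷ 1 ∷ 4 ∷ 3 ∷ 2 ∷ 5 ∷ [])) ∷ (contains F₆ (2 ∷ 1 ∷ 4 ∷ 3 ∷ 0 ∷ 5 ∷ [])) ∷ [])) ∷ (earlier 0 (0 ∷ 8 ∷ 16 ∷ 24 ∷ 32 ∷ 40 ∷ [])) ∷ [])) ∷ (earlier 0 (0 ∷ 8 ∷ 16 ∷ 24 ∷ 32 ∷ 41 ∷ [])) ∷ (switch ((1 , p3) ∷ (4 , p3) ∷ []) ((switch ((0 , p2) ∷ (1 , p2) ∷ (2 , p3) ∷ (4 , p3) ∷ []) ((switch ((2 , p3) ∷ (3 , p3) ∷ []) []) ∷ (earlier 0 (0 ∷ 8 ∷ 16 ∷ 24 ∷ 32 ∷ 40 ∷ 48 ∷ [])) ∷ [])) ∷ (include 5 ((switch ((2 , p3) ∷ (5 , p3) ∷ []) ((switch ((1 , p3) ∷ (5 , p3) ∷ []) ((switch ((0 , p2) ∷ (1 , p2) ∷ []) []) ∷ [])) ∷ (earlier 0 (0 ∷ 8 ∷ 16 ∷ 24 ∷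 32 ∷ 40 ∷ 48 ∷ 57 ∷ [])) ∷ (switch ((0 , p3) ∷ (1 , p2) ∷ (5 , p3) ∷ []) []) ∷ (earlier 0 (0 ∷ 8 ∷ 16 ∷ 24 ∷ 32 ∷ 40 ∷ 48 ∷ 56 ∷ 65 ∷ [])) ∷ [])) ∷ [])) ∷ [])) ∷ (earlier 0 (0 ∷ 8 ∷ 16 ∷ 24 ∷ 32 ∷ 41 ∷ 48 ∷ [])) ∷ [])) ∷ [])) ∷ (earlier 0 (0 ∷ 8 ∷ 16 ∷ 24 ∷ 33 ∷ [])) ∷ (earlier 0 (4 ∷ 26 ∷ 19 ∷ 10 ∷ 32 ∷ [])) ∷ (earlier 0 (4 ∷ 26 ∷ 19 ∷ 10 ∷ 33 ∷ [])) ∷ (include 5 ((switch ((0 , p3) ∷ (3 , p3) ∷ []) ((include 4 ((switch ((2 , p3) ∷ (4 , p3) ∷ []) ((switch ((0 , p2) ∷ (1 , p2) ∷ (2 , p3) ∷ (4 , p3) ∷ []) []) ∷ (earlier 0 (0 ∷ 8 ∷ 16 ∷ 24 ∷ 32 ∷ 40 ∷ 49 ∷ [])) ∷ (switch ((3 , p3) ∷ (4 , p3) ∷ []) []) ∷ (earlier 0 (0 ∷ 8 ∷ 16 ∷ 24 ∷ 32 ∷ 40 ∷ 49 ∷ [])) ∷ (include 6 ((switch ((0 , p3) ∷ (1 , p2) ∷ (6 , p2) ∷ []) []) ∷ [])) ∷ (earlier 0 (0 ∷ 8 ∷ 16 ∷ 24 ∷ 32 ∷ 40 ∷ 49 ∷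 56 ∷ [])) ∷ [])) ∷ [])) ∷ (include 4 ((switch ((2 , p3) ∷ (4 , p3) ∷ []) ((include 7 ((switch ((0 , p3) ∷ (1 , p2) ∷ (7 , p2) ∷ []) ((switch ((0 , p2) ∷ (1 , p2) ∷ []) []) ∷ (earlier 0 (0 ∷ 8 ∷ 16 ∷ 24 ∷ 32 ∷ 40 ∷ 49 ∷ 56 ∷ [])) ∷ (earlier 0 (0 ∷ 8 ∷ 16 ∷ 24 ∷ 32 ∷ 40 ∷ 48 ∷ 56 ∷ [])) ∷ (earlier 0 (0 ∷ 8 ∷ 16 ∷ 24 ∷ 32 ∷ 40 ∷ 49 ∷ 56 ∷ [])) ∷ [])) ∷ [])) ∷ (earlier 0 (0 ∷ 8 ∷ 16 ∷ 24 ∷ 32 ∷ 40 ∷ 48 ∷ 57 ∷ [])) ∷ (switch ((2 , p3) ∷ (3 , p3) ∷ []) ((include 6 ((switch ((0 , p3) ∷ (2 , p3) ∷ (6 , p3) ∷ []) []) ∷ [])) ∷ (earlier 0 (0 ∷ 8 ∷ 16 ∷ 24 ∷ 32 ∷ 40 ∷ 48 ∷ 56 ∷ 65 ∷ [])) ∷ (contains K₃₃ (0 ∷ 2 ∷ 7 ∷ 1 ∷ 3 ∷ 6 ∷ [])) ∷ (contains K₃₃ (0 ∷ 2 ∷ 7 ∷ 1 ∷ 3 ∷ 6 ∷ [])) ∷ (earlier 0 (0 ∷ 8 ∷ 16 ∷ 24 ∷ 32 ∷ 40 ∷ 48 ∷ 56 ∷ 64 ∷ [])) ∷ (earlier 0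 (0 ∷ 8 ∷ 16 ∷ 24 ∷ 32 ∷ 40 ∷ 48 ∷ 56 ∷ 65 ∷ [])) ∷ [])) ∷ (earlier 0 (0 ∷ 8 ∷ 16 ∷ 24 ∷ 32 ∷ 40 ∷ 49 ∷ 56 ∷ [])) ∷ (switch ((0 , p2) ∷ (1 , p2) ∷ (3 , p3) ∷ (4 , p3) ∷ []) ((switch ((0 , p2) ∷ (1 , p2) ∷ (2 , p3) ∷ (4 , p3) ∷ []) []) ∷ (earlier 0 (0 ∷ 8 ∷ 16 ∷ 24 ∷ 32 ∷ 40 ∷ 48 ∷ 57 ∷ [])) ∷ (earlier 0 (0 ∷ 8 ∷ 16 ∷ 24 ∷ 32 ∷ 40 ∷ 48 ∷ 56 ∷ [])) ∷ (earlier 0 (0 ∷ 8 ∷ 16 ∷ 24 ∷ 32 ∷ 40 ∷ 48 ∷ 57 ∷ [])) ∷ [])) ∷ (earlier 0 (0 ∷ 8 ∷ 16 ∷ 24 ∷ 32 ∷ 40 ∷ 49 ∷ 56 ∷ [])) ∷ (include 7 ((switch ((0 , p3) ∷ (1 , p2) ∷ (7 , p2) ∷ []) ((switch ((0 , p2) ∷ (1 , p2) ∷ []) []) ∷ (earlier 0 (0 ∷ 8 ∷ 16 ∷ 24 ∷ 32 ∷ 40 ∷ 49 ∷ 56 ∷ 64 ∷ [])) ∷ (earlier 0 (0 ∷ 8 ∷ 16 ∷ 24 ∷ 32 ∷ 40 ∷ 48 ∷ 56 ∷ 64 ∷ [])) ∷ (earlier 0 (0 ∷ 8 ∷ 16 ∷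 24 ∷ 32 ∷ 40 ∷ 49 ∷ 56 ∷ 64 ∷ [])) ∷ [])) ∷ [])) ∷ (earlier 0 (0 ∷ 8 ∷ 16 ∷ 24 ∷ 32 ∷ 40 ∷ 48 ∷ 57 ∷ 64 ∷ [])) ∷ [])) ∷ [])) ∷ [])) ∷ (earlier 0 (0 ∷ 8 ∷ 16 ∷ 24 ∷ 32 ∷ 41 ∷ [])) ∷ (switch ((0 , p2) ∷ (1 , p2) ∷ (3 , p2) ∷ []) ((switch ((1 , p2) ∷ (2 , p3) ∷ (5 , p2) ∷ []) ((switch ((2 , p2) ∷ (5 , p2) ∷ []) ((contains K₃₃ (0 ∷ 2 ∷ 4 ∷ 1 ∷ 5 ∷ 6 ∷ [])) ∷ (triangle (5 , q1)) ∷ (triangle (5 , q1)) ∷ [])) ∷ (earlier 0 (0 ∷ 8 ∷ 16 ∷ 24 ∷ 32 ∷ 40 ∷ 49 ∷ [])) ∷ [])) ∷ (switch ((0 , p3) ∷ (1 , p2) ∷ []) ((switch ((1 , p2) ∷ (2 , p3) ∷ (5 , p2) ∷ []) ((switch ((3 , p3) ∷ (5 , p3) ∷ []) []) ∷ (earlier 0 (0 ∷ 8 ∷ 16 ∷ 24 ∷ 32 ∷ 40 ∷ 48 ∷ 57 ∷ [])) ∷ [])) ∷ (switch ((1 , p2) ∷ (2 , p3) ∷ (5 , p2) ∷ []) ((include 4 ((include 7 ((switch ((1 , p3) ∷ (4 , p3) ∷ (7 , p2) ∷ []) ((contains K₃₃ (0 ∷ 4 ∷ 7 ∷ 1 ∷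 5 ∷ 6 ∷ [])) ∷ (contains K₃₃ (0 ∷ 4 ∷ 7 ∷ 1 ∷ 5 ∷ 6 ∷ [])) ∷ [])) ∷ [])) ∷ [])) ∷ (earlier 0 (0 ∷ 8 ∷ 16 ∷ 24 ∷ 32 ∷ 40 ∷ 48 ∷ 57 ∷ [])) ∷ (earlier 0 (0 ∷ 8 ∷ 16 ∷ 24 ∷ 32 ∷ 40 ∷ 48 ∷ 56 ∷ [])) ∷ (earlier 0 (0 ∷ 8 ∷ 16 ∷ 24 ∷ 32 ∷ 40 ∷ 48 ∷ 57 ∷ [])) ∷ (include 4 ((include 7 ((switch ((1 , p3) ∷ (4 , p3) ∷ (7 , p2) ∷ []) ((contains K₃₃ (0 ∷ 4 ∷ 7 ∷ 1 ∷ 5 ∷ 6 ∷ [])) ∷ (contains K₃₃ (0 ∷ 4 ∷ 7 ∷ 1 ∷ 5 ∷ 6 ∷ [])) ∷ [])) ∷ [])) ∷ [])) ∷ (earlier 0 (0 ∷ 8 ∷ 16 ∷ 24 ∷ 32 ∷ 40 ∷ 48 ∷ 57 ∷ 64 ∷ [])) ∷ (earlier 0 (0 ∷ 8 ∷ 16 ∷ 24 ∷ 32 ∷ 40 ∷ 48 ∷ 56 ∷ 64 ∷ [])) ∷ (earlier 0 (0 ∷ 8 ∷ 16 ∷ 24 ∷ 32 ∷ 40 ∷ 48 ∷ 57 ∷ 64 ∷ [])) ∷ (switch ((3 , p3) ∷ (5 , p3) ∷ []) ((switch ((0 , p2) ∷ (1 , p2) ∷ (3 , p3) ∷ (5 ,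 p3) ∷ []) []) ∷ (earlier 0 (0 ∷ 8 ∷ 16 ∷ 24 ∷ 32 ∷ 40 ∷ 48 ∷ 57 ∷ 64 ∷ [])) ∷ [])) ∷ (earlier 0 (0 ∷ 8 ∷ 16 ∷ 24 ∷ 32 ∷ 40 ∷ 48 ∷ 56 ∷ 65 ∷ [])) ∷ [])) ∷ [])) ∷ (earlier 0 (0 ∷ 8 ∷ 16 ∷ 24 ∷ 32 ∷ 40 ∷ 49 ∷ [])) ∷ (include 4 ((switch ((3 , p2) ∷ (5 , p3) ∷ []) ((triangle (5 , q1)) ∷ (contains K₃₃ (0 ∷ 2 ∷ 4 ∷ 1 ∷ 3 ∷ 5 ∷ [])) ∷ (switch ((3 , p2) ∷ []) ((contains K₃₃ (0 ∷ 2 ∷ 4 ∷ 1 ∷ 3 ∷ 5 ∷ [])) ∷ [])) ∷ [])) ∷ [])) ∷ (earlier 0 (0 ∷ 8 ∷ 16 ∷ 24 ∷ 32 ∷ 40 ∷ [])) ∷ (switch ((0 , p3) ∷ (2 , p3) ∷ []) ((switch ((3 , p2) ∷ []) ((contains K₃₃ (0 ∷ 2 ∷ 6 ∷ 1 ∷ 3 ∷ 5 ∷ [])) ∷ (switch ((3 , p2) ∷ (5 , p3) ∷ []) ((contains K₃₃ (0 ∷ 2 ∷ 4 ∷ 1 ∷ 3 ∷ 5 ∷ [])) ∷ (contains K₃₃ (0 ∷ 4 ∷ 6 ∷ 1 ∷ 3 ∷ 5 ∷ [])) ∷ [])) ∷ [])) ∷ (switch ((2 , p2) ∷ []) ((include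 4 ((switch ((0 , p2) ∷ (1 , p2) ∷ (2 , p3) ∷ (4 , p3) ∷ []) ((switch ((3 , p2) ∷ (5 , p3) ∷ []) ((contains K₃₃ (0 ∷ 2 ∷ 4 ∷ 1 ∷ 3 ∷ 5 ∷ [])) ∷ (contains K₃₃ (0 ∷ 4 ∷ 6 ∷ 1 ∷ 3 ∷ 5 ∷ [])) ∷ [])) ∷ (contains K₃₃ (0 ∷ 2 ∷ 6 ∷ 1 ∷ 3 ∷ 5 ∷ [])) ∷ (earlier 0 (0 ∷ 8 ∷ 16 ∷ 24 ∷ 32 ∷ 40 ∷ 48 ∷ 56 ∷ [])) ∷ (contains K₃₃ (0 ∷ 2 ∷ 6 ∷ 1 ∷ 3 ∷ 7 ∷ [])) ∷ (contains K₃₃ (0 ∷ 2 ∷ 6 ∷ 1 ∷ 3 ∷ 7 ∷ [])) ∷ (contains K₃₃ (0 ∷ 2 ∷ 6 ∷ 1 ∷ 3 ∷ 7 ∷ [])) ∷ (contains K₃₃ (0 ∷ 2 ∷ 6 ∷ 1 ∷ 3 ∷ 7 ∷ [])) ∷ (contains K₃₃ (0 ∷ 2 ∷ 6 ∷ 1 ∷ 3 ∷ 5 ∷ [])) ∷ (earlier 0 (0 ∷ 8 ∷ 16 ∷ 24 ∷ 32 ∷ 40 ∷ 48 ∷ 56 ∷ [])) ∷ [])) ∷ [])) ∷ (contains K₃₃ (0 ∷ 2 ∷ 6 ∷ 1 ∷ 3 ∷ 7 ∷ [])) ∷ (contains K₃₃ (0 ∷ 2 ∷ 6 ∷ 1 ∷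 3 ∷ 7 ∷ [])) ∷ (include 4 ((switch ((0 , p2) ∷ (1 , p2) ∷ (2 , p3) ∷ (4 , p3) ∷ []) ((switch ((3 , p2) ∷ (5 , p3) ∷ []) ((contains K₃₃ (0 ∷ 2 ∷ 4 ∷ 1 ∷ 3 ∷ 5 ∷ [])) ∷ (contains K₃₃ (0 ∷ 4 ∷ 6 ∷ 1 ∷ 3 ∷ 5 ∷ [])) ∷ [])) ∷ (contains K₃₃ (0 ∷ 2 ∷ 6 ∷ 1 ∷ 3 ∷ 5 ∷ [])) ∷ (earlier 0 (0 ∷ 8 ∷ 16 ∷ 24 ∷ 32 ∷ 40 ∷ 48 ∷ 56 ∷ 64 ∷ [])) ∷ (contains K₃₃ (0 ∷ 2 ∷ 6 ∷ 1 ∷ 3 ∷ 7 ∷ [])) ∷ (contains K₃₃ (0 ∷ 2 ∷ 6 ∷ 1 ∷ 3 ∷ 7 ∷ [])) ∷ (contains K₃₃ (0 ∷ 2 ∷ 6 ∷ 1 ∷ 3 ∷ 7 ∷ [])) ∷ (contains K₃₃ (0 ∷ 2 ∷ 6 ∷ 1 ∷ 3 ∷ 7 ∷ [])) ∷ (contains K₃₃ (0 ∷ 2 ∷ 6 ∷ 1 ∷ 3 ∷ 5 ∷ [])) ∷ (earlier 0 (0 ∷ 8 ∷ 16 ∷ 24 ∷ 32 ∷ 40 ∷ 48 ∷ 56 ∷ 64 ∷ [])) ∷ [])) ∷ [])) ∷ (contains K₃₃ (0 ∷ 2 ∷ 6 ∷ 1 ∷ 3 ∷ 5 ∷ [])) ∷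 (contains K₃₃ (0 ∷ 2 ∷ 6 ∷ 1 ∷ 3 ∷ 7 ∷ [])) ∷ (contains K₃₃ (0 ∷ 2 ∷ 6 ∷ 1 ∷ 3 ∷ 7 ∷ [])) ∷ [])) ∷ (switch ((3 , p2) ∷ (5 , p3) ∷ []) ((contains K₃₃ (0 ∷ 2 ∷ 4 ∷ 1 ∷ 3 ∷ 5 ∷ [])) ∷ (contains K₃₃ (0 ∷ 4 ∷ 6 ∷ 1 ∷ 3 ∷ 5 ∷ [])) ∷ [])) ∷ (switch ((0 , p3) ∷ (1 , p2) ∷ []) ((contains K₃₃ (0 ∷ 2 ∷ 6 ∷ 1 ∷ 3 ∷ 7 ∷ [])) ∷ (switch ((3 , p3) ∷ (5 , p3) ∷ []) ((contains K₃₃ (0 ∷ 2 ∷ 6 ∷ 1 ∷ 3 ∷ 7 ∷ [])) ∷ (contains K₃₃ (0 ∷ 4 ∷ 6 ∷ 1 ∷ 3 ∷ 5 ∷ [])) ∷ [])) ∷ [])) ∷ (earlier 0 (0 ∷ 8 ∷ 16 ∷ 24 ∷ 32 ∷ 40 ∷ 48 ∷ 57 ∷ [])) ∷ (earlier 0 (0 ∷ 8 ∷ 16 ∷ 24 ∷ 32 ∷ 40 ∷ 48 ∷ 60 ∷ [])) ∷ (earlier 0 (0 ∷ 8 ∷ 16 ∷ 24 ∷ 32 ∷ 40 ∷ 48 ∷ 62 ∷ [])) ∷ [])) ∷ (earlier 0 (0 ∷ 8 ∷ 16 ∷ 24 ∷ 32 ∷ 40 ∷ 49 ∷ [])) ∷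 (switch ((3 , p3) ∷ (5 , p3) ∷ []) ((triangle (5 , q1)) ∷ (triangle (6 , q0)) ∷ (triangle (6 , q0)) ∷ (switch ((3 , p3) ∷ (5 , p3) ∷ []) []) ∷ [])) ∷ (switch ((1 , p2) ∷ (2 , p3) ∷ (5 , p2) ∷ []) ((switch ((2 , p2) ∷ (5 , p2) ∷ []) ((contains K₃₃ (0 ∷ 2 ∷ 4 ∷ 1 ∷ 5 ∷ 7 ∷ [])) ∷ (contains K₃₃ (0 ∷ 2 ∷ 4 ∷ 1 ∷ 3 ∷ 5 ∷ [])) ∷ (contains K₃₃ (0 ∷ 2 ∷ 4 ∷ 1 ∷ 3 ∷ 5 ∷ [])) ∷ [])) ∷ (earlier 0 (0 ∷ 8 ∷ 16 ∷ 24 ∷ 32 ∷ 40 ∷ 48 ∷ 57 ∷ [])) ∷ [])) ∷ (earlier 17 (0 ∷ 8 ∷ 16 ∷ 24 ∷ 32 ∷ 40 ∷ [])) ∷ (earlier 4 (0 ∷ 8 ∷ 16 ∷ 24 ∷ 32 ∷ 40 ∷ 52 ∷ [])) ∷ (earlier 4 (0 ∷ 8 ∷ 16 ∷ 24 ∷ 32 ∷ 40 ∷ 54 ∷ [])) ∷ (earlier 17 (0 ∷ 8 ∷ 16 ∷ 24 ∷ 32 ∷ 40 ∷ [])) ∷ [])) ∷ (switch ((1 , p3) ∷ []) ((include 4 ((include 6 ((switch ((1 , p3) ∷ (6 , p2) ∷ []) ((triangle (6 , q0)) ∷ (switch ((0 , p2) ∷ (1 , p2) ∷ []) []) ∷ []))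 ∷ (switch ((1 , p3) ∷ (6 , p3) ∷ []) ((switch ((1 , p3) ∷ (5 , p3) ∷ (6 , p3) ∷ []) []) ∷ [])) ∷ (switch ((0 , p3) ∷ (1 , p2) ∷ (6 , p2) ∷ []) ((switch ((2 , p3) ∷ (3 , p3) ∷ []) []) ∷ [])) ∷ (earlier 4 (0 ∷ 8 ∷ 16 ∷ 24 ∷ 32 ∷ 40 ∷ 49 ∷ [])) ∷ (switch ((1 , p3) ∷ (6 , p3) ∷ []) ((switch ((2 , p3) ∷ (6 , p2) ∷ []) ((switch ((0 , p3) ∷ (2 , p2) ∷ (6 , p3) ∷ []) ((earlier 105 (4 ∷ 26 ∷ 19 ∷ 10 ∷ 53 ∷ 38 ∷ 43 ∷ [])) ∷ [])) ∷ (earlier 0 (0 ∷ 8 ∷ 16 ∷ 24 ∷ 32 ∷ 40 ∷ 48 ∷ [])) ∷ (earlier 0 (0 ∷ 8 ∷ 16 ∷ 24 ∷ 32 ∷ 40 ∷ 48 ∷ [])) ∷ (earlier 81 (4 ∷ 26 ∷ 19 ∷ 10 ∷ 53 ∷ 38 ∷ 41 ∷ [])) ∷ [])) ∷ (switch ((0 , p2) ∷ (1 , p2) ∷ (2 , p2) ∷ []) ((switch ((0 , p2) ∷ (1 , p3) ∷ (2 , p3) ∷ (6 , p2) ∷ []) []) ∷ [])) ∷ [])) ∷ (earlier 7 (0 ∷ 8 ∷ 16 ∷ 24 ∷ 32 ∷ 40 ∷ 49 ∷ [])) ∷ (earlier 5 (0 ∷ 8 ∷ 16 ∷ 24 ∷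 32 ∷ 40 ∷ 49 ∷ [])) ∷ (earlier 0 (0 ∷ 8 ∷ 16 ∷ 24 ∷ 32 ∷ 40 ∷ 49 ∷ [])) ∷ [])) ∷ [])) ∷ (include 7 ((switch ((3 , p3) ∷ (7 , p3) ∷ []) ((switch ((2 , p3) ∷ (7 , p2) ∷ []) ((switch ((1 , p3) ∷ (5 , p3) ∷ (7 , p2) ∷ []) []) ∷ [])) ∷ (earlier 0 (0 ∷ 8 ∷ 16 ∷ 24 ∷ 32 ∷ 40 ∷ 49 ∷ 56 ∷ 64 ∷ [])) ∷ (switch ((1 , p3) ∷ (7 , p3) ∷ []) ((switch ((3 , p3) ∷ (7 , p2) ∷ []) []) ∷ (earlier 0 (0 ∷ 8 ∷ 16 ∷ 24 ∷ 32 ∷ 40 ∷ 49 ∷ 56 ∷ 64 ∷ 72 ∷ [])) ∷ (triangle (8 , q0)) ∷ (triangle (8 , q0)) ∷ (switch ((3 , p3) ∷ (7 , p2) ∷ []) []) ∷ (earlier 0 (0 ∷ 8 ∷ 16 ∷ 24 ∷ 32 ∷ 40 ∷ 49 ∷ 56 ∷ 64 ∷ 72 ∷ 80 ∷ [])) ∷ [])) ∷ (earlier 0 (0 ∷ 8 ∷ 16 ∷ 24 ∷ 32 ∷ 40 ∷ 48 ∷ 56 ∷ 65 ∷ [])) ∷ (switch ((2 , p3) ∷ (7 , p2) ∷ []) ((switch ((1 , p3) ∷ (5 , p3) ∷ (7 , p2) ∷ []) []) ∷ [])) ∷ (earlier 0 (0 ∷ 8 ∷ 16 ∷ 24 ∷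 32 ∷ 40 ∷ 49 ∷ 56 ∷ 64 ∷ 72 ∷ [])) ∷ (switch ((2 , p3) ∷ (5 , p3) ∷ []) ((include 4 ((switch ((1 , p3) ∷ (5 , p3) ∷ (7 , p2) ∷ []) ((contains K₃₃ (0 ∷ 4 ∷ 6 ∷ 1 ∷ 5 ∷ 7 ∷ [])) ∷ (contains K₃₃ (0 ∷ 4 ∷ 6 ∷ 1 ∷ 5 ∷ 7 ∷ [])) ∷ (contains K₃₃ (0 ∷ 4 ∷ 6 ∷ 1 ∷ 5 ∷ 7 ∷ [])) ∷ (contains K₃₃ (0 ∷ 4 ∷ 6 ∷ 1 ∷ 5 ∷ 7 ∷ [])) ∷ (switch ((0 , p3) ∷ (1 , p2) ∷ (3 , p3) ∷ (7 , p2) ∷ []) []) ∷ [])) ∷ [])) ∷ (earlier 0 (0 ∷ 8 ∷ 16 ∷ 24 ∷ 32 ∷ 40 ∷ 48 ∷ 56 ∷ 65 ∷ [])) ∷ [])) ∷ (earlier 6 (0 ∷ 8 ∷ 16 ∷ 24 ∷ 32 ∷ 40 ∷ 48 ∷ 56 ∷ 68 ∷ [])) ∷ (earlier 6 (0 ∷ 8 ∷ 16 ∷ 24 ∷ 32 ∷ 40 ∷ 48 ∷ 56 ∷ 70 ∷ [])) ∷ [])) ∷ (switch ((0 , p3) ∷ (2 , p3) ∷ (7 , p3) ∷ []) ((switch ((1 , p3) ∷ (7 , p2) ∷ []) []) ∷ (earlier 0 (0 ∷ 8 ∷ 16 ∷ 24 ∷ 32 ∷ 40 ∷ 49 ∷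 56 ∷ 64 ∷ [])) ∷ (switch ((2 , p3) ∷ (3 , p3) ∷ []) ((switch ((1 , p3) ∷ (7 , p2) ∷ []) ((contains K₃₃ (0 ∷ 2 ∷ 6 ∷ 1 ∷ 3 ∷ 7 ∷ [])) ∷ [])) ∷ (earlier 0 (0 ∷ 8 ∷ 16 ∷ 24 ∷ 32 ∷ 40 ∷ 49 ∷ 56 ∷ [])) ∷ [])) ∷ (switch ((1 , p3) ∷ (7 , p2) ∷ []) []) ∷ (earlier 0 (0 ∷ 8 ∷ 16 ∷ 24 ∷ 32 ∷ 40 ∷ 49 ∷ 56 ∷ 64 ∷ 72 ∷ [])) ∷ [])) ∷ (switch ((1 , p3) ∷ (7 , p3) ∷ []) ((switch ((0 , p3) ∷ (3 , p3) ∷ (7 , p2) ∷ []) ((switch ((2 , p3) ∷ (3 , p3) ∷ []) ((contains K₃₃ (0 ∷ 2 ∷ 4 ∷ 1 ∷ 3 ∷ 5 ∷ [])) ∷ (contains K₃₃ (0 ∷ 2 ∷ 4 ∷ 1 ∷ 3 ∷ 5 ∷ [])) ∷ [])) ∷ [])) ∷ (earlier 0 (0 ∷ 8 ∷ 16 ∷ 24 ∷ 32 ∷ 40 ∷ 49 ∷ 56 ∷ 64 ∷ [])) ∷ (switch ((0 , p3) ∷ (3 , p3) ∷ (7 , p2) ∷ []) ((switch ((2 , p3) ∷ (3 , p3) ∷ []) ((contains K₃₃ (0 ∷ 2 ∷ 4 ∷ 1 ∷ 3 ∷ 5 ∷ [])) ∷ (contains K₃₃ (0 ∷ 2 ∷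 4 ∷ 1 ∷ 3 ∷ 5 ∷ [])) ∷ [])) ∷ [])) ∷ (earlier 0 (0 ∷ 8 ∷ 16 ∷ 24 ∷ 32 ∷ 40 ∷ 49 ∷ 56 ∷ 64 ∷ 72 ∷ [])) ∷ (switch ((1 , p3) ∷ []) []) ∷ [])) ∷ (switch ((3 , p2) ∷ (7 , p2) ∷ []) ((switch ((1 , p3) ∷ (7 , p3) ∷ []) []) ∷ (earlier 0 (0 ∷ 8 ∷ 16 ∷ 24 ∷ 32 ∷ 40 ∷ 49 ∷ 56 ∷ 64 ∷ [])) ∷ (switch ((2 , p3) ∷ (5 , p3) ∷ []) ((contains K₃₃ (0 ∷ 2 ∷ 4 ∷ 1 ∷ 3 ∷ 5 ∷ [])) ∷ (switch ((3 , p3) ∷ (5 , p3) ∷ []) ((switch ((0 , p2) ∷ (1 , p2) ∷ (3 , p3) ∷ (7 , p2) ∷ []) []) ∷ [])) ∷ (earlier 0 (0 ∷ 8 ∷ 16 ∷ 24 ∷ 32 ∷ 40 ∷ 48 ∷ 56 ∷ 65 ∷ [])) ∷ (contains K₃₃ (0 ∷ 2 ∷ 4 ∷ 1 ∷ 3 ∷ 5 ∷ [])) ∷ [])) ∷ (switch ((3 , p2) ∷ []) ((triangle (8 , q0)) ∷ [])) ∷ (earlier 0 (0 ∷ 8 ∷ 16 ∷ 24 ∷ 32 ∷ 40 ∷ 48 ∷ 56 ∷ 65 ∷ [])) ∷ (switch ((1 , p3) ∷ (7 , p3) ∷ []) []) ∷ (earlier 0 (0 ∷ 8 ∷ 16 ∷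 24 ∷ 32 ∷ 40 ∷ 49 ∷ 56 ∷ 64 ∷ 72 ∷ [])) ∷ (earlier 1 (0 ∷ 8 ∷ 16 ∷ 24 ∷ 32 ∷ 40 ∷ 48 ∷ 56 ∷ 68 ∷ [])) ∷ (earlier 1 (0 ∷ 8 ∷ 16 ∷ 24 ∷ 32 ∷ 40 ∷ 48 ∷ 56 ∷ 70 ∷ [])) ∷ [])) ∷ (earlier 18 (0 ∷ 8 ∷ 16 ∷ 24 ∷ 32 ∷ 40 ∷ 48 ∷ 57 ∷ [])) ∷ (earlier 13 (0 ∷ 8 ∷ 16 ∷ 24 ∷ 32 ∷ 40 ∷ 48 ∷ 57 ∷ [])) ∷ (earlier 0 (0 ∷ 8 ∷ 16 ∷ 24 ∷ 32 ∷ 40 ∷ 48 ∷ 57 ∷ [])) ∷ (earlier 7 (0 ∷ 8 ∷ 16 ∷ 24 ∷ 32 ∷ 40 ∷ 48 ∷ 57 ∷ [])) ∷ [])) ∷ [])) ∷ (earlier 45 (0 ∷ 8 ∷ 16 ∷ 24 ∷ 32 ∷ 41 ∷ [])) ∷ (earlier 0 (0 ∷ 8 ∷ 16 ∷ 24 ∷ 32 ∷ 41 ∷ [])) ∷ (switch ((0 , p3) ∷ (3 , p3) ∷ []) ((include 4 ((switch ((2 , p3) ∷ (4 , p3) ∷ []) ((switch ((3 , p3) ∷ (4 , p3) ∷ []) ((switch ((2 , p3) ∷ (3 , p3) ∷ []) ((contains K₃₃ (0 ∷ 2 ∷ 4 ∷ 1 ∷ 3 ∷ 6 ∷ [])) ∷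 (contains K₃₃ (0 ∷ 2 ∷ 4 ∷ 1 ∷ 3 ∷ 6 ∷ [])) ∷ [])) ∷ (earlier 0 (0 ∷ 8 ∷ 16 ∷ 24 ∷ 32 ∷ 40 ∷ 48 ∷ [])) ∷ [])) ∷ (earlier 0 (0 ∷ 8 ∷ 16 ∷ 24 ∷ 32 ∷ 40 ∷ 49 ∷ [])) ∷ (switch ((0 , p3) ∷ (2 , p3) ∷ (4 , p3) ∷ (5 , p2) ∷ []) []) ∷ (earlier 0 (0 ∷ 8 ∷ 16 ∷ 24 ∷ 32 ∷ 40 ∷ 49 ∷ [])) ∷ [])) ∷ [])) ∷ (include 4 ((switch ((0 , p3) ∷ (1 , p2) ∷ (4 , p3) ∷ []) ((switch ((2 , p3) ∷ (4 , p3) ∷ []) ((earlier 4 (0 ∷ 8 ∷ 16 ∷ 24 ∷ 32 ∷ 40 ∷ 48 ∷ [])) ∷ (earlier 4 (0 ∷ 8 ∷ 16 ∷ 24 ∷ 32 ∷ 40 ∷ 49 ∷ [])) ∷ [])) ∷ [])) ∷ [])) ∷ [])) ∷ (earlier 0 (0 ∷ 8 ∷ 16 ∷ 24 ∷ 32 ∷ 41 ∷ [])) ∷ [])) ∷ (earlier 0 (0 ∷ 8 ∷ 16 ∷ 24 ∷ 33 ∷ 40 ∷ [])) ∷ (switch ((0 , p3) ∷ (2 , p3) ∷ []) ((switch ((2 , p3) ∷ (3 , p3) ∷ []) ((include 5 ((switch ((0 , p2) ∷ (1 , p2) ∷ (2 , p3) ∷ (5 , p3) ∷ []) ((contains K₃₃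 (0 ∷ 2 ∷ 4 ∷ 1 ∷ 3 ∷ 5 ∷ [])) ∷ (switch ((2 , p2) ∷ []) ((triangle (6 , q0)) ∷ (contains K₃₃ (1 ∷ 3 ∷ 5 ∷ 2 ∷ 4 ∷ 6 ∷ [])) ∷ (switch ((2 , p2) ∷ []) ((contains K₃₃ (1 ∷ 3 ∷ 5 ∷ 2 ∷ 4 ∷ 6 ∷ [])) ∷ (contains K₃₃ (0 ∷ 2 ∷ 4 ∷ 1 ∷ 3 ∷ 5 ∷ [])) ∷ [])) ∷ (contains K₃₃ (0 ∷ 2 ∷ 4 ∷ 1 ∷ 3 ∷ 5 ∷ [])) ∷ [])) ∷ (earlier 0 (0 ∷ 8 ∷ 16 ∷ 24 ∷ 32 ∷ 40 ∷ 49 ∷ [])) ∷ (contains K₃₃ (0 ∷ 2 ∷ 4 ∷ 1 ∷ 3 ∷ 5 ∷ [])) ∷ [])) ∷ [])) ∷ (earlier 0 (0 ∷ 8 ∷ 16 ∷ 24 ∷ 32 ∷ 41 ∷ [])) ∷ (switch ((1 , p2) ∷ (2 , p3) ∷ []) ((include 4 ((switch ((0 , p3) ∷ (1 , p2) ∷ (2 , p3) ∷ (4 , p3) ∷ []) []) ∷ [])) ∷ (earlier 0 (0 ∷ 8 ∷ 16 ∷ 24 ∷ 32 ∷ 40 ∷ 49 ∷ [])) ∷ [])) ∷ (earlier 0 (0 ∷ 8 ∷ 16 ∷ 24 ∷ 32 ∷ 41 ∷ [])) ∷ (earlier 3 (0 ∷ 8 ∷ 16 ∷ 24 ∷ 32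 ∷ 40 ∷ [])) ∷ (earlier 3 (0 ∷ 8 ∷ 16 ∷ 24 ∷ 32 ∷ 41 ∷ [])) ∷ [])) ∷ (earlier 0 (4 ∷ 26 ∷ 19 ∷ 10 ∷ 36 ∷ [])) ∷ (include 4 ((switch ((2 , p3) ∷ (4 , p2) ∷ []) ((include 5 ((switch ((3 , p3) ∷ (5 , p2) ∷ []) ((triangle (6 , q0)) ∷ (triangle (6 , q0)) ∷ (triangle (6 , q0)) ∷ (triangle (6 , q0)) ∷ (switch ((0 , p3) ∷ (1 , p2) ∷ (4 , p3) ∷ (5 , p2) ∷ []) []) ∷ (earlier 0 (0 ∷ 8 ∷ 16 ∷ 24 ∷ 32 ∷ 40 ∷ 48 ∷ 57 ∷ [])) ∷ [])) ∷ [])) ∷ (earlier 0 (0 ∷ 8 ∷ 16 ∷ 24 ∷ 32 ∷ 41 ∷ 48 ∷ [])) ∷ (switch ((1 , p2) ∷ (2 , p3) ∷ []) ((contains K₃₃ (0 ∷ 2 ∷ 4 ∷ 1 ∷ 3 ∷ 5 ∷ [])) ∷ (contains K₃₃ (0 ∷ 2 ∷ 4 ∷ 1 ∷ 3 ∷ 5 ∷ [])) ∷ (contains K₃₃ (0 ∷ 2 ∷ 4 ∷ 1 ∷ 3 ∷ 5 ∷ [])) ∷ (contains K₃₃ (0 ∷ 2 ∷ 4 ∷ 1 ∷ 3 ∷ 5 ∷ [])) ∷ (contains K₃₃ (0 ∷ 2 ∷ 4 ∷ 1 ∷ 3 ∷ 5 ∷ [])) ∷ (contains K₃₃ (0 ∷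 2 ∷ 4 ∷ 1 ∷ 3 ∷ 5 ∷ [])) ∷ [])) ∷ (contains K₃₃ (0 ∷ 2 ∷ 4 ∷ 1 ∷ 3 ∷ 5 ∷ [])) ∷ (contains K₃₃ (0 ∷ 2 ∷ 4 ∷ 1 ∷ 3 ∷ 5 ∷ [])) ∷ (switch ((1 , p2) ∷ (2 , p3) ∷ []) ((include 7 ((include 6 ((switch ((1 , p2) ∷ (2 , p3) ∷ (6 , p3) ∷ []) ((contains K₃₃ (0 ∷ 2 ∷ 4 ∷ 1 ∷ 3 ∷ 5 ∷ [])) ∷ (contains K₃₃ (0 ∷ 2 ∷ 4 ∷ 1 ∷ 3 ∷ 5 ∷ [])) ∷ [])) ∷ [])) ∷ [])) ∷ (earlier 0 (0 ∷ 8 ∷ 16 ∷ 24 ∷ 32 ∷ 40 ∷ 48 ∷ 57 ∷ [])) ∷ (contains K₃₃ (0 ∷ 2 ∷ 4 ∷ 1 ∷ 3 ∷ 5 ∷ [])) ∷ (contains K₃₃ (0 ∷ 2 ∷ 4 ∷ 1 ∷ 3 ∷ 5 ∷ [])) ∷ [])) ∷ (earlier 0 (0 ∷ 8 ∷ 16 ∷ 24 ∷ 32 ∷ 40 ∷ 49 ∷ [])) ∷ (switch ((2 , p3) ∷ (3 , p3) ∷ []) ((switch ((0 , p3) ∷ (1 , p2) ∷ (2 , p3) ∷ (4 , p3) ∷ []) []) ∷ (earlier 0 (0 ∷ 8 ∷ 16 ∷ 24 ∷ 32 ∷ 40 ∷ 49 ∷ 56 ∷ [])) ∷ (switch ((0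 , p3) ∷ (1 , p2) ∷ (2 , p3) ∷ (4 , p3) ∷ []) []) ∷ (earlier 0 (0 ∷ 8 ∷ 16 ∷ 24 ∷ 32 ∷ 40 ∷ 48 ∷ 56 ∷ 65 ∷ [])) ∷ (earlier 1 (0 ∷ 8 ∷ 16 ∷ 24 ∷ 32 ∷ 40 ∷ 48 ∷ 56 ∷ [])) ∷ (earlier 1 (0 ∷ 8 ∷ 16 ∷ 24 ∷ 32 ∷ 40 ∷ 49 ∷ 56 ∷ [])) ∷ [])) ∷ (earlier 0 (0 ∷ 8 ∷ 16 ∷ 24 ∷ 32 ∷ 41 ∷ 48 ∷ 56 ∷ [])) ∷ (switch ((1 , p2) ∷ (2 , p3) ∷ []) ((switch ((2 , p3) ∷ (3 , p3) ∷ []) ((contains K₃₃ (0 ∷ 2 ∷ 4 ∷ 1 ∷ 3 ∷ 7 ∷ [])) ∷ (switch ((0 , p3) ∷ (1 , p2) ∷ (2 , p3) ∷ (4 , p3) ∷ []) ((contains K₃₃ (0 ∷ 4 ∷ 6 ∷ 1 ∷ 3 ∷ 5 ∷ [])) ∷ (contains K₃₃ (0 ∷ 4 ∷ 6 ∷ 1 ∷ 3 ∷ 5 ∷ [])) ∷ [])) ∷ (earlier 0 (0 ∷ 8 ∷ 16 ∷ 24 ∷ 32 ∷ 40 ∷ 48 ∷ 56 ∷ 65 ∷ [])) ∷ (contains K₃₃ (0 ∷ 2 ∷ 4 ∷ 1 ∷ 3 ∷ 7 ∷ [])) ∷ (earlier 0 (0 ∷ 8 ∷ 16 ∷ 24 ∷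 32 ∷ 40 ∷ 48 ∷ 56 ∷ 64 ∷ [])) ∷ (earlier 0 (0 ∷ 8 ∷ 16 ∷ 24 ∷ 32 ∷ 40 ∷ 48 ∷ 56 ∷ 65 ∷ [])) ∷ (contains K₃₃ (0 ∷ 4 ∷ 6 ∷ 1 ∷ 3 ∷ 5 ∷ [])) ∷ (contains K₃₃ (0 ∷ 4 ∷ 6 ∷ 1 ∷ 3 ∷ 5 ∷ [])) ∷ [])) ∷ (earlier 0 (0 ∷ 8 ∷ 16 ∷ 24 ∷ 32 ∷ 40 ∷ 48 ∷ 57 ∷ [])) ∷ (contains K₃₃ (0 ∷ 2 ∷ 4 ∷ 1 ∷ 3 ∷ 5 ∷ [])) ∷ (contains K₃₃ (0 ∷ 2 ∷ 4 ∷ 1 ∷ 3 ∷ 5 ∷ [])) ∷ (contains K₃₃ (0 ∷ 2 ∷ 4 ∷ 1 ∷ 3 ∷ 5 ∷ [])) ∷ (contains K₃₃ (0 ∷ 2 ∷ 4 ∷ 1 ∷ 3 ∷ 5 ∷ [])) ∷ (contains K₃₃ (0 ∷ 2 ∷ 4 ∷ 1 ∷ 3 ∷ 5 ∷ [])) ∷ (contains K₃₃ (0 ∷ 2 ∷ 4 ∷ 1 ∷ 3 ∷ 5 ∷ [])) ∷ [])) ∷ (earlier 0 (0 ∷ 8 ∷ 16 ∷ 24 ∷ 32 ∷ 40 ∷ 49 ∷ [])) ∷ (switch ((1 , p2) ∷ (2 , p3) ∷ []) ((include 6 ((switch ((1 , p3) ∷ (2 , p3) ∷ (4 , p2) ∷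 (6 , p2) ∷ []) ((contains K₃₃ (0 ∷ 2 ∷ 4 ∷ 1 ∷ 3 ∷ 5 ∷ [])) ∷ (contains K₃₃ (0 ∷ 2 ∷ 4 ∷ 1 ∷ 3 ∷ 5 ∷ [])) ∷ (contains K₃₃ (0 ∷ 2 ∷ 4 ∷ 1 ∷ 3 ∷ 6 ∷ [])) ∷ (contains K₃₃ (0 ∷ 2 ∷ 4 ∷ 1 ∷ 3 ∷ 6 ∷ [])) ∷ [])) ∷ [])) ∷ (earlier 0 (0 ∷ 8 ∷ 16 ∷ 24 ∷ 32 ∷ 40 ∷ 49 ∷ [])) ∷ (triangle (5 , q1)) ∷ (triangle (5 , q1)) ∷ (triangle (5 , q1)) ∷ (triangle (5 , q1)) ∷ (switch ((2 , p3) ∷ (3 , p3) ∷ []) ((switch ((2 , p2) ∷ []) ((contains K₃₃ (0 ∷ 2 ∷ 4 ∷ 1 ∷ 3 ∷ 5 ∷ [])) ∷ (contains K₃₃ (0 ∷ 2 ∷ 4 ∷ 1 ∷ 3 ∷ 6 ∷ [])) ∷ (contains K₃₃ (0 ∷ 4 ∷ 7 ∷ 1 ∷ 5 ∷ 6 ∷ [])) ∷ (contains K₃₃ (0 ∷ 4 ∷ 7 ∷ 1 ∷ 5 ∷ 6 ∷ [])) ∷ (include 5 ((switch ((0 , p2) ∷ (2 , p3) ∷ (3 , p3) ∷ (5 , p3) ∷ []) ((contains K₃₃ (0 ∷ 2 ∷ 4 ∷ 1 ∷ 3 ∷ 6 ∷ [])) ∷ (contains K₃₃ (0 ∷ 2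 ∷ 4 ∷ 1 ∷ 3 ∷ 6 ∷ [])) ∷ [])) ∷ [])) ∷ (contains K₃₃ (0 ∷ 2 ∷ 4 ∷ 1 ∷ 3 ∷ 6 ∷ [])) ∷ (contains K₃₃ (0 ∷ 2 ∷ 4 ∷ 1 ∷ 3 ∷ 5 ∷ [])) ∷ [])) ∷ (earlier 0 (0 ∷ 8 ∷ 16 ∷ 24 ∷ 32 ∷ 41 ∷ 48 ∷ 56 ∷ [])) ∷ (contains K₃₃ (0 ∷ 2 ∷ 4 ∷ 1 ∷ 3 ∷ 6 ∷ [])) ∷ (contains K₃₃ (0 ∷ 2 ∷ 4 ∷ 1 ∷ 3 ∷ 6 ∷ [])) ∷ (contains K₃₃ (0 ∷ 4 ∷ 7 ∷ 1 ∷ 3 ∷ 5 ∷ [])) ∷ (contains K₃₃ (0 ∷ 4 ∷ 7 ∷ 1 ∷ 3 ∷ 5 ∷ [])) ∷ (contains K₃₃ (0 ∷ 4 ∷ 7 ∷ 1 ∷ 3 ∷ 5 ∷ [])) ∷ (contains K₃₃ (0 ∷ 4 ∷ 7 ∷ 1 ∷ 3 ∷ 5 ∷ [])) ∷ (switch ((2 , p2) ∷ []) ((contains K₃₃ (0 ∷ 2 ∷ 4 ∷ 1 ∷ 3 ∷ 6 ∷ [])) ∷ (contains K₃₃ (0 ∷ 2 ∷ 4 ∷ 1 ∷ 3 ∷ 5 ∷ [])) ∷ (contains K₃₃ (0 ∷ 2 ∷ 4 ∷ 1 ∷ 3 ∷ 6 ∷ [])) ∷ (contains K₃₃ (0 ∷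 2 ∷ 4 ∷ 1 ∷ 3 ∷ 5 ∷ [])) ∷ [])) ∷ (earlier 0 (0 ∷ 8 ∷ 16 ∷ 24 ∷ 32 ∷ 41 ∷ 48 ∷ 56 ∷ 64 ∷ [])) ∷ [])) ∷ (earlier 0 (0 ∷ 8 ∷ 16 ∷ 24 ∷ 32 ∷ 40 ∷ 49 ∷ 56 ∷ [])) ∷ (contains K₃₃ (0 ∷ 2 ∷ 4 ∷ 1 ∷ 3 ∷ 5 ∷ [])) ∷ (contains K₃₃ (0 ∷ 2 ∷ 4 ∷ 1 ∷ 3 ∷ 5 ∷ [])) ∷ (contains K₃₃ (0 ∷ 2 ∷ 4 ∷ 1 ∷ 3 ∷ 5 ∷ [])) ∷ (contains K₃₃ (0 ∷ 2 ∷ 4 ∷ 1 ∷ 3 ∷ 5 ∷ [])) ∷ (contains K₃₃ (0 ∷ 2 ∷ 4 ∷ 1 ∷ 3 ∷ 5 ∷ [])) ∷ (contains K₃₃ (0 ∷ 2 ∷ 4 ∷ 1 ∷ 3 ∷ 5 ∷ [])) ∷ [])) ∷ [])) ∷ [])) ∷ (switch ((0 , p3) ∷ (3 , p3) ∷ []) ((switch ((2 , p3) ∷ (3 , p3) ∷ []) ((contains K₃₃ (0 ∷ 2 ∷ 4 ∷ 1 ∷ 3 ∷ 5 ∷ [])) ∷ (contains K₃₃ (0 ∷ 2 ∷ 4 ∷ 1 ∷ 3 ∷ 5 ∷ [])) ∷ [])) ∷ (switch ((2 , p3) ∷ (3 , p3) ∷ []) ((switch ((0 , p2) ∷ (1 ,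 p2) ∷ (2 , p3) ∷ (3 , p3) ∷ []) ((contains K₃₃ (0 ∷ 2 ∷ 4 ∷ 1 ∷ 3 ∷ 5 ∷ [])) ∷ (contains K₃₃ (0 ∷ 2 ∷ 4 ∷ 1 ∷ 3 ∷ 6 ∷ [])) ∷ (contains K₃₃ (0 ∷ 2 ∷ 4 ∷ 1 ∷ 3 ∷ 5 ∷ [])) ∷ (contains K₃₃ (0 ∷ 2 ∷ 4 ∷ 1 ∷ 3 ∷ 6 ∷ [])) ∷ (contains K₃₃ (0 ∷ 2 ∷ 4 ∷ 1 ∷ 3 ∷ 5 ∷ [])) ∷ [])) ∷ (earlier 0 (0 ∷ 8 ∷ 16 ∷ 24 ∷ 32 ∷ 40 ∷ 49 ∷ [])) ∷ (contains K₃₃ (0 ∷ 2 ∷ 4 ∷ 1 ∷ 3 ∷ 5 ∷ [])) ∷ (contains K₃₃ (0 ∷ 2 ∷ 4 ∷ 1 ∷ 3 ∷ 5 ∷ [])) ∷ (switch ((0 , p2) ∷ (1 , p2) ∷ (3 , p2) ∷ []) ((contains K₃₃ (0 ∷ 2 ∷ 4 ∷ 1 ∷ 3 ∷ 5 ∷ [])) ∷ (contains K₃₃ (0 ∷ 2 ∷ 4 ∷ 1 ∷ 3 ∷ 6 ∷ [])) ∷ (contains K₃₃ (0 ∷ 2 ∷ 4 ∷ 1 ∷ 3 ∷ 5 ∷ [])) ∷ [])) ∷ (earlier 0 (0 ∷ 8 ∷ 16 ∷ 24 ∷ 32 ∷ 40 ∷ 49 ∷ 56 ∷ [])) ∷ []))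 ∷ (contains K₃₃ (0 ∷ 2 ∷ 4 ∷ 1 ∷ 3 ∷ 5 ∷ [])) ∷ (switch ((2 , p3) ∷ (3 , p3) ∷ []) ((switch ((0 , p2) ∷ (2 , p3) ∷ (3 , p2) ∷ []) ((contains K₃₃ (0 ∷ 2 ∷ 6 ∷ 3 ∷ 5 ∷ 7 ∷ [])) ∷ [])) ∷ (earlier 0 (0 ∷ 8 ∷ 16 ∷ 24 ∷ 32 ∷ 40 ∷ 48 ∷ 57 ∷ [])) ∷ [])) ∷ (earlier 0 (0 ∷ 8 ∷ 16 ∷ 24 ∷ 32 ∷ 40 ∷ 49 ∷ [])) ∷ (earlier 0 (0 ∷ 8 ∷ 16 ∷ 24 ∷ 32 ∷ 40 ∷ 52 ∷ [])) ∷ (earlier 0 (0 ∷ 8 ∷ 16 ∷ 24 ∷ 32 ∷ 40 ∷ 54 ∷ [])) ∷ [])) ∷ (earlier 0 (0 ∷ 8 ∷ 16 ∷ 24 ∷ 32 ∷ 41 ∷ [])) ∷ (earlier 7 (4 ∷ 26 ∷ 19 ∷ 10 ∷ 36 ∷ 40 ∷ [])) ∷ (earlier 0 (4 ∷ 26 ∷ 19 ∷ 10 ∷ 36 ∷ 40 ∷ [])) ∷ (earlier 0 (4 ∷ 26 ∷ 19 ∷ 10 ∷ 36 ∷ 41 ∷ [])) ∷ (earlier 0 (0 ∷ 8 ∷ 16 ∷ 24 ∷ 32 ∷ 44 ∷ [])) ∷ (earlier 0 (0 ∷ 8 ∷ 16 ∷ 24 ∷ 32 ∷ 46 ∷ []))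 ∷ (earlier 0 (4 ∷ 26 ∷ 19 ∷ 10 ∷ 36 ∷ 44 ∷ [])) ∷ (earlier 0 (4 ∷ 26 ∷ 19 ∷ 10 ∷ 36 ∷ 46 ∷ [])) ∷ [])) ∷ (earlier 0 (0 ∷ 8 ∷ 16 ∷ 24 ∷ 33 ∷ [])) ∷ (include 5 ((include 4 ((switch ((2 , p3) ∷ (4 , p3) ∷ []) ((switch ((3 , p3) ∷ (4 , p3) ∷ []) ((switch ((0 , p2) ∷ (1 , p3) ∷ (2 , p3) ∷ []) ((contains K₃₃ (0 ∷ 2 ∷ 7 ∷ 1 ∷ 3 ∷ 6 ∷ [])) ∷ [])) ∷ (earlier 0 (0 ∷ 8 ∷ 16 ∷ 24 ∷ 32 ∷ 40 ∷ 48 ∷ 57 ∷ [])) ∷ (switch ((1 , p3) ∷ (4 , p3) ∷ []) ((switch ((2 , p3) ∷ (3 , p3) ∷ []) ((switch ((0 , p2) ∷ (1 , p2) ∷ (2 , p3) ∷ (4 , p3) ∷ []) []) ∷ (earlier 0 (0 ∷ 8 ∷ 16 ∷ 24 ∷ 32 ∷ 40 ∷ 48 ∷ 56 ∷ 65 ∷ [])) ∷ (earlier 0 (0 ∷ 8 ∷ 16 ∷ 24 ∷ 32 ∷ 40 ∷ 48 ∷ 56 ∷ 64 ∷ [])) ∷ (earlier 0 (0 ∷ 8 ∷ 16 ∷ 24 ∷ 32 ∷ 40 ∷ 48 ∷ 56 ∷ 65 ∷ [])) ∷ [])) ∷ [])) ∷ (earlier 0 (0 ∷ 8 ∷ 16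 ∷ 24 ∷ 32 ∷ 40 ∷ 48 ∷ 57 ∷ [])) ∷ [])) ∷ (earlier 0 (0 ∷ 8 ∷ 16 ∷ 24 ∷ 32 ∷ 40 ∷ 49 ∷ [])) ∷ (switch ((1 , p3) ∷ (4 , p3) ∷ []) ((switch ((2 , p3) ∷ (4 , p3) ∷ (5 , p2) ∷ []) ((switch ((1 , p2) ∷ (2 , p3) ∷ (5 , p2) ∷ []) ((switch ((2 , p3) ∷ (4 , p2) ∷ (5 , p2) ∷ []) []) ∷ (earlier 0 (0 ∷ 8 ∷ 16 ∷ 24 ∷ 32 ∷ 40 ∷ 48 ∷ 56 ∷ 65 ∷ [])) ∷ [])) ∷ (earlier 0 (0 ∷ 8 ∷ 16 ∷ 24 ∷ 32 ∷ 40 ∷ 48 ∷ 57 ∷ [])) ∷ (earlier 0 (0 ∷ 8 ∷ 16 ∷ 24 ∷ 32 ∷ 40 ∷ 48 ∷ 60 ∷ [])) ∷ (earlier 0 (0 ∷ 8 ∷ 16 ∷ 24 ∷ 32 ∷ 40 ∷ 48 ∷ 62 ∷ [])) ∷ [])) ∷ (switch ((2 , p3) ∷ (4 , p3) ∷ (5 , p2) ∷ []) ((earlier 5 (0 ∷ 8 ∷ 16 ∷ 24 ∷ 32 ∷ 40 ∷ 61 ∷ 48 ∷ [])) ∷ (earlier 5 (0 ∷ 8 ∷ 16 ∷ 24 ∷ 32 ∷ 40 ∷ 63 ∷ 48 ∷ [])) ∷ (switch ((2 , p3) ∷ (4 , p2) ∷ (5 , p2) ∷ []) ((switch ((0 ,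 p2) ∷ (1 , p2) ∷ (2 , p3) ∷ (4 , p3) ∷ []) []) ∷ (earlier 0 (0 ∷ 8 ∷ 16 ∷ 24 ∷ 32 ∷ 40 ∷ 48 ∷ 57 ∷ 64 ∷ [])) ∷ (switch ((0 , p2) ∷ (1 , p2) ∷ (3 , p3) ∷ (4 , p3) ∷ []) ((switch ((1 , p2) ∷ (2 , p3) ∷ (5 , p2) ∷ []) []) ∷ (earlier 0 (0 ∷ 8 ∷ 16 ∷ 24 ∷ 32 ∷ 40 ∷ 48 ∷ 57 ∷ 64 ∷ 72 ∷ [])) ∷ (earlier 0 (0 ∷ 8 ∷ 16 ∷ 24 ∷ 32 ∷ 40 ∷ 48 ∷ 56 ∷ 64 ∷ 72 ∷ [])) ∷ (earlier 0 (0 ∷ 8 ∷ 16 ∷ 24 ∷ 32 ∷ 40 ∷ 48 ∷ 57 ∷ 64 ∷ 72 ∷ [])) ∷ [])) ∷ (earlier 0 (0 ∷ 8 ∷ 16 ∷ 24 ∷ 32 ∷ 40 ∷ 48 ∷ 56 ∷ 64 ∷ 73 ∷ [])) ∷ (contains K₃₃ (0 ∷ 5 ∷ 6 ∷ 1 ∷ 4 ∷ 7 ∷ [])) ∷ (contains K₃₃ (0 ∷ 5 ∷ 6 ∷ 1 ∷ 4 ∷ 7 ∷ [])) ∷ [])) ∷ (earlier 0 (0 ∷ 8 ∷ 16 ∷ 24 ∷ 32 ∷ 40 ∷ 48 ∷ 56 ∷ 65 ∷ [])) ∷ (contains K₃₃ (0 ∷ 5 ∷ 6 ∷ 1 ∷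 4 ∷ 7 ∷ [])) ∷ (contains K₃₃ (0 ∷ 5 ∷ 6 ∷ 1 ∷ 4 ∷ 7 ∷ [])) ∷ (earlier 0 (0 ∷ 8 ∷ 16 ∷ 24 ∷ 32 ∷ 40 ∷ 48 ∷ 56 ∷ 68 ∷ [])) ∷ (earlier 0 (0 ∷ 8 ∷ 16 ∷ 24 ∷ 32 ∷ 40 ∷ 48 ∷ 56 ∷ 70 ∷ [])) ∷ [])) ∷ [])) ∷ (earlier 0 (0 ∷ 8 ∷ 16 ∷ 24 ∷ 32 ∷ 40 ∷ 49 ∷ [])) ∷ [])) ∷ [])) ∷ (earlier 0 (0 ∷ 8 ∷ 16 ∷ 24 ∷ 32 ∷ 41 ∷ [])) ∷ (switch ((2 , p2) ∷ []) ((switch ((2 , p2) ∷ (3 , p3) ∷ (5 , p3) ∷ []) ((triangle (5 , q1)) ∷ [])) ∷ (switch ((1 , p2) ∷ (2 , p2) ∷ (5 , p3) ∷ []) ((contains K₃₃ (0 ∷ 2 ∷ 5 ∷ 1 ∷ 3 ∷ 4 ∷ [])) ∷ (include 4 ((switch ((0 , p3) ∷ (2 , p2) ∷ (4 , p2) ∷ []) ((switch ((2 , p3) ∷ (5 , p2) ∷ []) ((contains K₃₃ (0 ∷ 2 ∷ 5 ∷ 1 ∷ 4 ∷ 6 ∷ [])) ∷ [])) ∷ (switch ((1 , p2) ∷ (3 , p3) ∷ (5 , p3) ∷ []) ((contains K₃₃ (0 ∷ 2 ∷ 7 ∷ 1 ∷ 3 ∷ 6 ∷ [])) ∷ (contains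 K₃₃ (0 ∷ 2 ∷ 7 ∷ 1 ∷ 3 ∷ 6 ∷ [])) ∷ (contains K₃₃ (0 ∷ 2 ∷ 7 ∷ 1 ∷ 3 ∷ 6 ∷ [])) ∷ (contains K₃₃ (0 ∷ 2 ∷ 7 ∷ 1 ∷ 3 ∷ 6 ∷ [])) ∷ (contains K₃₃ (0 ∷ 2 ∷ 7 ∷ 1 ∷ 3 ∷ 6 ∷ [])) ∷ (contains K₃₃ (0 ∷ 2 ∷ 7 ∷ 1 ∷ 3 ∷ 6 ∷ [])) ∷ [])) ∷ (contains K₃₃ (0 ∷ 2 ∷ 5 ∷ 1 ∷ 3 ∷ 4 ∷ [])) ∷ [])) ∷ [])) ∷ (earlier 0 (0 ∷ 8 ∷ 16 ∷ 24 ∷ 32 ∷ 40 ∷ 49 ∷ [])) ∷ (contains K₃₃ (0 ∷ 2 ∷ 5 ∷ 1 ∷ 3 ∷ 4 ∷ [])) ∷ (include 4 ((switch ((0 , p2) ∷ (2 , p3) ∷ (3 , p2) ∷ (4 , p3) ∷ []) ((triangle (5 , q1)) ∷ [])) ∷ [])) ∷ [])) ∷ (switch ((2 , p2) ∷ (5 , p2) ∷ []) ((include 4 ((include 6 ((switch ((2 , p3) ∷ (6 , p3) ∷ []) ((switch ((1 , p3) ∷ []) ((contains K₃₃ (0 ∷ 2 ∷ 6 ∷ 1 ∷ 3 ∷ 7 ∷ [])) ∷ [])) ∷ (earlier 0 (0 ∷ 8 ∷ 16 ∷ 24 ∷ 32 ∷ 40 ∷ 48 ∷ 57 ∷ []))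 ∷ [])) ∷ [])) ∷ [])) ∷ (earlier 0 (0 ∷ 8 ∷ 16 ∷ 24 ∷ 32 ∷ 40 ∷ 49 ∷ [])) ∷ (triangle (5 , q1)) ∷ (triangle (5 , q1)) ∷ (switch ((1 , p3) ∷ []) ((include 4 ((switch ((2 , p3) ∷ (4 , p3) ∷ []) ((triangle (5 , q1)) ∷ (triangle (5 , q1)) ∷ (contains K₃₃ (0 ∷ 5 ∷ 7 ∷ 1 ∷ 4 ∷ 6 ∷ [])) ∷ (contains K₃₃ (0 ∷ 5 ∷ 7 ∷ 1 ∷ 4 ∷ 6 ∷ [])) ∷ (switch ((0 , p2) ∷ (1 , p2) ∷ (3 , p3) ∷ (4 , p3) ∷ []) ((contains K₃₃ (0 ∷ 5 ∷ 7 ∷ 1 ∷ 4 ∷ 6 ∷ [])) ∷ (contains K₃₃ (0 ∷ 5 ∷ 7 ∷ 1 ∷ 4 ∷ 6 ∷ [])) ∷ (contains K₃₃ (0 ∷ 5 ∷ 7 ∷ 1 ∷ 4 ∷ 6 ∷ [])) ∷ (contains K₃₃ (0 ∷ 5 ∷ 7 ∷ 1 ∷ 4 ∷ 6 ∷ [])) ∷ [])) ∷ (triangle (5 , q1)) ∷ [])) ∷ [])) ∷ (triangle (5 , q1)) ∷ (switch ((1 , p2) ∷ (2 , p2) ∷ (5 , p3) ∷ []) []) ∷ (earlier 0 (0 ∷ 8 ∷ 16 ∷ 24 ∷ 32 ∷ 40 ∷ 48 ∷ 57 ∷ [])) ∷ [])) ∷ (earlier 0 (0 ∷ 8 ∷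 16 ∷ 24 ∷ 32 ∷ 40 ∷ 49 ∷ 56 ∷ [])) ∷ (triangle (6 , q0)) ∷ (triangle (6 , q0)) ∷ (switch ((2 , p2) ∷ []) []) ∷ [])) ∷ (switch ((1 , p2) ∷ (3 , p3) ∷ (5 , p3) ∷ []) ((switch ((2 , p2) ∷ (3 , p3) ∷ (5 , p3) ∷ []) ((contains K₃₃ (0 ∷ 2 ∷ 5 ∷ 1 ∷ 3 ∷ 4 ∷ [])) ∷ (contains K₃₃ (1 ∷ 3 ∷ 6 ∷ 2 ∷ 5 ∷ 7 ∷ [])) ∷ (contains K₃₃ (1 ∷ 3 ∷ 6 ∷ 2 ∷ 5 ∷ 7 ∷ [])) ∷ (contains K₃₃ (1 ∷ 3 ∷ 6 ∷ 2 ∷ 5 ∷ 7 ∷ [])) ∷ (contains K₃₃ (1 ∷ 3 ∷ 6 ∷ 2 ∷ 5 ∷ 7 ∷ [])) ∷ (contains K₃₃ (1 ∷ 3 ∷ 6 ∷ 2 ∷ 5 ∷ 7 ∷ [])) ∷ (contains K₃₃ (1 ∷ 3 ∷ 6 ∷ 2 ∷ 5 ∷ 7 ∷ [])) ∷ [])) ∷ (earlier 0 (0 ∷ 8 ∷ 16 ∷ 24 ∷ 32 ∷ 40 ∷ 48 ∷ 57 ∷ [])) ∷ (earlier 0 (0 ∷ 8 ∷ 16 ∷ 24 ∷ 32 ∷ 40 ∷ 48 ∷ 60 ∷ [])) ∷ (earlier 0 (0 ∷ 8 ∷ 16 ∷ 24 ∷ 32 ∷ 40 ∷ 48 ∷ 62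 ∷ [])) ∷ [])) ∷ (earlier 13 (0 ∷ 8 ∷ 16 ∷ 24 ∷ 32 ∷ 40 ∷ [])) ∷ (switch ((2 , p2) ∷ (3 , p3) ∷ []) ((earlier 16 (0 ∷ 8 ∷ 16 ∷ 24 ∷ 32 ∷ 40 ∷ 48 ∷ [])) ∷ (contains K₃₃ (0 ∷ 2 ∷ 5 ∷ 1 ∷ 3 ∷ 6 ∷ [])) ∷ (earlier 16 (0 ∷ 8 ∷ 16 ∷ 24 ∷ 32 ∷ 40 ∷ 48 ∷ [])) ∷ (switch ((3 , p2) ∷ []) ((switch ((2 , p3) ∷ (3 , p3) ∷ []) ((contains K₃₃ (0 ∷ 2 ∷ 7 ∷ 3 ∷ 4 ∷ 6 ∷ [])) ∷ (switch ((1 , p3) ∷ []) ((contains K₃₃ (0 ∷ 2 ∷ 8 ∷ 1 ∷ 3 ∷ 6 ∷ [])) ∷ (contains K₃₃ (0 ∷ 2 ∷ 7 ∷ 3 ∷ 4 ∷ 6 ∷ [])) ∷ [])) ∷ (earlier 0 (0 ∷ 8 ∷ 16 ∷ 24 ∷ 32 ∷ 40 ∷ 48 ∷ 56 ∷ 65 ∷ [])) ∷ (contains K₃₃ (0 ∷ 2 ∷ 7 ∷ 3 ∷ 4 ∷ 6 ∷ [])) ∷ [])) ∷ [])) ∷ (earlier 0 (0 ∷ 8 ∷ 16 ∷ 24 ∷ 32 ∷ 40 ∷ 48 ∷ 57 ∷ [])) ∷ (switch ((0 , p2) ∷ (1 , p3) ∷ (3 , p3) ∷ []) ((contains K₃₃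 (0 ∷ 2 ∷ 7 ∷ 1 ∷ 3 ∷ 6 ∷ [])) ∷ (contains K₃₃ (0 ∷ 2 ∷ 7 ∷ 1 ∷ 3 ∷ 6 ∷ [])) ∷ (switch ((1 , p3) ∷ (2 , p3) ∷ (5 , p2) ∷ []) ((contains K₃₃ (0 ∷ 2 ∷ 7 ∷ 1 ∷ 3 ∷ 6 ∷ [])) ∷ (contains K₃₃ (0 ∷ 2 ∷ 5 ∷ 1 ∷ 4 ∷ 6 ∷ [])) ∷ (switch ((3 , p2) ∷ []) ((contains K₃₃ (0 ∷ 2 ∷ 8 ∷ 1 ∷ 3 ∷ 4 ∷ [])) ∷ [])) ∷ (earlier 0 (0 ∷ 8 ∷ 16 ∷ 24 ∷ 32 ∷ 40 ∷ 48 ∷ 56 ∷ 65 ∷ [])) ∷ (contains K₃₃ (0 ∷ 2 ∷ 5 ∷ 1 ∷ 4 ∷ 6 ∷ [])) ∷ (contains K₃₃ (0 ∷ 2 ∷ 5 ∷ 1 ∷ 4 ∷ 6 ∷ [])) ∷ [])) ∷ (contains K₃₃ (0 ∷ 2 ∷ 7 ∷ 1 ∷ 3 ∷ 6 ∷ [])) ∷ (contains K₃₃ (0 ∷ 2 ∷ 7 ∷ 1 ∷ 3 ∷ 6 ∷ [])) ∷ [])) ∷ (earlier 0 (0 ∷ 8 ∷ 16 ∷ 24 ∷ 32 ∷ 40 ∷ 48 ∷ 57 ∷ [])) ∷ (earlier 3 (0 ∷ 8 ∷ 16 ∷ 24 ∷ 32 ∷ 40 ∷ 48 ∷ 56 ∷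 [])) ∷ (earlier 3 (0 ∷ 8 ∷ 16 ∷ 24 ∷ 32 ∷ 40 ∷ 48 ∷ 57 ∷ [])) ∷ (contains K₃₃ (0 ∷ 2 ∷ 5 ∷ 1 ∷ 3 ∷ 6 ∷ [])) ∷ [])) ∷ (earlier 0 (0 ∷ 8 ∷ 16 ∷ 24 ∷ 32 ∷ 40 ∷ 49 ∷ [])) ∷ [])) ∷ (switch ((0 , p3) ∷ (1 , p2) ∷ []) ((include 4 ((include 6 ((switch ((2 , p3) ∷ (6 , p3) ∷ []) ((switch ((2 , p2) ∷ []) ((switch ((0 , p3) ∷ (1 , p2) ∷ (3 , p3) ∷ (6 , p3) ∷ []) ((switch ((0 , p3) ∷ (2 , p3) ∷ (5 , p2) ∷ (6 , p3) ∷ []) ((switch ((2 , p3) ∷ (3 , p3) ∷ []) ((contains K₃₃ (0 ∷ 2 ∷ 5 ∷ 1 ∷ 3 ∷ 4 ∷ [])) ∷ (contains K₃₃ (0 ∷ 2 ∷ 5 ∷ 1 ∷ 3 ∷ 4 ∷ [])) ∷ [])) ∷ (earlier 0 (0 ∷ 8 ∷ 16 ∷ 24 ∷ 32 ∷ 40 ∷ 48 ∷ 56 ∷ [])) ∷ [])) ∷ (earlier 0 (0 ∷ 8 ∷ 16 ∷ 24 ∷ 32 ∷ 40 ∷ 48 ∷ 56 ∷ [])) ∷ (earlier 0 (0 ∷ 8 ∷ 16 ∷ 24 ∷ 32 ∷ 40 ∷ 48 ∷ 56 ∷ [])) ∷ [])) ∷ (switch ((2 , p3) ∷ (3 , p3)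 ∷ []) ((contains K₃₃ (0 ∷ 2 ∷ 5 ∷ 1 ∷ 3 ∷ 4 ∷ [])) ∷ (contains K₃₃ (0 ∷ 2 ∷ 5 ∷ 1 ∷ 3 ∷ 4 ∷ [])) ∷ [])) ∷ (switch ((0 , p3) ∷ (1 , p2) ∷ (3 , p3) ∷ (6 , p3) ∷ []) ((switch ((0 , p3) ∷ (2 , p3) ∷ (5 , p2) ∷ (6 , p3) ∷ []) ((switch ((2 , p3) ∷ (3 , p3) ∷ []) ((contains K₃₃ (0 ∷ 2 ∷ 5 ∷ 1 ∷ 3 ∷ 4 ∷ [])) ∷ (contains K₃₃ (0 ∷ 2 ∷ 5 ∷ 1 ∷ 3 ∷ 4 ∷ [])) ∷ [])) ∷ (earlier 0 (0 ∷ 8 ∷ 16 ∷ 24 ∷ 32 ∷ 40 ∷ 48 ∷ 56 ∷ 64 ∷ [])) ∷ [])) ∷ (earlier 0 (0 ∷ 8 ∷ 16 ∷ 24 ∷ 32 ∷ 40 ∷ 48 ∷ 56 ∷ 64 ∷ [])) ∷ (earlier 0 (0 ∷ 8 ∷ 16 ∷ 24 ∷ 32 ∷ 40 ∷ 48 ∷ 56 ∷ 64 ∷ [])) ∷ [])) ∷ (earlier 3 (0 ∷ 8 ∷ 16 ∷ 24 ∷ 32 ∷ 40 ∷ 48 ∷ [])) ∷ [])) ∷ (earlier 0 (0 ∷ 8 ∷ 16 ∷ 24 ∷ 32 ∷ 40 ∷ 48 ∷ [])) ∷ (switch ((2 , p3) ∷ (3 , p3) ∷ []) ((contains K₃₃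 (0 ∷ 2 ∷ 5 ∷ 1 ∷ 3 ∷ 4 ∷ [])) ∷ (contains K₃₃ (0 ∷ 2 ∷ 5 ∷ 1 ∷ 3 ∷ 4 ∷ [])) ∷ [])) ∷ [])) ∷ (switch ((0 , p3) ∷ (1 , p2) ∷ (6 , p3) ∷ []) ((switch ((0 , p2) ∷ (1 , p2) ∷ []) []) ∷ [])) ∷ (switch ((2 , p3) ∷ (6 , p2) ∷ []) []) ∷ (earlier 3 (0 ∷ 8 ∷ 16 ∷ 24 ∷ 32 ∷ 40 ∷ 49 ∷ [])) ∷ (switch ((2 , p3) ∷ (6 , p3) ∷ []) ((switch ((3 , p2) ∷ (6 , p3) ∷ []) ((switch ((0 , p3) ∷ (2 , p2) ∷ (6 , p2) ∷ []) ((earlier 242 (4 ∷ 26 ∷ 19 ∷ 10 ∷ 52 ∷ 39 ∷ 43 ∷ [])) ∷ [])) ∷ (earlier 0 (0 ∷ 8 ∷ 16 ∷ 24 ∷ 32 ∷ 40 ∷ 48 ∷ [])) ∷ [])) ∷ (earlier 0 (0 ∷ 8 ∷ 16 ∷ 24 ∷ 32 ∷ 40 ∷ 48 ∷ [])) ∷ (earlier 0 (0 ∷ 8 ∷ 16 ∷ 24 ∷ 32 ∷ 40 ∷ 48 ∷ [])) ∷ (switch ((2 , p3) ∷ (5 , p3) ∷ []) ((contains K₃₃ (0 ∷ 2 ∷ 5 ∷ 1 ∷ 3 ∷ 4 ∷ [])) ∷ (contains K₃₃ (0 ∷ 2 ∷ 5 ∷ 1 ∷ 3 ∷ 4 ∷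 [])) ∷ [])) ∷ [])) ∷ (earlier 4 (0 ∷ 8 ∷ 16 ∷ 24 ∷ 32 ∷ 40 ∷ 49 ∷ [])) ∷ (earlier 5 (0 ∷ 8 ∷ 16 ∷ 24 ∷ 32 ∷ 40 ∷ 49 ∷ [])) ∷ (earlier 0 (0 ∷ 8 ∷ 16 ∷ 24 ∷ 32 ∷ 40 ∷ 49 ∷ [])) ∷ [])) ∷ [])) ∷ (include 6 ((include 4 ((switch ((0 , p3) ∷ (1 , p2) ∷ (6 , p3) ∷ []) ((switch ((0 , p3) ∷ (2 , p3) ∷ (6 , p2) ∷ []) []) ∷ (earlier 0 (0 ∷ 8 ∷ 16 ∷ 24 ∷ 32 ∷ 40 ∷ 48 ∷ 57 ∷ 64 ∷ [])) ∷ (switch ((0 , p3) ∷ (2 , p3) ∷ (6 , p2) ∷ []) []) ∷ (earlier 0 (0 ∷ 8 ∷ 16 ∷ 24 ∷ 32 ∷ 40 ∷ 48 ∷ 57 ∷ 64 ∷ 72 ∷ [])) ∷ [])) ∷ [])) ∷ (switch ((3 , p3) ∷ (6 , p2) ∷ []) ((switch ((2 , p3) ∷ (6 , p3) ∷ []) ((switch ((1 , p3) ∷ (5 , p3) ∷ (6 , p3) ∷ []) []) ∷ [])) ∷ (earlier 0 (0 ∷ 8 ∷ 16 ∷ 24 ∷ 32 ∷ 40 ∷ 48 ∷ 57 ∷ 64 ∷ [])) ∷ (switch ((2 , p3) ∷ (6 , p2) ∷ []) ((switch ((3 , p3) ∷ (6 , p3) ∷ []) []) ∷ (earlier 0 (0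 ∷ 8 ∷ 16 ∷ 24 ∷ 32 ∷ 40 ∷ 48 ∷ 57 ∷ 64 ∷ 72 ∷ [])) ∷ (triangle (8 , q0)) ∷ (triangle (8 , q0)) ∷ (switch ((3 , p3) ∷ (6 , p3) ∷ []) []) ∷ (earlier 0 (0 ∷ 8 ∷ 16 ∷ 24 ∷ 32 ∷ 40 ∷ 48 ∷ 57 ∷ 64 ∷ 72 ∷ 80 ∷ [])) ∷ [])) ∷ (earlier 0 (0 ∷ 8 ∷ 16 ∷ 24 ∷ 32 ∷ 40 ∷ 48 ∷ 56 ∷ 65 ∷ [])) ∷ (switch ((2 , p3) ∷ (6 , p3) ∷ []) ((switch ((1 , p3) ∷ (5 , p3) ∷ (6 , p3) ∷ []) []) ∷ [])) ∷ (earlier 0 (0 ∷ 8 ∷ 16 ∷ 24 ∷ 32 ∷ 40 ∷ 48 ∷ 57 ∷ 64 ∷ 72 ∷ [])) ∷ (earlier 2 (0 ∷ 8 ∷ 16 ∷ 24 ∷ 32 ∷ 40 ∷ 48 ∷ 56 ∷ 68 ∷ [])) ∷ (earlier 2 (0 ∷ 8 ∷ 16 ∷ 24 ∷ 32 ∷ 40 ∷ 48 ∷ 56 ∷ 70 ∷ [])) ∷ [])) ∷ (switch ((2 , p3) ∷ (6 , p2) ∷ []) ((switch ((0 , p3) ∷ (1 , p2) ∷ (6 , p3) ∷ []) []) ∷ (earlier 0 (0 ∷ 8 ∷ 16 ∷ 24 ∷ 32 ∷ 40 ∷ 48 ∷ 57 ∷ 64 ∷ [])) ∷ (switch ((0 ,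 p3) ∷ (1 , p2) ∷ (6 , p3) ∷ []) []) ∷ (earlier 0 (0 ∷ 8 ∷ 16 ∷ 24 ∷ 32 ∷ 40 ∷ 48 ∷ 57 ∷ 64 ∷ 72 ∷ [])) ∷ (switch ((2 , p3) ∷ (3 , p3) ∷ []) ((contains K₃₃ (0 ∷ 2 ∷ 5 ∷ 1 ∷ 3 ∷ 4 ∷ [])) ∷ (contains K₃₃ (0 ∷ 5 ∷ 7 ∷ 1 ∷ 3 ∷ 6 ∷ [])) ∷ (contains K₃₃ (0 ∷ 5 ∷ 7 ∷ 1 ∷ 3 ∷ 6 ∷ [])) ∷ (contains K₃₃ (0 ∷ 2 ∷ 5 ∷ 1 ∷ 3 ∷ 4 ∷ [])) ∷ [])) ∷ [])) ∷ (include 4 ((switch ((3 , p2) ∷ (6 , p3) ∷ []) ((switch ((3 , p2) ∷ []) []) ∷ (earlier 0 (0 ∷ 8 ∷ 16 ∷ 24 ∷ 32 ∷ 40 ∷ 48 ∷ 57 ∷ 64 ∷ [])) ∷ (switch ((3 , p2) ∷ []) ((triangle (8 , q0)) ∷ [])) ∷ (earlier 0 (0 ∷ 8 ∷ 16 ∷ 24 ∷ 32 ∷ 40 ∷ 48 ∷ 56 ∷ 65 ∷ [])) ∷ (switch ((3 , p2) ∷ []) []) ∷ (earlier 0 (0 ∷ 8 ∷ 16 ∷ 24 ∷ 32 ∷ 40 ∷ 48 ∷ 57 ∷ 64 ∷ 72 ∷ [])) ∷ (earlier 1 (0 ∷ 8 ∷ 16 ∷ 24 ∷ 32 ∷ 40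 ∷ 48 ∷ 56 ∷ 68 ∷ [])) ∷ (earlier 1 (0 ∷ 8 ∷ 16 ∷ 24 ∷ 32 ∷ 40 ∷ 48 ∷ 56 ∷ 70 ∷ [])) ∷ [])) ∷ [])) ∷ (earlier 9 (0 ∷ 8 ∷ 16 ∷ 24 ∷ 32 ∷ 40 ∷ 49 ∷ 56 ∷ [])) ∷ (earlier 17 (0 ∷ 8 ∷ 16 ∷ 24 ∷ 32 ∷ 40 ∷ 49 ∷ 56 ∷ [])) ∷ (earlier 0 (0 ∷ 8 ∷ 16 ∷ 24 ∷ 32 ∷ 40 ∷ 49 ∷ 56 ∷ [])) ∷ (earlier 5 (0 ∷ 8 ∷ 16 ∷ 24 ∷ 32 ∷ 40 ∷ 49 ∷ 56 ∷ [])) ∷ [])) ∷ [])) ∷ (earlier 42 (0 ∷ 8 ∷ 16 ∷ 24 ∷ 32 ∷ 41 ∷ [])) ∷ (include 4 ((switch ((1 , p3) ∷ (4 , p3) ∷ []) ((triangle (5 , q0)) ∷ (switch ((1 , p3) ∷ []) ((triangle (5 , q0)) ∷ [])) ∷ (earlier 0 (0 ∷ 8 ∷ 16 ∷ 24 ∷ 32 ∷ 40 ∷ 49 ∷ [])) ∷ (earlier 0 (0 ∷ 8 ∷ 16 ∷ 24 ∷ 32 ∷ 40 ∷ 52 ∷ [])) ∷ (earlier 0 (0 ∷ 8 ∷ 16 ∷ 24 ∷ 32 ∷ 40 ∷ 54 ∷ [])) ∷ [])) ∷ [])) ∷ (earlier 3 (0 ∷ 8 ∷ 16 ∷ 24 ∷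 32 ∷ 41 ∷ [])) ∷ (earlier 0 (0 ∷ 8 ∷ 16 ∷ 24 ∷ 32 ∷ 41 ∷ [])) ∷ [])) ∷ (earlier 0 (0 ∷ 8 ∷ 16 ∷ 24 ∷ 33 ∷ 40 ∷ [])) ∷ (earlier 131 (4 ∷ 26 ∷ 19 ∷ 10 ∷ 32 ∷ 40 ∷ [])) ∷ (earlier 131 (4 ∷ 26 ∷ 19 ∷ 10 ∷ 33 ∷ 40 ∷ [])) ∷ (earlier 91 (4 ∷ 26 ∷ 19 ∷ 10 ∷ 32 ∷ [])) ∷ (earlier 91 (4 ∷ 26 ∷ 19 ∷ 10 ∷ 33 ∷ [])) ∷ (earlier 0 (4 ∷ 26 ∷ 19 ∷ 10 ∷ 32 ∷ 40 ∷ [])) ∷ (earlier 0 (4 ∷ 26 ∷ 19 ∷ 10 ∷ 33 ∷ 40 ∷ [])) ∷ [])) ∷ (earlier 319 (0 ∷ 8 ∷ 16 ∷ 25 ∷ [])) ∷ (switch ((0 , p3) ∷ (2 , p3) ∷ []) ((triangle (2 , q0)) ∷ (triangle (2 , q0)) ∷ (triangle (3 , q1)) ∷ (include 4 ((switch ((0 , p3) ∷ (2 , p2) ∷ (4 , p3) ∷ []) ((triangle (4 , q1)) ∷ (triangle (3 , q1)) ∷ (switch ((3 , p3) ∷ []) []) ∷ (switch ((0 , p3) ∷ (2 , p2) ∷ (4 , p3) ∷ []) ((triangle (3 , q1)) ∷ (triangle (3 , q1)) ∷ (triangle (3 , q1)) ∷ (triangle (3 , q1)) ∷ (triangle (3 ,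 q1)) ∷ (switch ((3 , p3) ∷ []) []) ∷ (earlier 0 (0 ∷ 8 ∷ 16 ∷ 24 ∷ 32 ∷ 40 ∷ 48 ∷ [])) ∷ [])) ∷ (earlier 2 (0 ∷ 8 ∷ 16 ∷ 24 ∷ 32 ∷ [])) ∷ [])) ∷ [])) ∷ (earlier 0 (0 ∷ 8 ∷ 16 ∷ 24 ∷ 33 ∷ [])) ∷ (switch ((3 , p3) ∷ []) ((switch ((0 , p3) ∷ (1 , p2) ∷ []) ((contains K₃₃ (0 ∷ 2 ∷ 5 ∷ 1 ∷ 3 ∷ 4 ∷ [])) ∷ [])) ∷ (earlier 0 (0 ∷ 8 ∷ 16 ∷ 24 ∷ 32 ∷ 41 ∷ [])) ∷ [])) ∷ (earlier 0 (0 ∷ 8 ∷ 16 ∷ 24 ∷ 33 ∷ [])) ∷ (include 4 ((earlier 352 (17 ∷ 11 ∷ 1 ∷ 32 ∷ 26 ∷ [])) ∷ (earlier 343 (17 ∷ 11 ∷ 1 ∷ 33 ∷ 27 ∷ [])) ∷ (switch ((1 , p3) ∷ []) ((triangle (3 , q1)) ∷ (triangle (4 , q1)) ∷ [])) ∷ (earlier 0 (0 ∷ 8 ∷ 16 ∷ 24 ∷ 33 ∷ [])) ∷ (earlier 353 (17 ∷ 11 ∷ 1 ∷ 33 ∷ 26 ∷ [])) ∷ (earlier 344 (17 ∷ 11 ∷ 1 ∷ 32 ∷ 27 ∷ [])) ∷ [])) ∷ (switch ((3 , p3) ∷ []) ((switch ((1 , p2) ∷ (2 , p3) ∷ (3 ,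 p3) ∷ []) ((triangle (2 , q0)) ∷ (triangle (3 , q1)) ∷ (triangle (3 , q1)) ∷ (triangle (2 , q0)) ∷ (triangle (2 , q0)) ∷ (switch ((1 , p2) ∷ (2 , p3) ∷ (3 , p3) ∷ []) ((triangle (3 , q1)) ∷ (triangle (3 , q1)) ∷ (contains F₆ (1 ∷ 0 ∷ 3 ∷ 2 ∷ 5 ∷ 4 ∷ [])) ∷ (contains F₆ (1 ∷ 0 ∷ 3 ∷ 2 ∷ 5 ∷ 4 ∷ [])) ∷ (switch ((0 , p3) ∷ []) []) ∷ (contains F₆ (1 ∷ 0 ∷ 3 ∷ 2 ∷ 5 ∷ 4 ∷ [])) ∷ (contains F₆ (1 ∷ 0 ∷ 3 ∷ 2 ∷ 5 ∷ 4 ∷ [])) ∷ (earlier 0 (0 ∷ 8 ∷ 16 ∷ 24 ∷ 32 ∷ 40 ∷ 48 ∷ [])) ∷ [])) ∷ (switch ((3 , p3) ∷ []) []) ∷ (triangle (2 , q0)) ∷ (triangle (2 , q0)) ∷ (earlier 0 (0 ∷ 8 ∷ 16 ∷ 24 ∷ 32 ∷ 40 ∷ [])) ∷ [])) ∷ (earlier 0 (0 ∷ 8 ∷ 16 ∷ 24 ∷ 33 ∷ [])) ∷ [])) ∷ (earlier 9 (0 ∷ 8 ∷ 16 ∷ 24 ∷ 36 ∷ [])) ∷ (earlier 9 (0 ∷ 8 ∷ 16 ∷ 24 ∷ 38 ∷ [])) ∷ (earlier 7 (0 ∷ 8 ∷ 16 ∷ 24 ∷ 36 ∷ [])) ∷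 (earlier 7 (0 ∷ 8 ∷ 16 ∷ 24 ∷ 38 ∷ [])) ∷ (earlier 5 (0 ∷ 8 ∷ 16 ∷ 24 ∷ 34 ∷ [])) ∷ [])) ∷ (earlier 15 (0 ∷ 8 ∷ 16 ∷ 25 ∷ [])) ∷ (earlier 0 (0 ∷ 8 ∷ 16 ∷ 25 ∷ [])) ∷ [])) ∷ (switch ((2 , p3) ∷ []) ((switch ((0 , p3) ∷ (2 , p2) ∷ []) ((triangle (2 , q1)) ∷ (triangle (2 , q1)) ∷ (include 3 ((switch ((1 , p3) ∷ []) ((switch ((0 , p3) ∷ (3 , p3) ∷ []) ((contains K₃₃ (0 ∷ 2 ∷ 6 ∷ 1 ∷ 3 ∷ 5 ∷ [])) ∷ [])) ∷ (earlier 0 (0 ∷ 8 ∷ 16 ∷ 24 ∷ 32 ∷ 40 ∷ 49 ∷ [])) ∷ [])) ∷ [])) ∷ (earlier 0 (0 ∷ 8 ∷ 16 ∷ 24 ∷ 32 ∷ 41 ∷ [])) ∷ (triangle (1 , q0)) ∷ (triangle (1 , q0)) ∷ (triangle (1 , q0)) ∷ (include 3 ((include 4 ((switch ((3 , p2) ∷ (4 , p2) ∷ []) ((triangle (4 , q0)) ∷ (triangle (1 , q0)) ∷ (triangle (4 , q0)) ∷ [])) ∷ [])) ∷ [])) ∷ (earlier 0 (0 ∷ 8 ∷ 16 ∷ 24 ∷ 33 ∷ [])) ∷ (include 3 ((switch ((2 , p2) ∷ (3 , p3) ∷ []) ((switch ((0 , p2) ∷ (2 , p2) ∷ []) ((triangle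 (1 , q0)) ∷ (triangle (1 , q0)) ∷ (triangle (1 , q0)) ∷ [])) ∷ (earlier 0 (0 ∷ 8 ∷ 16 ∷ 24 ∷ 32 ∷ 41 ∷ [])) ∷ (earlier 0 (0 ∷ 8 ∷ 16 ∷ 24 ∷ 32 ∷ 40 ∷ [])) ∷ (earlier 0 (0 ∷ 8 ∷ 16 ∷ 24 ∷ 32 ∷ 41 ∷ [])) ∷ (switch ((1 , p3) ∷ []) ((switch ((0 , p2) ∷ (1 , p3) ∷ (2 , p2) ∷ []) ((contains K₃₃ (0 ∷ 2 ∷ 6 ∷ 1 ∷ 3 ∷ 4 ∷ [])) ∷ (contains K₃₃ (0 ∷ 2 ∷ 6 ∷ 1 ∷ 4 ∷ 5 ∷ [])) ∷ (contains K₃₃ (0 ∷ 2 ∷ 6 ∷ 1 ∷ 4 ∷ 5 ∷ [])) ∷ (contains K₃₃ (0 ∷ 2 ∷ 6 ∷ 1 ∷ 3 ∷ 4 ∷ [])) ∷ [])) ∷ (earlier 0 (0 ∷ 8 ∷ 16 ∷ 24 ∷ 32 ∷ 40 ∷ 49 ∷ [])) ∷ (earlier 13 (4 ∷ 26 ∷ 18 ∷ 11 ∷ 32 ∷ 42 ∷ [])) ∷ [])) ∷ (earlier 0 (0 ∷ 8 ∷ 16 ∷ 24 ∷ 33 ∷ 40 ∷ [])) ∷ (switch ((1 , p3) ∷ []) ((contains F₆ (4 ∷ 0 ∷ 3 ∷ 2 ∷ 1 ∷ 5 ∷ [])) ∷ (contains F₆ (4 ∷ 0 ∷ 3 ∷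 2 ∷ 1 ∷ 5 ∷ [])) ∷ [])) ∷ (earlier 0 (0 ∷ 8 ∷ 16 ∷ 24 ∷ 32 ∷ 41 ∷ [])) ∷ (switch ((0 , p2) ∷ (3 , p3) ∷ []) ((switch ((0 , p2) ∷ (1 , p3) ∷ (3 , p3) ∷ []) ((contains K₃₃ (0 ∷ 2 ∷ 6 ∷ 1 ∷ 3 ∷ 5 ∷ [])) ∷ (contains K₃₃ (0 ∷ 2 ∷ 6 ∷ 1 ∷ 3 ∷ 5 ∷ [])) ∷ (contains K₃₃ (0 ∷ 2 ∷ 6 ∷ 1 ∷ 3 ∷ 5 ∷ [])) ∷ (contains K₃₃ (0 ∷ 2 ∷ 6 ∷ 1 ∷ 3 ∷ 5 ∷ [])) ∷ [])) ∷ (earlier 0 (0 ∷ 8 ∷ 16 ∷ 24 ∷ 33 ∷ 40 ∷ 48 ∷ [])) ∷ (triangle (1 , q0)) ∷ (triangle (1 , q0)) ∷ (triangle (1 , q0)) ∷ (triangle (1 , q0)) ∷ (triangle (1 , q0)) ∷ [])) ∷ (earlier 0 (0 ∷ 8 ∷ 16 ∷ 24 ∷ 32 ∷ 41 ∷ 48 ∷ [])) ∷ (earlier 2 (0 ∷ 8 ∷ 16 ∷ 24 ∷ 32 ∷ 40 ∷ [])) ∷ (earlier 2 (0 ∷ 8 ∷ 16 ∷ 24 ∷ 32 ∷ 41 ∷ [])) ∷ (earlier 0 (0 ∷ 8 ∷ 16 ∷ 24 ∷ 32 ∷ 40 ∷ 48 ∷ [])) ∷ (earlier 0 (0 ∷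 8 ∷ 16 ∷ 24 ∷ 32 ∷ 41 ∷ 48 ∷ [])) ∷ [])) ∷ [])) ∷ (switch ((1 , p3) ∷ []) ((include 3 ((earlier 17 (4 ∷ 26 ∷ 18 ∷ 11 ∷ 32 ∷ [])) ∷ [])) ∷ (earlier 0 (0 ∷ 8 ∷ 16 ∷ 24 ∷ 33 ∷ [])) ∷ [])) ∷ (earlier 10 (0 ∷ 8 ∷ 16 ∷ 24 ∷ 32 ∷ [])) ∷ (earlier 10 (0 ∷ 8 ∷ 16 ∷ 24 ∷ 33 ∷ [])) ∷ (earlier 13 (0 ∷ 8 ∷ 16 ∷ 24 ∷ 32 ∷ 44 ∷ [])) ∷ (earlier 13 (0 ∷ 8 ∷ 16 ∷ 24 ∷ 32 ∷ 46 ∷ [])) ∷ (earlier 2 (0 ∷ 8 ∷ 16 ∷ 24 ∷ 32 ∷ 42 ∷ [])) ∷ [])) ∷ (earlier 0 (0 ∷ 8 ∷ 16 ∷ 25 ∷ 32 ∷ [])) ∷ (triangle (2 , q1)) ∷ (include 3 ((earlier 404 (4 ∷ 26 ∷ 18 ∷ 11 ∷ 32 ∷ [])) ∷ [])) ∷ (earlier 0 (0 ∷ 8 ∷ 16 ∷ 25 ∷ 32 ∷ [])) ∷ (switch ((0 , p3) ∷ (2 , p2) ∷ []) ((triangle (2 , q1)) ∷ (triangle (2 , q1)) ∷ (switch ((1 , p3) ∷ []) ((include 3 ((switch ((0 , p3) ∷ (3 , p3) ∷ []) ((contains K₃₃ (0 ∷ 2 ∷ 7 ∷ 1 ∷ 3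 ∷ 6 ∷ [])) ∷ [])) ∷ [])) ∷ (earlier 0 (0 ∷ 8 ∷ 16 ∷ 24 ∷ 32 ∷ 40 ∷ 48 ∷ 57 ∷ [])) ∷ [])) ∷ (earlier 0 (0 ∷ 8 ∷ 16 ∷ 24 ∷ 32 ∷ 40 ∷ 49 ∷ [])) ∷ (triangle (1 , q0)) ∷ (triangle (1 , q0)) ∷ (triangle (1 , q0)) ∷ (triangle (1 , q0)) ∷ (triangle (1 , q0)) ∷ (include 3 ((include 4 ((switch ((0 , p3) ∷ (2 , p3) ∷ (4 , p3) ∷ []) ((triangle (4 , q0)) ∷ (triangle (1 , q0)) ∷ (triangle (1 , q0)) ∷ (triangle (1 , q0)) ∷ (triangle (5 , q0)) ∷ (triangle (5 , q0)) ∷ (switch ((3 , p2) ∷ (4 , p2) ∷ []) ((triangle (1 , q0)) ∷ (triangle (1 , q0)) ∷ (triangle (1 , q0)) ∷ (triangle (1 , q0)) ∷ (triangle (1 , q0)) ∷ (triangle (1 , q0)) ∷ (triangle (1 , q0)) ∷ [])) ∷ [])) ∷ [])) ∷ [])) ∷ (earlier 0 (0 ∷ 8 ∷ 16 ∷ 24 ∷ 33 ∷ 40 ∷ [])) ∷ (triangle (5 , q0)) ∷ (triangle (5 , q0)) ∷ (include 3 ((include 6 ((switch ((2 , p3) ∷ (6 , p3) ∷ []) ((triangle (1 , q0)) ∷ (triangle (1 , q0)) ∷ (triangle (1 , q0)) ∷ (triangle (1 , q0)) ∷ (triangle (1 , q0)) ∷ [])) ∷ (switch ((3 , p2) ∷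 []) ((switch ((1 , p3) ∷ []) ((earlier 385 (19 ∷ 25 ∷ 5 ∷ 49 ∷ 8 ∷ 45 ∷ 34 ∷ [])) ∷ (earlier 385 (19 ∷ 25 ∷ 5 ∷ 49 ∷ 8 ∷ 47 ∷ 34 ∷ [])) ∷ [])) ∷ [])) ∷ (earlier 2 (0 ∷ 8 ∷ 16 ∷ 24 ∷ 32 ∷ 40 ∷ 49 ∷ [])) ∷ (earlier 0 (0 ∷ 8 ∷ 16 ∷ 24 ∷ 32 ∷ 40 ∷ 49 ∷ [])) ∷ [])) ∷ [])) ∷ (earlier 5 (0 ∷ 8 ∷ 16 ∷ 24 ∷ 32 ∷ 40 ∷ [])) ∷ (earlier 5 (0 ∷ 8 ∷ 16 ∷ 24 ∷ 33 ∷ 40 ∷ [])) ∷ (earlier 9 (0 ∷ 8 ∷ 16 ∷ 24 ∷ 32 ∷ 40 ∷ 52 ∷ [])) ∷ (earlier 9 (0 ∷ 8 ∷ 16 ∷ 24 ∷ 32 ∷ 40 ∷ 54 ∷ [])) ∷ (triangle (5 , q0)) ∷ (triangle (5 , q0)) ∷ (earlier 0 (0 ∷ 8 ∷ 16 ∷ 24 ∷ 32 ∷ 40 ∷ 50 ∷ [])) ∷ [])) ∷ (earlier 0 (0 ∷ 8 ∷ 16 ∷ 25 ∷ 32 ∷ 40 ∷ [])) ∷ (include 3 ((earlier 42 (4 ∷ 26 ∷ 18 ∷ 11 ∷ 36 ∷ [])) ∷ (switch ((3 , p3) ∷ []) ((switch ((0 , p3) ∷ (2 , p3) ∷ (3 ,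 p3) ∷ []) ((switch ((0 , p2) ∷ (2 , p3) ∷ (3 , p2) ∷ []) ((triangle (1 , q0)) ∷ (contains K₃₃ (0 ∷ 2 ∷ 5 ∷ 3 ∷ 4 ∷ 6 ∷ [])) ∷ [])) ∷ (earlier 0 (0 ∷ 8 ∷ 16 ∷ 24 ∷ 32 ∷ 40 ∷ 49 ∷ [])) ∷ (switch ((0 , p3) ∷ (1 , p2) ∷ []) ((triangle (1 , q0)) ∷ (switch ((0 , p3) ∷ []) []) ∷ (contains K₃₃ (0 ∷ 2 ∷ 6 ∷ 1 ∷ 3 ∷ 4 ∷ [])) ∷ [])) ∷ (earlier 0 (0 ∷ 8 ∷ 16 ∷ 24 ∷ 32 ∷ 40 ∷ 49 ∷ [])) ∷ (earlier 0 (0 ∷ 8 ∷ 16 ∷ 24 ∷ 32 ∷ 40 ∷ 48 ∷ [])) ∷ (earlier 0 (0 ∷ 8 ∷ 16 ∷ 24 ∷ 32 ∷ 40 ∷ 49 ∷ [])) ∷ (earlier 2 (0 ∷ 8 ∷ 16 ∷ 24 ∷ 32 ∷ 40 ∷ 48 ∷ [])) ∷ (earlier 2 (0 ∷ 8 ∷ 16 ∷ 24 ∷ 32 ∷ 40 ∷ 49 ∷ [])) ∷ [])) ∷ (earlier 0 (0 ∷ 8 ∷ 16 ∷ 24 ∷ 32 ∷ 41 ∷ [])) ∷ [])) ∷ (earlier 416 (4 ∷ 26 ∷ 18 ∷ 11 ∷ 32 ∷ [])) ∷ (earlier 47 (4 ∷ 27 ∷ 18 ∷ 11 ∷ 36 ∷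 [])) ∷ (earlier 416 (4 ∷ 27 ∷ 18 ∷ 11 ∷ 32 ∷ [])) ∷ (earlier 0 (0 ∷ 8 ∷ 16 ∷ 25 ∷ 32 ∷ [])) ∷ [])) ∷ (earlier 0 (0 ∷ 8 ∷ 16 ∷ 24 ∷ 33 ∷ [])) ∷ (include 3 ((earlier 46 (4 ∷ 26 ∷ 18 ∷ 11 ∷ 36 ∷ [])) ∷ (earlier 1 (4 ∷ 27 ∷ 19 ∷ 11 ∷ 32 ∷ [])) ∷ (earlier 402 (4 ∷ 26 ∷ 18 ∷ 11 ∷ 32 ∷ [])) ∷ (earlier 46 (4 ∷ 27 ∷ 18 ∷ 11 ∷ 36 ∷ [])) ∷ (earlier 402 (4 ∷ 27 ∷ 18 ∷ 11 ∷ 32 ∷ [])) ∷ (earlier 1 (4 ∷ 26 ∷ 19 ∷ 11 ∷ 32 ∷ [])) ∷ [])) ∷ (earlier 0 (0 ∷ 8 ∷ 16 ∷ 24 ∷ 33 ∷ [])) ∷ (include 3 ((earlier 45 (4 ∷ 26 ∷ 18 ∷ 11 ∷ 34 ∷ [])) ∷ (earlier 374 (4 ∷ 26 ∷ 18 ∷ 11 ∷ 32 ∷ [])) ∷ (earlier 45 (4 ∷ 27 ∷ 18 ∷ 11 ∷ 34 ∷ [])) ∷ (earlier 374 (4 ∷ 27 ∷ 18 ∷ 11 ∷ 32 ∷ [])) ∷ [])) ∷ [])) ∷ (earlier 40 (0 ∷ 8 ∷ 17 ∷ 24 ∷ [])) ∷ (earlier 0 (0 ∷ 8 ∷ 17 ∷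 24 ∷ [])) ∷ [])) ∷ (earlier 0 (0 ∷ 9 ∷ 16 ∷ 24 ∷ [])) ∷ [])) ∷ (earlier 0 (1 ∷ 8 ∷ 16 ∷ 24 ∷ [])) ∷ [])

abstract
  -- Each `refl` evaluates the checker on a complete tree; `abstract` keeps the trees from being
  -- unfolded again afterwards.
  certificate : ∀ G → Σ (List Proof) λ ps → is-just (checkAll G [] (starts G point) ps) ≡ true
  certificate triangles = triangleProof , refl
  certificate quads = quadProof , refl

-- Soundness of the Boolean tests.

∨-true : ∀ {a b} → a ∨ b ≡ true → a ≡ true ⊎ b ≡ true
∨-true {true} _ = inj₁ refl
∨-true {false} p = inj₂ p

not-true : ∀ {b} → not b ≡ true → b ≡ false
not-true {false} _ = refl

if-true : ∀ {A : Set} {b : Bool} {x y : A} → b ≡ true → (if b then x else y) ≡ x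
if-true refl = refl

∧-intro : ∀ {a b} → a ≡ true → b ≡ true → a ∧ b ≡ true
∧-intro refl refl = refl

≡true : ∀ {b} → (b ≡ false → ⊥) → b ≡ true
≡true {true} _ = refl
≡true {false} h = ⊥-elim (h refl)

≡false : ∀ {b} → (b ≡ true → ⊥) → b ≡ false
≡false {false} _ = refl
≡false {true} h = ⊥-elim (h refl)

≡ᵇ-sound : ∀ a b → (a ≡ᵇ b) ≡ true → a ≡ b
≡ᵇ-sound a b p = ≡ᵇ⇒≡ a b (Equivalence.from T-≡ p)

≡ᵇ-refl : ∀ a → (a ≡ᵇ a) ≡ true
≡ᵇ-refl a = Equivalence.to T-≡ (≡⇒≡ᵇ a a refl)

<ᵇ-sound : ∀ a b → (a <ᵇ b) ≡ true → a < b
<ᵇ-sound a b p = <ᵇ⇒< a b (Equivalence.from T-≡ p)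

eqQ-sound : ∀ i j → eqQ i j ≡ true → i ≡ j
eqQ-sound i j p = codeQ-injective i j (≡ᵇ-sound _ _ p)

eqD-sound : ∀ d e → eqD d e ≡ true → d ≡ e
eqD-sound (a , i) (b , j) p with ∧-true {a ≡ᵇ b} p
... | u , v with ≡ᵇ-sound a b u | eqQ-sound i j v
... | refl | refl = refl

eqD-refl : ∀ d → eqD d d ≡ true
eqD-refl (a , i) = ∧-intro (≡ᵇ-refl a) (≡ᵇ-refl (codeQ i))

mem-sound : ∀ a bs → mem a bs ≡ true → a ∈ bs
mem-sound a (b ∷ bs) p with ∨-true {a ≡ᵇ b} p
... | inj₁ q = here (≡ᵇ-sound a b q)
... | inj₂ q = there (mem-sound a bs q)

mem-complete : ∀ {a bs} → a ∈ bs → mem a bs ≡ true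
mem-complete {a} (here refl) rewrite ≡ᵇ-refl a = refl
mem-complete {a} {b ∷ bs} (there p) rewrite mem-complete p with a ≡ᵇ b
... | true = refl
... | false = refl

memD-sound : ∀ d es → memD d es ≡ true → d ∈ es
memD-sound d (e ∷ es) p with ∨-true {eqD d e} p
... | inj₁ q = here (eqD-sound d e q)
... | inj₂ q = there (memD-sound d es q)

memD-complete : ∀ {d es} → d ∈ es → memD d es ≡ true
memD-complete {d} (here refl) rewrite eqD-refl d = refl
memD-complete {d} {e ∷ es} (there p) rewrite memD-complete p with eqD d e
... | true = refl
... | false = refl

every-sound : ∀ {A : Set} (p : A → Bool) {xs x} → every p xs ≡ true → x ∈ xs → p x ≡ true
every-sound p {y ∷ ys} h m with ∧-true {p y} h
every-sound p {y ∷ ys} h (here refl) | u , v = u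
every-sound p {y ∷ ys} h (there m) | u , v = every-sound p v m

keep-∈ : ∀ {A : Set} (p : A → Bool) {xs x} → x ∈ xs → p x ≡ true → x ∈ keep p xs
keep-∈ p {y ∷ ys} (here refl) h rewrite h = here refl
keep-∈ p {y ∷ ys} (there m) h with p y
... | true = there (keep-∈ p m h)
... | false = keep-∈ p m h

keep-sound : ∀ {A : Set} (p : A → Bool) xs {x} → x ∈ keep p xs → x ∈ xs × p x ≡ true
keep-sound p (y ∷ ys) m with p y in eq
keep-sound p (y ∷ ys) (here refl) | true = here refl , eq
keep-sound p (y ∷ ys) (there m) | true with keep-sound p ys m
... | u , v = there u , v
keep-sound p (y ∷ ys) m | false with keep-sound p ys m
... | u , v = there u , v

∈-concat : ∀ {A B : Set} {f : A → List B} {xs x y} → x ∈ xs → y ∈ f x → y ∈ gather f xs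
∈-concat (here refl) y∈ = ∈-++⁺ˡ y∈
∈-concat {f = f} {xs = z ∷ _} (there m) y∈ = ∈-++⁺ʳ (f z) (∈-concat m y∈)

∈-darts : ∀ a i → (a , i) ∈ darts a
∈-darts a q0 = here refl
∈-darts a q1 = there (here refl)
∈-darts a q2 = there (there (here refl))
∈-darts a q3 = there (there (there (here refl)))

darts-name : ∀ {a d} → d ∈ darts a → proj₁ d ≡ a
darts-name (here refl) = refl
darts-name (there (here refl)) = refl
darts-name (there (there (here refl))) = refl
darts-name (there (there (there (here refl)))) = refl

∈-allDarts : ∀ {k} d → proj₁ d < k → d ∈ allDarts k
∈-allDarts (a , i) h = ∈-concat {f = darts} (∈-upTo⁺ h) (∈-darts a i)

∈-dartsOf : ∀ {S} d → proj₁ d ∈ S → d ∈ dartsOf S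
∈-dartsOf (a , i) h = ∈-concat {f = darts} h (∈-darts a i)

dartsOf-name : ∀ S {d} → d ∈ dartsOf S → proj₁ d ∈ S
dartsOf-name (a ∷ S) (here refl) = here refl
dartsOf-name (a ∷ S) (there (here refl)) = here refl
dartsOf-name (a ∷ S) (there (there (here refl))) = here refl
dartsOf-name (a ∷ S) (there (there (there (here refl)))) = here refl
dartsOf-name (a ∷ S) (there (there (there (there m)))) = there (dartsOf-name S m)

allDarts-name : ∀ k {d} → d ∈ allDarts k → proj₁ d < k
allDarts-name k m = ∈-upTo⁻ (dartsOf-name (upTo k) m)

look-sound : ∀ h d {e} → look h d ≡ just e → (d , e) ∈ h ⊎ (e , d) ∈ h
look-sound ((x , y) ∷ r) d p with eqD x d in u
look-sound ((x , y) ∷ r) d refl | true with eqD-sound x d u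
... | refl = inj₁ (here refl)
look-sound ((x , y) ∷ r) d p | false with eqD y d in v
look-sound ((x , y) ∷ r) d refl | false | true with eqD-sound y d v
... | refl = inj₂ (here refl)
look-sound ((x , y) ∷ r) d p | false | false with look-sound r d p
... | inj₁ m = inj₁ (there m)
... | inj₂ m = inj₂ (there m)

look-none : ∀ h d {e} → look h d ≡ nothing → (d , e) ∈ h ⊎ (e , d) ∈ h → ⊥
look-none [] d p (inj₁ ())
look-none [] d p (inj₂ ())
look-none ((x , y) ∷ r) d p m with eqD x d in u
look-none ((x , y) ∷ r) d () m | true
look-none ((x , y) ∷ r) d p m | false with eqD y d in v
look-none ((x , y) ∷ r) d () m | false | true
look-none ((x , y) ∷ r) d p (inj₁ (here refl)) | false | false = true≢false (eqD-refl d) u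
look-none ((x , y) ∷ r) d p (inj₂ (here refl)) | false | false = true≢false (eqD-refl d) v
look-none ((x , y) ∷ r) d p (inj₁ (there m)) | false | false = look-none r d p (inj₁ m)
look-none ((x , y) ∷ r) d p (inj₂ (there m)) | false | false = look-none r d p (inj₂ m)

adjacent-sound : ∀ h a b → adjacent h a b ≡ true →
  ∃[ x ] ∃[ y ] (((x , y) ∈ h ⊎ (y , x) ∈ h) × proj₁ x ≡ a × proj₁ y ≡ b)
adjacent-sound ((x@(a′ , _) , y@(b′ , _)) ∷ h) a b p with ∨-true {(a′ ≡ᵇ a) ∧ (b′ ≡ᵇ b)} p
... | inj₁ q with ∧-true {a′ ≡ᵇ a} q
...   | u , v = x , y , inj₁ (here refl) , ≡ᵇ-sound _ _ u , ≡ᵇ-sound _ _ v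
adjacent-sound ((x@(a′ , _) , y@(b′ , _)) ∷ h) a b p | inj₂ q with ∨-true {(a′ ≡ᵇ b) ∧ (b′ ≡ᵇ a)} q
... | inj₁ r with ∧-true {a′ ≡ᵇ b} r
...   | u , v = y , x , inj₂ (here refl) , ≡ᵇ-sound _ _ v , ≡ᵇ-sound _ _ u
adjacent-sound ((x@(a′ , _) , y@(b′ , _)) ∷ h) a b p | inj₂ q | inj₂ r with adjacent-sound h a b r
... | x′ , y′ , inj₁ m , u , v = x′ , y′ , inj₁ (there m) , u , v
... | x′ , y′ , inj₂ m , u , v = x′ , y′ , inj₂ (there m) , u , v

-- States realised in a transition system.

module Framing {n : ℕ} (Sy : System n) (t : Transitions.Trans Sy) where
  open System Sy
  open Transitions Sy public
  open Orbit t public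

  -- The darts at a vertex, labelled so that t pairs them by p1.
  record Frame : Set where
    field
      at      : Q → D
      at-vert : ∀ i → vert (at i) ≡ vert (at q0)
      at-inj  : ∀ {i j} → at i ≡ at j → i ≡ j
      at-onto : ∀ x → vert x ≡ vert (at q0) → ∃[ i ] at i ≡ x
      at-turn : ∀ i → turn t (at i) ≡ at (xr p1 i)
  open Frame public

  -- Two darts from different pairs and their partners are four distinct darts at a vertex, hence
  -- all of them.
  frame₂ : (x y : D) → vert y ≡ vert x → y ≢ x → y ≢ turn t x → Frame
  frame₂ x y vy y≢x y≢tx = record { at = a ; at-vert = av ; at-inj = λ {i} {j} → ai i j ; at-onto = ao ; at-turn = am }
    where
    a : Q → D
    a q0 = x
    a q1 = turn t x
    a q2 = y
    a q3 = turn t y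
    av : ∀ i → vert (a i) ≡ vert x
    av q0 = refl
    av q1 = turn-vert t x
    av q2 = vy
    av q3 = trans (turn-vert t y) vy
    am : ∀ i → turn t (a i) ≡ a (xr p1 i)
    am q0 = refl
    am q1 = turn-inv t x
    am q2 = refl
    am q3 = turn-inv t y
    tt-≢ : ∀ {u v} → u ≢ turn t v → turn t u ≢ v
    tt-≢ {u} h p = h (trans (sym (turn-inv t u)) (cong (turn t) p))
    ai : ∀ i j → a i ≡ a j → i ≡ j
    ai q0 q0 _ = refl
    ai q0 q1 p = ⊥-elim (turn-irr t x (sym p))
    ai q0 q2 p = ⊥-elim (y≢x (sym p))
    ai q0 q3 p = ⊥-elim (tt-≢ y≢tx (sym p))
    ai q1 q0 p = ⊥-elim (turn-irr t x p)
    ai q1 q1 _ = refl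
    ai q1 q2 p = ⊥-elim (y≢tx (sym p))
    ai q1 q3 p = ⊥-elim (y≢x (trans (sym (turn-inv t y)) (trans (cong (turn t) (sym p)) (turn-inv t x))))
    ai q2 q0 p = ⊥-elim (y≢x p)
    ai q2 q1 p = ⊥-elim (y≢tx p)
    ai q2 q2 _ = refl
    ai q2 q3 p = ⊥-elim (turn-irr t y (sym p))
    ai q3 q0 p = ⊥-elim (tt-≢ y≢tx p)
    ai q3 q1 p = ⊥-elim (y≢x (trans (sym (turn-inv t y)) (trans (cong (turn t) p) (turn-inv t x))))
    ai q3 q2 p = ⊥-elim (turn-irr t y p)
    ai q3 q3 _ = refl
    loc : ∀ z → vert z ≡ vert x → ∃[ i ] star (vert x) i ≡ z
    loc z e with star-onto z
    ... | i , q = i , trans (cong (λ v → star v i) (sym e)) q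
    ao : ∀ z → vert z ≡ vert x → ∃[ i ] a i ≡ z
    ao z vz with loc x refl | loc (turn t x) (turn-vert t x) | loc y vy | loc (turn t y) (av q3) | loc z vz
    ... | i , pi | j , pj | k , pk | l , pl | m , pm
      with coverQ i j k l m (ne pi pj (λ e → turn-irr t x (sym e))) (ne pk pi y≢x) (ne pk pj y≢tx)
             (ne pl pi (tt-≢ y≢tx)) (ne pl pj (λ e → case ai q3 q1 e of λ ())) (ne pl pk (turn-irr t y))
      where
      ne : ∀ {i j u v} → star (vert x) i ≡ u → star (vert x) j ≡ v → u ≢ v → i ≢ j
      ne p q h refl = h (trans (sym p) q)
    ... | inj₁ (inj₁ refl) = q0 , trans (sym pi) pm
    ... | inj₁ (inj₂ refl) = q1 , trans (sym pj) pm
    ... | inj₂ (inj₁ refl) = q2 , trans (sym pk) pm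
    ... | inj₂ (inj₂ refl) = q3 , trans (sym pl) pm

  abstract
    frame : (x : D) → Σ Frame λ F → at F q0 ≡ x
    frame x with star-onto x | star-onto (turn t x)
    ... | i , p | j , q with pickQ i j
    ... | k , k≢i , k≢j =
      frame₂ x (star (vert x) k) (star-vert _ _)
        (λ e → k≢i (star-inj _ (trans e (sym p))))
        (λ e → k≢j (star-inj _ (trans e (trans (sym q) (cong (λ v → star v j) (turn-vert t x)))))) , refl

  Env : Set
  Env = ℕ → Frame

  ⟦_⟧_ : Dart → Env → D
  ⟦ d ⟧ ι = at (ι (proj₁ d)) (proj₂ d)

  vtx : Env → ℕ → Fin n
  vtx ι a = vert (at (ι a) q0)

  vert⟦⟧ : ∀ ι d → vert (⟦ d ⟧ ι) ≡ vtx ι (proj₁ d)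
  vert⟦⟧ ι (a , i) = at-vert (ι a) i

  turn⟦⟧ : ∀ ι d → turn t (⟦ d ⟧ ι) ≡ ⟦ flip1 d ⟧ ι
  turn⟦⟧ ι (a , i) = at-turn (ι a) i

  -- The changed transitions on actual darts: at a listed vertex the dart is read in the frame of
  -- that vertex, and elsewhere the old turn is kept.
  ovr : Env → Changes → D → D
  ovr ι [] x = turn t x
  ovr ι ((a , p) ∷ f) x with vert x FP.≟ vtx ι a
  ... | yes e = at (ι a) (xr p (proj₁ (at-onto (ι a) x e)))
  ... | no _ = ovr ι f x

  ovr-hit : ∀ ι a p f i → ovr ι ((a , p) ∷ f) (at (ι a) i) ≡ at (ι a) (xr p i)
  ovr-hit ι a p f i with vert (at (ι a) i) FP.≟ vtx ι a
  ... | yes e = cong (λ j → at (ι a) (xr p j)) (at-inj (ι a) (proj₂ (at-onto (ι a) (at (ι a) i) e)))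
  ... | no ¬e = ⊥-elim (¬e (at-vert (ι a) i))

  ovr-miss : ∀ ι a p f {x} → vert x ≢ vtx ι a → ovr ι ((a , p) ∷ f) x ≡ ovr ι f x
  ovr-miss ι a p f {x} h with vert x FP.≟ vtx ι a
  ... | yes e = ⊥-elim (h e)
  ... | no _ = refl

  ovr-vert : ∀ ι f x → vert (ovr ι f x) ≡ vert x
  ovr-vert ι [] x = turn-vert t x
  ovr-vert ι ((a , p) ∷ f) x with vert x FP.≟ vtx ι a
  ... | yes e = trans (at-vert (ι a) _) (sym e)
  ... | no _ = ovr-vert ι f x

  ovr-inv : ∀ ι f x → ovr ι f (ovr ι f x) ≡ x
  ovr-inv ι [] x = turn-inv t x
  ovr-inv ι ((a , p) ∷ f) x = by (vert x FP.≟ vtx ι a)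
    where
    by : Dec (vert x ≡ vtx ι a) → ovr ι ((a , p) ∷ f) (ovr ι ((a , p) ∷ f) x) ≡ x
    by (no h) = trans (cong (ovr ι ((a , p) ∷ f)) (ovr-miss ι a p f h))
      (trans (ovr-miss ι a p f (h ∘ trans (sym (ovr-vert ι f x)))) (ovr-inv ι f x))
    by (yes e) with at-onto (ι a) x e
    ... | i , refl = trans (cong (ovr ι ((a , p) ∷ f)) (ovr-hit ι a p f i))
      (trans (ovr-hit ι a p f (xr p i)) (cong (at (ι a)) (xr-involutive p i)))

  ovr-irr : ∀ ι f x → ovr ι f x ≢ x
  ovr-irr ι [] x = turn-irr t x
  ovr-irr ι ((a , p) ∷ f) x = by (vert x FP.≟ vtx ι a)
    where
    by : Dec (vert x ≡ vtx ι a) → ovr ι ((a , p) ∷ f) x ≢ x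
    by (no h) q = ovr-irr ι f x (trans (sym (ovr-miss ι a p f h)) q)
    by (yes e) q with at-onto (ι a) x e
    ... | i , refl = xr-irreflexive p i (at-inj (ι a) (trans (sym (ovr-hit ι a p f i)) q))

  change : Env → Changes → Trans
  change ι f = record { turn = ovr ι f ; turn-vert = ovr-vert ι f ; turn-inv = ovr-inv ι f ; turn-irr = ovr-irr ι f }

  ovr-off : ∀ ι f {x} → (∀ {a} → a ∈ map proj₁ f → vert x ≢ vtx ι a) → ovr ι f x ≡ turn t x
  ovr-off ι [] h = refl
  ovr-off ι ((a , p) ∷ f) h = trans (ovr-miss ι a p f (h (here refl))) (ovr-off ι f (h ∘ there))

  ovr-diff : ∀ ι f {x} → ovr ι f x ≢ turn t x → ∃[ a ] (a ∈ map proj₁ f × vert x ≡ vtx ι a)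
  ovr-diff ι [] h = ⊥-elim (h refl)
  ovr-diff ι ((a , p) ∷ f) {x} h = by (vert x FP.≟ vtx ι a)
    where
    by : Dec (vert x ≡ vtx ι a) → ∃[ b ] (b ∈ a ∷ map proj₁ f × vert x ≡ vtx ι b)
    by (yes e) = a , here refl , e
    by (no ne) with ovr-diff ι f (h ∘ trans (ovr-miss ι a p f ne))
    ... | b , m , e = b , there m , e

module Realise {n : ℕ} (Sy : System n) (t : Transitions.Trans Sy) (eul : Transitions.Eul Sy t) where
  open System Sy
  open Framing Sy t public

  Glued : Env → ℕ → Dart × Dart → Set
  Glued ι k (d , e) = proj₁ d < k × proj₁ e < k × glue (⟦ d ⟧ ι) ≡ ⟦ e ⟧ ι

  Returns : Env → List ℕ → Dart × Dart → Set
  Returns ι S (d , e) = proj₁ d ∈ S × proj₁ e ∈ S × ∃[ l ] Path (map (vtx ι) S) l (⟦ d ⟧ ι) (⟦ e ⟧ ι)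

  Apart : Env → ℕ → Set
  Apart ι k = ∀ {a b} → a < k → b < k → vtx ι a ≡ vtx ι b → a ≡ b

  -- All that a state asserts holds for the vertices and darts that `ι` assigns to its names, and
  -- different names denote different vertices.
  record Real (ι : Env) (s : State) : Set where
    field
      apart   : Apart ι (k s)
      glued   : All (Glued ι (k s)) (g s)
      named   : All (_< k s) (S s)
      returns : All (Returns ι (S s)) (m s)
  open Real public

  Ext : ℕ → Env → Env → Set
  Ext k ι ι′ = ∀ {a} → a < k → ι a ≡ ι′ a

  ext-⟦⟧ : ∀ {k ι ι′} → Ext k ι ι′ → ∀ d → proj₁ d < k → ⟦ d ⟧ ι ≡ ⟦ d ⟧ ι′
  ext-⟦⟧ x (a , i) h = cong (λ F → at F i) (x h)

  ext-trans : ∀ {k k′ ι ι′ ι″} → Ext k ι ι′ → k ≤ k′ → Ext k′ ι′ ι″ → Ext k ι ι″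
  ext-trans x le y h = trans (x h) (y (≤-trans h le))

  same-dart : ∀ {ι k} → Apart ι k → ∀ {d e} → proj₁ d < k → proj₁ e < k → ⟦ d ⟧ ι ≡ ⟦ e ⟧ ι → d ≡ e
  same-dart {ι} ap {a , i} {b , j} h h′ p
    with ap h h′ (trans (sym (vert⟦⟧ ι (a , i))) (trans (cong vert p) (vert⟦⟧ ι (b , j))))
  ... | refl = cong (a ,_) (at-inj (ι a) p)

  at-name : ∀ ι a {x} → vert x ≡ vtx ι a → ∃[ i ] ⟦ (a , i) ⟧ ι ≡ x
  at-name ι a {x} p = at-onto (ι a) x p

  glue-sym : ∀ {d e} → glue d ≡ e → glue e ≡ d
  glue-sym {d} p = trans (cong glue (sym p)) (glue-inv d)

  module _ {ι : Env} {s : State} (R : Real ι s) where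
    glued-∈ : ∀ {d e} → (d , e) ∈ g s ⊎ (e , d) ∈ g s → Glued ι (k s) (d , e)
    glued-∈ (inj₁ m) = All.lookup (glued R) m
    glued-∈ (inj₂ m) with All.lookup (glued R) m
    ... | a , b , p = b , a , glue-sym p

    glued-look : ∀ {d e} → look (g s) d ≡ just e → Glued ι (k s) (d , e)
    glued-look {d} p = glued-∈ (look-sound (g s) d p)

    returns-look : ∀ {d e} → look (m s) d ≡ just e → Returns ι (S s) (d , e)
    returns-look {d} {e} p with look-sound (m s) d p
    ... | inj₁ x = All.lookup (returns R) x
    ... | inj₂ x with All.lookup (returns R) x
    ...   | a , b , l , q = b , a , path-sym (subst (_∈ map (vtx ι) (S s)) (sym (vert⟦⟧ ι e)) (∈-map⁺ (vtx ι) a)) q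

    -- The set `S′` is kept general, because strands are followed relative to S and also relative to
    -- S with a further vertex.
    module Strand {S′ : List ℕ} (S′< : All (_< k s) S′) where
      Sv : List (Fin n)
      Sv = map (vtx ι) S′

      ∈Sv : ∀ {d} → proj₁ d ∈ S′ → vert (⟦ d ⟧ ι) ∈ Sv
      ∈Sv {d} h = subst (_∈ Sv) (sym (vert⟦⟧ ι d)) (∈-map⁺ (vtx ι) h)

      Sv∈ : ∀ {d} → proj₁ d < k s → vert (⟦ d ⟧ ι) ∈ Sv → proj₁ d ∈ S′
      Sv∈ {d} d<k h with ∈-map⁻ (vtx ι) h
      ... | a , a∈ , p with apart R d<k (All.lookup S′< a∈) (trans (sym (vert⟦⟧ ι d)) p)
      ... | refl = a∈

      -- The circuit arriving at y next meets `S′` at p, possibly at once.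
      Ends : Dart → Dart → Set
      Ends y p = (proj₁ y ∈ S′ × p ≡ y) ⊎ (proj₁ y ∉ S′ × ∃[ l ] Path Sv l (⟦ flip1 y ⟧ ι) (⟦ p ⟧ ι))

      arrive : ∀ {x y p} → proj₁ y < k s → glue x ≡ ⟦ y ⟧ ι → Ends y p → ∃[ l ] Path Sv l x (⟦ p ⟧ ι)
      arrive {x} {y} y<k q (inj₁ (y∈ , refl)) =
        0 , subst (Path Sv 0 x) q (stop (subst (λ z → vert z ∈ Sv) (sym q) (∈Sv y∈)))
      arrive {x} {y} y<k q (inj₂ (y∉ , l , a)) =
        suc l , go (y∉ ∘ Sv∈ {y} y<k ∘ subst (λ z → vert z ∈ Sv) q)
                   (subst (λ z → Path Sv l z _) (sym (trans (cong (turn t) q) (turn⟦⟧ ι y))) a)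

      strand-inside : ∀ n y {p} → proj₁ y < k s → strand n (g s) S′ y ≡ inside p → Ends y p
      strand-inside (suc n) y y<k e with mem (proj₁ y) S′ in u
      strand-inside (suc n) y y<k refl | true = inj₁ (mem-sound _ _ u , refl)
      strand-inside (suc n) y y<k e | false with look (g s) (flip1 y) in v
      ... | just z with glued-look v
      ...   | _ , z<k , q = inj₂ ((λ h → true≢false (mem-complete h) u) ,
                arrive z<k q (strand-inside n z z<k e))

      -- A path to `S′` from the start of the strand runs through its open end z. The bound on the
      -- length is what later rules out a strand that closes up.
      strand-open : ∀ n y {z} → proj₁ y < k s → strand n (g s) S′ y ≡ open′ z →
        proj₁ y ∉ S′ × (∀ {l e} → Path Sv l (⟦ flip1 y ⟧ ι) e → ∃[ l′ ] (l′ ≤ l × Path Sv l′ (⟦ z ⟧ ι) e))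
      strand-open (suc n) y y<k e with mem (proj₁ y) S′ in u
      strand-open (suc n) y y<k () | true
      strand-open (suc n) y y<k e | false with look (g s) (flip1 y) in v
      strand-open (suc n) y y<k refl | false | nothing = (λ h → true≢false (mem-complete h) u) , λ {l} a → l , ≤-refl , a
      strand-open (suc n) y y<k e | false | just w with glued-look v
      ...   | _ , w<k , q with strand-open n w w<k e
      ...     | w∉ , h = (λ h → true≢false (mem-complete h) u) , λ where
                  (stop x) → ⊥-elim (w∉ (Sv∈ {w} w<k (subst (λ z → vert z ∈ Sv) q x)))
                  (go x a) → case h (subst (λ z → Path Sv _ z _) (trans (cong (turn t) q) (turn⟦⟧ ι w)) a) of
                    λ { (l′ , le , b) → l′ , m≤n⇒m≤1+n le , b }

      strand-name : ∀ n y {b} → proj₁ y < k s → strand n (g s) S′ y ≡ inside b → proj₁ b < k s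
      strand-name (suc n) y y<k e with mem (proj₁ y) S′
      strand-name (suc n) y y<k refl | true = y<k
      strand-name (suc n) y y<k e | false with look (g s) (flip1 y) in v
      ... | just z = strand-name n z (proj₁ (proj₂ (glued-look v))) e

    open Strand (named R)

    -- The filter never discards the truth: its first tests express that the graph is simple and
    -- each dart has one reverse, and the last that the circuit is single.
    okGlue-complete : ∀ {x y} → proj₁ x < k s → proj₁ y < k s → glue (⟦ x ⟧ ι) ≡ ⟦ y ⟧ ι →
                      look (g s) x ≡ nothing → okGlue s x y ≡ true
    okGlue-complete {x} {y} x<k y<k p none =
      ∧-intro (cong not (≡false names)) (∧-intro (fresh-y (look (g s) y) refl)
        (∧-intro (cong not (≡false unlinked)) (compat _ _ refl refl)))
      where
      names : (proj₁ x ≡ᵇ proj₁ y) ≡ true → ⊥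
      names e = glue-vert (⟦ x ⟧ ι) (trans (cong vert p) (trans (vert⟦⟧ ι y)
        (trans (cong (vtx ι) (sym (≡ᵇ-sound (proj₁ x) (proj₁ y) e))) (sym (vert⟦⟧ ι x)))))
      fresh-y : ∀ w → look (g s) y ≡ w → is-nothing w ≡ true
      fresh-y nothing e = refl
      fresh-y (just x′) e with glued-look e
      ... | _ , x′<k , q with same-dart {ι} (apart R) x′<k x<k (trans (sym q) (glue-sym p))
      ... | refl = ⊥-elim (look-none (g s) x none (case look-sound (g s) y e of λ { (inj₁ u) → inj₂ u ; (inj₂ u) → inj₁ u }))
      unlinked : adjacent (g s) (proj₁ x) (proj₁ y) ≡ true → ⊥
      unlinked e with adjacent-sound (g s) _ _ e
      ... | x′ , y′ , m , u , v with glued-∈ m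
      ... | x′<k , y′<k , q
        with same-dart {ι} (apart R) x′<k x<k
               (glue-multi (trans (vert⟦⟧ ι x′) (trans (cong (vtx ι) u) (sym (vert⟦⟧ ι x))))
                 (trans (cong vert q) (trans (vert⟦⟧ ι y′) (trans (cong (vtx ι) v) (sym (trans (cong vert p) (vert⟦⟧ ι y)))))))
      ... | refl = look-none (g s) x none m
      F : ℕ
      F = suc (k s)
      strandOf : Dart → End
      strandOf = strand F (g s) (S s)
      -- If both strands end in S, the edge joins them to one excursion, and excursions are unique.
      compat : ∀ u v → strandOf x ≡ u → strandOf y ≡ v → compatible s x u v ≡ true
      compat (inside a) (inside b) ea eb with look (m s) a in la
      ... | nothing = refl
      ... | just c with returns-look la
      ...   | a∈ , c∈ , l , q = conclude (same-dart {ι} (apart R) (All.lookup (named R) c∈) (strand-name F y y<k eb) c≡b)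
        where
        from-x : ∃[ l ] Path Sv l (⟦ x ⟧ ι) (⟦ b ⟧ ι)
        from-x = arrive y<k p (strand-inside F y y<k eb)
        joined : Ends x a → ∃[ l ] Path Sv l (⟦ a ⟧ ι) (⟦ b ⟧ ι)
        joined (inj₁ (_ , refl)) = from-x
        joined (inj₂ (x∉ , _ , w)) = path-rev w (x∉ ∘ Sv∈ {flip1 x} x<k)
          (subst (λ z → Path Sv (proj₁ from-x) z (⟦ b ⟧ ι)) (sym (trans (turn⟦⟧ ι (flip1 x)) (cong (λ i → at (ι (proj₁ x)) i) (xr-involutive p1 (proj₂ x))))) (proj₂ from-x))
        c≡b : ⟦ c ⟧ ι ≡ ⟦ b ⟧ ι
        c≡b = proj₂ (path-det q (proj₂ (joined (strand-inside F x x<k ea))))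
        conclude : c ≡ b → eqD c b ≡ true
        conclude refl = eqD-refl c
      compat (open′ a) (open′ z) ea eb = nonempty (S s) (λ b m → cong not (≡false (closed b m)))
        where
        nonempty : ∀ L {c} → (∀ b → b ∈ L → c ≡ true) → null L ∨ c ≡ true
        nonempty [] h = refl
        nonempty (b ∷ L) h = h b (here refl)
        closed : ∀ b → b ∈ S s → eqD z x ≡ true → ⊥
        closed b b∈ e with eqD-sound z x e | strand-open F y y<k eb
        ... | refl | y∉ , h with path-exists eul (∈Sv {b , q0} b∈) (⟦ x ⟧ ι)
        ...   | _ , _ , a = back a
          where
          -- The trail from x leads off S back to x, so the excursion from x would be as long as a
          -- proper part of itself.
          back : ∀ {l e} → Path Sv l (⟦ x ⟧ ι) e → ⊥
          back (stop u) = y∉ (Sv∈ {y} y<k (subst (λ z → vert z ∈ Sv) p u))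
          back (go u a) with h (subst (λ z → Path Sv _ z _) (trans (cong (turn t) p) (turn⟦⟧ ι y)) a)
          ... | l′ , le , b′ = <-irrefl (sym (proj₁ (path-det (go u a) b′))) (s≤s le)
      compat (inside _) (open′ _) _ _ = refl
      compat (inside _) unknown _ _ = refl
      compat (open′ _) (inside _) _ _ = refl
      compat (open′ _) unknown _ _ = refl
      compat unknown (inside _) _ _ = refl
      compat unknown (open′ _) _ _ = refl
      compat unknown unknown _ _ = refl

module Resolving {n : ℕ} (Sy : System n) (t : Transitions.Trans Sy) (eul : Transitions.Eul Sy t) where
  open System Sy
  open Realise Sy t eul public

  -- The list of cases contains one that occurs in the given system.
  Live : List State → Set
  Live xs = ∃[ s ] ∃[ ι ] (s ∈ xs × Real ι s)

  live-concat : ∀ {A : Set} (f : A → List State) {xs x} → x ∈ xs → Live (f x) → Live (gather f xs)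
  live-concat f x∈ (s , ι , m , R) = s , ι , ∈-concat x∈ m , R

  upd : ℕ → Frame → Env → Env
  upd k F ι a with a ≟ k
  ... | yes _ = F
  ... | no _ = ι a

  upd-new : ∀ k F ι → upd k F ι k ≡ F
  upd-new k F ι with k ≟ k
  ... | yes _ = refl
  ... | no ¬p = ⊥-elim (¬p refl)

  upd-old : ∀ k F ι → Ext k ι (upd k F ι)
  upd-old k F ι {a} a<k with a ≟ k
  ... | yes refl = ⊥-elim (<-irrefl refl a<k)
  ... | no _ = refl

  vtx-ext : ∀ {k ι ι′} → Ext k ι ι′ → ∀ {S} → All (_< k) S → map (vtx ι) S ≡ map (vtx ι′) S
  vtx-ext x [] = refl
  vtx-ext x (p ∷ ps) = cong₂ _∷_ (cong (λ F → vert (at F q0)) (x p)) (vtx-ext x ps)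

  glued-ext : ∀ {k k′ ι ι′} → Ext k ι ι′ → k ≤ k′ → ∀ {p} → Glued ι k p → Glued ι′ k′ p
  glued-ext x le {d , e} (d<k , e<k , q) =
    ≤-trans d<k le , ≤-trans e<k le , trans (cong glue (sym (ext-⟦⟧ x d d<k))) (trans q (ext-⟦⟧ x e e<k))

  returns-ext : ∀ {k ι ι′ S} → Ext k ι ι′ → All (_< k) S → ∀ {p} → Returns ι S p → Returns ι′ S p
  returns-ext {ι = ι} {ι′} x S< {d , e} (d∈ , e∈ , l , a) = d∈ , e∈ , l ,
    subst₂ (λ V y → Path V l (⟦ d ⟧ ι′) y) (vtx-ext x S<) (ext-⟦⟧ x e (All.lookup S< e∈))
      (subst (λ y → Path _ l y (⟦ e ⟧ ι)) (ext-⟦⟧ x d (All.lookup S< d∈)) a)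

  real-join : ∀ {ι s x y} → Real ι s → Glued ι (k s) (x , y) → Real ι (join s x y)
  real-join R h = record { apart = apart R ; glued = h ∷ glued R ; named = named R ; returns = returns R }

  real-fresh : ∀ {ι s d} (R : Real ι s) → proj₁ d < k s →
    (∀ {a} → a < k s → vert (glue (⟦ d ⟧ ι)) ≢ vtx ι a) →
    let F = frame (glue (⟦ d ⟧ ι)) in Real (upd (k s) (proj₁ F) ι) (fresh s d)
  real-fresh {ι} {s} {d} R d<k new = record
    { apart = ap
    ; glued = (m<n⇒m<1+n d<k , n<1+n (k s) ,
               trans (cong glue (sym (ext-⟦⟧ xt d d<k))) (trans (sym (proj₂ F)) (cong (λ G → at G q0) (sym (upd-new (k s) (proj₁ F) ι)))))
              ∷ All.map (glued-ext xt (n≤1+n _)) (glued R)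
    ; named = All.map m<n⇒m<1+n (named R)
    ; returns = All.map (returns-ext xt (named R)) (returns R)
    }
    where
    F = frame (glue (⟦ d ⟧ ι))
    xt : Ext (k s) ι (upd (k s) (proj₁ F) ι)
    xt = upd-old (k s) (proj₁ F) ι
    ι′ = upd (k s) (proj₁ F) ι
    top : ∀ {a} → a < suc (k s) → a ≢ k s → a < k s
    top h ne = ≤∧≢⇒< (≤-pred h) ne
    old : ∀ {a} → a < k s → vtx ι a ≡ vtx ι′ a
    old h = cong (λ G → vert (at G q0)) (xt h)
    new′ : vtx ι′ (k s) ≡ vert (glue (⟦ d ⟧ ι))
    new′ = trans (cong (λ G → vert (at G q0)) (upd-new (k s) (proj₁ F) ι)) (cong vert (proj₂ F))
    ap : Apart ι′ (suc (k s))
    ap {a} {b} a< b< p = by (a ≟ k s) (b ≟ k s)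
      where
      by : Dec (a ≡ k s) → Dec (b ≡ k s) → a ≡ b
      by (yes refl) (yes refl) = refl
      by (yes refl) (no b≢) = ⊥-elim (new (top b< b≢) (trans (sym new′) (trans p (sym (old (top b< b≢))))))
      by (no a≢) (yes refl) = ⊥-elim (new (top a< a≢) (trans (sym new′) (trans (sym p) (sym (old (top a< a≢))))))
      by (no a≢) (no b≢) = apart R (top a< a≢) (top b< b≢) (trans (old (top a< a≢)) (trans p (sym (old (top b< b≢)))))

  record Resolved (ι : Env) (s : State) (d : Dart) (xs : List (State × Dart)) : Set where
    constructor resolved
    field
      {s′} : State
      {ι′} : Env
      {e}  : Dart
      mem′ : (s′ , e) ∈ xs
      real : Real ι′ s′
      ext  : Ext (k s) ι ι′
      le   : k s ≤ k s′
      e<   : proj₁ e < k s′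
      meet : glue (⟦ d ⟧ ι) ≡ ⟦ e ⟧ ι′

  -- The actual other end is known, or lies at a named vertex and passes `okGlue`, or lies at a
  -- vertex not yet named, which then receives a name.
  resolve-sound : ∀ {ι s d} → Real ι s → proj₁ d < k s → Resolved ι s d (resolve s d)
  resolve-sound {ι} {s} {d} R d<k = by (look (g s) d) refl
    where
    by : ∀ w → look (g s) d ≡ w → Resolved ι s d (resolve′ s d w)
    by (just e) q with glued-look R q
    ... | _ , e<k , p = resolved (here refl) R (λ _ → refl) ≤-refl e<k p
    by nothing q with anyUpTo? (λ a → vert (glue (⟦ d ⟧ ι)) FP.≟ vtx ι a) (k s)
    ... | yes (a , a<k , p) with at-name ι a p
    ...   | i , r = resolved
              (∈-++⁺ˡ (∈-map⁺ (λ e → join s d e , e) (keep-∈ (okGlue s d) (∈-allDarts (a , i) a<k)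
                (okGlue-complete R d<k a<k (sym r) q))))
              (real-join R (d<k , a<k , sym r)) (λ _ → refl) ≤-refl a<k (sym r)
    by nothing q | no ¬p = resolved
      (∈-++⁺ʳ _ (here refl)) (real-fresh R d<k (λ {a} a<k e → ¬p (a , a<k , e)))
      (upd-old (k s) (proj₁ F) ι) (n≤1+n _) (n<1+n _)
      (trans (sym (proj₂ F)) (cong (λ G → at G q0) (sym (upd-new (k s) (proj₁ F) ι))))
      where
      F = frame (glue (⟦ d ⟧ ι))

  resolveAt-sound : ∀ {ι s d b} → Real ι s → proj₁ d < k s → b < k s → vert (glue (⟦ d ⟧ ι)) ≡ vtx ι b →
                    Live (resolveAt s d b)
  resolveAt-sound {ι} {s} {d} {b} R d<k b<k p = by (look (g s) d) refl
    where
    by : ∀ w → look (g s) d ≡ w → Live (resolveAt′ s d b w)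
    by (just e) q with glued-look R q
    ... | _ , e<k , r with apart R e<k b<k (trans (sym (vert⟦⟧ ι e)) (trans (cong vert (sym r)) p))
    ... | refl rewrite ≡ᵇ-refl (proj₁ e) = s , ι , here refl , R
    by nothing q with at-name ι b p
    ... | i , r = join s d (b , i) , ι ,
      ∈-map⁺ (join s d) (keep-∈ (okGlue s d) (∈-darts b i) (okGlue-complete R d<k b<k (sym r) q)) ,
      real-join R (d<k , b<k , sym r)

  -- t′ is the system obtained from t by the changes f, as far as the names below k₀ tell.
  module Turned (t′ : Trans) (f : Changes) where
    module O = Orbit t′
    nx′ : D → D
    nx′ = O.nx

    -- The statement speaks of all extensions of the naming, because further vertices get names
    -- while a trail is being followed.
    Tracks : Env → State → Set
    Tracks ι s = ∀ {ι′ s′} → Ext (k s) ι ι′ → k s ≤ k s′ → Real ι′ s′ →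
                 ∀ d → proj₁ d < k s′ → turn t′ (⟦ d ⟧ ι′) ≡ ⟦ mate f d ⟧ ι′

    tracks-mono : ∀ {ι} s {ι′} s′ → Ext (k s) ι ι′ → k s ≤ k s′ → Tracks ι s → Tracks ι′ s′
    tracks-mono s s′ x le h y le′ = h (ext-trans x le y) (≤-trans le le′)

    track : ∀ {ι s} → Real ι s → Tracks ι s → ∀ d → proj₁ d < k s → turn t′ (⟦ d ⟧ ι) ≡ ⟦ mate f d ⟧ ι
    track R h = h (λ _ → refl) ≤-refl R

    -- The actual trail is followed edge by edge; at each edge the list of possibilities contains
    -- the one that occurs.
    close3-sound : ∀ {ι s d₀} → Real ι s → Tracks ι s → proj₁ d₀ < k s →
      vert (glue (nx′ (nx′ (⟦ d₀ ⟧ ι)))) ≡ vert (⟦ d₀ ⟧ ι) → Live (close3 f d₀ s)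
    close3-sound {ι} {s} {d₀} R T d<k ret with resolve-sound R d<k
    ... | resolved {s₁} {ι₁} {y₁} m₁ R₁ x₁ le₁ y₁< g₁
      with resolve-sound {d = mate f y₁} R₁ y₁<
    ... | resolved {s₂} {ι₂} {y₂} m₂ R₂ x₂ le₂ y₂< g₂ =
      live-concat (arrive₂ f d₀) m₁ (live-concat (arrive₁ f d₀) m₂ (resolveAt-sound {d = mate f y₂} R₂ y₂< (≤-trans d<k (≤-trans le₁ le₂))
        (trans (cong (vert ∘ glue) (sym n₂)) (trans ret
          (trans (vert⟦⟧ ι d₀) (cong (λ F → vert (at F q0)) (trans (x₁ d<k) (x₂ (≤-trans d<k le₁)))))))))
      where
      T₁ = tracks-mono s s₁ x₁ le₁ T
      T₂ = tracks-mono s₁ s₂ x₂ le₂ T₁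
      n₁ : nx′ (⟦ d₀ ⟧ ι) ≡ ⟦ mate f y₁ ⟧ ι₁
      n₁ = trans (cong (turn t′) g₁) (track R₁ T₁ y₁ y₁<)
      n₂ : nx′ (nx′ (⟦ d₀ ⟧ ι)) ≡ ⟦ mate f y₂ ⟧ ι₂
      n₂ = trans (cong nx′ n₁) (trans (cong (turn t′) g₂) (track R₂ T₂ y₂ y₂<))

    close4-sound : ∀ {ι s d₀} → Real ι s → Tracks ι s → proj₁ d₀ < k s →
      vert (glue (nx′ (nx′ (nx′ (⟦ d₀ ⟧ ι))))) ≡ vert (⟦ d₀ ⟧ ι) → Live (close4 f d₀ s)
    close4-sound {ι} {s} {d₀} R T d<k ret with resolve-sound R d<k
    ... | resolved {s₁} {ι₁} {y₁} m₁ R₁ x₁ le₁ y₁< g₁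
      with resolve-sound {d = mate f y₁} R₁ y₁<
    ... | resolved {s₂} {ι₂} {y₂} m₂ R₂ x₂ le₂ y₂< g₂
      with resolve-sound {d = mate f y₂} R₂ y₂<
    ... | resolved {s₃} {ι₃} {y₃} m₃ R₃ x₃ le₃ y₃< g₃ =
      live-concat (arrive₃ f d₀) m₁ (live-concat (arrive₂ f d₀) m₂ (live-concat (arrive₁ f d₀) m₃ (resolveAt-sound {d = mate f y₃} R₃ y₃< (≤-trans d<k (≤-trans le₁ (≤-trans le₂ le₃)))
        (trans (cong (vert ∘ glue) (sym n₃)) (trans ret
          (trans (vert⟦⟧ ι d₀) (cong (λ F → vert (at F q0))
            (trans (x₁ d<k) (trans (x₂ (≤-trans d<k le₁)) (x₃ (≤-trans d<k (≤-trans le₁ le₂))))))))))))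
      where
      T₁ = tracks-mono s s₁ x₁ le₁ T
      T₂ = tracks-mono s₁ s₂ x₂ le₂ T₁
      T₃ = tracks-mono s₂ s₃ x₃ le₃ T₂
      n₁ : nx′ (⟦ d₀ ⟧ ι) ≡ ⟦ mate f y₁ ⟧ ι₁
      n₁ = trans (cong (turn t′) g₁) (track R₁ T₁ y₁ y₁<)
      n₂ : nx′ (nx′ (⟦ d₀ ⟧ ι)) ≡ ⟦ mate f y₂ ⟧ ι₂
      n₂ = trans (cong nx′ n₁) (trans (cong (turn t′) g₂) (track R₂ T₂ y₂ y₂<))
      n₃ : nx′ (nx′ (nx′ (⟦ d₀ ⟧ ι))) ≡ ⟦ mate f y₃ ⟧ ι₃
      n₃ = trans (cong nx′ n₂) (trans (cong (turn t′) g₃) (track R₃ T₃ y₃ y₃<))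

    -- Both closing procedures at once: Ret d says that the trail starting with d returns in time.
    module Via (close : Dart → State → List State) (Ret : D → Set)
      (close-sound : ∀ {ι s d₀} → Real ι s → Tracks ι s → proj₁ d₀ < k s → Ret (⟦ d₀ ⟧ ι) → Live (close d₀ s))
      (A : List Dart) where

      via₁-sound : ∀ {ι s y d} → Real ι s → Tracks ι s → All (λ a → proj₁ a < k s) A → proj₁ y < k s →
        glue d ≡ ⟦ y ⟧ ι → Ret d → d ∉ map (λ a → ⟦ a ⟧ ι) A → Live (via₁ close A s y)
      via₁-sound {ι} {s} {y} {d} R T A< y<k p ret d∉ with resolve-sound R y<k
      ... | resolved {s₁} {ι₁} {e} m R₁ x le e< q = live-concat (closeNew close A) m (pass (memD e A) refl)
        where
        d≡e : d ≡ ⟦ e ⟧ ι₁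
        d≡e = trans (sym (glue-inv d)) (trans (cong glue p) q)
        pass : ∀ b → memD e A ≡ b → Live (unless b (close e s₁))
        pass true u = ⊥-elim (d∉ (subst (_∈ map (λ a → ⟦ a ⟧ ι) A)
          (trans (ext-⟦⟧ x e (All.lookup A< e∈)) (sym d≡e)) (∈-map⁺ (λ a → ⟦ a ⟧ ι) e∈)))
          where e∈ = memD-sound e A u
        pass false u = close-sound R₁ (tracks-mono s s₁ x le T) e< (subst Ret d≡e ret)

-- Soundness of switching transitions.

pairing-changed : ∀ f {a} → a ∈ map proj₁ f → every (λ x → not (isP1 (proj₂ x))) f ≡ true → pairing f a ≢ p1
pairing-changed ((b , p) ∷ f) {a} m h e with ∧-true {not (isP1 p)} h | b ≡ᵇ a in u
pairing-changed ((b , p1) ∷ f) m h e | () , _ | true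
pairing-changed ((b , p2) ∷ f) m h () | _ | true
pairing-changed ((b , p3) ∷ f) m h () | _ | true
pairing-changed ((b , p) ∷ f) {a} (here refl) h e | _ | false = true≢false (≡ᵇ-refl a) u
pairing-changed ((b , p) ∷ f) {a} (there m) h e | _ , h′ | false = pairing-changed f m h′ e

xr-pairing : ∀ p i → xr p i ≡ xr p1 i → p ≡ p1
xr-pairing p1 i e = refl
xr-pairing p2 q0 ()
xr-pairing p2 q1 ()
xr-pairing p2 q2 ()
xr-pairing p2 q3 ()
xr-pairing p3 q0 ()
xr-pairing p3 q1 ()
xr-pairing p3 q2 ()
xr-pairing p3 q3 ()

-- One of the two orientations of a changed transition starts at q0 or q1.
low : ∀ p i → p ≢ p1 → (i ≡ q0 ⊎ i ≡ q1) ⊎ (xr p i ≡ q0 ⊎ xr p i ≡ q1)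
low p1 i h = ⊥-elim (h refl)
low p q0 h = inj₁ (inj₁ refl)
low p q1 h = inj₁ (inj₂ refl)
low p2 q2 h = inj₂ (inj₁ refl)
low p2 q3 h = inj₂ (inj₂ refl)
low p3 q2 h = inj₂ (inj₂ refl)
low p3 q3 h = inj₂ (inj₁ refl)

>>=-just : ∀ {A B : Set} (x : Maybe A) {f : A → Maybe B} {z} → (x >>= f) ≡ just z →
           ∃[ y ] (x ≡ just y × f y ≡ just z)
>>=-just (just y) p = y , refl , p

changed-any : ∀ f ys → changed f ys ≡ true → ∃[ y ] (y ∈ ys × proj₁ y ∈ map proj₁ f)
changed-any f (y ∷ ys) h with ∨-true {mem (proj₁ y) (map proj₁ f)} h
... | inj₁ u = y , here refl , mem-sound _ _ u
... | inj₂ u with changed-any f ys u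
...   | z , m , q = z , there m , q

⌊⌋-true : ∀ {A : Set} (d : Dec A) → ⌊ d ⌋ ≡ true → A
⌊⌋-true (yes a) _ = a

⌊⌋-yes : ∀ {A : Set} (d : Dec A) → A → ⌊ d ⌋ ≡ true
⌊⌋-yes (yes _) _ = refl
⌊⌋-yes (no ¬a) a = ⊥-elim (¬a a)

⌊⌋-no : ∀ {A : Set} (d : Dec A) → ¬ A → ⌊ d ⌋ ≡ false
⌊⌋-no (yes a) ¬a = ⊥-elim (¬a a)
⌊⌋-no (no _) _ = refl

∧-false : ∀ a {b} → a ∧ b ≡ false → a ≡ false ⊎ (a ≡ true × b ≡ false)
∧-false false _ = inj₁ refl
∧-false true p = inj₂ (refl , p)

distinctD-sound : ∀ ds → distinctD ds ≡ true → Distinct ds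
distinctD-sound [] _ = []
distinctD-sound (d ∷ ds) h with ∧-true {not (memD d ds)} h
... | u , v = (λ m → true≢false (memD-complete m) (not-true u)) ∷ distinctD-sound ds v

module Bad {n : ℕ} (Sy : System n) where
  open System Sy
  open Transitions Sy

  -- `Orbit.it t 2 d` is the third dart of the trail that starts with d, and its reverse sits at the
  -- vertex reached after three edges; likewise for four.
  bad3 bad4 : Trans → D → Bool
  bad3 t d = ⌊ vert (glue (Orbit.it t 2 d)) FP.≟ vert d ⌋
  bad4 t d = ⌊ vert (glue (Orbit.it t 3 d)) FP.≟ vert d ⌋

  count3 count4 : Trans → ℕ
  count3 t = sum (bit ∘ bad3 t)
  count4 t = sum (bit ∘ bad4 t)

-- The interpretation `E` of names is a parameter, because known walks are also evaluated in F₆,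
-- where the labels are not adapted to the transitions.
module Walking {n : ℕ} (Sy : System n) (s : State) (E : Dart → Fin (System.N Sy)) (ok : Dart → Set)
  (look-glue : ∀ {d e} → look (g s) d ≡ just e → ok e × System.glue Sy (E d) ≡ E e)
  (same-vert : ∀ d e → proj₁ d ≡ proj₁ e → System.vert Sy (E d) ≡ System.vert Sy (E e))
  (t″ : Transitions.Trans Sy) (f′ : Changes)
  (tr : ∀ d → ok d → Transitions.turn t″ (E d) ≡ E (mate f′ d)) where
  open System Sy
  open Transitions Sy

  module O″ = Orbit t″

  Steps3 : D → List Dart → Dart → Set
  Steps3 x ys y = ∃[ y₁ ] ∃[ y₂ ] (ys ≡ y₁ ∷ y₂ ∷ [] × ok y₁ × ok y₂ × ok y ×
    glue x ≡ E y₁ × glue (O″.nx x) ≡ E y₂ × glue (O″.nx (O″.nx x)) ≡ E y)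

  Steps4 : D → List Dart → Dart → Set
  Steps4 x ys y = ∃[ y₁ ] ∃[ y₂ ] ∃[ y₃ ] (ys ≡ y₁ ∷ y₂ ∷ y₃ ∷ [] × ok y₁ × ok y₂ × ok y₃ ×
    ok y × glue x ≡ E y₁ × glue (O″.nx x) ≡ E y₂ × glue (O″.nx (O″.nx x)) ≡ E y₃ ×
    glue (O″.nx (O″.nx (O″.nx x))) ≡ E y)

  returning-sound : ∀ {a zs z ys y} → returning a zs z ≡ just (ys , y) → zs ≡ ys × z ≡ y × proj₁ y ≡ a
  returning-sound {a} {zs} {z} e with proj₁ z ≡ᵇ a in u
  returning-sound {a} {zs} {z} refl | true = refl , refl , ≡ᵇ-sound _ a u

  walk3-sound : ∀ {d ys y} → walk3 s f′ d ≡ just (ys , y) → Steps3 (E d) ys y × vert (E y) ≡ vert (E d)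
  walk3-sound {d} e with >>=-just (look (g s) d) e
  ... | y₁ , l₁ , e₁ with >>=-just (look (g s) (mate f′ y₁)) e₁
  ... | y₂ , l₂ , e₂ with >>=-just (look (g s) (mate f′ y₂)) e₂
  ... | y₃ , l₃ , e₃ with returning-sound {proj₁ d} e₃ | look-glue l₁ | look-glue l₂ | look-glue l₃
  ... | refl , refl , q | k₁ , g₁ | k₂ , g₂ | k₃ , g₃ =
    (y₁ , y₂ , refl , k₁ , k₂ , k₃ , g₁ , h₂ , trans (cong glue (trans (cong (turn t″) h₂) (tr y₂ k₂))) g₃) ,
    same-vert y₃ d q
    where
    h₂ = trans (cong glue (trans (cong (turn t″) g₁) (tr y₁ k₁))) g₂

  walk4-sound : ∀ {d ys y} → walk4 s f′ d ≡ just (ys , y) → Steps4 (E d) ys y × vert (E y) ≡ vert (E d)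
  walk4-sound {d} e with >>=-just (look (g s) d) e
  ... | y₁ , l₁ , e₁ with >>=-just (look (g s) (mate f′ y₁)) e₁
  ... | y₂ , l₂ , e₂ with >>=-just (look (g s) (mate f′ y₂)) e₂
  ... | y₃ , l₃ , e₃ with >>=-just (look (g s) (mate f′ y₃)) e₃
  ... | y₄ , l₄ , e₄ with returning-sound {proj₁ d} e₄ | look-glue l₁ | look-glue l₂ | look-glue l₃ | look-glue l₄
  ... | refl , refl , q | k₁ , g₁ | k₂ , g₂ | k₃ , g₃ | k₄ , g₄ =
    (y₁ , y₂ , y₃ , refl , k₁ , k₂ , k₃ , k₄ , g₁ , h₂ , h₃ , trans (cong glue (trans (cong (turn t″) h₃) (tr y₃ k₃))) g₄) ,
    same-vert y₄ d q
    where
    h₂ = trans (cong glue (trans (cong (turn t″) g₁) (tr y₁ k₁))) g₂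
    h₃ = trans (cong glue (trans (cong (turn t″) h₂) (tr y₂ k₂))) g₃

module Switching {n : ℕ} (Sy : System n) (t : Transitions.Trans Sy) (eul : Transitions.Eul Sy t) where
  open System Sy
  open Resolving Sy t eul public
  open Bad Sy public

  module Switch {ι : Env} {s : State} (R : Real ι s) (f : Changes) (ok : okChange s f ≡ true) where
    f-S : ∀ {a} → a ∈ map proj₁ f → a ∈ S s
    f-S m with ∈-map⁻ proj₁ m
    ... | x , x∈ , refl = mem-sound _ _ (proj₁ (∧-true (every-sound _ ok x∈)))

    f-k : ∀ {a} → a ∈ map proj₁ f → a < k s
    f-k m = All.lookup (named R) (f-S m)

    f-p1 : every (λ x → not (isP1 (proj₂ x))) f ≡ true
    f-p1 = lem f ok
      where
      lem : ∀ f → okChange s f ≡ true → every (λ x → not (isP1 (proj₂ x))) f ≡ true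
      lem [] h = refl
      lem (x ∷ f) h with ∧-true h
      ... | u , v = ∧-intro (proj₂ (∧-true u)) (lem f v)

    t′ : Trans
    t′ = change ι f

    open Turned t′ f

    -- Vertices named later differ from the changed ones, so the change does not touch them.
    tracks : Tracks ι s
    tracks {ι′} {s′} x le R′ d d<k = lem f f-k
      where
      lem : ∀ f → (∀ {a} → a ∈ map proj₁ f → a < k s) → ovr ι f (⟦ d ⟧ ι′) ≡ ⟦ mate f d ⟧ ι′
      lem [] h = turn⟦⟧ ι′ d
      lem ((a , p) ∷ f) h with a ≡ᵇ proj₁ d in u
      ... | true with ≡ᵇ-sound a (proj₁ d) u
      ...   | refl = trans (cong (λ F → ovr ι ((a , p) ∷ f) (at F (proj₂ d))) (sym (x (h (here refl)))))
                       (trans (ovr-hit ι a p f (proj₂ d)) (cong (λ F → at F (xr p (proj₂ d))) (x (h (here refl)))))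
      lem ((a , p) ∷ f) h | false = trans (ovr-miss ι a p f ne) (lem f (h ∘ there))
        where
        ne : vert (⟦ d ⟧ ι′) ≢ vtx ι a
        ne q = true≢false (trans (cong (a ≡ᵇ_) (sym a≡d)) (≡ᵇ-refl a)) u
          where
          a≡d : a ≡ proj₁ d
          a≡d = apart R′ (≤-trans (h (here refl)) le) d<k
            (trans (cong (λ F → vert (at F q0)) (sym (x (h (here refl))))) (trans (sym q) (vert⟦⟧ ι′ d)))

    here-tracks : ∀ d → proj₁ d < k s → turn t′ (⟦ d ⟧ ι) ≡ ⟦ mate f d ⟧ ι
    here-tracks = track R tracks

    open Strand R (named R) using (Sv; ∈Sv; Sv∈)

    off-S : ∀ y → vert y ∉ Sv → turn t′ y ≡ turn t y
    off-S y h = ovr-off ι f (λ a∈ e → h (subst (_∈ Sv) (sym e) (∈-map⁺ (vtx ι) (f-S a∈))))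

    tour-conn : ∀ n x → proj₁ x < k s → ∀ {d} → d ∈ tour n f (m s) x → Conn t′ (⟦ x ⟧ ι) (⟦ d ⟧ ι)
    tour-conn zero x x<k (here refl) = ε
    tour-conn (suc n) x x<k (here refl) = ε
    tour-conn (suc n) x x<k {d} (there p) = by (look (m s) x) refl p
      where
      by : ∀ w → look (m s) x ≡ w → d ∈ tour′ n f (m s) w → Conn t′ (⟦ x ⟧ ι) (⟦ d ⟧ ι)
      by (just y) e p with returns-look R e
      by (just y) e (here refl) | _ , y∈ , _ , a = path-conn t′ off-S a
      by (just y) e (there p) | _ , y∈ , _ , a =
        path-conn t′ off-S a ◅◅ subst (Step t′ (⟦ y ⟧ ι)) (here-tracks y y<k) around ◅ tour-conn n (mate f y) y<k p
        where y<k = All.lookup (named R) y∈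

    -- Excursions survive the change, so the symbolic tour is an actual trail; as it meets every
    -- dart at S, `eul-transfer` applies.
    eul′ : single f s ≡ true → Eul t′
    eul′ h = lem (S s) refl h
      where
      lem : ∀ L → S s ≡ L → single f (state (k s) (g s) L (m s)) ≡ true → Eul t′
      lem (a ∷ L) e h = eul-transfer eul t′ Sv (⟦ a₀ ⟧ ι) (∈Sv {a₀} a∈) off-S all-conn
        where
        a₀ : Dart
        a₀ = a , q0
        a∈ : a ∈ S s
        a∈ = subst (a ∈_) (sym e) (here refl)
        all-conn : ∀ x → vert x ∈ Sv → Conn t′ x (⟦ a₀ ⟧ ι)
        all-conn x x∈ with ∈-map⁻ (vtx ι) x∈
        ... | b , b∈ , q with at-name ι b q
        ...   | i , refl = conn-sym t′ (tour-conn (2 * length (a ∷ L)) a₀ (All.lookup (named R) a∈)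
                  (memD-sound _ _ (every-sound (λ d → memD d (tour (2 * length (a ∷ L)) f (m s) a₀)) h (∈-dartsOf (b , i) (subst (b ∈_) e b∈)))))

    changed-at : ∀ {y} → proj₁ y < k s → proj₁ y ∈ map proj₁ f → turn t′ (⟦ y ⟧ ι) ≢ turn t (⟦ y ⟧ ι)
    changed-at {y} y<k y∈ e = pairing-changed f y∈ f-p1 (xr-pairing _ (proj₂ y)
      (at-inj (ι (proj₁ y)) (trans (sym (here-tracks y y<k)) (trans e (turn⟦⟧ ι y)))))

    at-changed : ∀ {x} → turn t′ x ≢ turn t x → ∃[ a ] ∃[ i ] (a ∈ map proj₁ f × x ≡ ⟦ (a , i) ⟧ ι)
    at-changed h with ovr-diff ι f h
    ... | a , a∈ , e with at-name ι a e
    ...   | i , p = a , i , a∈ , sym p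

    -- The old and the new trail from d make the same turns at all intermediate vertices, so both
    -- return or neither does.
    ag3 ag4 : D → Bool
    ag3 d = ⌊ nx′ d FP.≟ nx d ⌋ ∧ ⌊ nx′ (nx d) FP.≟ nx (nx d) ⌋
    ag4 d = ⌊ nx′ d FP.≟ nx d ⌋ ∧ (⌊ nx′ (nx d) FP.≟ nx (nx d) ⌋ ∧ ⌊ nx′ (nx (nx d)) FP.≟ nx (nx (nx d)) ⌋)

    ag3-agree : ∀ d → ag3 d ≡ true → bad3 t d ≡ bad3 t′ d
    ag3-agree d h with ∧-true {⌊ nx′ d FP.≟ nx d ⌋} h
    ... | u , v = cong (λ z → ⌊ vert (glue z) FP.≟ vert d ⌋) (sym (trans (cong nx′ (⌊⌋-true _ u)) (⌊⌋-true _ v)))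

    ag4-agree : ∀ d → ag4 d ≡ true → bad4 t d ≡ bad4 t′ d
    ag4-agree d h with ∧-true {⌊ nx′ d FP.≟ nx d ⌋} h
    ... | u , v with ∧-true {⌊ nx′ (nx d) FP.≟ nx (nx d) ⌋} v
    ... | v₁ , w = cong (λ z → ⌊ vert (glue z) FP.≟ vert d ⌋)
      (sym (trans (cong nx′ (trans (cong nx′ (⌊⌋-true _ u)) (⌊⌋-true _ v₁))) (⌊⌋-true _ w)))

    look-glue : ∀ {d e} → look (g s) d ≡ just e → proj₁ e < k s × glue (⟦ d ⟧ ι) ≡ ⟦ e ⟧ ι
    look-glue e = proj₂ (glued-look R e)

    same-vert : ∀ d e → proj₁ d ≡ proj₁ e → vert (⟦ d ⟧ ι) ≡ vert (⟦ e ⟧ ι)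
    same-vert d e q = trans (vert⟦⟧ ι d) (trans (cong (vtx ι) q) (sym (vert⟦⟧ ι e)))

    module Walk₀ = Walking Sy s (λ d → ⟦ d ⟧ ι) (λ d → proj₁ d < k s) look-glue same-vert

    module Old = Walk₀ t [] (λ d _ → turn⟦⟧ ι d)
    module New = Walk₀ t′ f here-tracks

    names : List Dart → List D
    names = map (λ d → ⟦ d ⟧ ι)

    -- What the two lengths have in common.
    module Count (w : Walk) (bad : Trans → D → Bool) (ag : D → Bool) (rev : D → D)
      (agree : ∀ d → ag d ≡ true → bad t d ≡ bad t′ d)
      (lost : ∀ {d ys y} → w s [] d ≡ just (ys , y) → changed f ys ≡ true →
              bad t (⟦ d ⟧ ι) ≡ true × ag (⟦ d ⟧ ι) ≡ false)
      (rev-w : ∀ {d ys y} → w s f d ≡ just (ys , y) → ⟦ y ⟧ ι ≡ rev (⟦ d ⟧ ι))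
      (rev-rev : ∀ d → rev (rev d) ≡ d)
      (gain : gains w s f ≡ true) where

      A : List Dart
      A = affected w s f f

      Rs : List Dart
      Rs = affected w s f []

      A< : All (λ a → proj₁ a < k s) A
      A< = All.tabulate (λ m → allDarts-name (k s) (proj₁ (keep-sound _ (allDarts (k s)) m)))

      -- The known new trails are closed under reversal by `reversible`, and reversing twice gives
      -- back the trail.
      rev-∉ : ∀ {d} → d ∉ names A → rev d ∉ names A
      rev-∉ {d} h m with ∈-map⁻ (λ a → ⟦ a ⟧ ι) m
      ... | a , a∈ , q = by (w s f a) refl (every-sound (λ d → endIn A (w s f d)) (proj₁ (∧-true (proj₂ (∧-true {distinctD Rs} gain)))) a∈)
        where
        by : ∀ z → w s f a ≡ z → endIn A z ≡ true → ⊥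
        by (just (ys , y)) e u = h (subst (_∈ names A) (trans (rev-w e) (trans (cong rev (sym q)) (rev-rev d)))
          (∈-map⁺ (λ a → ⟦ a ⟧ ι) (memD-sound y A u)))

      Rs-lost : ∀ {x} → x ∈ names Rs → bad t x ≡ true × ag x ≡ false
      Rs-lost m with ∈-map⁻ (λ a → ⟦ a ⟧ ι) m
      ... | r , r∈ , refl = by (w s [] r) refl (proj₂ (keep-sound (λ d → affected′ f (w s [] d)) (allDarts (k s)) r∈))
        where
        by : ∀ z → w s [] r ≡ z → affected′ f z ≡ true → bad t (⟦ r ⟧ ι) ≡ true × ag (⟦ r ⟧ ι) ≡ false
        by (just (ys , y)) e u = lost e u

      distinct-names : ∀ {ds} → All (λ a → proj₁ a < k s) ds → Distinct ds → Distinct (names ds)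
      distinct-names [] [] = []
      distinct-names {d ∷ ds} (p ∷ ps) (q ∷ qs) = (λ m → lem (∈-map⁻ (λ a → ⟦ a ⟧ ι) m)) ∷ distinct-names ps qs
        where
        lem : ∃[ e ] (e ∈ ds × ⟦ d ⟧ ι ≡ ⟦ e ⟧ ι) → ⊥
        lem (e , e∈ , r) with same-dart {ι} (apart R) p (All.lookup ps e∈) r
        ... | refl = q e∈

      -- `newcomer` with the lost trails as leavers and the known new trails as those accounted for.
      outcome : sum (bit ∘ bad t′) < sum (bit ∘ bad t) ⊎
                ∃[ d ] (bad t′ d ≡ true × ag d ≡ false × d ∉ names A)
      outcome = newcomer (bad t) (bad t′) ag (names Rs) (names A) agree Rs-lost
        (distinct-names (All.tabulate (λ m → allDarts-name (k s) (proj₁ (keep-sound _ (allDarts (k s)) m))))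
          (distinctD-sound Rs (proj₁ (∧-true gain))))
        (subst₂ _<_ (sym (length-map _ A)) (sym (length-map _ Rs))
          (<ᵇ-sound (length A) (length Rs) (proj₂ (∧-true {reversible w s f A} (proj₂ (∧-true {distinctD Rs} gain))))))

    rev3 rev4 : D → D
    rev3 d = glue (nx′ (nx′ d))
    rev4 d = glue (nx′ (nx′ (nx′ d)))

    nx-rev : ∀ d → nx′ (glue (nx′ d)) ≡ glue d
    nx-rev d = trans (cong (turn t′) (glue-inv _)) (turn-inv t′ _)

    rev3-rev3 : ∀ d → rev3 (rev3 d) ≡ d
    rev3-rev3 d = trans (cong glue (trans (cong nx′ (nx-rev (nx′ d))) (nx-rev d))) (glue-inv d)

    rev4-rev4 : ∀ d → rev4 (rev4 d) ≡ d
    rev4-rev4 d = trans (cong glue (trans (cong nx′ (trans (cong nx′ (nx-rev (nx′ (nx′ d)))) (nx-rev (nx′ d)))) (nx-rev d))) (glue-inv d)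

    Ret3 Ret4 : D → Set
    Ret3 d = vert (glue (nx′ (nx′ d))) ≡ vert d
    Ret4 d = vert (glue (nx′ (nx′ (nx′ d)))) ≡ vert d

    ret3-rev : ∀ {d} → Ret3 d → Ret3 (rev3 d)
    ret3-rev {d} r = trans (cong vert (rev3-rev3 d)) (sym r)

    ret4-rev : ∀ {d} → Ret4 d → Ret4 (rev4 d)
    ret4-rev {d} r = trans (cong vert (rev4-rev4 d)) (sym r)

    data Diff3 (d : D) : Set where
      first  : turn t′ (glue d) ≢ turn t (glue d) → Diff3 d
      second : turn t′ (glue (nx′ d)) ≢ turn t (glue (nx′ d)) → Diff3 d

    diff3 : ∀ d → ag3 d ≡ false → Diff3 d
    diff3 d h with nx′ d FP.≟ nx d
    ... | no ne = first ne
    ... | yes e with nx′ (nx d) FP.≟ nx (nx d)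
    ...   | no ne = second (λ q → ne (subst (λ z → nx′ z ≡ nx z) e q))

    data Diff4 (d : D) : Set where
      early : Diff3 d → Diff4 d
      third : turn t′ (glue (nx′ (nx′ d))) ≢ turn t (glue (nx′ (nx′ d))) → Diff4 d

    diff4 : ∀ d → ag4 d ≡ false → Diff4 d
    diff4 d h with nx′ d FP.≟ nx d
    ... | no ne = early (first ne)
    ... | yes e with nx′ (nx d) FP.≟ nx (nx d)
    ...   | no ne = early (second (λ q → ne (subst (λ z → nx′ z ≡ nx z) e q)))
    ...   | yes e′ with nx′ (nx (nx d)) FP.≟ nx (nx (nx d))
    ...     | no ne = third (λ q → ne (subst (λ z → nx′ z ≡ nx z) (trans (cong nx′ e) e′) q))

    diff-turn : ∀ {x} → turn t′ x ≢ turn t x → turn t′ (turn t′ x) ≢ turn t (turn t′ x)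
    diff-turn {x} h e = h (trans (sym (turn-inv t (turn t′ x))) (cong (turn t) (trans (sym e) (turn-inv t′ x))))

    f-entry : ∀ {a} → a ∈ map proj₁ f → ∃[ p ] ((a , p) ∈ f)
    f-entry m with ∈-map⁻ proj₁ m
    ... | (a , p) , x∈ , refl = p , x∈

    module V3 = Via (close3 f) Ret3 close3-sound
    module V4 = Via (close4 f) Ret4 close4-sound

    new3-first : ∀ {A d} → All (λ a → proj₁ a < k s) A → Ret3 d → d ∉ names A →
                 turn t′ (glue d) ≢ turn t (glue d) → Live (new3 f A s)
    new3-first {A} {d} A< r d∉ h with at-changed h
    ... | a , i , a∈ , e with f-entry a∈
    ... | p , m = live-concat (new3-at f A s) m (live-concat (via₁ (close3 f) A s) (∈-darts a i) (V3.via₁-sound A R tracks A< (f-k a∈) e r d∉))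

    -- A new trail differs from the old one at its first or second intermediate vertex, and reversal
    -- exchanges these two cases.
    new3-sound : ∀ {A d} → All (λ a → proj₁ a < k s) A → Ret3 d → d ∉ names A → rev3 d ∉ names A →
                 ag3 d ≡ false → Live (new3 f A s)
    new3-sound {d = d} A< r d∉ rd∉ h with diff3 d h
    ... | first ne = new3-first A< r d∉ ne
    ... | second ne = new3-first A< (ret3-rev r) rd∉
      (subst (λ z → turn t′ z ≢ turn t z) (sym (glue-inv _)) (diff-turn ne))

    live-++ˡ : ∀ {xs ys} → Live xs → Live (xs ++ ys)
    live-++ˡ (s , ι , m , r) = s , ι , ∈-++⁺ˡ m , r

    live-++ʳ : ∀ xs {ys} → Live ys → Live (xs ++ ys)
    live-++ʳ xs (s , ι , m , r) = s , ι , ∈-++⁺ʳ xs m , r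

    new4-first : ∀ {A d} → All (λ a → proj₁ a < k s) A → Ret4 d → d ∉ names A →
                 turn t′ (glue d) ≢ turn t (glue d) → Live (new4 f A s)
    new4-first {A} {d} A< r d∉ h with at-changed h
    ... | a , i , a∈ , e with f-entry a∈
    ... | p , m = live-concat (new4-at f A s) m (live-++ˡ (live-concat (via₁ (close4 f) A s) (∈-darts a i) (V4.via₁-sound A R tracks A< (f-k a∈) e r d∉)))

    via₂-sound : ∀ {A d y} → All (λ a → proj₁ a < k s) A → Ret4 d → d ∉ names A → proj₁ y < k s →
                 glue (nx′ d) ≡ ⟦ y ⟧ ι → Live (via₂ f A s y)
    via₂-sound {A} {d} {y} A< r d∉ y<k q with resolve-sound {d = y} R y<k
    ... | resolved {s₁} {ι₁} {d₁} m R₁ x le d₁< q₁ =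
      live-concat (via₁′ f A) m (V4.via₁-sound A R₁ T₁ (All.map (λ h → ≤-trans h le) A<) d₁< e r
        (λ h → d∉ (subst (d ∈_) (names-ext A A<) h)))
      where
      T₁ = tracks-mono s s₁ x le tracks
      names-ext : ∀ A → All (λ a → proj₁ a < k s) A → map (λ a → ⟦ a ⟧ ι₁) A ≡ names A
      names-ext [] [] = refl
      names-ext (a ∷ A) (p ∷ ps) = cong₂ _∷_ (sym (ext-⟦⟧ x a p)) (names-ext A ps)
      n≡ : nx′ d ≡ ⟦ d₁ ⟧ ι₁
      n≡ = trans (sym (glue-inv _)) (trans (cong glue q) q₁)
      e : glue d ≡ ⟦ mate f d₁ ⟧ ι₁
      e = trans (sym (turn-inv t′ _)) (trans (cong (turn t′) n≡) (track R₁ T₁ d₁ d₁<))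

    new4-second : ∀ {A d a i} → All (λ a → proj₁ a < k s) A → Ret4 d → d ∉ names A → a ∈ map proj₁ f →
                  glue (nx′ d) ≡ ⟦ (a , i) ⟧ ι → i ≡ q0 ⊎ i ≡ q1 → Live (new4 f A s)
    new4-second {A} {d} {a} {i} A< r d∉ a∈ e i≡ with f-entry a∈
    ... | p , m = live-concat (new4-at f A s) m (live-++ʳ (gather (via₁ (close4 f) A s) (darts a))
                    (live-concat (via₂ f A s) (mm i≡) (via₂-sound A< r d∉ (f-k a∈) e)))
      where
      mm : ∀ {i} → i ≡ q0 ⊎ i ≡ q1 → (a , i) ∈ (a , q0) ∷ (a , q1) ∷ []
      mm (inj₁ refl) = here refl
      mm (inj₂ refl) = there (here refl)

    -- Reversal takes a difference at the third intermediate vertex to the first. At the second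
    -- vertex, either the trail or its reversal arrives at `q0` or `q1`, by `low`.
    new4-sound : ∀ {A d} → All (λ a → proj₁ a < k s) A → Ret4 d → d ∉ names A → rev4 d ∉ names A →
                 ag4 d ≡ false → Live (new4 f A s)
    new4-sound {d = d} A< r d∉ rd∉ h with diff4 d h
    ... | early (first ne) = new4-first A< r d∉ ne
    ... | third ne = new4-first A< (ret4-rev r) rd∉
      (subst (λ z → turn t′ z ≢ turn t z) (sym (glue-inv _)) (diff-turn ne))
    ... | early (second ne) with at-changed ne
    ...   | a , i , a∈ , e with low (pairing f a) i (pairing-changed f a∈ f-p1)
    ...     | inj₁ i≡ = new4-second A< r d∉ a∈ e i≡
    ...     | inj₂ i≡ = new4-second A< (ret4-rev r) rd∉ a∈
                (trans (cong glue (nx-rev _)) (trans (glue-inv _) (trans (cong (turn t′) e) (here-tracks (a , i) (f-k a∈))))) i≡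

    changed-step : ∀ {y x} → proj₁ y < k s → proj₁ y ∈ map proj₁ f → glue x ≡ ⟦ y ⟧ ι → nx′ x ≢ nx x
    changed-step {y} y<k y∈ e q = changed-at {y} y<k y∈ (trans (cong (turn t′) (sym e)) (trans q (cong (turn t) e)))

    lost3 : ∀ {d ys y} → walk3 s [] d ≡ just (ys , y) → changed f ys ≡ true →
            bad3 t (⟦ d ⟧ ι) ≡ true × ag3 (⟦ d ⟧ ι) ≡ false
    lost3 {d} e c with Old.walk3-sound {d} e
    ... | (y₁ , y₂ , refl , k₁ , k₂ , _ , g₁ , g₂ , g₃) , v =
      ⌊⌋-yes _ (trans (cong vert g₃) v) , ≡false λ h → case ∧-true {⌊ nx′ (⟦ d ⟧ ι) FP.≟ nx (⟦ d ⟧ ι) ⌋} h of λ where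
        (a , b) → differ (⌊⌋-true _ a) (⌊⌋-true _ b)
      where
      differ : nx′ (⟦ d ⟧ ι) ≡ nx (⟦ d ⟧ ι) → nx′ (nx (⟦ d ⟧ ι)) ≡ nx (nx (⟦ d ⟧ ι)) → ⊥
      differ a b with changed-any f (y₁ ∷ y₂ ∷ []) c
      ... | _ , here refl , m = changed-step {y₁} k₁ m g₁ a
      ... | _ , there (here refl) , m = changed-step {y₂} k₂ m g₂ b

    lost4 : ∀ {d ys y} → walk4 s [] d ≡ just (ys , y) → changed f ys ≡ true →
            bad4 t (⟦ d ⟧ ι) ≡ true × ag4 (⟦ d ⟧ ι) ≡ false
    lost4 {d} e c with Old.walk4-sound {d} e
    ... | (y₁ , y₂ , y₃ , refl , k₁ , k₂ , k₃ , _ , g₁ , g₂ , g₃ , g₄) , v =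
      ⌊⌋-yes _ (trans (cong vert g₄) v) , ≡false λ h → case ∧-true {⌊ nx′ (⟦ d ⟧ ι) FP.≟ nx (⟦ d ⟧ ι) ⌋} h of λ where
        (a , h′) → case ∧-true {⌊ nx′ (nx (⟦ d ⟧ ι)) FP.≟ nx (nx (⟦ d ⟧ ι)) ⌋} h′ of λ where
          (b , c′) → differ (⌊⌋-true _ a) (⌊⌋-true _ b) (⌊⌋-true _ c′)
      where
      differ : nx′ (⟦ d ⟧ ι) ≡ nx (⟦ d ⟧ ι) → nx′ (nx (⟦ d ⟧ ι)) ≡ nx (nx (⟦ d ⟧ ι)) →
           nx′ (nx (nx (⟦ d ⟧ ι))) ≡ nx (nx (nx (⟦ d ⟧ ι))) → ⊥
      differ a b c″ with changed-any f (y₁ ∷ y₂ ∷ y₃ ∷ []) c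
      ... | _ , here refl , m = changed-step {y₁} k₁ m g₁ a
      ... | _ , there (here refl) , m = changed-step {y₂} k₂ m g₂ b
      ... | _ , there (there (here refl)) , m = changed-step {y₃} k₃ m g₃ c″

    rev-w3 : ∀ {d ys y} → walk3 s f d ≡ just (ys , y) → ⟦ y ⟧ ι ≡ rev3 (⟦ d ⟧ ι)
    rev-w3 {d} e with New.walk3-sound {d} e
    ... | (_ , _ , _ , _ , _ , _ , _ , _ , q) , _ = sym q

    rev-w4 : ∀ {d ys y} → walk4 s f d ≡ just (ys , y) → ⟦ y ⟧ ι ≡ rev4 (⟦ d ⟧ ι)
    rev-w4 {d} e with New.walk4-sound {d} e
    ... | (_ , _ , _ , _ , _ , _ , _ , _ , _ , _ , _ , q) , _ = sym q

    -- The dichotomy of the descent: fewer short closed trails, or one that was not foreseen, and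
    -- then one of the listed larger states occurs.
    switch3 : single f s ≡ true → gains walk3 s f ≡ true →
      (∃[ t″ ] (Eul t″ × count3 t″ < count3 t)) ⊎ Live (new3 f (affected walk3 s f f) s)
    switch3 h gn with C.outcome
      where module C = Count walk3 bad3 ag3 rev3 ag3-agree lost3 rev-w3 rev3-rev3 gn
    ... | inj₁ lt = inj₁ (t′ , eul′ h , lt)
    ... | inj₂ (d , b , a , d∉) = inj₂ (new3-sound C.A< (⌊⌋-true _ b) d∉ (C.rev-∉ d∉) a)
      where module C = Count walk3 bad3 ag3 rev3 ag3-agree lost3 rev-w3 rev3-rev3 gn

    -- A closed trail of length three in the changed system must be new, because the old system has
    -- none; this case comes before the count of those of length four.
    switch4 : (∀ d → bad3 t d ≡ false) → single f s ≡ true → gains walk4 s f ≡ true →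
      (∃[ t″ ] (Eul t″ × (∀ d → bad3 t″ d ≡ false) × count4 t″ < count4 t)) ⊎
      Live (new3 f [] s ++ new4 f (affected walk4 s f f) s)
    switch4 free h gn with FP.any? (λ d → vert (glue (Orbit.it t′ 2 d)) FP.≟ vert d)
    ... | yes (d , r) = inj₂ (live-++ˡ (new3-sound [] r (λ ()) (λ ())
            (≡false λ a → true≢false (trans (ag3-agree d a) (⌊⌋-yes _ r)) (free d))))
    ... | no none with C.outcome
      where module C = Count walk4 bad4 ag4 rev4 ag4-agree lost4 rev-w4 rev4-rev4 gn
    ...   | inj₁ lt = inj₁ (t′ , eul′ h , (λ d → ⌊⌋-no _ (λ r → none (d , r))) , lt)
    ...   | inj₂ (d , b , a , d∉) = inj₂ (live-++ʳ (new3 f [] s) (new4-sound C.A< (⌊⌋-true _ b) d∉ (C.rev-∉ d∉) a))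
      where module C = Count walk4 bad4 ag4 rev4 ag4-agree lost4 rev-w4 rev4-rev4 gn

-- Soundness of enlarging, of renaming and of the checker.

every-complete : ∀ {A : Set} (p : A → Bool) xs → (∀ {x} → x ∈ xs → p x ≡ true) → every p xs ≡ true
every-complete p [] h = refl
every-complete p (x ∷ xs) h = ∧-intro (h (here refl)) (every-complete p xs (h ∘ there))

nth-∈ : ∀ {A : Set} (z : A) xs {i} → i < length xs → nth z xs i ∈ xs
nth-∈ z (x ∷ xs) {zero} h = here refl
nth-∈ z (x ∷ xs) {suc i} (s≤s h) = there (nth-∈ z xs h)

nth-map : ∀ {A B : Set} (h : A → B) z xs i → nth (h z) (map h xs) i ≡ h (nth z xs i)
nth-map h z [] i = refl
nth-map h z (x ∷ xs) zero = refl
nth-map h z (x ∷ xs) (suc i) = nth-map h z xs i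

nth-injective : ∀ z xs → distinctN xs ≡ true → ∀ {i j} → i < length xs → j < length xs →
                nth z xs i ≡ nth z xs j → i ≡ j
nth-injective z (x ∷ xs) h {zero} {zero} _ _ e = refl
nth-injective z (x ∷ xs) h {zero} {suc j} _ (s≤s j<) e =
  ⊥-elim (true≢false (mem-complete (subst (_∈ xs) (sym e) (nth-∈ z xs j<))) (not-true (proj₁ (∧-true h))))
nth-injective z (x ∷ xs) h {suc i} {zero} (s≤s i<) _ e =
  ⊥-elim (true≢false (mem-complete (subst (_∈ xs) e (nth-∈ z xs i<))) (not-true (proj₁ (∧-true h))))
nth-injective z (x ∷ xs) h {suc i} {suc j} (s≤s i<) (s≤s j<) e =
  cong suc (nth-injective z xs (proj₂ (∧-true {not (mem x xs)} h)) i< j< e)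

code-apart : ∀ c → proj₂ (code c) ≢ proj₁ (code c) × proj₂ (code c) ≢ xr p1 (proj₁ (code c))
code-apart 0 = (λ ()) , λ ()
code-apart 1 = (λ ()) , λ ()
code-apart 2 = (λ ()) , λ ()
code-apart 3 = (λ ()) , λ ()
code-apart 4 = (λ ()) , λ ()
code-apart 5 = (λ ()) , λ ()
code-apart 6 = (λ ()) , λ ()
code-apart (suc (suc (suc (suc (suc (suc (suc c))))))) = (λ ()) , λ ()

module Refuting {n : ℕ} (Sy : System n) (t : Transitions.Trans Sy) (eul : Transitions.Eul Sy t) where
  open System Sy
  open Switching Sy t eul public

  path-it : ∀ {S l d e} → Path S l d e → e ≡ glue (it l d)
  path-it (stop _) = refl
  path-it {l = suc l} {d} (go _ a) = trans (path-it a) (cong glue (it-nx l d))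

  path-resp : ∀ {V V′} → (∀ {v} → v ∈ V → v ∈ V′) → (∀ {v} → v ∈ V′ → v ∈ V) →
              ∀ {l d e} → Path V l d e → Path V′ l d e
  path-resp to from (stop h) = stop (to h)
  path-resp to from (go h a) = go (h ∘ from) (path-resp to from a)

  module Enlarge {ι : Env} {s : State} (R : Real ι s) {u : ℕ} (u<k : u < k s) (u∉S : u ∉ S s) where
    S2 : List ℕ
    S2 = u ∷ S s

    S2< : All (_< k s) S2
    S2< = u<k ∷ named R

    private
      module A = Strand R (named R)
      module B = Strand R S2<

    Good : List (Dart × Dart) → Set
    Good = All (Returns ι S2)

    Known : List (Dart × Dart) → Dart → Set
    Known m x = ∃[ y ] (look m x ≡ just y)

    good-look : ∀ {m x y} → Good m → look m x ≡ just y → Returns ι S2 (x , y)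
    good-look {m} {x} {y} G p with look-sound m x p
    ... | inj₁ h = All.lookup G h
    ... | inj₂ h with All.lookup G h
    ...   | a , b , l , q = b , a , path-sym (B.∈Sv {y} a) q

    known-∈ : ∀ m x {y} → (x , y) ∈ m ⊎ (y , x) ∈ m → Known m x
    known-∈ m x h with look m x in e
    ... | just y = y , refl
    ... | nothing = ⊥-elim (look-none m x e h)

    swap : ∀ {A B : Set} → A ⊎ B → B ⊎ A
    swap (inj₁ a) = inj₂ a
    swap (inj₂ b) = inj₁ b

    named-end : ∀ {V l d e} → V ≡ S2 → Path (map (vtx ι) V) l d e → ∃[ y ] (proj₁ y ∈ S2 × e ≡ ⟦ y ⟧ ι)
    named-end refl a with ∈-map⁻ (vtx ι) (path-end a)
    ... | b , b∈ , q with at-name ι b q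
    ...   | i , p = (b , i) , b∈ , sym p

    same : ∀ {d e} → proj₁ d ∈ S2 → proj₁ e ∈ S2 → ⟦ d ⟧ ι ≡ ⟦ e ⟧ ι → d ≡ e
    same a b = same-dart {ι} (apart R) (All.lookup S2< a) (All.lookup S2< b)

    det : ∀ {x y z} → Returns ι S2 (x , y) → Returns ι S2 (x , z) → y ≡ z
    det (_ , y∈ , _ , a) (_ , z∈ , _ , b) = same y∈ z∈ (proj₂ (path-det a b))

    back : ∀ {x y} → Returns ι S2 (x , y) → Returns ι S2 (y , x)
    back {x} (a , b , _ , p) = b , a , path-sym (B.∈Sv {x} a) p

    end-sound : ∀ {x p} → proj₁ x ∈ S2 → end s u (look (g s) x) ≡ inside p → Returns ι S2 (x , p)
    end-sound {x} {p} x∈ e with look (g s) x in q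
    ... | just y with glued-look R q
    ...   | _ , y<k , r with B.strand-inside (suc (k s)) y y<k e
    ...     | h with B.arrive y<k r h
    ...       | l , a with named-end refl a
    ...         | z , z∈ , eq with same-dart {ι} (apart R) (B.strand-name (suc (k s)) y y<k e) (All.lookup S2< z∈) eq
    ...           | refl = x∈ , z∈ , l , a

    ends-∈ : ∀ {x e} m es → e ∈ es → e ≢ x → look m e ≡ nothing → ((x , e) ∷ m) ∈ ends s u m es x
    ends-∈ {x} {e} m (.e ∷ es) (here refl) ne h rewrite ≡false {eqD e x} (λ q → ne (eqD-sound e x q)) | h = here refl
    ends-∈ {x} {e} m (e′ ∷ es) (there p) ne h with eqD e′ x ∨ not (is-nothing (look m e′))
    ... | true = ends-∈ m es p ne h
    ... | false = there (ends-∈ m es p ne h)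

    Extended : List (Dart × Dart) → Dart → List (List (Dart × Dart)) → Set
    Extended m x ms = ∃[ m′ ] (m′ ∈ ms × Good m′ × Known m′ x × (∀ {y} → Known m y → Known m′ y))

    -- The circuit is single, so the excursion from x does return. Its end is among the candidates,
    -- as it agrees with the strand when that is known, and it has no other partner because returns
    -- are symmetric.
    extend-sound : ∀ {m} x → Good m → proj₁ x ∈ S2 → Extended m x (extend s u x m)
    extend-sound {m} x G x∈ = by (look m x) refl
      where
      by : ∀ w → look m x ≡ w → Extended m x (extend′ s u m x w)
      by (just y) e = m , here refl , G , (y , e) , λ h → h
      by nothing e with path-exists eul (B.∈Sv {x} x∈) (⟦ x ⟧ ι)
      ... | l , z , a with named-end refl a
      ...   | y , y∈ , refl = (x , y) ∷ m , ends-∈ m _ (cand (end s u (look (g s) x)) refl) y≢x (fresh-y (look m y) refl) ,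
                ret ∷ G , known-∈ ((x , y) ∷ m) x (inj₁ (here refl)) , keepK
        where
        ret : Returns ι S2 (x , y)
        ret = x∈ , y∈ , l , a
        cand : ∀ w → end s u (look (g s) x) ≡ w → y ∈ candidates s u w
        cand (inside p) q = here (det ret (end-sound {x} x∈ q))
        cand (open′ _) q = ∈-dartsOf y y∈
        cand unknown q = ∈-dartsOf y y∈
        -- An excursion that came back along its own first dart would meet its reversal, against
        -- `noRev`.
        y≢x : y ≢ x
        y≢x refl = noRev l 0 (⟦ x ⟧ ι) (sym (glue-sym (sym (path-it a))))
        fresh-y : ∀ w → look m y ≡ w → look m y ≡ nothing
        fresh-y nothing q = q
        fresh-y (just z) q with det (good-look G q) (back ret)
        ... | refl = ⊥-elim (look-none m x e (swap (look-sound m y q)))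
        keepK : ∀ {w} → Known m w → Known ((x , y) ∷ m) w
        keepK {w} (v , q) with look-sound m w q
        ... | inj₁ h = known-∈ ((x , y) ∷ m) w (inj₁ (there h))
        ... | inj₂ h = known-∈ ((x , y) ∷ m) w (inj₂ (there h))

    module Full {m′ : List (Dart × Dart)} (G : Good m′) (all-u : ∀ i → Known m′ (u , i)) where
      nothing-true : ∀ {A : Set} (w : Maybe A) → is-nothing w ≡ true → w ≡ nothing
      nothing-true nothing _ = refl

      -- All four darts of u have their returns in `m′`. An old excursion that met u would thus show
      -- its first dart in `m′`; if it does not, the excursion misses u and remains one for the
      -- larger set.
      persist-good : ∀ L → (∀ {p} → p ∈ L → p ∈ m s) → Good (persist s m′ L)
      persist-good [] h = G
      persist-good ((x , y) ∷ L) h with is-nothing (look m′ x) ∧ is-nothing (look m′ y) in q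
      ... | false = persist-good L (h ∘ there)
      ... | true with All.lookup (returns R) (h (here refl))
      ...   | x∈ , y∈ , l , a = ret ∷ persist-good L (h ∘ there)
        where
        ret : Returns ι S2 (x , y)
        ret with path-exists eul (B.∈Sv {x} (there x∈)) (⟦ x ⟧ ι)
        ... | l′ , z , b with named-end refl b
        ...   | (.u , i) , here refl , refl with all-u i
        ...     | w , e with det (good-look G e) (back (there x∈ , here refl , l′ , b))
        ...       | refl = ⊥-elim (look-none m′ x (nothing-true _ (proj₁ (∧-true q))) (swap (look-sound m′ (u , i) e)))
        ret | l′ , z , b | v , there v∈ , refl
          with same-dart {ι} (apart R) (All.lookup (named R) v∈) (All.lookup (named R) y∈)
                 (proj₂ (path-det (path-shrink b (A.∈Sv {v} v∈)) a))
        ...     | refl = there x∈ , there y∈ , l′ , b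

      full : List (Dart × Dart)
      full = persist s m′ (m s)

      full-good : Good full
      full-good = persist-good (m s) (λ p → p)

      -- An old return is a chain of new returns through u.
      through-sound : ∀ n x {y} → through n u full (look full x) ≡ just y →
                      proj₁ y ∈ S s × ∃[ l ] Path A.Sv l (⟦ x ⟧ ι) (⟦ y ⟧ ι)
      through-sound (suc n) x {y} h with look full x in e
      ... | just z with proj₁ z ≡ᵇ u in v | good-look full-good e
      through-sound (suc n) x {y} h | just z | true | z∈ with through-sound n (flip1 z) h
      ... | y∈ , l , a = y∈ , path-compose (proj₂ (proj₂ (proj₂ z∈)))
                      (u∉S ∘ subst (_∈ S s) (≡ᵇ-sound (proj₁ z) u v) ∘ A.Sv∈ {z} (All.lookup S2< (proj₁ (proj₂ z∈)))) (subst (λ w → Path A.Sv l w _) (sym (turn⟦⟧ ι z)) a)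
      through-sound (suc n) x {y} refl | just z | false | (_ , z∈ , l , a) = y∈ , l , path-shrink a (A.∈Sv {z} y∈)
        where
        y∈ : proj₁ z ∈ S s
        y∈ = lem z∈
          where
          lem : proj₁ z ∈ S2 → proj₁ z ∈ S s
          lem (here e) = ⊥-elim (true≢false (trans (cong (_≡ᵇ u) e) (≡ᵇ-refl u)) v)
          lem (there p) = p

      sameMaybe-true : ∀ v w → (∀ {x y} → v ≡ just x → w ≡ just y → x ≡ y) → sameMaybe v w ≡ true
      sameMaybe-true (just x) (just y) h rewrite h refl refl = eqD-refl y
      sameMaybe-true (just x) nothing h = refl
      sameMaybe-true nothing w h = refl

      sameEnd-true : ∀ v w → (∀ {x y} → v ≡ inside x → w ≡ just y → x ≡ y) → sameEnd v w ≡ true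
      sameEnd-true (inside x) (just y) h rewrite h refl refl = eqD-refl y
      sameEnd-true (inside x) nothing h = refl
      sameEnd-true (open′ x) w h = refl
      sameEnd-true unknown w h = refl

      coherent-full : coherent s u full ≡ true
      coherent-full = ∧-intro
        (every-complete _ (dartsOf (S s)) λ {d} d∈ → sameMaybe-true _ _ λ p q →
          case through-sound 3 d p of λ { (y∈ , _ , a) → case returns-look R q of λ { (_ , z∈ , _ , b) →
            same (there y∈) (there z∈) (proj₂ (path-det a b)) } })
        (every-complete _ (dartsOf S2) λ {d} d∈ → sameEnd-true _ _ λ p q →
          det (end-sound {d} (dartsOf-name S2 d∈) p) (good-look full-good q))

      -- The invariant of `loop`: the darts collected so far lead to one another, except that the
      -- last one leads to the current dart x.
      Closing : Dart → List Dart → Dart → Set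
      Closing x₀ W x = (x₀ ≡ x ⊎ x₀ ∈ W) × proj₁ x ∈ S2 ×
        (∀ {z} → z ∈ W → proj₁ z ∈ S2 × ∃[ y ] (Returns ι S2 (z , y) × (flip1 y ∈ W ⊎ flip1 y ≡ x)))

      loop-sound : ∀ n {x₀ x W W′} → Closing x₀ W x → loop n full x₀ x W ≡ just W′ →
        x₀ ∈ W′ × (∀ {z} → z ∈ W′ → proj₁ z ∈ S2 × ∃[ y ] (Returns ι S2 (z , y) × flip1 y ∈ W′))
      loop-sound (suc n) {x₀} {x} {W} {W′} (st , x∈ , cl) h = by (look full x) refl h
        where
        inW : x₀ ∈ x ∷ W
        inW = [ (λ e → here e) , there ]′ st
        old : ∀ {z} → z ∈ W → proj₁ z ∈ S2 × ∃[ y ] (Returns ι S2 (z , y) × flip1 y ∈ x ∷ W)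
        old z∈ with cl z∈
        ... | a , y , r , inj₁ p = a , y , r , there p
        ... | a , y , r , inj₂ refl = a , y , r , here refl
        by : ∀ w → look full x ≡ w → loop′ n full x₀ (x ∷ W) w ≡ just W′ →
          x₀ ∈ W′ × (∀ {z} → z ∈ W′ → proj₁ z ∈ S2 × ∃[ y ] (Returns ι S2 (z , y) × flip1 y ∈ W′))
        by (just y) e h with good-look full-good e | eqD (flip1 y) x₀ in q
        by (just y) e refl | r | true = inW , λ
          { (here refl) → x∈ , y , r , subst (_∈ x ∷ W) (sym (eqD-sound _ _ q)) inW ; (there p) → old p }
        by (just y) e h | r | false = loop-sound n
          (inj₂ inW , proj₁ (proj₂ r) , λ { (here refl) → x∈ , y , r , inj₂ refl
                                          ; (there p) → case old p of λ { (a , z , r′ , f) → a , z , r′ , inj₁ f } }) h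

      -- A completed loop is closed under passing from one excursion to the next, so by
      -- `closed-covers` it contains each dart at S or its partner.
      covering-full : ∀ w → loop (2 * length S2) full (u , q0) (u , q0) [] ≡ w → covering S2 w ≡ true
      covering-full nothing e = refl
      covering-full (just W) e with loop-sound (2 * length S2) (inj₁ refl , here refl , λ ()) e
      ... | x₀∈ , cl = every-complete _ (dartsOf S2) λ {d} d∈ → let d∈S = dartsOf-name S2 d∈ in
        [ (λ p → or₁ (memD-complete (find {d} d∈S p)))
        , (λ p → or₂ {memD d W} (memD-complete (find {flip1 d} d∈S (subst (_∈ map (λ z → ⟦ z ⟧ ι) W) (turn⟦⟧ ι d) p)))) ]′
        (closed-covers eul (map (λ z → ⟦ z ⟧ ι) W) (∈-map⁺ (λ z → ⟦ z ⟧ ι) x₀∈) step (⟦ d ⟧ ι) (B.∈Sv {d} d∈S))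
        where
        or₁ : ∀ {a b} → a ≡ true → a ∨ b ≡ true
        or₁ refl = refl
        or₂ : ∀ {a b} → b ≡ true → a ∨ b ≡ true
        or₂ {true} refl = refl
        or₂ {false} refl = refl
        find : ∀ {d} → proj₁ d ∈ S2 → ⟦ d ⟧ ι ∈ map (λ z → ⟦ z ⟧ ι) W → d ∈ W
        find d∈ p with ∈-map⁻ (λ z → ⟦ z ⟧ ι) p
        ... | z , z∈ , q with same d∈ (proj₁ (cl z∈)) q
        ...   | refl = z∈
        step : ∀ {y} → y ∈ map (λ z → ⟦ z ⟧ ι) W → ∃[ l ] ∃[ e ] (Path B.Sv l y e × turn t e ∈ map (λ z → ⟦ z ⟧ ι) W)
        step p with ∈-map⁻ (λ z → ⟦ z ⟧ ι) p
        ... | z , z∈ , refl with cl z∈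
        ...   | _ , y , (_ , _ , l , a) , f∈ = l , ⟦ y ⟧ ι , a ,
                subst (_∈ map (λ z → ⟦ z ⟧ ι) W) (sym (turn⟦⟧ ι y)) (∈-map⁺ (λ z → ⟦ z ⟧ ι) f∈)

      enlarged : State
      enlarged = state (k s) (g s) S2 full

      admitted : enlarged ∈ admit s u m′
      admitted = subst (enlarged ∈_) (sym (if-true (∧-intro coherent-full (covering-full _ refl)))) (here refl)

      real-enlarged : Real ι enlarged
      real-enlarged = record { apart = apart R ; glued = glued R ; named = S2< ; returns = full-good }

    -- The actual return map of `u ∷ S` is among the maps that are enumerated, and it passes the
    -- tests of `admit`.
    enlarge-sound : ∃[ s′ ] (s′ ∈ enlarge s u × Real ι s′ × k s′ ≡ k s)
    enlarge-sound with extend-sound {[]} (u , q0) [] (here refl)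
    ... | m₀ , i₀ , G₀ , k₀ , _ with extend-sound (u , q1) G₀ (here refl)
    ... | m₁ , i₁ , G₁ , k₁ , c₁ with extend-sound (u , q2) G₁ (here refl)
    ... | m₂ , i₂ , G₂ , k₂ , c₂ with extend-sound (u , q3) G₂ (here refl)
    ... | m₃ , i₃ , G₃ , k₃ , c₃ = F.enlarged , ∈-concat {f = admit s u}
          (∈-concat {f = extend s u (u , q3)} (∈-concat {f = extend s u (u , q2)} (∈-concat {f = extend s u (u , q1)} i₀ i₁) i₂) i₃)
          F.admitted , F.real-enlarged , refl
      where
      all-u : ∀ i → Known m₃ (u , i)
      all-u q0 = c₃ (c₂ (c₁ k₀))
      all-u q1 = c₃ (c₂ k₁)
      all-u q2 = c₃ k₂
      all-u q3 = k₃
      module F = Full G₃ all-u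

  -- A realisation is pulled back along a renaming: each name of the smaller state denotes the frame
  -- of its image, relabelled in a way that respects `p1`.
  module Renamed {ι : Env} {s s′ : State} (R : Real ι s′) (r : Renaming) (ok : embeds s s′ r ≡ true) where
    dec : ℕ → ℕ × Q × Q
    dec a = decode (nth 0 r a)

    base : ℕ → Frame
    base a = ι (renameN r a)

    x y : ℕ → Q
    x a = proj₁ (proj₂ (dec a))
    y a = proj₂ (proj₂ (dec a))

    apart-xy : ∀ a → y a ≢ x a × y a ≢ xr p1 (x a)
    apart-xy a = code-apart (nth 0 r a % 8)

    ι′ : Env
    ι′ a = frame₂ (at (base a) (x a)) (at (base a) (y a)) (trans (at-vert (base a) (y a)) (sym (at-vert (base a) (x a))))
      (proj₁ (apart-xy a) ∘ at-inj (base a))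
      (λ e → proj₂ (apart-xy a) (at-inj (base a) (trans e (at-turn (base a) (x a)))))

    ι′-⟦⟧ : ∀ d → ⟦ d ⟧ ι′ ≡ ⟦ renameD r d ⟧ ι
    ι′-⟦⟧ (a , q0) = refl
    ι′-⟦⟧ (a , q1) = at-turn (base a) (x a)
    ι′-⟦⟧ (a , q2) = refl
    ι′-⟦⟧ (a , q3) = at-turn (base a) (y a)

    vtx-ι′ : ∀ a → vtx ι′ a ≡ vtx ι (renameN r a)
    vtx-ι′ a = at-vert (base a) (x a)

    c₁ = ∧-true {k s ≡ᵇ length r} ok
    c₂ = ∧-true {distinctN (map (λ e → proj₁ (decode e)) r)} (proj₂ c₁)
    c₃ = ∧-true {every (λ e → proj₁ (decode e) <ᵇ k s′) r} (proj₂ c₂)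
    c₄ = ∧-true {preserves (k s) r (g s) (g s′)} (proj₂ c₃)
    c₅ = ∧-true {preserves (k s) r (m s) (m s′)} (proj₂ c₄)
    c₆ = ∧-true {over (S s) (m s)} (proj₂ c₅)
    c₇ = ∧-true {every (λ a → a <ᵇ k s) (S s)} (proj₂ c₆)
    c₈ = ∧-true {every (λ a → mem (renameN r a) (S s′)) (S s)} (proj₂ c₇)

    len : k s ≡ length r
    len = ≡ᵇ-sound _ _ (proj₁ c₁)

    name< : ∀ {a} → a < k s → renameN r a < k s′
    name< a< = <ᵇ-sound _ _ (every-sound _ (proj₁ c₃) (nth-∈ 0 r (subst (_ <_) len a<)))

    apart′ : Apart ι′ (k s)
    apart′ {a} {b} a< b< p = nth-injective (proj₁ (decode 0)) (map (λ e → proj₁ (decode e)) r) (proj₁ c₂)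
      (subst (a <_) (trans len (sym (length-map _ r))) a<) (subst (b <_) (trans len (sym (length-map _ r))) b<)
      (trans (nth-map (λ e → proj₁ (decode e)) 0 r a)
        (trans (apart R (name< a<) (name< b<) (trans (sym (vtx-ι′ a)) (trans p (vtx-ι′ b)))) (sym (nth-map (λ e → proj₁ (decode e)) 0 r b))))

    isJust-sound : ∀ {w e} → isJustD w e ≡ true → w ≡ just e
    isJust-sound {just d} {e} h = cong just (eqD-sound d e h)

    glued′ : ∀ {p} → p ∈ g s → Glued ι′ (k s) p
    glued′ {d , e} m∈ with ∧-true {proj₁ d <ᵇ k s} (every-sound _ (proj₁ c₄) m∈)
    ... | d< , h with ∧-true {proj₁ e <ᵇ k s} h
    ... | e< , q with glued-look R (isJust-sound {look (g s′) (renameD r d)} q)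
    ... | _ , _ , gl = <ᵇ-sound _ _ d< , <ᵇ-sound _ _ e< , trans (cong glue (ι′-⟦⟧ d)) (trans gl (sym (ι′-⟦⟧ e)))

    to : ∀ {v} → v ∈ map (vtx ι) (S s′) → v ∈ map (vtx ι′) (S s)
    to h with ∈-map⁻ (vtx ι) h
    ... | b , b∈ , refl with ∈-map⁻ (renameN r) (mem-sound b (map (renameN r) (S s)) (every-sound _ (proj₂ c₈) b∈))
    ... | a , a∈ , refl = subst (_∈ map (vtx ι′) (S s)) (vtx-ι′ a) (∈-map⁺ (vtx ι′) a∈)

    from : ∀ {v} → v ∈ map (vtx ι′) (S s) → v ∈ map (vtx ι) (S s′)
    from h with ∈-map⁻ (vtx ι′) h
    ... | a , a∈ , refl = subst (_∈ map (vtx ι) (S s′)) (sym (vtx-ι′ a))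
                            (∈-map⁺ (vtx ι) (mem-sound _ _ (every-sound _ (proj₁ c₈) a∈)))

    returns′ : ∀ {p} → p ∈ m s → Returns ι′ (S s) p
    returns′ {d , e} m∈ with ∧-true {proj₁ d <ᵇ k s} (every-sound _ (proj₁ c₅) m∈) | ∧-true {mem (proj₁ d) (S s)} (every-sound _ (proj₁ c₆) m∈)
    ... | _ , h | d∈ , e∈ with returns-look R (isJust-sound {look (m s′) (renameD r d)} (proj₂ (∧-true {proj₁ e <ᵇ k s} h)))
    ... | _ , _ , l , a = mem-sound _ _ d∈ , mem-sound _ _ e∈ , l ,
          subst₂ (Path _ l) (sym (ι′-⟦⟧ d)) (sym (ι′-⟦⟧ e)) (path-resp to from a)

    real′ : Real ι′ s
    real′ = record { apart = λ {a} {b} → apart′ {a} {b} ; glued = All.tabulate glued′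
                   ; named = All.tabulate (λ a∈ → <ᵇ-sound _ _ (every-sound _ (proj₁ c₇) a∈))
                   ; returns = All.tabulate returns′ }

  Improved : Goal → Set
  Improved triangles = ∃[ t′ ] (Eul t′ × count3 t′ < count3 t)
  Improved quads = ∃[ t′ ] (Eul t′ × (∀ d → bad3 t′ d ≡ false) × count4 t′ < count4 t)

  Avoids : Pattern → Set
  Avoids p = (v : ℕ → Fin n) → (∀ {i j} → i < order p → j < order p → v i ≡ v j → i ≡ j) →
    (∀ {i j} → (i , j) ∈ edges p → ∃[ d ] (vert d ≡ v i × vert (glue d) ≡ v j)) → ⊥

  module Check (G : Goal) (avoids : ∀ p → Avoids p) (free : isQuads G ≡ true → ∀ d → bad3 t d ≡ false) where
    -- To refute a state means to improve the system in which it occurs; an outright contradiction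
    -- is a special case.
    Refuted : State → Set
    Refuted s = ∀ ι → Real ι s → Improved G

    pattern-absurd : ∀ {ι s} p vs → Real ι s → hasPattern s p vs ≡ true → ⊥
    pattern-absurd {ι} {s} p vs R h with ∧-true {length vs ≡ᵇ order p} h
    ... | h₁ , h′ with ∧-true {distinctN vs} h′
    ... | h₂ , h″ with ∧-true {every (λ a → a <ᵇ k s) vs} h″
    ... | h₃ , h₄ = avoids p (λ i → vtx ι (nth 0 vs i))
      (λ i< j< e → nth-injective 0 vs h₂ (lt i<) (lt j<) (apart R (below (lt i<)) (below (lt j<)) e))
      (λ m∈ → edge (every-sound _ h₄ m∈))
      where
      lt : ∀ {i} → i < order p → i < length vs
      lt = subst (_ <_) (sym (≡ᵇ-sound _ _ h₁))
      below : ∀ {i} → i < length vs → nth 0 vs i < k s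
      below i< = <ᵇ-sound _ _ (every-sound _ h₃ (nth-∈ 0 vs i<))
      edge : ∀ {a b} → adjacent (g s) a b ≡ true → ∃[ d ] (vert d ≡ vtx ι a × vert (glue d) ≡ vtx ι b)
      edge e with adjacent-sound (g s) _ _ e
      ... | d , e , m∈ , refl , refl with glued-∈ R m∈
      ... | _ , _ , q = ⟦ d ⟧ ι , vert⟦⟧ ι d , trans (cong vert q) (vert⟦⟧ ι e)

    triangle-absurd : ∀ {ι s} d → Real ι s → isQuads G ≡ true → isReturn (walk3 s [] d) ≡ true → ⊥
    triangle-absurd {ι} {s} d R q h = by (walk3 s [] d) refl h
      where
      open Switch R [] refl
      by : ∀ w → walk3 s [] d ≡ w → isReturn w ≡ true → ⊥
      by (just (ys , y)) e _ with Old.walk3-sound {d} e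
      ... | (_ , _ , _ , _ , _ , _ , _ , _ , g₃) , v = true≢false (⌊⌋-yes _ (trans (cong vert g₃) v)) (free q (⟦ d ⟧ ι))

    switch-sound : ∀ {ι s} G′ → G′ ≡ G → Real ι s → ∀ f → switchable G′ s f ≡ true → Improved G′ ⊎ Live (news G′ s f)
    switch-sound {s = s} triangles e R f h with ∧-true {okChange s f} h
    ... | a , b with ∧-true {single f s} b
    ... | c , d = Switch.switch3 R f a c d
    switch-sound {s = s} quads refl R f h with ∧-true {okChange s f} h
    ... | a , b with ∧-true {single f s} b
    ... | c , d = Switch.switch4 R f a (free refl) c d

    -- Each constructor of `Proof` passes to a list of cases of which one occurs, or ends in a
    -- contradiction, or reduces to a table entry. The table is threaded through, so later parts of
    -- the tree may refer to all states completed before.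
    check-sound : ∀ {tbl tbl′ s} p → check G tbl s p ≡ just tbl′ → All Refuted tbl → Refuted s × All Refuted tbl′
    checkAll-sound : ∀ {tbl tbl′} ss ps → checkAll G tbl ss ps ≡ just tbl′ → All Refuted tbl →
                     All Refuted ss × All Refuted tbl′
    checkIf-sound : ∀ {tbl tbl′ s} b ss ps → checkIf b G tbl s ss ps ≡ just tbl′ → All Refuted tbl →
                    (b ≡ true → All Refuted ss → Refuted s) → Refuted s × All Refuted tbl′
    check-sound {s = s} (switch f ps) e T = checkIf-sound _ (news G s f) ps e T
      λ ok ref ι R → [ (λ z → z) , (λ { (s′ , ι′ , m∈ , R′) → All.lookup ref m∈ ι′ R′ }) ]′ (switch-sound G refl R f ok)
    check-sound {s = s} (include u ps) e T = checkIf-sound _ (enlarge s u) ps e T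
      λ ok ref ι R → case ∧-true {u <ᵇ k s} ok of λ { (a , b) →
        case Enlarge.enlarge-sound R (<ᵇ-sound u (k s) a) (λ m∈ → true≢false (mem-complete m∈) (not-true b)) of
          λ { (s′ , m∈ , R′ , _) → All.lookup ref m∈ ι R′ } }
    check-sound {s = s} (contains p vs) e T with hasPattern s p vs in h
    check-sound {s = s} (contains p vs) refl T | true = (λ ι R → ⊥-elim (pattern-absurd p vs R h)) , T
    check-sound {s = s} (triangle d) e T with isQuads G ∧ (proj₁ d <ᵇ k s) ∧ isReturn (walk3 s [] d) in h
    check-sound {s = s} (triangle d) refl T | true =
      (λ ι R → ⊥-elim (triangle-absurd d R (proj₁ (∧-true {isQuads G} h)) (proj₂ (∧-true {proj₁ d <ᵇ k s} (proj₂ (∧-true {isQuads G} h)))))) , T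
    check-sound {tbl} {s = s} (earlier i r) e T with embeds′ (nthState tbl i) s r in h
    check-sound {tbl} {s = s} (earlier i r) refl T | true = found (nthState tbl i) (nth-refuted tbl i T) h , T
      where
      RefutedM : Maybe State → Set
      RefutedM nothing = ⊤
      RefutedM (just s) = Refuted s
      nth-refuted : ∀ tbl i → All Refuted tbl → RefutedM (nthState tbl i)
      nth-refuted [] i T = tt
      nth-refuted (_ ∷ tbl) zero (r ∷ T) = r
      nth-refuted (_ ∷ tbl) (suc i) (r ∷ T) = nth-refuted tbl i T
      found : ∀ w → RefutedM w → embeds′ w s r ≡ true → Refuted s
      found (just s₁) ref h ι R = ref _ (Renamed.real′ R r h)
    checkAll-sound [] [] refl T = [] , T
    checkAll-sound {tbl} (s ∷ ss) (p ∷ ps) e T with check G tbl s p in h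
    ... | just tbl₁ with check-sound p h T
    ...   | r , T₁ with checkAll-sound ss ps e T₁
    ...     | rs , T₂ = r ∷ rs , T₂
    checkIf-sound {tbl} true ss ps e T k with checkAll G tbl ss ps in h
    checkIf-sound {tbl} true ss ps refl T k | just tbl₁ with checkAll-sound ss ps h T
    ... | rs , T₁ = k refl rs , k refl rs ∷ T₁

  real-point : ∀ d → ∃[ ι ] (Real ι point × ⟦ (0 , q0) ⟧ ι ≡ d)
  real-point d = (λ _ → proj₁ (frame d)) ,
    record { apart = λ { (s≤s z≤n) (s≤s z≤n) _ → refl } ; glued = [] ; named = [] ; returns = [] } , proj₂ (frame d)

  module Base₀ = Turned t []

  tracks₀ : ∀ ι s → Base₀.Tracks ι s
  tracks₀ ι s {ι′} x le R d d<k = turn⟦⟧ ι′ d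

  starts-live : ∀ G {ι s s′} → s′ ∈ enlarge s 0 → Real ι s′ → 0 < k s′ →
    (if isQuads G then bad4 t (⟦ (0 , q0) ⟧ ι) else bad3 t (⟦ (0 , q0) ⟧ ι)) ≡ true → Live (starts G s)
  starts-live triangles {ι} {s} {s′} m∈ R lt b =
    live-concat (close3 [] (0 , q0)) m∈ (Base₀.close3-sound R (tracks₀ ι s′) lt (⌊⌋-true _ b))
  starts-live quads {ι} {s} {s′} m∈ R lt b =
    live-concat (close4 [] (0 , q0)) m∈ (Base₀.close4-sound R (tracks₀ ι s′) lt (⌊⌋-true _ b))

  live-refuted : ∀ G (avoids : ∀ p → Avoids p) (free : isQuads G ≡ true → ∀ d → bad3 t d ≡ false) ss ps →
    is-just (checkAll G [] ss ps) ≡ true → Live ss → Improved G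
  live-refuted G avoids free ss ps ok (s , ι , m∈ , R) = by (checkAll G [] ss ps) refl ok
    where
    by : ∀ w → checkAll G [] ss ps ≡ w → is-just w ≡ true → Improved G
    by (just tbl) e _ = All.lookup (proj₁ (Check.checkAll-sound G avoids free ss ps e [])) m∈ ι R

  -- A start state is realised when `(0 , q0)` names a bad dart, and the checked tree refutes all
  -- start states.
  improve : ∀ G s ps → is-just (checkAll G [] (starts G s) ps) ≡ true → (∀ p → Avoids p) →
    (isQuads G ≡ true → ∀ d → bad3 t d ≡ false) →
    ∀ {ι} → Real ι s → 0 < k s → 0 ∉ S s →
    (if isQuads G then bad4 t (⟦ (0 , q0) ⟧ ι) else bad3 t (⟦ (0 , q0) ⟧ ι)) ≡ true → Improved G
  improve G s ps ok avoids free {ι} R lt 0∉ b = live-refuted G avoids free (starts G s) ps ok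
    (live (Enlarge.enlarge-sound R lt 0∉))
    where
    live : ∃[ s′ ] (s′ ∈ enlarge s 0 × Real ι s′ × k s′ ≡ k s) → Live (starts G s)
    live (s′ , m∈ , R′ , eq) = starts-live G m∈ R′ (subst (0 <_) (sym eq) lt) b

-- The darts of a quartic graph, and the existence of an Eulerian transition system.

record Listing {n : ℕ} (p : Fin n → Bool) (m : ℕ) : Set where
  field
    item     : Fin m → Fin n
    item-inj : ∀ {i j} → item i ≡ item j → i ≡ j
    item-p   : ∀ i → p (item i) ≡ true
    item-all : ∀ v → p v ≡ true → ∃[ i ] item i ≡ v
open Listing

listing : ∀ {n} (p : Fin n → Bool) → Listing p (countF p)
listing {zero} p = record { item = λ () ; item-inj = λ { {()} } ; item-p = λ () ; item-all = λ () }
listing {suc n} p with p zero in e | listing (p ∘ suc)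
... | false | L = record
  { item = suc ∘ item L ; item-inj = item-inj L ∘ FP.suc-injective ; item-p = item-p L
  ; item-all = λ { zero h → ⊥-elim (true≢false h e) ; (suc v) h → let (i , q) = item-all L v h in i , cong suc q } }
... | true | L = record { item = it ; item-inj = λ {i} {j} → inj i j ; item-p = pp ; item-all = al }
  where
  it : Fin (suc (countF (p ∘ suc))) → Fin (suc n)
  it zero = zero
  it (suc i) = suc (item L i)
  inj : ∀ i j → it i ≡ it j → i ≡ j
  inj zero zero _ = refl
  inj (suc i) (suc j) q = cong suc (item-inj L (FP.suc-injective q))
  pp : ∀ i → p (it i) ≡ true
  pp zero = e
  pp (suc i) = item-p L i
  al : ∀ v → p v ≡ true → ∃[ i ] it i ≡ v
  al zero h = zero , refl
  al (suc v) h = let (i , q) = item-all L v h in suc i , cong suc q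

toFin : Q → Fin 4
toFin q0 = zero
toFin q1 = suc zero
toFin q2 = suc (suc zero)
toFin q3 = suc (suc (suc zero))

fromFin : Fin 4 → Q
fromFin zero = q0
fromFin (suc zero) = q1
fromFin (suc (suc zero)) = q2
fromFin (suc (suc (suc zero))) = q3

from-to : ∀ i → fromFin (toFin i) ≡ i
from-to q0 = refl
from-to q1 = refl
from-to q2 = refl
from-to q3 = refl

to-from : ∀ i → toFin (fromFin i) ≡ i
to-from zero = refl
to-from (suc zero) = refl
to-from (suc (suc zero)) = refl
to-from (suc (suc (suc zero))) = refl

sum-combine : ∀ n (h : Fin (n * 4) → ℕ) → sum h ≡ sum {n} (λ u → sum {4} (λ i → h (combine u i)))
sum-combine zero h = refl
sum-combine (suc n) h = trans
  (regroup (h zero) (h (suc zero)) (h (suc (suc zero))) (h (suc (suc (suc zero)))) (sum (λ d → h (suc (suc (suc (suc d)))))))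
  (cong₂ _+_ refl (sum-combine n (λ d → h (suc (suc (suc (suc d)))))))
  where
  regroup : ∀ a b c d e → a + (b + (c + (d + e))) ≡ (a + (b + (c + (d + 0)))) + e
  regroup a b c d e rewrite +-identityʳ d | +-assoc a (b + (c + d)) e | +-assoc b (c + d) e | +-assoc c d e = refl

-- A dart is coded by its tail and the position of its head among the four neighbours. The coding is
-- opaque; later arguments use that a dart is determined by its two ends, `dart-ext`.
module Darts {n : ℕ} (G : Graph n) (quartic : Quartic G) where
  nbs : ∀ u → Listing (adj G u) 4
  nbs u = subst (Listing (adj G u)) (quartic u) (listing (adj G u))

  Dt : Set
  Dt = Fin (n * 4)

  abstract
    pack : Fin n → Fin 4 → Dt
    pack = combine {n} {4}

    tail : Dt → Fin n
    tail d = proj₁ (remQuot {n} 4 d)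

    slot : Dt → Fin 4
    slot d = proj₂ (remQuot {n} 4 d)

    tail-pack : ∀ u i → tail (pack u i) ≡ u
    tail-pack u i = cong proj₁ (FP.remQuot-combine {n} {4} u i)

    slot-pack : ∀ u i → slot (pack u i) ≡ i
    slot-pack u i = cong proj₂ (FP.remQuot-combine {n} {4} u i)

    pack-slot : ∀ d → pack (tail d) (slot d) ≡ d
    pack-slot d = FP.combine-remQuot {n} 4 d

    sum-pack : ∀ (h : Dt → ℕ) → sum h ≡ sum (λ u → sum (λ i → h (pack u i)))
    sum-pack h = sum-combine n h

  pack-inj : ∀ u {i j} → pack u i ≡ pack u j → i ≡ j
  pack-inj u {i} {j} p = trans (sym (slot-pack u i)) (trans (cong slot p) (slot-pack u j))

  adj-sym : ∀ {u v} → Adj G u v → Adj G v u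
  adj-sym {u} {v} a = trans (Graph.sym G v u) a

  adj-irr : ∀ {u v} → Adj G u v → u ≢ v
  adj-irr {u} a refl = true≢false a (irrefl G u)

  abstract
    head : Dt → Fin n
    head d = item (nbs (tail d)) (slot d)

    head-pack : ∀ u (i : Fin 4) → head (pack u i) ≡ item (nbs u) i
    head-pack u i = cong₂ (λ v j → item (nbs v) j) (tail-pack u i) (slot-pack u i)

    dart-ext : ∀ {d e} → tail d ≡ tail e → head d ≡ head e → d ≡ e
    dart-ext {d} {e} p q = trans (sym (pack-slot d))
      (trans (cong₂ pack p (item-inj (nbs (tail e)) (trans (cong (λ v → item (nbs v) (slot d)) (sym p)) q)))
        (pack-slot e))

    head-adj : ∀ d → Adj G (tail d) (head d)
    head-adj d = item-p (nbs (tail d)) (slot d)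

    dart : ∀ u v → Adj G u v → Dt
    dart u v a = pack u (proj₁ (item-all (nbs u) v a))

    tail-dart : ∀ u v a → tail (dart u v a) ≡ u
    tail-dart u v a = tail-pack u _

    head-dart : ∀ u v a → head (dart u v a) ≡ v
    head-dart u v a = trans (head-pack u _) (proj₂ (item-all (nbs u) v a))

    flip : Dt → Dt
    flip d = dart (head d) (tail d) (adj-sym (head-adj d))

    tail-flip : ∀ d → tail (flip d) ≡ head d
    tail-flip d = tail-dart _ _ _

    head-flip : ∀ d → head (flip d) ≡ tail d
    head-flip d = head-dart _ _ _

  system : System n
  system = record
    { N = n * 4
    ; vert = tail
    ; glue = flip
    ; glue-inv = λ d → dart-ext (trans (tail-flip (flip d)) (head-flip d)) (trans (head-flip (flip d)) (tail-flip d))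
    ; glue-vert = λ d p → adj-irr (head-adj d) (trans (sym p) (tail-flip d))
    ; glue-multi = λ {d} {e} p q → dart-ext p (trans (sym (tail-flip d)) (trans q (tail-flip e)))
    ; star = λ v i → pack v (toFin i)
    ; star-vert = λ v i → tail-pack v (toFin i)
    ; star-inj = λ v {i} {j} p → trans (sym (from-to i)) (trans (cong fromFin (pack-inj v p)) (from-to j))
    ; star-onto = λ d → fromFin (slot d) , trans (cong (pack (tail d)) (to-from (slot d))) (pack-slot d)
    }

  open System system using (vert; glue; glue-inv; star; star-vert; star-inj; star-onto)
  open Transitions system

  -- An arbitrary transition system, from which the merging of circuits starts.
  start : Trans
  start = record { turn = tr ; turn-vert = λ d → tail-pack (tail d) _ ; turn-inv = ti ; turn-irr = tn }
    where
    opp : Fin 4 → Fin 4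
    opp i = toFin (xr p1 (fromFin i))
    tr : Dt → Dt
    tr d = pack (tail d) (opp (slot d))
    opp-opp : ∀ i → opp (opp i) ≡ i
    opp-opp i = trans (cong (toFin ∘ xr p1) (from-to _)) (trans (cong toFin (xr-involutive p1 _)) (to-from i))
    ti : ∀ d → tr (tr d) ≡ d
    ti d = trans (cong₂ pack (tail-pack (tail d) _) (trans (cong opp (slot-pack (tail d) _)) (opp-opp (slot d))))
             (pack-slot d)
    tn : ∀ d → tr d ≢ d
    tn d p = xr-irreflexive p1 (fromFin (slot d)) (trans (sym (from-to _))
      (cong fromFin (pack-inj (tail d) (trans p (sym (pack-slot d))))))

  N : ℕ
  N = n * 4

  module Reach (t : Trans) (d₀ : Dt) where
    open Orbit t

    bounded : ∃[ m ] (m < N × it (suc m) d₀ ≡ d₀)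
    bounded with FP.pigeonhole (n<1+n N) (λ i → it (toℕ i) d₀)
    ... | i , j , i<j , p = toℕ j ∸ suc (toℕ i) , suc≤ (≤-trans (s≤s z≤n) i<j) (≤-pred (FP.toℕ<n j)) ,
        sym (it-cancel (toℕ i) _ d₀ (trans p (cong (λ x → it x d₀) (sym (trans (+-suc (toℕ i) _) (m+[n∸m]≡n i<j))))))
      where
      suc≤ : ∀ {a b} → 0 < a → a ≤ b → suc (a ∸ suc (toℕ i)) ≤ b
      suc≤ {suc a} _ h = ≤-trans (s≤s (m∸n≤m a (toℕ i))) h

    -- The orbit has a period of at most `N`, so reachability is decided by a bounded search.
    near : ∀ k → ∃[ j ] (j < N × it k d₀ ≡ it j d₀)
    near k = down k (<-wellFounded k)
      where
      per : ℕ
      per = suc (proj₁ bounded)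
      down : ∀ k → Acc _<_ k → ∃[ j ] (j < N × it k d₀ ≡ it j d₀)
      down k (acc rs) with k <? per
      ... | yes lt = k , ≤-trans lt (proj₁ (proj₂ bounded)) , refl
      ... | no ge with down (k ∸ per) (rs (∸-monoʳ-< {k} (s≤s z≤n) (≮⇒≥ ge)))
      ...   | j , j< , p = j , j< , trans (trans (cong (λ x → it x d₀) (sym (m∸n+n≡m (≮⇒≥ ge))))
                (trans (it-+ (k ∸ per) (per) d₀) (cong (it (k ∸ per)) (proj₂ (proj₂ bounded))))) p

    Hit : Dt → Fin N → Set
    Hit e k = it (toℕ k) d₀ ≡ e ⊎ it (toℕ k) d₀ ≡ glue e

    hit? : ∀ e → Dec (∃ (Hit e))
    hit? e = FP.any? λ k → (it (toℕ k) d₀ FP.≟ e) ⊎-dec (it (toℕ k) d₀ FP.≟ glue e)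

    reached : Dt → Bool
    reached e = ⌊ hit? e ⌋

    reached-complete : ∀ {e} → Conn t d₀ e → reached e ≡ true
    reached-complete {e} c with reaches c
    ... | k , h with near k
    ... | j , j<N , p = ⌊⌋-yes (hit? e) (fromℕ< j<N ,
      [ (λ q → inj₁ (trans eq q)) , (λ q → inj₂ (trans eq q)) ]′ h)
      where
      eq : it (toℕ (fromℕ< j<N)) d₀ ≡ it k d₀
      eq = trans (cong (λ x → it x d₀) (FP.toℕ-fromℕ< j<N)) (sym p)

    conn-it : ∀ k → Conn t d₀ (it k d₀)
    conn-it zero = ε
    conn-it (suc k) = conn-it k ◅◅ across ◅ around ◅ ε

    reached-sound : ∀ {e} → reached e ≡ true → Conn t d₀ e
    reached-sound {e} h with ⌊⌋-true (hit? e) h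
    ... | k , inj₁ refl = conn-it (toℕ k)
    ... | k , inj₂ p = subst (Conn t d₀) (trans (cong glue p) (glue-inv e)) (conn-it (toℕ k) ◅◅ across ◅ ε)

  -- Two trails meeting at a vertex are merged by exchanging their transitions there.
  module Merge (t : Trans) (F : Framing.Frame system t) where
    open Framing system t using (at; at-vert; at-inj; at-onto; at-turn; change; ovr-hit; ovr-off)
    open Orbit t

    t′ : Trans
    t′ = change (λ _ → F) ((0 , p2) ∷ [])

    V : List (Fin n)
    V = vert (at F q0) ∷ []

    off : ∀ z → vert z ∉ V → turn t′ z ≡ turn t z
    off z h = ovr-off (λ _ → F) ((0 , p2) ∷ []) λ { (here refl) e → h (here e) }

    path-glue : ∀ {S l d e} → Path S l d e → e ≡ glue (it l d)
    path-glue (stop _) = refl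
    path-glue {l = suc l} {d} (go _ a) = trans (path-glue a) (cong glue (it-nx l d))

    step-of : ∀ i → Conn t′ (at F i) (at F (xr p2 i))
    step-of i = subst (Step t′ (at F i)) (ovr-hit (λ _ → F) 0 p2 [] i) around ◅ ε

    turn-of : ∀ i → Conn t (at F i) (at F (xr p1 i))
    turn-of i = subst (Step t (at F i)) (at-turn F i) around ◅ ε

    module _ (apart : ¬ Conn t (at F q0) (at F q2)) where
      -- In the old system the trail from this dart can return to the vertex only at darts of its
      -- own component, that is at its partner, since `noRev` excludes the dart itself. The way back
      -- uses no transition at the vertex, so it exists in the new system too.
      home : ∀ i → (∀ j → j ≢ i → j ≡ xr p1 i ⊎ ¬ Conn t (at F i) (at F j)) → Conn t′ (at F i) (at F (xr p1 i))
      home i only = use (path-home {V} {at F i} (here (at-vert F i)))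
        where
        use : ∃[ l ] ∃[ e ] Path V l (at F i) e → Conn t′ (at F i) (at F (xr p1 i))
        use (l , e , a) = by (at-onto F e (atV (path-end a)))
          where
          atV : vert e ∈ V → vert e ≡ vert (at F q0)
          atV (here p) = p
          by : ∃[ j ] at F j ≡ e → Conn t′ (at F i) (at F (xr p1 i))
          by (j , refl) with only j (λ { refl → noRev l 0 (at F i) (trans (sym (glue-inv _)) (cong glue (sym (path-glue a)))) })
          ... | inj₁ refl = path-conn t′ off a
          ... | inj₂ none = ⊥-elim (none (path-conn t (λ _ _ → refl) a))

      home₀ : Conn t′ (at F q0) (at F q1)
      home₀ = home q0 λ { q0 h → ⊥-elim (h refl) ; q1 _ → inj₁ refl ; q2 _ → inj₂ apart
                        ; q3 _ → inj₂ λ c → apart (c ◅◅ turn-of q3) }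

      home₂ : Conn t′ (at F q2) (at F q3)
      home₂ = home q2 λ { q2 h → ⊥-elim (h refl) ; q3 _ → inj₁ refl ; q0 _ → inj₂ λ c → apart (conn-sym t c)
                        ; q1 _ → inj₂ λ c → apart (turn-of q0 ◅◅ conn-sym t c) }

      turned : ∀ i → Conn t′ (at F i) (at F (xr p1 i))
      turned q0 = home₀
      turned q1 = conn-sym t′ home₀
      turned q2 = home₂
      turned q3 = conn-sym t′ home₂

      -- An old turn at the merged vertex is replaced by the whole excursion between the two darts
      -- that it used to join.
      merge-step : ∀ {a b} → Step t a b → Conn t′ a b
      merge-step across = across ◅ ε
      merge-step {a} around = by (vert a FP.≟ vert (at F q0))
        where
        frame-step : ∃[ i ] at F i ≡ a → Conn t′ a (turn t a)
        frame-step (i , refl) = subst (Conn t′ (at F i)) (sym (at-turn F i)) (turned i)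
        by : Dec (vert a ≡ vert (at F q0)) → Conn t′ a (turn t a)
        by (no ne) = subst (Step t′ a) (off a (λ { (here e) → ne e })) around ◅ ε
        by (yes e) = frame-step (at-onto F a e)

      merge : ∀ {a b} → Conn t a b → Conn t′ a b
      merge ε = ε
      merge (s ◅ ss) = merge-step s ◅◅ merge ss

  sum-mono-< : ∀ {m} (f g : Fin m → ℕ) → (∀ i → f i ≤ g i) → ∀ i → f i < g i → sum f < sum g
  sum-mono-< {suc m} f g h zero lt = +-mono-<-≤ lt (sum-mono (f ∘ suc) (g ∘ suc) (h ∘ suc))
  sum-mono-< {suc m} f g h (suc i) lt = +-mono-≤-< (h zero) (sum-mono-< (f ∘ suc) (g ∘ suc) (h ∘ suc) i lt)

  bit-≤ : ∀ {a b} → (a ≡ true → b ≡ true) → bit a ≤ bit b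
  bit-≤ {false} h = z≤n
  bit-≤ {true} h rewrite h refl = ≤-refl

  bit-1 : ∀ b → bit b ≤ 1
  bit-1 true = ≤-refl
  bit-1 false = z≤n

  module _ (conn : ∀ u v → Star (Adj G) u v) where
    Mixed : Trans → Dt → Set
    Mixed t d₀ = ∃[ x ] ∃[ y ] (vert y ≡ vert x × Conn t d₀ x × ¬ Conn t d₀ y)

    -- Along a path in the graph from the start to a dart that is not reached, some vertex has both
    -- darts that are reached and darts that are not.
    mixed : ∀ t d₀ e → ¬ Conn t d₀ e → Mixed t d₀
    mixed t d₀ e none = walkTo (conn (vert d₀) (vert e)) (d₀ , refl , ε)
      where
      open Reach t d₀
      atVertex : ∀ x → Conn t d₀ x → Mixed t d₀ ⊎ (∀ y → vert y ≡ vert x → Conn t d₀ y)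
      atVertex x cx with anyQ? (λ i → reached (star (vert x) i) ≟B false)
        where open import Data.Bool.Properties using () renaming (_≟_ to _≟B_)
      ... | yes (i , h) = inj₁ (x , star (vert x) i , star-vert (vert x) i , cx , λ c → true≢false (reached-complete c) h)
      ... | no all = inj₂ λ y vy → let (i , q) = star-onto y in
              subst (Conn t d₀) (trans (cong (λ v → star v i) (sym vy)) q)
                (reached-sound (≡true (λ h → all (i , h))))
      walkTo : ∀ {u} → Star (Adj G) u (vert e) → (∃[ x ] (vert x ≡ u × Conn t d₀ x)) → Mixed t d₀
      walkTo ε (x , vx , cx) with atVertex x cx
      ... | inj₁ m = m
      ... | inj₂ all = ⊥-elim (none (all e (sym vx)))
      walkTo (_◅_ {u} {w} a path) (x , vx , cx) with atVertex x cx
      ... | inj₁ m = m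
      ... | inj₂ all = walkTo path (flip (dart u w a) , trans (tail-flip _) (head-dart u w a) ,
              all (dart u w a) (trans (tail-dart u w a) (sym vx)) ◅◅ across ◅ ε)

    -- The fuel bounds the number of darts not yet reached, and each merge reaches more.
    eulerian-from : ∀ t d₀ → ∀ f → N ≤ f + sum (bit ∘ Reach.reached t d₀) → ∃[ t′ ] Eul t′
    eulerian-from t d₀ f le with FP.any? (λ e → Reach.reached t d₀ e ≟B false)
      where open import Data.Bool.Properties using () renaming (_≟_ to _≟B_)
    ... | no none = t , λ d e → conn-sym t (all d) ◅◅ all e
      where
      all : ∀ e → Conn t d₀ e
      all e = Reach.reached-sound t d₀ (≡true (λ h → none (e , h)))
    ... | yes (e , h) with mixed t d₀ e (λ c → true≢false (Reach.reached-complete t d₀ c) h)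
    ... | x , y , vy , cx , ¬cy = further f le
      where
      y≢x : y ≢ x
      y≢x refl = ¬cy cx
      y≢tx : y ≢ turn t x
      y≢tx refl = ¬cy (cx ◅◅ around ◅ ε)
      module M = Merge t (Framing.frame₂ system t x y vy y≢x y≢tx)
      xy : ¬ Conn t x y
      xy c = ¬cy (cx ◅◅ c)
      kept : ∀ {z} → Conn t d₀ z → Conn M.t′ d₀ z
      kept = M.merge xy
      gained : Conn M.t′ d₀ y
      gained = kept cx ◅◅ M.step-of q0
      grows : sum (bit ∘ Reach.reached t d₀) < sum (bit ∘ Reach.reached M.t′ d₀)
      grows = sum-mono-< (bit ∘ Reach.reached t d₀) (bit ∘ Reach.reached M.t′ d₀) (λ z → bit-≤ (λ r → Reach.reached-complete M.t′ d₀ (kept (Reach.reached-sound t d₀ r)))) y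
        (subst₂ (λ a b → bit a < bit b) (sym (≡false (λ r → ¬cy (Reach.reached-sound t d₀ r))))
          (sym (Reach.reached-complete M.t′ d₀ gained)) (s≤s z≤n))
      at-most : sum (bit ∘ Reach.reached M.t′ d₀) ≤ N
      at-most = ≤-trans (sum-mono {N} (bit ∘ Reach.reached M.t′ d₀) (λ _ → 1) (λ z → bit-1 (Reach.reached M.t′ d₀ z))) (≤-reflexive (ones N))
        where
        ones : ∀ j → sum {j} (λ _ → 1) ≡ j
        ones zero = refl
        ones (suc j) = cong suc (ones j)
      further : ∀ f → N ≤ f + sum (bit ∘ Reach.reached t d₀) → ∃[ t′ ] Eul t′
      further zero le = ⊥-elim (<-irrefl refl (≤-trans (≤-trans (s≤s le) grows) at-most))
      further (suc f) le = eulerian-from M.t′ d₀ f (≤-trans le (≤-trans (≤-reflexive (sym (+-suc f _))) (+-monoʳ-≤ f grows)))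

    eulerian-exists : Fin n → ∃[ t ] Eul t
    eulerian-exists v = eulerian-from start (star v q0) N (m≤m+n N _)

-- The descent to a system without short closed trails.

module Descent {n : ℕ} (Sy : System n) where
  open System Sy
  open Transitions Sy
  open Bad Sy

  Avoiding : Pattern → Set
  Avoiding p = (v : ℕ → Fin n) → (∀ {i j} → i < order p → j < order p → v i ≡ v j → i ≡ j) →
    (∀ {i j} → (i , j) ∈ edges p → ∃[ d ] (vert d ≡ v i × vert (glue d) ≡ v j)) → ⊥

  module _ (avoids : ∀ p → Avoiding p) where
    -- The bad dart is named `(0 , q0)` in the state with a single vertex, and the certificate does
    -- the rest.
    improved : ∀ G t (eul : Eul t) → (isQuads G ≡ true → ∀ d → bad3 t d ≡ false) → ∀ d →
      (if isQuads G then bad4 t d else bad3 t d) ≡ true → Refuting.Improved Sy t eul G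
    improved G t eul free d b = use (Refuting.real-point Sy t eul d)
      where
      open Refuting Sy t eul using (Env; Real; ⟦_⟧_; Improved; improve)
      use : ∃[ ι ] (Real ι point × ⟦ (0 , q0) ⟧ ι ≡ d) → Improved G
      use (ι , R , refl) = improve G point (proj₁ (certificate G)) (proj₂ (certificate G)) avoids free
        R (s≤s z≤n) (λ ()) b

    triangle-free : ∀ t → Eul t → Acc _<_ (count3 t) → ∃[ t′ ] (Eul t′ × (∀ d → bad3 t′ d ≡ false))
    triangle-free t eul (acc rs) = by (FP.any? (λ d → vert (glue (Orbit.it t 2 d)) FP.≟ vert d))
      where
      again : ∃[ t′ ] (Eul t′ × count3 t′ < count3 t) → ∃[ t′ ] (Eul t′ × (∀ d → bad3 t′ d ≡ false))
      again (t′ , eul′ , lt) = triangle-free t′ eul′ (rs lt)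
      by : Dec (∃[ d ] (vert (glue (Orbit.it t 2 d)) ≡ vert d)) → ∃[ t′ ] (Eul t′ × (∀ d → bad3 t′ d ≡ false))
      by (no none) = t , eul , λ d → ⌊⌋-no _ (λ p → none (d , p))
      by (yes (d , p)) = again (improved triangles t eul (λ ()) d (⌊⌋-yes _ p))

    -- Freedom from closed trails of length three is part of the induction: the case analysis uses
    -- it, and each step preserves it.
    quad-free : ∀ t → Eul t → (∀ d → bad3 t d ≡ false) → Acc _<_ (count4 t) →
      ∃[ t′ ] (Eul t′ × (∀ d → bad3 t′ d ≡ false) × (∀ d → bad4 t′ d ≡ false))
    quad-free t eul free (acc rs) = by (FP.any? (λ d → vert (glue (Orbit.it t 3 d)) FP.≟ vert d))
      where
      Done : Set
      Done = ∃[ t′ ] (Eul t′ × (∀ d → bad3 t′ d ≡ false) × (∀ d → bad4 t′ d ≡ false))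
      again : ∃[ t′ ] (Eul t′ × (∀ d → bad3 t′ d ≡ false) × count4 t′ < count4 t) → Done
      again (t′ , eul′ , free′ , lt) = quad-free t′ eul′ free′ (rs lt)
      by : Dec (∃[ d ] (vert (glue (Orbit.it t 3 d)) ≡ vert d)) → Done
      by (no none) = t , eul , free , λ d → ⌊⌋-no _ (λ p → none (d , p))
      by (yes (d , p)) = again (improved quads t eul (λ _ → free) d (⌊⌋-yes _ p))

    good-system : ∀ t → Eul t → ∃[ t′ ] (Eul t′ × (∀ d → bad3 t′ d ≡ false) × (∀ d → bad4 t′ d ≡ false))
    good-system t eul = next (triangle-free t eul (<-wellFounded _))
      where
      next : ∃[ t′ ] (Eul t′ × (∀ d → bad3 t′ d ≡ false)) → _
      next (t′ , eul′ , free) = quad-free t′ eul′ free (<-wellFounded _)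

-- From a transition system to a circuit.

module Tours {n : ℕ} (G : Graph n) (quartic : Quartic G) where
  open Darts G quartic
  open Transitions system
  open Bad system

  least : ∀ t d₀ p → Acc _<_ p → Orbit.it t (suc p) d₀ ≡ d₀ →
          ∃[ p ] (Orbit.it t (suc p) d₀ ≡ d₀ × (∀ {j} → j < p → Orbit.it t (suc j) d₀ ≢ d₀))
  least t d₀ p (acc rs) e with anyUpTo? (λ j → Orbit.it t (suc j) d₀ FP.≟ d₀) p
  ... | yes (j , j<p , e′) = least t d₀ j (rs j<p) e′
  ... | no none = p , e , λ j<p e′ → none (_ , j<p , e′)

  module Build (t : Trans) (eul : Eul t) (free3 : ∀ d → bad3 t d ≡ false) (free4 : ∀ d → bad4 t d ≡ false)
               (d₀ : Dt) (p : ℕ) (cycle : Orbit.it t (suc p) d₀ ≡ d₀)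
               (minimal : ∀ {j} → j < p → Orbit.it t (suc j) d₀ ≢ d₀) where
    open Orbit t

    cycles : ∀ q → it (q * suc p) d₀ ≡ d₀
    cycles zero = refl
    cycles (suc q) = trans (it-+ (suc p) (q * suc p) d₀) (trans (cong (it (suc p)) (cycles q)) cycle)

    it-mod : ∀ k → it (k % suc p) d₀ ≡ it k d₀
    it-mod k = sym (trans (cong (λ x → it x d₀) (m≡m%n+[m/n]*n k (suc p)))
      (trans (it-+ (k % suc p) (k / suc p * suc p) d₀) (cong (it (k % suc p)) (cycles (k / suc p)))))

    injective-≤ : ∀ {i j} → i ≤ j → j < suc p → it i d₀ ≡ it j d₀ → i ≡ j
    injective-≤ {i} {j} i≤j j<p e with i ≟ j
    ... | yes q = q
    ... | no ne = ⊥-elim (minimal {j ∸ suc i} small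
        (sym (it-cancel i _ d₀ (trans e (cong (λ x → it x d₀) (sym (trans (+-suc i _) (m+[n∸m]≡n i<j))))))))
      where
      i<j : i < j
      i<j = ≤∧≢⇒< i≤j ne
      small : j ∸ suc i < p
      small = ≤-trans (≤-reflexive (trans (sym (+-∸-assoc 1 i<j)) refl)) (≤-trans (m∸n≤m j i) (≤-pred j<p))

    injective : ∀ {i j} → i < suc p → j < suc p → it i d₀ ≡ it j d₀ → i ≡ j
    injective {i} {j} i< j< e with ≤-total i j
    ... | inj₁ h = injective-≤ h j< e
    ... | inj₂ h = sym (injective-≤ h i< (sym e))

    at′ : ℕ → Fin n
    at′ k = tail (it (toℕ (fromℕ< (m%n<n k (suc p)))) d₀)

    at-it : ∀ k → at′ k ≡ tail (it k d₀)
    at-it k = trans (cong (λ x → tail (it x d₀)) (FP.toℕ-fromℕ< (m%n<n k (suc p)))) (cong tail (it-mod k))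

    next-head : ∀ k → tail (it (suc k) d₀) ≡ head (it k d₀)
    next-head k = trans (nx-vert (it k d₀)) (tail-flip _)

    at-suc : ∀ k → at′ (suc k) ≡ head (it k d₀)
    at-suc k = trans (at-it (suc k)) (next-head k)

    -- The orbit over its least period. Two traversals of an edge in the same direction would
    -- shorten the period, and two in opposite directions contradict `noRev`.
    circuit : Circuit G
    circuit = record
      { len = p
      ; vert = λ i → tail (it (toℕ i) d₀)
      ; walk = λ i _ → subst₂ (Adj G) (sym (at-it i)) (sym (at-suc i)) (head-adj (it i d₀))
      ; trail = λ i j i< j< → λ
          { (inj₁ (a , b)) → injective i< j< (dart-ext (trans (sym (at-it i)) (trans a (at-it j)))
                                               (trans (sym (at-suc i)) (trans b (at-suc j))))
          ; (inj₂ (a , b)) → ⊥-elim (noRev i j d₀ (dart-ext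
              (trans (sym (at-it i)) (trans a (trans (at-suc j) (sym (tail-flip _)))))
              (trans (sym (at-suc i)) (trans b (trans (at-it j) (sym (head-flip _))))))) }
      }

    eulerian : Eulerian circuit
    eulerian u v a with covers eul d₀ (dart u v a)
    ... | k , h = k % suc p , m%n<n k (suc p) , [ (λ q → inj₁ (same q)) , (λ q → inj₂ (reversed q)) ]′ h
      where
      e = dart u v a
      at-k : at′ (k % suc p) ≡ tail (it k d₀)
      at-k = trans (at-it (k % suc p)) (cong tail (it-mod k))
      at-k′ : at′ (suc (k % suc p)) ≡ head (it k d₀)
      at-k′ = trans (at-suc (k % suc p)) (cong head (it-mod k))
      same : it k d₀ ≡ e → at′ (k % suc p) ≡ u × at′ (suc (k % suc p)) ≡ v
      same q = trans at-k (trans (cong tail q) (tail-dart u v a)) , trans at-k′ (trans (cong head q) (head-dart u v a))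
      reversed : it k d₀ ≡ flip e → at′ (k % suc p) ≡ v × at′ (suc (k % suc p)) ≡ u
      reversed q = trans at-k (trans (cong tail q) (trans (tail-flip e) (head-dart u v a))) ,
                   trans at-k′ (trans (cong head q) (trans (head-flip e) (tail-dart u v a)))

    -- A return after one edge would be a loop, and after two edges a turn straight back in a simple
    -- graph; for three and four the system is free of them.
    no-return : ∀ i L → 1 ≤ L → L ≤ 4 → at′ i ≢ at′ (i + L)
    no-return i 1 _ _ q = adj-irr (head-adj (it i d₀)) (trans (sym (at-it i)) (trans q (trans (cong at′ (+-comm i 1)) (at-suc i))))
    no-return i 2 _ _ q = turn-irr t _ (dart-ext {it (suc i) d₀} {flip (it i d₀)}
      (trans (next-head i) (sym (tail-flip _)))
      (trans (sym (at-suc (suc i))) (trans (cong at′ (+-comm 2 i)) (trans (sym q) (trans (at-it i) (sym (head-flip _)))))))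
    no-return i 3 _ _ q = true≢false (⌊⌋-yes _ (trans (tail-flip _)
      (trans (cong head (sym (it-+ 2 i d₀))) (trans (sym (at-suc (2 + i))) (trans (cong at′ (+-comm 3 i)) (trans (sym q) (at-it i)))))))
      (free3 (it i d₀))
    no-return i 4 _ _ q = true≢false (⌊⌋-yes _ (trans (tail-flip _)
      (trans (cong head (sym (it-+ 3 i d₀))) (trans (sym (at-suc (3 + i))) (trans (cong at′ (+-comm 4 i)) (trans (sym q) (at-it i)))))))
      (free4 (it i d₀))
    no-return i (suc (suc (suc (suc (suc L))))) _ (s≤s (s≤s (s≤s (s≤s ())))) q

    avoiding : LocallySelfAvoiding 4 circuit
    avoiding i L _ L≤4 (1≤L , _ , q , _) = no-return i L 1≤L L≤4 q

  exists-tour : Connected G → (∀ p → Descent.Avoiding system p) →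
                Σ (Circuit G) (λ C → Eulerian C × LocallySelfAvoiding 4 C)
  exists-tour (v , conn) avoids = finish (good (eulerian-exists conn v))
    where
    good : ∃[ t ] Eul t → ∃[ t ] (Eul t × (∀ d → bad3 t d ≡ false) × (∀ d → bad4 t d ≡ false))
    good (t , eul) = Descent.good-system system avoids t eul
    d₀ : Dt
    d₀ = pack v zero
    build : ∀ t → Eul t → (∀ d → bad3 t d ≡ false) → (∀ d → bad4 t d ≡ false) →
      ∃[ p ] (Orbit.it t (suc p) d₀ ≡ d₀ × (∀ {j} → j < p → Orbit.it t (suc j) d₀ ≢ d₀)) →
      Σ (Circuit G) (λ C → Eulerian C × LocallySelfAvoiding 4 C)
    build t eul free₃ free₄ (p , cycle , minimal) = B.circuit , B.eulerian , B.avoiding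
      where module B = Build t eul free₃ free₄ d₀ p cycle minimal
    finish : ∃[ t ] (Eul t × (∀ d → bad3 t d ≡ false) × (∀ d → bad4 t d ≡ false)) →
      Σ (Circuit G) (λ C → Eulerian C × LocallySelfAvoiding 4 C)
    finish (t , eul , free₃ , free₄) = build t eul free₃ free₄
      (least t d₀ (proj₁ (Orbit.period t d₀)) (<-wellFounded _) (proj₂ (Orbit.period t d₀)))

-- From a circuit to a transition system, and connectedness.

module FromCircuit {n : ℕ} (G : Graph n) (quartic : Quartic G) (C : Circuit G) (euler : Eulerian C)
                   (avoid : LocallySelfAvoiding 4 C) where
  open Darts G quartic
  open System system using (glue; glue-inv)
  open Transitions system
  open Bad system

  len : ℕ
  len = Circuit.len C

  p : ℕ
  p = suc len

  at′ : ℕ → Fin n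
  at′ = Circuit.at C

  infix 4 _≈_
  record _≈_ (j k : ℕ) : Set where
    constructor congruent
    field same : j % p ≡ k % p
  open _≈_

  ≈-sym : ∀ {j k} → j ≈ k → k ≈ j
  ≈-sym (congruent e) = congruent (sym e)

  ≈-trans : ∀ {j k l} → j ≈ k → k ≈ l → j ≈ l
  ≈-trans (congruent e) (congruent f) = congruent (trans e f)

  ≡⇒≈ : ∀ {j k} → j ≡ k → j ≈ k
  ≡⇒≈ refl = congruent refl

  ≈-+ʳ : ∀ {j k} → j ≈ k → ∀ l → j + l ≈ k + l
  ≈-+ʳ {j} {k} (congruent e) l = congruent (trans (%-distribˡ-+ j l p)
    (trans (cong (λ x → (x + l % p) % p) e) (sym (%-distribˡ-+ k l p))))

  at-cong : ∀ {j k} → j ≈ k → at′ j ≡ at′ k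
  at-cong {j} {k} e = cong (Circuit.vert C) (FP.fromℕ<-cong (j % p) (k % p) (same e) (m%n<n j p) (m%n<n k p))

  ≈-suc : ∀ {j k} → j ≈ k → suc j ≈ suc k
  ≈-suc {j} {k} e = ≈-trans (≡⇒≈ (+-comm 1 j)) (≈-trans (≈-+ʳ e 1) (≡⇒≈ (+-comm k 1)))

  mod-≈ : ∀ k → k % p ≈ k
  mod-≈ k = congruent (m%n%n≡m%n k p)

  +p-≈ : ∀ k → k + p ≈ k
  +p-≈ k = congruent ([m+n]%n≡m%n k p)

  +kp-≈ : ∀ k j → k + j * p ≈ k
  +kp-≈ k j = congruent ([m+kn]%n≡m%n k j p)

  adj-at : ∀ k → Adj G (at′ k) (at′ (suc k))
  adj-at k = subst₂ (Adj G) (at-cong (mod-≈ k)) (at-cong (≈-suc {k % p} {k} (mod-≈ k))) (Circuit.walk C (k % p) (m%n<n k p))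

  c : ℕ → Dt
  c k = dart (at′ k) (at′ (suc k)) (adj-at k)

  tail-c : ∀ k → tail (c k) ≡ at′ k
  tail-c k = tail-dart _ _ _

  head-c : ∀ k → head (c k) ≡ at′ (suc k)
  head-c k = head-dart _ _ _

  c-ends : ∀ {d k} → tail d ≡ at′ k → head d ≡ at′ (suc k) → d ≡ c k
  c-ends a b = dart-ext (trans a (sym (tail-c _))) (trans b (sym (head-c _)))

  c-cong : ∀ {j k} → j ≈ k → c j ≡ c k
  c-cong {j} {k} e = c-ends (trans (tail-c j) (at-cong e)) (trans (head-c j) (at-cong (≈-suc {j} {k} e)))

  -- The circuit repeats no edge in either direction, so a dart occurs at one position modulo the
  -- length.
  unique : ∀ j k → c j ≡ c k ⊎ c j ≡ flip (c k) → j ≈ k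
  unique j k h = congruent (Circuit.trail C (j % p) (k % p) (m%n<n j p) (m%n<n k p)
    ([ (λ q → inj₁ (trans (lo j) (trans (cong tail q) (sym (lo k))) , trans (hi j) (trans (cong head q) (sym (hi k)))))
     , (λ q → inj₂ (trans (lo j) (trans (cong tail q) (trans (tail-flip _) (sym (hi k)))) ,
                    trans (hi j) (trans (cong head q) (trans (head-flip _) (sym (lo k)))))) ]′ h))
    where
    lo : ∀ j → at′ (j % p) ≡ tail (c j)
    lo j = trans (at-cong (mod-≈ j)) (sym (tail-c j))
    hi : ∀ j → at′ (suc (j % p)) ≡ head (c j)
    hi j = trans (at-cong (≈-suc {j % p} {j} (mod-≈ j))) (sym (head-c j))

  flip-irr : ∀ d → flip d ≢ d
  flip-irr d e = adj-irr (head-adj d) (trans (sym (cong tail e)) (tail-flip d))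

  never-back : ∀ j k → c j ≢ flip (c k)
  never-back j k e = flip-irr (c k) (trans (sym e) (c-cong {j} {k} (unique j k (inj₂ e))))

  index : ∀ d → ∃[ i ] (d ≡ c i ⊎ d ≡ flip (c i))
  index d with euler (tail d) (head d) (head-adj d)
  ... | i , _ , inj₁ (a , b) = i , inj₁ (c-ends (sym a) (sym b))
  ... | i , _ , inj₂ (a , b) = i , inj₂ (dart-ext (sym (trans (tail-flip (c i)) (trans (head-c i) b)))
                                                    (sym (trans (head-flip (c i)) (trans (tail-c i) a))))

  back : ∀ k → suc (k + len) ≈ k
  back k = ≈-trans (≡⇒≈ (sym (+-suc k len))) (+p-≈ k)

  -- Modulo the length, `i + len` is the position before i: a dart along which the circuit leaves is
  -- paired with the reverse of the dart before it.
  tr′ : ∀ d → ∃[ i ] (d ≡ c i ⊎ d ≡ flip (c i)) → Dt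
  tr′ d (i , inj₁ _) = flip (c (i + len))
  tr′ d (i , inj₂ _) = c (suc i)

  tr : Dt → Dt
  tr d = tr′ d (index d)

  tr-c : ∀ k → tr (c (suc k)) ≡ flip (c k)
  tr-c k = by (index (c (suc k)))
    where
    by : ∀ w → tr′ (c (suc k)) w ≡ flip (c k)
    by (i , inj₁ q) = cong flip (c-cong {i + len} {k} (pred (unique (suc k) i (inj₁ q))))
      where
      pred : suc k ≈ i → i + len ≈ k
      pred e = ≈-trans (≈-+ʳ (≈-sym e) len) (back k)
    by (i , inj₂ q) = ⊥-elim (never-back (suc k) i q)

  tr-flip : ∀ k → tr (flip (c k)) ≡ c (suc k)
  tr-flip k = by (index (flip (c k)))
    where
    by : ∀ w → tr′ (flip (c k)) w ≡ c (suc k)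
    by (i , inj₁ q) = ⊥-elim (never-back i k (sym q))
    by (i , inj₂ q) = c-cong {suc i} {suc k} (≈-suc {i} {k} (unique i k (inj₁ (trans (sym (glue-inv (c i)))
      (trans (cong flip (sym q)) (glue-inv (c k)))))))

  data View (d : Dt) : Set where
    forth : ∀ k → d ≡ c (suc k) → View d
    back′ : ∀ k → d ≡ flip (c k) → View d

  view : ∀ d → View d
  view d with index d
  ... | i , inj₁ e = forth (i + len) (trans e (c-cong {i} {suc (i + len)} (≈-sym (back i))))
  ... | i , inj₂ e = back′ i e

  t : Trans
  t = record { turn = tr ; turn-vert = tv ; turn-inv = ti ; turn-irr = tn }
    where
    meet : ∀ k → tail (flip (c k)) ≡ tail (c (suc k))
    meet k = trans (tail-flip _) (trans (head-c k) (sym (tail-c (suc k))))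
    tv : ∀ d → tail (tr d) ≡ tail d
    tv d with view d
    ... | forth k refl = trans (cong tail (tr-c k)) (meet k)
    ... | back′ k refl = trans (cong tail (tr-flip k)) (sym (meet k))
    ti : ∀ d → tr (tr d) ≡ d
    ti d with view d
    ... | forth k refl = trans (cong tr (tr-c k)) (tr-flip k)
    ... | back′ k refl = trans (cong tr (tr-flip k)) (tr-c k)
    tn : ∀ d → tr d ≢ d
    tn d e with view d
    ... | forth k refl = never-back (suc k) k (trans (sym e) (tr-c k))
    ... | back′ k refl = never-back (suc k) k (trans (sym (tr-flip k)) e)

  open Orbit t

  c-conn : ∀ k → Conn t (c 0) (c k)
  c-conn zero = ε
  c-conn (suc k) = c-conn k ◅◅ across ◅ subst (Step t (flip (c k))) (tr-flip k) around ◅ ε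

  eul : Eul t
  eul d e = conn-sym t (from d) ◅◅ from e
    where
    from : ∀ d → Conn t (c 0) d
    from d with index d
    ... | i , inj₁ refl = c-conn i
    ... | i , inj₂ refl = c-conn i ◅◅ across ◅ ε

  it-c : ∀ j k → it j (c k) ≡ c (j + k)
  it-c zero k = refl
  it-c (suc j) k = trans (cong nx (it-c j k)) (tr-flip (j + k))

  it-back : ∀ j k → it j (flip (c (j + k))) ≡ flip (c k)
  it-back zero k = refl
  it-back (suc j) k = trans (sym (it-nx j _)) (trans (cong (it j) (trans (cong tr (glue-inv _)) (tr-c (j + k)))) (it-back j k))

  Apart′ : ℕ → Set
  Apart′ m = ∀ k → at′ k ≢ at′ (k + m)

  -- A first return after L edges is a genuine subcycle, because shorter returns do not occur. A
  -- circuit shorter than L would itself be such a shorter return.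
  further : ∀ L → 1 ≤ L → L ≤ 4 → (∀ {m} → 1 ≤ m → m < L → Apart′ m) → Apart′ L
  further L 1≤L L≤4 less k e = avoid (k % p) L (m%n<n k p) L≤4 (1≤L , L≤p , at-L , distinct)
    where
    L≤p : L ≤ p
    L≤p with L ≤? p
    ... | yes h = h
    ... | no h = ⊥-elim (less (s≤s z≤n) (≰⇒> h) k (sym (at-cong (+p-≈ k))))
    at-L : at′ (k % p) ≡ at′ (k % p + L)
    at-L = trans (at-cong (mod-≈ k)) (trans e (at-cong (≈-+ʳ (≈-sym (mod-≈ k)) L)))
    below : ∀ a b → a < b → b < L → at′ (k % p + a) ≢ at′ (k % p + b)
    below a b a<b b<L q = less {b ∸ a} (m<n⇒0<n∸m a<b) (≤-trans (s≤s (m∸n≤m b a)) b<L) (k % p + a)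
      (trans q (cong at′ (trans (cong (k % p +_) (sym (m+[n∸m]≡n (<⇒≤ a<b)))) (sym (+-assoc (k % p) a (b ∸ a))))))
    distinct : ∀ a b → a < L → b < L → at′ (k % p + a) ≡ at′ (k % p + b) → a ≡ b
    distinct a b a<L b<L q with <-cmp a b

    ... | tri< lt _ _ = ⊥-elim (below a b lt b<L q)
    ... | tri≈ _ eq _ = eq
    ... | tri> _ _ gt = ⊥-elim (below b a gt a<L (sym q))

  apart₀ : ∀ {A : Set} {m} → 1 ≤ m → m < 1 → A
  apart₀ h (s≤s z≤n) = ⊥-elim (1+n≰n h)

  apart₁ : Apart′ 1
  apart₁ k e = adj-irr (adj-at k) (trans e (cong at′ (+-comm k 1)))

  apart₂ : Apart′ 2
  apart₂ k e = never-back (suc k) k (dart-ext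
    (trans (tail-c (suc k)) (sym (trans (tail-flip _) (head-c k))))
    (trans (head-c (suc k)) (trans (sym (trans e (cong at′ (+-comm k 2)))) (sym (trans (head-flip _) (tail-c k))))))

  apart₃ : Apart′ 3
  apart₃ = further 3 (s≤s z≤n) (s≤s (s≤s (s≤s z≤n))) λ
    { {suc zero} _ _ → apart₁ ; {suc (suc zero)} _ _ → apart₂ ; {suc (suc (suc m))} _ (s≤s (s≤s (s≤s ()))) }

  apart₄ : Apart′ 4
  apart₄ = further 4 (s≤s z≤n) ≤-refl λ
    { {suc zero} _ _ → apart₁ ; {suc (suc zero)} _ _ → apart₂ ; {suc (suc (suc zero))} _ _ → apart₃
    ; {suc (suc (suc (suc m)))} _ (s≤s (s≤s (s≤s (s≤s ())))) }

  -- For a dart traversed backwards the circuit is read in reverse; `l` is the position j steps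
  -- before k, modulo the length.
  no-return : ∀ j → Apart′ (suc j) → ∀ d → tail (flip (it j d)) ≢ tail d
  no-return j ap d e with index d
  ... | k , inj₁ refl = ap k (sym (trans (cong at′ (+-comm k (suc j)))
        (trans (sym (trans (tail-flip _) (trans (cong head (it-c j k)) (head-c (j + k))))) (trans e (tail-c k)))))
  ... | k , inj₂ refl = ap l (trans (sym (tail-c l)) (trans (sym (trans (tail-flip _) (trans (cong head step) (head-flip _))))
        (trans e (trans (tail-flip _) (trans (head-c k) (at-cong (≈-trans (≈-suc (≈-sym eq)) (≡⇒≈ (trans (cong suc (+-comm j l)) (sym (+-suc l j))))))))))) 
    where
    l : ℕ
    l = k + j * len
    eq : j + l ≈ k
    eq = ≈-trans (≡⇒≈ (trans (sym (+-assoc j k (j * len))) (trans (cong (_+ j * len) (+-comm j k))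
           (trans (+-assoc k j (j * len)) (cong (k +_) (sym (*-suc j len))))))) (+kp-≈ k j)
    step : it j (flip (c k)) ≡ flip (c l)
    step = trans (cong (it j ∘ flip) (sym (c-cong {j + l} {k} eq))) (it-back j l)

  free3 : ∀ d → bad3 t d ≡ false
  free3 d = ⌊⌋-no _ (no-return 2 apart₃ d)

  free4 : ∀ d → bad4 t d ≡ false
  free4 d = ⌊⌋-no _ (no-return 3 apart₄ d)

  connected : Connected G
  connected = at′ 0 , λ u v → path u v (visit u) (visit v)
    where
    visit : ∀ u → ∃[ k ] at′ k ≡ u
    visit u with index (pack u zero)
    ... | k , inj₁ e = k , trans (sym (tail-c k)) (trans (cong tail (sym e)) (tail-pack u zero))
    ... | k , inj₂ e = suc k , trans (sym (head-c k)) (trans (sym (tail-flip _)) (trans (cong tail (sym e)) (tail-pack u zero)))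
    onward : ∀ j k → Star (Adj G) (at′ k) (at′ (j + k))
    onward zero k = ε
    onward (suc j) k = onward j k ◅◅ adj-at (j + k) ◅ ε
    path : ∀ u v → ∃[ k ] at′ k ≡ u → ∃[ k ] at′ k ≡ v → Star (Adj G) u v
    path u v (j , refl) (k , refl) = subst (Star (Adj G) (at′ j)) (at-cong {k + j * len + j} {k} eq) (onward (k + j * len) j)
      where
      eq : k + j * len + j ≈ k
      eq = ≈-trans (≡⇒≈ (trans (+-assoc k (j * len) j) (cong (k +_) (trans (+-comm (j * len) j) (sym (*-suc j len)))))) (+kp-≈ k j)

-- No choice of transitions works inside F₆.

-- F₆ with the vertices x, a, b, c, d, y named 0 … 5; the darts (0 , q3) and (5 , q3) leave it.
F₆-glue : List (Dart × Dart)
F₆-glue =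
  ((0 , q0) , (1 , q0)) ∷ ((0 , q1) , (2 , q0)) ∷ ((0 , q2) , (3 , q0)) ∷ ((5 , q0) , (1 , q1)) ∷
  ((5 , q1) , (3 , q1)) ∷ ((5 , q2) , (4 , q0)) ∷ ((1 , q2) , (2 , q1)) ∷ ((1 , q3) , (4 , q1)) ∷
  ((2 , q2) , (3 , q2)) ∷ ((2 , q3) , (4 , q2)) ∷ ((3 , q3) , (4 , q3)) ∷ []

F₆-state : State
F₆-state = state 6 F₆-glue [] []

follow : ℕ → State → Changes → Dart → List Dart
follow′ : ℕ → State → Changes → Maybe Dart → List Dart
follow zero s f x = []
follow (suc n) s f x = x ∷ follow′ n s f (look (g s) x)
follow′ n s f nothing = []
follow′ n s f (just y) = follow n s f (mate f y)

stays : Changes → List Dart → Maybe Dart → Bool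
stays f W nothing = false
stays f W (just y) = memD (mate f y) W

closedUnder : State → Changes → List Dart → Bool
closedUnder s f W = every (λ x → stays f W (look (g s) x)) W

some : {A : Set} → (A → Bool) → List A → Bool
some p [] = false
some p (x ∷ xs) = p x ∨ some p xs

-- The third defect is a trail that closes up among the edges of F₆. With fuel 11, the number of
-- these edges, such a trail is followed all the way round.
flawedAt : ℕ → State → Changes → Dart → Bool
flawedAt n s f d =
  isReturn (walk3 s f d) ∨ (isReturn (walk4 s f d) ∨ (memD d (follow n s f d) ∧ closedUnder s f (follow n s f d)))

flawed : ℕ → State → Changes → Bool
flawed n s f = some (flawedAt n s f) (allDarts (k s))

eachP : (P → Bool) → Bool
eachP φ = φ p1 ∧ (φ p2 ∧ φ p3)

six : P → P → P → P → P → P → Changes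
six a b c d e f = (0 , a) ∷ (1 , b) ∷ (2 , c) ∷ (3 , d) ∷ (4 , e) ∷ (5 , f) ∷ []

abstract
  -- Evaluation of all 3^6 choices of transitions at the six vertices.
  all-flawed : (eachP λ a → eachP λ b → eachP λ c → eachP λ d → eachP λ e → eachP λ f →
                flawed 11 F₆-state (six a b c d e f)) ≡ true
  all-flawed = refl

eachP-sound : ∀ φ → eachP φ ≡ true → ∀ p → φ p ≡ true
eachP-sound φ h p1 = proj₁ (∧-true h)
eachP-sound φ h p2 = proj₁ (∧-true (proj₂ (∧-true {φ p1} h)))
eachP-sound φ h p3 = proj₂ (∧-true {φ p2} (proj₂ (∧-true {φ p1} h)))

some-sound : ∀ {A : Set} (φ : A → Bool) xs → some φ xs ≡ true → ∃[ x ] (x ∈ xs × φ x ≡ true)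
some-sound φ (x ∷ xs) h with ∨-true {φ x} h
... | inj₁ u = x , here refl , u
... | inj₂ u with some-sound φ xs u
...   | y , m , q = y , there m , q

-- Four elements have exactly three involutions without fixed points.
involution-pairing : (τ : Q → Q) → (∀ i → τ (τ i) ≡ i) → (∀ i → τ i ≢ i) → ∃[ p ] (∀ i → τ i ≡ xr p i)
involution-pairing τ inv irr = by (τ q0) refl (τ q1) refl (τ q2) refl
  where
  back : ∀ {i j} → τ i ≡ j → τ j ≡ i
  back {i} e = trans (cong τ (sym e)) (inv i)
  clash : ∀ {i j k} → τ i ≡ k → τ j ≡ k → i ≡ j
  clash {i} {j} e f = trans (sym (inv i)) (trans (cong τ (trans e (sym f))) (inv j))
  out : ∀ {i} {A : Set} → τ i ≡ i → A
  out {i} e = ⊥-elim (irr i e)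
  build : ∀ p → τ q0 ≡ xr p q0 → τ q1 ≡ xr p q1 → τ q2 ≡ xr p q2 → τ q3 ≡ xr p q3 → ∃[ p ] (∀ i → τ i ≡ xr p i)
  build p a b c d = p , λ { q0 → a ; q1 → b ; q2 → c ; q3 → d }
  by : ∀ a → τ q0 ≡ a → ∀ b → τ q1 ≡ b → ∀ c → τ q2 ≡ c → ∃[ p ] (∀ i → τ i ≡ xr p i)
  by q0 e _ _ _ _ = out e
  by q1 e _ _ q3 h = build p1 e (back e) h (back h)
  by q1 e _ _ q0 h = case clash h (back e) of λ ()
  by q1 e _ _ q1 h = case clash h e of λ ()
  by q1 e _ _ q2 h = out h
  by q2 e q3 f _ _ = build p2 e f (back e) (back f)
  by q2 e q0 f _ _ = case clash f (back e) of λ ()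
  by q2 e q1 f _ _ = out f
  by q2 e q2 f _ _ = case clash f e of λ ()
  by q3 e q2 f _ _ = build p3 e f (back f) (back e)
  by q3 e q0 f _ _ = case clash f (back e) of λ ()
  by q3 e q1 f _ _ = out f
  by q3 e q3 f _ _ = case clash f e of λ ()

pick₃? : Dec (∀ i j k → ∃[ l ] (l ≢ i × l ≢ j × l ≢ k))
pick₃? = allQ? λ i → allQ? λ j → allQ? λ k → anyQ? λ l → ¬? (l ≟Q i) ×-dec ¬? (l ≟Q j) ×-dec ¬? (l ≟Q k)

abstract
  pick₃ : (i j k : Q) → Σ Q λ l → l ≢ i × l ≢ j × l ≢ k
  pick₃ = toWitness {a? = pick₃?} _

module Labels {n : ℕ} (Sy : System n) where
  open System Sy
  open Transitions Sy

  -- Unlike a `Frame`, a label is fixed by the neighbours in F₆ and not by the transitions; the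
  -- pairing of the transitions is read off afterwards.
  record Label : Set where
    field
      lab      : Q → D
      lab-vert : ∀ i → vert (lab i) ≡ vert (lab q0)
      lab-inj  : ∀ {i j} → lab i ≡ lab j → i ≡ j
      lab-onto : ∀ x → vert x ≡ vert (lab q0) → ∃[ i ] lab i ≡ x
  open Label public

  abstract
    label : ∀ x y z → vert y ≡ vert x → vert z ≡ vert x → x ≢ y → z ≢ x → z ≢ y →
      Σ Label λ L → lab L q0 ≡ x × lab L q1 ≡ y × lab L q2 ≡ z
    label x y z vy vz x≢y z≢x z≢y = record { lab = λ i → star v (σ i)
      ; lab-vert = λ i → trans (star-vert v (σ i)) (sym (star-vert v (σ q0)))
      ; lab-inj = λ e → σ-inj _ _ (star-inj v e)
      ; lab-onto = λ w e → onto w (trans e (star-vert v (σ q0))) } , ei , ej , ek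
      where
      v : Fin n
      v = vert x
      loc : ∀ w → vert w ≡ v → ∃[ i ] star v i ≡ w
      loc w e with star-onto w
      ... | i , q = i , trans (cong (λ u → star u i) (sym e)) q
      i j k₀ l : Q
      i = proj₁ (loc x refl)
      j = proj₁ (loc y vy)
      k₀ = proj₁ (loc z vz)
      l = proj₁ (pick₃ i j k₀)
      ei : star v i ≡ x
      ei = proj₂ (loc x refl)
      ej : star v j ≡ y
      ej = proj₂ (loc y vy)
      ek : star v k₀ ≡ z
      ek = proj₂ (loc z vz)
      ne : ∀ {a b u w} → star v a ≡ u → star v b ≡ w → u ≢ w → a ≢ b
      ne p q h refl = h (trans (sym p) q)
      ij : i ≢ j
      ij = ne ei ej x≢y
      ki : k₀ ≢ i
      ki = ne ek ei z≢x
      kj : k₀ ≢ j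
      kj = ne ek ej z≢y
      li : l ≢ i
      li = proj₁ (proj₂ (pick₃ i j k₀))
      lj : l ≢ j
      lj = proj₁ (proj₂ (proj₂ (pick₃ i j k₀)))
      lk : l ≢ k₀
      lk = proj₂ (proj₂ (proj₂ (pick₃ i j k₀)))
      σ : Q → Q
      σ q0 = i
      σ q1 = j
      σ q2 = k₀
      σ q3 = l
      σ-inj : ∀ a b → σ a ≡ σ b → a ≡ b
      σ-inj q0 q0 _ = refl
      σ-inj q0 q1 e = ⊥-elim (ij e)
      σ-inj q0 q2 e = ⊥-elim (ki (sym e))
      σ-inj q0 q3 e = ⊥-elim (li (sym e))
      σ-inj q1 q0 e = ⊥-elim (ij (sym e))
      σ-inj q1 q1 _ = refl
      σ-inj q1 q2 e = ⊥-elim (kj (sym e))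
      σ-inj q1 q3 e = ⊥-elim (lj (sym e))
      σ-inj q2 q0 e = ⊥-elim (ki e)
      σ-inj q2 q1 e = ⊥-elim (kj e)
      σ-inj q2 q2 _ = refl
      σ-inj q2 q3 e = ⊥-elim (lk (sym e))
      σ-inj q3 q0 e = ⊥-elim (li e)
      σ-inj q3 q1 e = ⊥-elim (lj e)
      σ-inj q3 q2 e = ⊥-elim (lk e)
      σ-inj q3 q3 _ = refl
      onto : ∀ w → vert w ≡ v → ∃[ a ] star v (σ a) ≡ w
      onto w e with loc w e
      ... | b , q with coverQ i j k₀ l b ij ki kj li lj lk
      ... | inj₁ (inj₁ refl) = q0 , q
      ... | inj₁ (inj₂ refl) = q1 , q
      ... | inj₂ (inj₁ refl) = q2 , q
      ... | inj₂ (inj₂ refl) = q3 , q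

  fourth : ∀ (L : Label) w → vert w ≡ vert (lab L q0) → w ≢ lab L q0 → w ≢ lab L q1 → w ≢ lab L q2 → lab L q3 ≡ w
  fourth L w e a b c with lab-onto L w e
  ... | q0 , q = ⊥-elim (a (sym q))
  ... | q1 , q = ⊥-elim (b (sym q))
  ... | q2 , q = ⊥-elim (c (sym q))
  ... | q3 , q = q

  pairing-of : ∀ (t : Trans) (L : Label) → ∃[ p ] (∀ i → turn t (lab L i) ≡ lab L (xr p i))
  pairing-of t L with involution-pairing τ τ-inv τ-irr
    where
    τ : Q → Q
    τ i = proj₁ (lab-onto L (turn t (lab L i)) (trans (turn-vert t _) (lab-vert L i)))
    τ-eq : ∀ i → lab L (τ i) ≡ turn t (lab L i)
    τ-eq i = proj₂ (lab-onto L (turn t (lab L i)) (trans (turn-vert t _) (lab-vert L i)))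
    τ-inv : ∀ i → τ (τ i) ≡ i
    τ-inv i = lab-inj L (trans (τ-eq (τ i)) (trans (cong (turn t) (τ-eq i)) (turn-inv t _)))
    τ-irr : ∀ i → τ i ≢ i
    τ-irr i e = turn-irr t (lab L i) (trans (sym (τ-eq i)) (cong (lab L) e))
  ... | p , h = p , λ i → trans (sym (proj₂ (lab-onto L (turn t (lab L i)) (trans (turn-vert t _) (lab-vert L i))))) (cong (lab L) (h i))

-- None of the defects can occur in a good system. The dart `leave` follows no known edge, so the
-- single circuit cannot be confined to known edges.
module Flawed {n : ℕ} (Sy : System n) (t : Transitions.Trans Sy) (eul : Transitions.Eul Sy t)
  (free3 : ∀ d → Bad.bad3 Sy t d ≡ false) (free4 : ∀ d → Bad.bad4 Sy t d ≡ false)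
  (s : State) (f : Changes) (L : ℕ → Labels.Label Sy)
  (glues : ∀ {d e} → (d , e) ∈ g s →
    proj₁ d < k s × proj₁ e < k s × System.glue Sy (Labels.lab (L (proj₁ d)) (proj₂ d)) ≡ Labels.lab (L (proj₁ e)) (proj₂ e))
  (apart : ∀ {a b} → a < k s → b < k s →
    System.vert Sy (Labels.lab (L a) q0) ≡ System.vert Sy (Labels.lab (L b) q0) → a ≡ b)
  (pairs : ∀ a → a < k s → pairing f a ≡ proj₁ (Labels.pairing-of Sy t (L a)))
  (leave : Dart) (leave< : proj₁ leave < k s) (leaves : look (g s) leave ≡ nothing) where
  open System Sy
  open Transitions Sy
  open Labels Sy
  open Orbit t

  E : Dart → D
  E (a , i) = lab (L a) i

  ok : Dart → Set
  ok d = proj₁ d < k s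

  tr : ∀ d → ok d → turn t (E d) ≡ E (mate f d)
  tr (a , i) h = trans (proj₂ (pairing-of t (L a)) i) (cong (λ p → lab (L a) (xr p i)) (sym (pairs a h)))

  look-glue : ∀ {d e} → look (g s) d ≡ just e → ok e × glue (E d) ≡ E e
  look-glue {d} {e} q = by (look-sound (g s) d q)
    where
    by : (d , e) ∈ g s ⊎ (e , d) ∈ g s → ok e × glue (E d) ≡ E e
    by (inj₁ m) = proj₂ (glues m)
    by (inj₂ m) = proj₁ (glues m) , trans (cong glue (sym (proj₂ (proj₂ (glues m))))) (glue-inv (E e))

  same-vert : ∀ d e → proj₁ d ≡ proj₁ e → vert (E d) ≡ vert (E e)
  same-vert (a , i) (.a , j) refl = trans (lab-vert (L a) i) (sym (lab-vert (L a) j))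

  module W = Walking Sy s E ok look-glue same-vert t f tr

  E-inj : ∀ {d e} → ok d → ok e → E d ≡ E e → d ≡ e
  E-inj {a , i} {b , j} u v q with apart u v (trans (sym (lab-vert (L a) i)) (trans (cong vert q) (lab-vert (L b) j)))
  ... | refl = cong (a ,_) (lab-inj (L a) q)

  no3 : ∀ d w → walk3 s f d ≡ w → isReturn w ≡ true → ⊥
  no3 d (just (ys , y)) e _ with W.walk3-sound {d} e
  ... | (_ , _ , _ , _ , _ , _ , _ , _ , g₃) , v = true≢false (⌊⌋-yes _ (trans (cong vert g₃) v)) (free3 (E d))

  no4 : ∀ d w → walk4 s f d ≡ w → isReturn w ≡ true → ⊥
  no4 d (just (ys , y)) e _ with W.walk4-sound {d} e
  ... | (_ , _ , _ , _ , _ , _ , _ , _ , _ , _ , _ , g₄) , v = true≢false (⌊⌋-yes _ (trans (cong vert g₄) v)) (free4 (E d))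

  -- A trail inside W never reaches the dart leave.
  confined : ∀ W d → ok d → d ∈ W → closedUnder s f W ≡ true → ⊥
  confined W d d< d∈ h = by (covers eul (E d) (E leave))
    where
    next : ∀ {x} → x ∈ W → ∃[ y ] (look (g s) x ≡ just y × mate f y ∈ W)
    next {x} m∈ = from (look (g s) x) refl (every-sound (λ x → stays f W (look (g s) x)) h m∈)
      where
      from : ∀ w → look (g s) x ≡ w → stays f W w ≡ true → ∃[ y ] (look (g s) x ≡ just y × mate f y ∈ W)
      from (just y) e q = y , e , memD-sound _ W q
    within : ∀ j → ∃[ x ] (x ∈ W × ok x × it j (E d) ≡ E x)
    within zero = d , d∈ , d< , refl
    within (suc j) with within j
    ... | x , m∈ , x< , q with next m∈
    ... | y , e , m′ with look-glue {x} e
    ... | y< , gl = mate f y , m′ , y< , trans (cong nx q) (trans (cong (turn t) gl) (tr y y<))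
    by : ∃[ j ] (it j (E d) ≡ E leave ⊎ it j (E d) ≡ glue (E leave)) → ⊥
    by (j , h) with within j
    ... | x , m∈ , x< , q with next m∈
    ... | y , e , _ with look-glue {x} e
    ... | y< , gl = [ first , second ]′ h
      where
      first : it j (E d) ≡ E leave → ⊥
      first r with E-inj {x} {leave} x< leave< (trans (sym q) r)
      ... | refl = case trans (sym leaves) e of λ ()
      second : it j (E d) ≡ glue (E leave) → ⊥
      second r with E-inj {y} {leave} y< leave< (trans (sym gl) (trans (cong glue (trans (sym q) r)) (glue-inv (E leave))))
      ... | refl = look-none (g s) leave leaves ([ inj₂ , inj₁ ]′ (look-sound (g s) x e))

  absurd : ∀ fuel → flawed fuel s f ≡ true → ⊥
  absurd fuel found = at-dart (some-sound (flawedAt fuel s f) (allDarts (k s)) found)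
    where
    at-dart : ∃[ d ] (d ∈ allDarts (k s) × flawedAt fuel s f d ≡ true) → ⊥
    at-dart (d , m∈ , h) = [ no3 d _ refl , (λ u → [ no4 d _ refl , (λ v →
      confined (follow fuel s f d) d (allDarts-name (k s) m∈) (memD-sound d _ (proj₁ (∧-true v)))
        (proj₂ (∧-true {memD d (follow fuel s f d)} v))) ]′ (∨-true {isReturn (walk4 s f d)} u)) ]′
      (∨-true {isReturn (walk3 s f d)} h)

flawed-six : ∀ a b c d e f → flawed 11 F₆-state (six a b c d e f) ≡ true
flawed-six a b c d e f =
  eachP-sound (λ z → flawed 11 F₆-state (six a b c d e z))
    (eachP-sound (λ y → eachP λ z → flawed 11 F₆-state (six a b c d y z))
    (eachP-sound (λ x → eachP λ y → eachP λ z → flawed 11 F₆-state (six a b c x y z))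
    (eachP-sound (λ w → eachP λ x → eachP λ y → eachP λ z → flawed 11 F₆-state (six a b w x y z))
    (eachP-sound (λ v → eachP λ w → eachP λ x → eachP λ y → eachP λ z → flawed 11 F₆-state (six a v w x y z))
    (eachP-sound (λ u → eachP λ v → eachP λ w → eachP λ x → eachP λ y → eachP λ z → flawed 11 F₆-state (six u v w x y z))
      all-flawed a) b) c) d) e) f

fin6 : ℕ → Fin 6
fin6 0 = zero
fin6 1 = suc zero
fin6 2 = suc (suc zero)
fin6 3 = suc (suc (suc zero))
fin6 4 = suc (suc (suc (suc zero)))
fin6 _ = suc (suc (suc (suc (suc zero))))

fin6-toℕ : ∀ {a} → a < 6 → toℕ (fin6 a) ≡ a
fin6-toℕ {0} _ = refl
fin6-toℕ {1} _ = refl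
fin6-toℕ {2} _ = refl
fin6-toℕ {3} _ = refl
fin6-toℕ {4} _ = refl
fin6-toℕ {5} _ = refl
fin6-toℕ {suc (suc (suc (suc (suc (suc a)))))} (s≤s (s≤s (s≤s (s≤s (s≤s (s≤s ()))))))

module Six {n : ℕ} (G : Graph n) (quartic : Quartic G) (φ₆ : Fin 6 → Fin n) (φ-inj : Injective _≡_ _≡_ φ₆)
           (φ-adj : ∀ i j → F6edges i j ≡ true → Adj G (φ₆ i) (φ₆ j)) where
  open Darts G quartic
  open Transitions system
  open Bad system
  open Labels system

  v : ℕ → Fin n
  v a = φ₆ (fin6 a)

  v-inj : ∀ {a b} → a < 6 → b < 6 → v a ≡ v b → a ≡ b
  v-inj a< b< e = trans (sym (fin6-toℕ a<)) (trans (cong toℕ (φ-inj e)) (fin6-toℕ b<))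

  lt : ∀ {a} → (a <ᵇ 6) ≡ true → a < 6
  lt {a} = <ᵇ-sound a 6

  differ : ∀ a b → (a <ᵇ 6) ≡ true → (b <ᵇ 6) ≡ true → (a ≡ᵇ b) ≡ false → v a ≢ v b
  differ a b p q r e = true≢false (trans (cong (_≡ᵇ b) (v-inj (lt {a} p) (lt {b} q) e)) (≡ᵇ-refl b)) r

  To : Fin n → Dt → Fin n → Set
  To u d w = tail d ≡ u × head d ≡ w

  to-dart : ∀ {u w} (a : Adj G u w) → To u (dart u w a) w
  to-dart a = tail-dart _ _ a , head-dart _ _ a

  -- Three neighbours are prescribed; a fourth one must then be at the end of the remaining dart
  -- `q3`.
  record Star₃ (u x y z : Fin n) : Set where
    field
      L  : Label
      s₀ : To u (lab L q0) x
      s₁ : To u (lab L q1) y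
      s₂ : To u (lab L q2) z
    s₃ : ∀ {w} → Adj G u w → w ≢ x → w ≢ y → w ≢ z → To u (lab L q3) w
    s₃ {w} a nx ny nz = subst (λ d → To u d w) (sym (fourth L (dart u w a) (trans (tail-dart u w a) (sym (proj₁ s₀)))
      (no-eq nx s₀) (no-eq ny s₁) (no-eq nz s₂))) (to-dart a)
      where
      no-eq : ∀ {d x} → w ≢ x → To u d x → dart u w a ≢ d
      no-eq ne (_ , h) refl = ne (trans (sym (head-dart u w a)) h)

  star₃ : ∀ {u x y z} → Adj G u x → Adj G u y → Adj G u z → x ≢ y → z ≢ x → z ≢ y → Star₃ u x y z
  star₃ {u} {x} {y} {z} a b c x≢y z≢x z≢y with label (dart u x a) (dart u y b) (dart u z c)
      (trans (tail-dart u y b) (sym (tail-dart u x a))) (trans (tail-dart u z c) (sym (tail-dart u x a)))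
      (apart a b x≢y) (apart c a z≢x) (apart c b z≢y)
    where
    apart : ∀ {x y} (a : Adj G u x) (b : Adj G u y) → x ≢ y → dart u x a ≢ dart u y b
    apart a b ne e = ne (trans (sym (head-dart _ _ a)) (trans (cong head e) (head-dart _ _ b)))
  ... | L , e₀ , e₁ , e₂ = record { L = L ; s₀ = subst (λ d → To u d x) (sym e₀) (to-dart a)
        ; s₁ = subst (λ d → To u d y) (sym e₁) (to-dart b) ; s₂ = subst (λ d → To u d z) (sym e₂) (to-dart c) }
  open Star₃

  A : ∀ a b → F6edges (fin6 a) (fin6 b) ≡ true → Adj G (v a) (v b)
  A a b e = φ-adj (fin6 a) (fin6 b) e

  A′ : ∀ a b → F6edges (fin6 a) (fin6 b) ≡ true → Adj G (v b) (v a)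
  A′ a b e = adj-sym (A a b e)

  S0 : Star₃ (v 0) (v 1) (v 2) (v 3)
  S0 = star₃ (A 0 1 refl) (A 0 2 refl) (A 0 3 refl) (differ 1 2 refl refl refl) (differ 3 1 refl refl refl) (differ 3 2 refl refl refl)

  S1 : Star₃ (v 1) (v 0) (v 5) (v 2)
  S1 = star₃ (A′ 0 1 refl) (A′ 5 1 refl) (A 1 2 refl) (differ 0 5 refl refl refl) (differ 2 0 refl refl refl) (differ 2 5 refl refl refl)

  S2 : Star₃ (v 2) (v 0) (v 1) (v 3)
  S2 = star₃ (A′ 0 2 refl) (A′ 1 2 refl) (A 2 3 refl) (differ 0 1 refl refl refl) (differ 3 0 refl refl refl) (differ 3 1 refl refl refl)

  S3 : Star₃ (v 3) (v 0) (v 5) (v 2)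
  S3 = star₃ (A′ 0 3 refl) (A′ 5 3 refl) (A′ 2 3 refl) (differ 0 5 refl refl refl) (differ 2 0 refl refl refl) (differ 2 5 refl refl refl)

  S4 : Star₃ (v 4) (v 5) (v 1) (v 2)
  S4 = star₃ (A′ 5 4 refl) (A′ 1 4 refl) (A′ 2 4 refl) (differ 5 1 refl refl refl) (differ 2 5 refl refl refl) (differ 2 1 refl refl refl)

  S5 : Star₃ (v 5) (v 1) (v 3) (v 4)
  S5 = star₃ (A 5 1 refl) (A 5 3 refl) (A 5 4 refl) (differ 1 3 refl refl refl) (differ 4 1 refl refl refl) (differ 4 3 refl refl refl)

  Ls : ℕ → Label
  Ls 0 = L S0
  Ls 1 = L S1
  Ls 2 = L S2
  Ls 3 = L S3
  Ls 4 = L S4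
  Ls _ = L S5

  tails : ∀ {a} → a < 6 → tail (lab (Ls a) q0) ≡ v a
  tails {0} _ = proj₁ (s₀ S0)
  tails {1} _ = proj₁ (s₀ S1)
  tails {2} _ = proj₁ (s₀ S2)
  tails {3} _ = proj₁ (s₀ S3)
  tails {4} _ = proj₁ (s₀ S4)
  tails {5} _ = proj₁ (s₀ S5)
  tails {suc (suc (suc (suc (suc (suc a)))))} (s≤s (s≤s (s≤s (s≤s (s≤s (s≤s ()))))))

  Glue : Dart × Dart → Set
  Glue (d , e) = proj₁ d < 6 × proj₁ e < 6 × flip (lab (Ls (proj₁ d)) (proj₂ d)) ≡ lab (Ls (proj₁ e)) (proj₂ e)

  join′ : ∀ {u w d e} → To u d w → To w e u → flip d ≡ e
  join′ {d = d} (a , b) (a′ , b′) = dart-ext (trans (tail-flip d) (trans b (sym a′))) (trans (head-flip d) (trans a (sym b′)))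

  s₃-1 = s₃ S1 (A 1 4 refl) (differ 4 0 refl refl refl) (differ 4 5 refl refl refl) (differ 4 2 refl refl refl)
  s₃-2 = s₃ S2 (A 2 4 refl) (differ 4 0 refl refl refl) (differ 4 1 refl refl refl) (differ 4 3 refl refl refl)
  s₃-3 = s₃ S3 (A 3 4 refl) (differ 4 0 refl refl refl) (differ 4 5 refl refl refl) (differ 4 2 refl refl refl)
  s₃-4 = s₃ S4 (A′ 3 4 refl) (differ 3 5 refl refl refl) (differ 3 1 refl refl refl) (differ 3 2 refl refl refl)

  all-glued : All Glue F₆-glue
  all-glued =
    (lt refl , lt refl , join′ (s₀ S0) (s₀ S1)) ∷ (lt refl , lt refl , join′ (s₁ S0) (s₀ S2)) ∷
    (lt refl , lt refl , join′ (s₂ S0) (s₀ S3)) ∷ (lt refl , lt refl , join′ (s₀ S5) (s₁ S1)) ∷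
    (lt refl , lt refl , join′ (s₁ S5) (s₁ S3)) ∷ (lt refl , lt refl , join′ (s₂ S5) (s₀ S4)) ∷
    (lt refl , lt refl , join′ (s₂ S1) (s₁ S2)) ∷ (lt refl , lt refl , join′ s₃-1 (s₁ S4)) ∷
    (lt refl , lt refl , join′ (s₂ S2) (s₂ S3)) ∷ (lt refl , lt refl , join′ s₃-2 (s₂ S4)) ∷
    (lt refl , lt refl , join′ s₃-3 s₃-4) ∷ []

  module _ (t : Trans) (eul : Eul t) (free3 : ∀ d → bad3 t d ≡ false) (free4 : ∀ d → bad4 t d ≡ false) where
    ps : ℕ → P
    ps a = proj₁ (pairing-of t (Ls a))

    pairs : ∀ a → a < 6 → pairing (six (ps 0) (ps 1) (ps 2) (ps 3) (ps 4) (ps 5)) a ≡ ps a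
    pairs 0 _ = refl
    pairs 1 _ = refl
    pairs 2 _ = refl
    pairs 3 _ = refl
    pairs 4 _ = refl
    pairs 5 _ = refl
    pairs (suc (suc (suc (suc (suc (suc a)))))) (s≤s (s≤s (s≤s (s≤s (s≤s (s≤s ()))))))

    -- The dart `(0 , q3)` is the one at x that follows none of the eleven edges.
    impossible : ⊥
    impossible = Flawed.absurd system t eul free3 free4 F₆-state (six (ps 0) (ps 1) (ps 2) (ps 3) (ps 4) (ps 5)) Ls
      (λ m∈ → All.lookup all-glued m∈)
      (λ a< b< e → v-inj a< b< (trans (sym (tails a<)) (trans e (tails b<))))
      pairs (0 , q3) (s≤s z≤n) refl 11 (flawed-six (ps 0) (ps 1) (ps 2) (ps 3) (ps 4) (ps 5))

no-F₆ : ∀ {n} (G : Graph n) → Quartic G → (C : Circuit G) → Eulerian C → LocallySelfAvoiding 4 C → ¬ ContainsF6 G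
no-F₆ G quartic C euler avoid (φ₆ , inj , adj₆) = Six.impossible G quartic φ₆ inj adj₆ F.t F.eul F.free3 F.free4
  where module F = FromCircuit G quartic C euler avoid

module F₆-Pattern where
  open import Data.Product.Properties using (≡-dec)
  open import Data.List.Membership.DecPropositional (≡-dec _≟_ _≟_) using (_∈?_)
  open import Data.Bool.Properties using () renaming (_≟_ to _≟B_)

  F6-edge? : Dec (∀ (i j : Fin 6) → F6edges i j ≡ true → (toℕ i , toℕ j) ∈ edges F₆)
  F6-edge? = FP.all? λ i → FP.all? λ j → (F6edges i j ≟B true) →-dec ((toℕ i , toℕ j) ∈? edges F₆)

  F6-edge : ∀ (i j : Fin 6) → F6edges i j ≡ true → (toℕ i , toℕ j) ∈ edges F₆
  F6-edge = toWitness {a? = F6-edge?} _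

-- Identifications, and the counting of vertices, edges and faces.

≤ᵇ-true : ∀ {a b} → a ≤ b → (a ≤ᵇ b) ≡ true
≤ᵇ-true h = Equivalence.to T-≡ (≤⇒≤ᵇ h)

≤ᵇ-sound : ∀ a b → (a ≤ᵇ b) ≡ true → a ≤ b
≤ᵇ-sound a b e = ≤ᵇ⇒≤ a b (Equivalence.from T-≡ e)

≤ᵇ-false : ∀ a b → b < a → (a ≤ᵇ b) ≡ false
≤ᵇ-false a b h = ≡false λ e → <-irrefl refl (≤-trans h (≤ᵇ-sound a b e))

-- The quotient map that identifies x with y, realised by deleting y.
identify : ∀ {N} (x y : Fin (suc N)) → x ≢ y → Fin (suc N) → Fin N
identify x y x≢y z with y FP.≟ z
... | yes _ = punchOut {i = y} {j = x} (x≢y ∘ sym)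
... | no ne = punchOut ne

identify-in : ∀ {N} (x y : Fin (suc N)) x≢y c → identify x y x≢y (punchIn y c) ≡ c
identify-in x y x≢y c with y FP.≟ punchIn y c
... | yes e = ⊥-elim (FP.punchInᵢ≢i y c (sym e))
... | no ne = trans (FP.punchOut-cong y refl) (FP.punchOut-punchIn y)

identify-≡ : ∀ {N} (x y : Fin (suc N)) x≢y → identify x y x≢y x ≡ identify x y x≢y y
identify-≡ x y x≢y with y FP.≟ x | y FP.≟ y
... | yes e | _ = ⊥-elim (x≢y (sym e))
... | no _ | yes _ = FP.punchOut-cong y refl
... | no _ | no ne = ⊥-elim (ne refl)

-- Fewer than N - 1 identifications leave at least two classes.
two-classes : ∀ l {N} (ps : List (Fin N × Fin N)) → length ps ≡ l → l + 2 ≤ N →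
  Σ (Fin N → Bool) λ s → (∀ {x y} → (x , y) ∈ ps → s x ≡ s y) × (∃[ x ] ∃[ y ] s x ≢ s y)
two-classes zero {suc (suc N)} [] _ h = (λ { zero → true ; (suc _) → false }) , (λ ()) , zero , suc zero , λ ()
two-classes zero {suc zero} [] _ (s≤s ())
two-classes (suc l) {suc N} ((x , y) ∷ ps) eq (s≤s h) with x FP.≟ y
... | yes refl with two-classes l ps (suc-injective eq) (m≤n⇒m≤1+n h)
...   | s , r , nc = s , (λ { (here refl) → refl ; (there m∈) → r m∈ }) , nc
two-classes (suc l) {suc N} ((x , y) ∷ ps) eq (s≤s h) | no x≢y
  with two-classes l (map (λ p → identify x y x≢y (proj₁ p) , identify x y x≢y (proj₂ p)) ps)
         (trans (length-map _ ps) (suc-injective eq)) h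
... | s , r , a , b , ne = s ∘ identify x y x≢y ,
        (λ { (here refl) → cong s (identify-≡ x y x≢y)
           ; (there m∈) → r (∈-map⁺ (λ p → identify x y x≢y (proj₁ p) , identify x y x≢y (proj₂ p)) m∈) }) ,
        punchIn y a , punchIn y b ,
        λ e → ne (trans (cong s (sym (identify-in x y x≢y a))) (trans e (cong s (identify-in x y x≢y b))))

select : ∀ {N} → (Fin N → Bool) → List (Fin N)
select {zero} q = []
select {suc N} q = if q zero then zero ∷ map suc (select (q ∘ suc)) else map suc (select (q ∘ suc))

select-length : ∀ {N} (q : Fin N → Bool) → length (select q) ≡ sum (bit ∘ q)
select-length {zero} q = refl
select-length {suc N} q with q zero
... | true = cong suc (trans (length-map Fin.suc (select (q ∘ suc))) (select-length (q ∘ suc)))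
... | false = trans (length-map Fin.suc (select (q ∘ suc))) (select-length (q ∘ suc))

select-∈ : ∀ {N} (q : Fin N → Bool) {i} → q i ≡ true → i ∈ select q
select-∈ {suc N} q {zero} h rewrite h = here refl
select-∈ {suc N} q {suc i} h with q zero
... | true = there (∈-map⁺ suc (select-∈ (q ∘ suc) h))
... | false = ∈-map⁺ suc (select-∈ (q ∘ suc) h)

sum-const : ∀ {m} (h : Fin m → ℕ) c → (∀ i → h i ≡ c) → sum h ≡ m * c
sum-const {zero} h c e = refl
sum-const {suc m} h c e = cong₂ _+_ (e zero) (sum-const (h ∘ suc) c (e ∘ suc))

countF-sum : ∀ {m} (q : Fin m → Bool) → countF q ≡ sum (bit ∘ q)
countF-sum {zero} q = refl
countF-sum {suc m} q = cong (bit (q zero) +_) (countF-sum (q ∘ suc))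

sum-pick : ∀ {m} (i : Fin m) (h : Fin m → ℕ) → sum (λ j → bit ⌊ i FP.≟ j ⌋ * h j) ≡ h i
sum-pick {suc m} zero h = trans (cong₂ _+_ (+-identityʳ (h zero)) (sum-zero m)) (+-identityʳ (h zero))
sum-pick {suc m} (suc i) h = trans (sum-cong (λ j → bit ⌊ Fin.suc i FP.≟ suc j ⌋ * h (suc j)) (λ j → bit ⌊ i FP.≟ j ⌋ * h (suc j)) (λ j → cong (λ b → bit b * h (suc j)) (lem j))) (sum-pick i (h ∘ suc))
  where
  lem : ∀ j → ⌊ Fin.suc i FP.≟ suc j ⌋ ≡ ⌊ i FP.≟ j ⌋
  lem j with i FP.≟ j
  ... | yes _ = refl
  ... | no _ = refl

-- A sum over the members of a listing, for a predicate that implies membership.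
sum-listing : ∀ {m r} {p : Fin m → Bool} (L : Listing p r) (q : Fin m → Bool) → (∀ v → q v ≡ true → p v ≡ true) →
              countF q ≡ sum (λ i → bit (q (item L i)))
sum-listing {m} {r} {p} L q q⇒p = begin
  countF q                                                    ≡⟨ countF-sum q ⟩
  sum (λ v → bit (q v))                                       ≡⟨ sum-cong (λ v → bit (q v)) (λ v → sum (λ i → bit ⌊ item L i FP.≟ v ⌋ * bit (q v))) (λ v → sym (inner v)) ⟩
  sum (λ v → sum (λ i → bit ⌊ item L i FP.≟ v ⌋ * bit (q v))) ≡⟨ ∑-comm (λ v i → bit ⌊ item L i FP.≟ v ⌋ * bit (q v)) ⟩
  sum (λ i → sum (λ v → bit ⌊ item L i FP.≟ v ⌋ * bit (q v))) ≡⟨ sum-cong (λ i → sum (λ v → bit ⌊ item L i FP.≟ v ⌋ * bit (q v))) (λ i → bit (q (item L i))) (λ i → sum-pick (item L i) (bit ∘ q)) ⟩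
  sum (λ i → bit (q (item L i)))                              ∎
  where
  open ≡-Reasoning
  inner : ∀ v → sum (λ i → bit ⌊ item L i FP.≟ v ⌋ * bit (q v)) ≡ bit (q v)
  inner v with q v in e
  ... | false = trans (sum-cong (λ i → bit ⌊ item L i FP.≟ v ⌋ * 0) (λ _ → 0) (λ i → *-zeroʳ (bit ⌊ item L i FP.≟ v ⌋))) (sum-zero r)
  ... | true with item-all L v (q⇒p v e)
  ...   | j , refl = trans (sum-cong (λ i → bit ⌊ item L i FP.≟ item L j ⌋ * 1) (λ i → bit ⌊ j FP.≟ i ⌋) same) (sum-single j)
    where
    same : ∀ i → bit ⌊ item L i FP.≟ item L j ⌋ * 1 ≡ bit ⌊ j FP.≟ i ⌋
    same i with item L i FP.≟ item L j | j FP.≟ i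
    ... | yes _ | yes _ = refl
    ... | yes u | no ne = ⊥-elim (ne (sym (item-inj L u)))
    ... | no ne | yes refl = ⊥-elim (ne refl)
    ... | no _ | no _ = refl

-- The summation local to numFaces (numEdges) is captured by unification: abstracting its argument
-- makes the equation below determine X.
module FaceSum (E : ∀ m → Graph m) (R : ∀ m → Rotation (E m)) where
  mutual
    X : (m : ℕ) → (Fin m → ℕ) → ℕ
    X = _

    X-is : ∀ m → numFaces (E m) (R m) ≡ X m (λ u → countF (faceRep (E m) (R m) u))
    X-is m with (λ u → countF (faceRep (E m) (R m) u))
    ... | w = refl {x = X m w}

  X-sum : ∀ m h → X m h ≡ sum h
  X-sum zero h = refl
  X-sum (suc m) h = cong (h zero +_) (X-sum m (h ∘ suc))

module EdgeSum (E : ∀ m → Graph m) where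
  mutual
    X : (m : ℕ) → (Fin m → ℕ) → ℕ
    X = _

    X-is : ∀ m → numEdges (E m) ≡ X m (λ u → countF (λ v → adj (E m) u v ∧ (suc (toℕ u) ≤ᵇ toℕ v)))
    X-is m with (λ u → countF (λ v → adj (E m) u v ∧ (suc (toℕ u) ≤ᵇ toℕ v)))
    ... | w = refl {x = X m w}

  X-sum : ∀ m h → X m h ≡ sum h
  X-sum zero h = refl
  X-sum (suc m) h = cong (h zero +_) (X-sum m (h ∘ suc))

edgeless : ∀ m → Graph m
edgeless m = record { adj = λ _ _ → false ; sym = λ _ _ → refl ; irrefl = λ _ → refl }

rotationless : ∀ m → Rotation (edgeless m)
rotationless m = record { rot = λ _ v → v ; rot-adj = λ _ _ () ; rot-inj = λ _ _ _ () ; rot-cyc = λ _ _ _ () }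

numFaces-sum : ∀ {n} (G : Graph n) (R : Rotation G) → numFaces G R ≡ sum (λ u → countF (faceRep G R u))
numFaces-sum {n} G R = FaceSum.X-sum edgeless rotationless n (λ u → countF (faceRep G R u))

numEdges-sum : ∀ {n} (G : Graph n) → numEdges G ≡ sum (λ u → countF (λ v → adj G u v ∧ (suc (toℕ u) ≤ᵇ toℕ v)))
numEdges-sum {n} G = EdgeSum.X-sum edgeless n (λ u → countF (λ v → adj G u v ∧ (suc (toℕ u) ≤ᵇ toℕ v)))

allF-complete : ∀ {m} (q : Fin m → Bool) → (∀ i → q i ≡ true) → allF q ≡ true
allF-complete {zero} q h = refl
allF-complete {suc m} q h = ∧-intro (h zero) (allF-complete (q ∘ suc) (h ∘ suc))

anyF-complete : ∀ {m} (q : Fin m → Bool) i → q i ≡ true → anyF q ≡ true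
anyF-complete {suc m} q zero h rewrite h = refl
anyF-complete {suc m} q (suc i) h with q zero
... | true = refl
... | false = anyF-complete (q ∘ suc) i h

countF-none : ∀ {m} (q : Fin m → Bool) → (∀ i → q i ≡ false) → countF q ≡ 0
countF-none {zero} q h = refl
countF-none {suc m} q h rewrite h zero = countF-none (q ∘ suc) (h ∘ suc)

or-true : ∀ b → not b ∨ true ≡ true
or-true true = refl
or-true false = refl

components≥1 : ∀ {n} (G : Graph (suc n)) → 1 ≤ numComponents G
components≥1 {n} G
  rewrite allF-complete {suc n} (λ w → not (reachB G (suc n) zero w) ∨ (0 ≤ᵇ toℕ w)) (λ w → or-true (reachB G (suc n) zero w)) =
  s≤s z≤n

module Counting {n : ℕ} (G : Graph n) (quartic : Quartic G) where
  open Darts G quartic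

  -- Counts over ordered pairs of vertices become counts over darts, in which faces and edges are
  -- compared below.
  sum-darts : ∀ (q : Fin n → Fin n → Bool) → (∀ u v → q u v ≡ true → adj G u v ≡ true) →
              sum (λ u → countF (q u)) ≡ sum (λ d → bit (q (tail d) (head d)))
  sum-darts q q⇒ = trans
    (sum-cong (λ u → countF (q u)) (λ u → sum (λ i → bit (q (tail (pack u i)) (head (pack u i))))) (λ u →
      trans (sum-listing (nbs u) (q u) (q⇒ u))
        (sum-cong (λ i → bit (q u (item (nbs u) i))) (λ i → bit (q (tail (pack u i)) (head (pack u i))))
          (λ i → cong₂ (λ a b → bit (q a b)) (sym (tail-pack u i)) (sym (head-pack u i))))))
    (sym (sum-pack (λ d → bit (q (tail d) (head d)))))

  sum-flip : ∀ (h : Dt → ℕ) → sum h ≡ sum (h ∘ flip)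
  sum-flip h = sum-permute h (permutation flip flip (System.glue-inv system) (System.glue-inv system))

  all-darts : sum {N} (λ _ → 1) ≡ N
  all-darts = trans (sum-const {N} (λ _ → 1) 1 (λ _ → refl)) (*-identityʳ N)

  below : (Fin n → ℕ) → Dt → Bool
  below κ d = suc (κ (tail d)) ≤ᵇ κ (head d)

  below-split : ∀ (κ : Fin n → ℕ) → (∀ {u v} → κ u ≡ κ v → u ≡ v) → ∀ d → bit (below κ d) + bit (below κ (flip d)) ≡ 1
  below-split κ inj d rewrite tail-flip d | head-flip d with <-cmp (κ (tail d)) (κ (head d))
  ... | tri< lt _ _ rewrite ≤ᵇ-true lt | ≤ᵇ-false (suc (κ (head d))) (κ (tail d)) (m<n⇒m<1+n lt) = refl
  ... | tri≈ _ e _ = ⊥-elim (adj-irr (head-adj d) (inj e))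
  ... | tri> _ _ gt rewrite ≤ᵇ-true gt | ≤ᵇ-false (suc (κ (tail d))) (κ (head d)) (m<n⇒m<1+n gt) = refl

  half : ∀ (κ : Fin n → ℕ) → (∀ {u v} → κ u ≡ κ v → u ≡ v) → sum (bit ∘ below κ) + sum (bit ∘ below κ) ≡ N
  half κ inj = begin
    sum (bit ∘ below κ) + sum (bit ∘ below κ)          ≡⟨ cong (sum (bit ∘ below κ) +_) (sum-flip (bit ∘ below κ)) ⟩
    sum (bit ∘ below κ) + sum (bit ∘ below κ ∘ flip)   ≡⟨ ∑-distrib-+ (bit ∘ below κ) (bit ∘ below κ ∘ flip) ⟨
    sum (λ d → bit (below κ d) + bit (below κ (flip d))) ≡⟨ sum-cong (λ d → bit (below κ d) + bit (below κ (flip d))) (λ _ → 1) (below-split κ inj) ⟩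
    sum {N} (λ _ → 1)                                  ≡⟨ all-darts ⟩
    N ∎
    where
    open ≡-Reasoning

  halves : ∀ {a b} → a + a ≡ b + b → a ≡ b
  halves {a} {b} e = *-cancelˡ-≡ a b 2 (trans (cong (a +_) (+-identityʳ a)) (trans e (sym (cong (b +_) (+-identityʳ b)))))

  -- For an injective ranking exactly one of the two darts of an edge ascends, so half of the 4n
  -- darts do.
  below-count : ∀ (κ : Fin n → ℕ) → (∀ {u v} → κ u ≡ κ v → u ≡ v) → sum (bit ∘ below κ) ≡ n + n
  below-count κ inj = halves (trans (half κ inj) four)
    where
    four : n * 4 ≡ (n + n) + (n + n)
    four = trans (*-comm n 4) (trans (cong (λ z → n + (n + (n + z))) (+-identityʳ n)) (sym (+-assoc n n (n + n))))

  edges≡ : numEdges G ≡ n + n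
  edges≡ = trans (numEdges-sum G) (trans (sum-darts (λ u v → adj G u v ∧ (suc (toℕ u) ≤ᵇ toℕ v)) (λ u v e → proj₁ (∧-true e)))
    (trans (sum-cong (λ d → bit (adj G (tail d) (head d) ∧ below toℕ d)) (bit ∘ below toℕ) (λ d → cong bit (cong (_∧ below toℕ d) (head-adj d)))) (below-count toℕ FP.toℕ-injective)))

  isolated≡ : numIsolated G ≡ 0
  isolated≡ = countF-none _ λ u → cong not (anyF-complete (adj G u) _ (item-p (nbs u) zero))

  rep : Rotation G → Dt → Bool
  rep R d = faceRep G R (tail d) (head d)

  faces≡ : ∀ R → numFaces G R ≡ sum (bit ∘ rep R)
  faces≡ R = trans (numFaces-sum G R) (sum-darts (faceRep G R) (λ u v e → proj₁ (∧-true e)))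

  -- Euler's formula with 2n edges, no isolated vertices and at least one component.
  many-faces : Fin n → ∀ R → n + numFaces G R + numIsolated G ≡ 2 * numComponents G + numEdges G →
               n + 2 ≤ sum (bit ∘ rep R)
  many-faces v R e = +-cancelˡ-≤ n (n + 2) _ (begin
    n + (n + 2)                            ≡⟨ trans (sym (+-assoc n n 2)) (+-comm (n + n) 2) ⟩
    2 + (n + n)                            ≤⟨ +-monoˡ-≤ (n + n) (*-monoʳ-≤ 2 (comp v G)) ⟩
    2 * numComponents G + (n + n)          ≡⟨ cong (2 * numComponents G +_) edges≡ ⟨
    2 * numComponents G + numEdges G       ≡⟨ e ⟨
    n + numFaces G R + numIsolated G       ≡⟨ trans (cong (n + numFaces G R +_) isolated≡) (+-identityʳ _) ⟩
    n + numFaces G R                       ≡⟨ cong (n +_) (faces≡ R) ⟩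
    n + sum (bit ∘ rep R)                  ∎)
    where
    open ≤-Reasoning
    comp : ∀ {n} → Fin n → (G : Graph n) → 1 ≤ numComponents G
    comp {suc n} _ G = components≥1 G

-- The Jordan curve property from Euler's formula.

allBelow-sound : ∀ m q → allBelow m q ≡ true → ∀ {j} → j < m → q j ≡ true
allBelow-sound (suc m) q h {j} (s≤s j≤m) with ∧-true {allBelow m q} h
... | u , v with j ≟ m
...   | yes refl = v
...   | no ne = allBelow-sound m q u (≤∧≢⇒< j≤m ne)

iter-+ : ∀ {A : Set} (h : A → A) j k a → iter (j + k) h a ≡ iter j h (iter k h a)
iter-+ h zero k a = refl
iter-+ h (suc j) k a = cong h (iter-+ h j k a)

iter-shift : ∀ {A : Set} (h : A → A) j a → iter j h (h a) ≡ iter (suc j) h a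
iter-shift h zero a = refl
iter-shift h (suc j) a = cong h (iter-shift h j a)

iter-period : ∀ {N} (h : Fin N → Fin N) → (∀ {a b} → h a ≡ h b → a ≡ b) → ∀ a → ∃[ m ] (m < N × iter (suc m) h a ≡ a)
iter-period {N} h inj a with FP.pigeonhole (n<1+n N) (λ i → iter (toℕ i) h a)
... | i , j , i<j , p = toℕ j ∸ suc (toℕ i) , small i<j (≤-pred (FP.toℕ<n j)) ,
    sym (cancel (toℕ i) _ a (trans p (cong (λ x → iter x h a) (sym (trans (+-suc (toℕ i) _) (m+[n∸m]≡n i<j))))))
  where
  small : ∀ {a b c} → a < b → b ≤ c → suc (b ∸ suc a) ≤ c
  small {a} {suc b} _ le = ≤-trans (s≤s (m∸n≤m b a)) le
  cancel : ∀ j k a → iter j h a ≡ iter (j + k) h a → a ≡ iter k h a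
  cancel zero k a e = e
  cancel (suc j) k a e = cancel j k a (inj e)

module Jordan {n : ℕ} (G : Graph n) (quartic : Quartic G) (conn : ∀ u v → Star (Adj G) u v)
              (R : Rotation G) (planar : n + numFaces G R + numIsolated G ≡ 2 * numComponents G + numEdges G) where
  open Darts G quartic
  open Counting G quartic
  open System system using (glue-inv)

  ρ : Dt → Dt
  ρ d = dart (tail d) (rot R (tail d) (head d)) (rot-adj R (tail d) (head d) (head-adj d))

  tail-ρ : ∀ d → tail (ρ d) ≡ tail d
  tail-ρ d = tail-dart _ _ _

  head-ρ : ∀ d → head (ρ d) ≡ rot R (tail d) (head d)
  head-ρ d = head-dart _ _ _

  ρ-inj : ∀ {d e} → ρ d ≡ ρ e → d ≡ e
  ρ-inj {d} {e} p = dart-ext t≡ (rot-inj R (tail e) (head d) (head e)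
      (subst (λ v → Adj G v (head d)) t≡ (head-adj d)) (head-adj e)
      (trans (cong (λ v → rot R v (head d)) (sym t≡)) (trans (sym (head-ρ d)) (trans (cong head p) (head-ρ e)))))
    where
    t≡ : tail d ≡ tail e
    t≡ = trans (sym (tail-ρ d)) (trans (cong tail p) (tail-ρ e))

  ρ-cycle : ∀ d e → tail d ≡ tail e → ∃[ j ] iter j ρ d ≡ e
  ρ-cycle d e p with rot-cyc R (tail d) (head d) (head e) (head-adj d) (subst (λ v → Adj G v (head e)) (sym p) (head-adj e))
  ... | j , q = j , dart-ext (trans (tails j) p) (trans (heads j) q)
    where
    tails : ∀ j → tail (iter j ρ d) ≡ tail d
    tails zero = refl
    tails (suc j) = trans (tail-ρ _) (tails j)
    heads : ∀ j → head (iter j ρ d) ≡ iter j (rot R (tail d)) (head d)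
    heads zero = refl
    heads (suc j) = trans (head-ρ _) (cong₂ (rot R) (tails j) (heads j))

  -- The permutation `φ` on darts: reverse, then rotate at the vertex reached. Its orbits are the
  -- faces.
  face : Dt → Dt
  face d = ρ (flip d)

  face-inj : ∀ {d e} → face d ≡ face e → d ≡ e
  face-inj {d} {e} p = trans (sym (glue-inv d)) (trans (cong flip (ρ-inj p)) (glue-inv e))

  face-φ : ∀ j d → iter j (φ G R) (tail d , head d) ≡ (tail (iter j face d) , head (iter j face d))
  face-φ zero d = refl
  face-φ (suc j) d = trans (cong (φ G R) (face-φ j d)) (cong₂ _,_ (sym (trans (tail-ρ _) (tail-flip x)))
      (sym (trans (head-ρ _) (cong₂ (rot R) (tail-flip x) (head-flip x)))))
    where x = iter j face d

  leq-antisym : ∀ {u v u′ v′ : Fin n} → dartLeq G R (u , v) (u′ , v′) ≡ true → dartLeq G R (u′ , v′) (u , v) ≡ true →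
                u ≡ u′ × v ≡ v′
  leq-antisym {u} {v} {u′} {v′} a b with split u v u′ v′ a | split u′ v′ u v b
    where
    split : ∀ u v u′ v′ → dartLeq G R (u , v) (u′ , v′) ≡ true → toℕ u < toℕ u′ ⊎ (u ≡ u′ × toℕ v ≤ toℕ v′)
    split u v u′ v′ h with ∨-true {suc (toℕ u) ≤ᵇ toℕ u′} h
    ... | inj₁ p = inj₁ (≤ᵇ-sound _ _ p)
    ... | inj₂ p = inj₂ (⌊⌋-true (u FP.≟ u′) (proj₁ (∧-true p)) , ≤ᵇ-sound _ _ (proj₂ (∧-true {eqF u u′} p)))
  ... | inj₁ p | inj₁ q = ⊥-elim (<-asym p q)
  ... | inj₁ p | inj₂ (refl , _) = ⊥-elim (<-irrefl refl p)
  ... | inj₂ (refl , _) | inj₁ q = ⊥-elim (<-irrefl refl q)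
  ... | inj₂ (refl , p) | inj₂ (_ , q) = refl , FP.toℕ-injective (≤-antisym p q)

  N≤n² : Fin n → N ≤ n * n
  N≤n² v = *-monoʳ-≤ n (FP.injective⇒≤ (λ {i} {j} → item-inj (nbs v) {i} {j}))

  rep-leq : ∀ d → rep R d ≡ true → ∀ j → j < n * n → dartLeq G R (tail d , head d) (tail (iter j face d) , head (iter j face d)) ≡ true
  rep-leq d h j j< = subst (λ z → dartLeq G R (tail d , head d) z ≡ true) (face-φ j d)
    (allBelow-sound (n * n) (λ k → dartLeq G R (tail d , head d) (iter k (φ G R) (tail d , head d)))
      (proj₂ (∧-true {adj G (tail d) (head d)} h)) j<)

  -- On a face, all darts but the representative are identified with their successors, which is all of it.
  face-const : (s : Dt → Bool) → (∀ d → rep R d ≡ false → s d ≡ s (face d)) → ∀ d → s d ≡ s (face d)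
  face-const s h d with rep R d in r
  ... | false = h d r
  ... | true with iter-period face face-inj d
  ... | m , m<N , per = trans (cong s (sym per)) (sym (around m ≤-refl))
    where
    big : m < n * n
    big = ≤-trans m<N (N≤n² (tail d))
    around : ∀ j → j ≤ m → s (face d) ≡ s (iter (suc j) face d)
    around zero _ = refl
    around (suc j) j<m with rep R (iter (suc j) face d) in r′
    ... | false = trans (around j (<⇒≤ j<m)) (h _ r′)
    ... | true = cong (s ∘ face) (sym same)
      where
      e = iter (suc j) face d
      -- Going on from e leads back to d, so two representatives on one face would each precede the
      -- other.
      back : iter (m ∸ j) face e ≡ d
      back = trans (sym (iter-+ face (m ∸ j) (suc j) d)) (trans (cong (λ k → iter k face d) (trans (+-suc (m ∸ j) j) (cong suc (m∸n+n≡m (<⇒≤ j<m))))) per)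
      le₂ : dartLeq G R (tail e , head e) (tail d , head d) ≡ true
      le₂ = subst (λ z → dartLeq G R (tail e , head e) (tail z , head z) ≡ true) back
              (rep-leq e r′ (m ∸ j) (≤-trans (s≤s (m∸n≤m m j)) big))
      same : e ≡ d
      same with leq-antisym (rep-leq d r (suc j) (≤-trans (s≤s j<m) big)) le₂
      ... | p , q = sym (dart-ext p q)

  -- A spanning tree adapted to a cycle of length L. The ranks `κ` grow away from the root, `x u` is
  -- the dart from u to its parent, the vertices of rank below L form a path in the tree, and `e₀`
  -- leads from the end of that path back to the root. At the root `x` takes the value `e₀`, so that
  -- `x` lists the edges of the tree together with the closing edge.
  record Ordering (L : ℕ) (e₀ : Dt) : Set where
    field
      κ       : Fin n → ℕ
      κ-inj   : ∀ {u v} → κ u ≡ κ v → u ≡ v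
      bound   : ℕ
      κ<      : ∀ u → κ u < bound
      x       : Fin n → Dt
      x-root  : ∀ {u} → κ u ≡ 0 → x u ≡ e₀
      x-tail  : ∀ {u} → κ u ≢ 0 → tail (x u) ≡ u
      x-down  : ∀ {u} → κ u ≢ 0 → κ (head (x u)) < κ u
      x-path  : ∀ {u} → κ u ≢ 0 → κ u < L → suc (κ (head (x u))) ≡ κ u
      long    : 3 ≤ L
      e₀-tail : suc (κ (tail e₀)) ≡ L
      e₀-head : κ (head e₀) ≡ 0
      filled  : ∀ {i} → i < L → ∃[ u ] κ u ≡ i

  module Separate {L : ℕ} {e₀ : Dt} (O : Ordering L e₀) where
    open Ordering O

    -- The closing dart is not a tree dart: otherwise its tail would have rank 1 and the cycle
    -- length 2.
    x-inj : ∀ {u u′} → x u ≡ x u′ → u ≡ u′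
    x-inj {u} {u′} p with κ u ≟ 0 | κ u′ ≟ 0
    ... | yes a | yes b = κ-inj (trans a (sym b))
    ... | yes a | no b = ⊥-elim (clash b (trans (sym p) (x-root a)))
      where
      clash : ∀ {u} → κ u ≢ 0 → x u ≡ e₀ → ⊥
      clash {u} b q = <-irrefl (sym L≡2) long
        where
        tu : tail e₀ ≡ u
        tu = trans (cong tail (sym q)) (x-tail b)
        κu : suc (κ u) ≡ L
        κu = trans (cong (suc ∘ κ) (sym tu)) e₀-tail
        L≡2 : L ≡ 2
        L≡2 = trans (sym κu) (cong suc (trans (sym (x-path b (≤-reflexive κu))) (cong suc (trans (cong (κ ∘ head) q) e₀-head))))
    ... | no a | yes b = ⊥-elim (clash a (trans p (x-root b)))
      where
      clash : ∀ {u} → κ u ≢ 0 → x u ≡ e₀ → ⊥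
      clash {u} b q = <-irrefl (sym L≡2) long
        where
        tu : tail e₀ ≡ u
        tu = trans (cong tail (sym q)) (x-tail b)
        κu : suc (κ u) ≡ L
        κu = trans (cong (suc ∘ κ) (sym tu)) e₀-tail
        L≡2 : L ≡ 2
        L≡2 = trans (sym κu) (cong suc (trans (sym (x-path b (≤-reflexive κu))) (cong suc (trans (cong (κ ∘ head) q) e₀-head))))
    ... | no a | no b = trans (sym (x-tail a)) (trans (cong tail p) (x-tail b))

    down : Dt → Bool
    down d = below κ (flip d)

    down-κ : ∀ d → κ (head d) < κ (tail d) → down d ≡ true
    down-κ d h = ≤ᵇ-true (subst₂ (λ a b → suc (κ a) ≤ κ b) (sym (tail-flip d)) (sym (head-flip d)) h)

    x-downs : ∀ u → down (x u) ≡ true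
    x-downs u with κ u ≟ 0
    ... | no a = down-κ (x u) (subst (λ z → κ (head (x u)) < κ z) (sym (x-tail a)) (x-down a))
    ... | yes a = trans (cong down (x-root a)) (down-κ e₀ (subst₂ _<_ (sym e₀-head) refl
                    (≤-pred (≤-trans (≤-trans (s≤s (s≤s z≤n)) long) (≤-reflexive (sym e₀-tail))))))

    isX : Dt → Bool
    isX d = ⌊ FP.any? (λ u → x u FP.≟ d) ⌋

    rest : Dt → Bool
    rest d = down d ∧ not (isX d)

    -- Of the 2n edges, the n edges listed by `x` are removed. Each edge is represented by its
    -- descending dart.
    rest-count : sum (bit ∘ rest) ≤ n
    rest-count = +-cancelʳ-≤ n _ n (begin
      sum (bit ∘ rest) + n                                                    ≡⟨ cong (sum (bit ∘ rest) +_) (trans (sym (*-identityʳ n)) (trans (sym (sum-const _ 1 (λ u → sum-single (x u)))) (∑-comm (λ u d → bit ⌊ x u FP.≟ d ⌋)))) ⟩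
      sum (bit ∘ rest) + sum (λ d → sum (λ u → bit ⌊ x u FP.≟ d ⌋))           ≡⟨ ∑-distrib-+ (bit ∘ rest) (λ d → sum (λ u → bit ⌊ x u FP.≟ d ⌋)) ⟨
      sum (λ d → bit (rest d) + sum (λ u → bit ⌊ x u FP.≟ d ⌋))               ≤⟨ sum-mono (λ d → bit (rest d) + sum (λ u → bit ⌊ x u FP.≟ d ⌋)) (bit ∘ down) pt ⟩
      sum (bit ∘ down)                                                        ≡⟨ sum-flip (bit ∘ below κ) ⟨
      sum (bit ∘ below κ)                                                     ≡⟨ below-count κ κ-inj ⟩
      n + n                                                                   ∎)
      where
      open ≤-Reasoning
      pt : ∀ d → bit (rest d) + sum (λ u → bit ⌊ x u FP.≟ d ⌋) ≤ bit (down d)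
      pt d with FP.any? (λ u → x u FP.≟ d)
      ... | yes (u , refl) rewrite x-downs u = ≤-reflexive (trans (sum-cong (λ u′ → bit ⌊ x u′ FP.≟ x u ⌋) (λ u′ → bit ⌊ u FP.≟ u′ ⌋) same) (sum-single u))
        where
        same : ∀ u′ → bit ⌊ x u′ FP.≟ x u ⌋ ≡ bit ⌊ u FP.≟ u′ ⌋
        same u′ with x u′ FP.≟ x u | u FP.≟ u′
        ... | yes _ | yes _ = refl
        ... | yes p | no ne = ⊥-elim (ne (sym (x-inj p)))
        ... | no ne | yes refl = ⊥-elim (ne refl)
        ... | no _ | no _ = refl
      ... | no none = ≤-reflexive (trans (cong (bit (down d ∧ true) +_) (trans (sum-cong (λ u → bit ⌊ x u FP.≟ d ⌋) (λ _ → 0)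
              (λ u → cong bit (⌊⌋-no (x u FP.≟ d) (λ p → none (u , p))))) (sum-zero n))) (trans (+-identityʳ _) (cong bit (and-true (down d)))))
        where
        and-true : ∀ b → b ∧ true ≡ b
        and-true true = refl
        and-true false = refl

    nonrep : Dt → Bool
    nonrep d = not (rep R d)

    pairs : List (Dt × Dt)
    pairs = map (λ d → d , face d) (select nonrep) ++ map (λ d → d , flip d) (select rest)

    pairs-length : length pairs ≡ sum (bit ∘ nonrep) + sum (bit ∘ rest)
    pairs-length = trans (length-++ (map (λ d → d , face d) (select nonrep)))
      (cong₂ _+_ (trans (length-map _ (select nonrep)) (select-length nonrep)) (trans (length-map _ (select rest)) (select-length rest)))

    -- One identification for each dart that does not represent its face and at most n for the
    -- remaining edges: with at least n + 2 faces, two fewer than the number of darts are made at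
    -- most. Hence at least two classes remain.
    enough : length pairs + 2 ≤ N
    enough = begin
      length pairs + 2                                   ≡⟨ cong (_+ 2) pairs-length ⟩
      sum (bit ∘ nonrep) + sum (bit ∘ rest) + 2          ≡⟨ +-assoc (sum (bit ∘ nonrep)) _ 2 ⟩
      sum (bit ∘ nonrep) + (sum (bit ∘ rest) + 2)        ≤⟨ +-monoʳ-≤ (sum (bit ∘ nonrep)) (≤-trans (+-monoˡ-≤ 2 rest-count) (many-faces (tail e₀) R planar)) ⟩
      sum (bit ∘ nonrep) + sum (bit ∘ rep R)             ≡⟨ ∑-distrib-+ (bit ∘ nonrep) (bit ∘ rep R) ⟨
      sum (λ d → bit (nonrep d) + bit (rep R d))         ≡⟨ sum-cong (λ d → bit (nonrep d) + bit (rep R d)) (λ _ → 1) (λ d → one (rep R d)) ⟩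
      sum {N} (λ _ → 1)                                  ≡⟨ all-darts ⟩
      N                                                  ∎
      where
      open ≤-Reasoning
      one : ∀ b → bit (not b) + bit b ≡ 1
      one true = refl
      one false = refl

    abstract
      classes : Σ (Dt → Bool) λ s → (∀ {a b} → (a , b) ∈ pairs → s a ≡ s b) × (Σ Dt λ a → Σ Dt λ b → s a ≢ s b)
      classes = two-classes (length pairs) pairs refl enough

    s : Dt → Bool
    s = proj₁ classes

    s-face : ∀ d → s d ≡ s (face d)
    s-face = face-const s (λ d h → proj₁ (proj₂ classes) (∈-++⁺ˡ (∈-map⁺ _ (select-∈ nonrep (cong not h)))))

    -- The function `s` is constant on faces, so this says that the two sides of the edge are not
    -- separated.
    Good : Dt → Set
    Good d = s d ≡ s (flip d)

    good-rest : ∀ d → rest d ≡ true → Good d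
    good-rest d h = proj₁ (proj₂ classes) (∈-++⁺ʳ (map (λ d → d , face d) (select nonrep)) (∈-map⁺ (λ d → d , flip d) (select-∈ rest h)))

    good-flip : ∀ {d} → Good (flip d) → Good d
    good-flip {d} h = trans (cong s (sym (glue-inv d))) (sym h)

    s-ρ : ∀ d → s (flip d) ≡ s (ρ d)
    s-ρ d = trans (s-face (flip d)) (cong (s ∘ ρ) (glue-inv d))

    -- Rotation past a good dart does not change `s`. Going round the vertex from `ρ z` to z
    -- therefore compares the two sides of z.
    one-bad : ∀ z → (∀ d → tail d ≡ tail z → d ≢ z → Good d) → Good z
    one-bad z h = sym (trans (s-ρ z) (go′ (proj₁ cyc) (ρ z) (tail-ρ z) (proj₂ cyc)))
      where
      cyc : ∃[ j ] iter j ρ (ρ z) ≡ z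
      cyc = ρ-cycle (ρ z) z (tail-ρ z)
      go′ : ∀ j d → tail d ≡ tail z → iter j ρ d ≡ z → s d ≡ s z
      go′ j d t≡ e with d FP.≟ z
      ... | yes refl = refl
      go′ zero d t≡ e | no ne = ⊥-elim (ne e)
      go′ (suc j) d t≡ e | no ne = trans (h d t≡ ne) (trans (s-ρ d) (go′ j (ρ d) (trans (tail-ρ d) t≡) (trans (iter-shift ρ j d) e)))

    down-cases : ∀ d → κ (head d) < κ (tail d) → Good d ⊎ (d ≡ x (tail d) × κ (tail d) ≢ 0) ⊎ d ≡ e₀
    down-cases d h with FP.any? (λ u → x u FP.≟ d)
    ... | no none = inj₁ (good-rest d (∧-intro (down-κ d h) (cong not (⌊⌋-no (FP.any? (λ u → x u FP.≟ d)) none))))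
    ... | yes (u , p) with κ u ≟ 0
    ...   | yes a = inj₂ (inj₂ (trans (sym p) (x-root a)))
    ...   | no a = inj₂ (inj₁ (trans (sym p) (cong x u≡) , a ∘ trans (cong κ u≡)))
      where
      u≡ : u ≡ tail d
      u≡ = trans (sym (x-tail a)) (cong tail p)

    up-flip : ∀ d → κ (tail d) < κ (head d) → κ (head (flip d)) < κ (tail (flip d))
    up-flip d h = subst₂ (λ a b → κ a < κ b) (sym (head-flip d)) (sym (tail-flip d)) h

    κ-cmp : ∀ d → κ (head d) < κ (tail d) ⊎ κ (tail d) < κ (head d)
    κ-cmp d with <-cmp (κ (head d)) (κ (tail d))
    ... | tri< lt _ _ = inj₁ lt
    ... | tri≈ _ e _ = ⊥-elim (adj-irr (head-adj d) (sym (κ-inj e)))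
    ... | tri> _ _ gt = inj₂ gt

    L≤κ-e₀ : ∀ {u} → L ≤ κ u → tail e₀ ≢ u
    L≤κ-e₀ h refl = <-irrefl refl (≤-trans (≤-reflexive e₀-tail) h)

    -- Off the cycle, from the highest ranks downwards: ascending darts are good by induction,
    -- descending ones other than the parent dart were identified with their reverses, and then
    -- `one-bad` settles the parent dart.
    high-good : ∀ u → Acc _<_ (bound ∸ κ u) → L ≤ κ u → ∀ d → tail d ≡ u → Good d
    high-good u (acc rs) L≤ d refl = by (κ-cmp d)
      where
      up : ∀ d′ → tail d′ ≡ tail d → κ (tail d′) < κ (head d′) → Good d′
      up d′ t≡ h = good-flip (high-good (head d′) (rs (∸-monoʳ-< (subst (λ z → κ z < κ (head d′)) t≡ h) (<⇒≤ (κ< (head d′)))))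
        (≤-trans L≤ (<⇒≤ (subst (λ z → κ z < κ (head d′)) t≡ h))) (flip d′) (tail-flip d′))
      others : ∀ d′ → tail d′ ≡ tail d → d′ ≢ x (tail d) → Good d′
      others d′ t≡ ne with κ-cmp d′
      ... | inj₂ h = up d′ t≡ h
      ... | inj₁ h with down-cases d′ h
      ...   | inj₁ g = g
      ...   | inj₂ (inj₁ (e , _)) = ⊥-elim (ne (trans e (cong x t≡)))
      ...   | inj₂ (inj₂ refl) = ⊥-elim (L≤κ-e₀ L≤ t≡)
      by : κ (head d) < κ (tail d) ⊎ κ (tail d) < κ (head d) → Good d
      by (inj₂ h) = up d refl h
      by (inj₁ h) with down-cases d h
      ... | inj₁ g = g
      ... | inj₂ (inj₂ refl) = ⊥-elim (L≤κ-e₀ L≤ refl)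
      ... | inj₂ (inj₁ (e , _)) = one-bad d (λ d′ t≡ ne → others d′ t≡ (λ q → ne (trans q (sym e))))

    -- A dart is good or belongs to the cycle: a path edge or the closing edge, in one of the two
    -- directions.
    data Kind (d : Dt) : Set where
      good : Good d → Kind d
      isx  : d ≡ x (tail d) → κ (tail d) ≢ 0 → κ (tail d) < L → Kind d
      flx  : flip d ≡ x (head d) → κ (head d) ≡ suc (κ (tail d)) → κ (head d) < L → Kind d
      ise  : d ≡ e₀ → Kind d
      fle  : flip d ≡ e₀ → Kind d

    kind : ∀ d → Kind d
    kind d with κ-cmp d
    ... | inj₁ h with down-cases d h
    ...   | inj₁ g = good g
    ...   | inj₂ (inj₂ e) = ise e
    ...   | inj₂ (inj₁ (e , a)) with κ (tail d) <? L
    ...     | yes l = isx e a l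
    ...     | no ge = good (high-good (tail d) (<-wellFounded _) (≮⇒≥ ge) d refl)
    kind d | inj₂ h with down-cases (flip d) (up-flip d h)
    ...   | inj₁ g = good (good-flip g)
    ...   | inj₂ (inj₂ e) = fle e
    ...   | inj₂ (inj₁ (e , a)) with κ (head d) <? L
    ...     | yes l = flx e′ (trans (sym (x-path a′ l)) (cong suc (cong κ (trans (cong head (sym e′)) (head-flip d))))) l
      where
      e′ : flip d ≡ x (head d)
      e′ = trans e (cong x (tail-flip d))
      a′ : κ (head d) ≢ 0
      a′ = a ∘ trans (cong κ (tail-flip d))
    ...     | no ge = good (good-flip (high-good (head d) (<-wellFounded _) (≮⇒≥ ge) (flip d) (tail-flip d)))

    -- Around the cycle goodness passes from each edge to the next.
    next-good : ∀ u u′ → κ u ≢ 0 → κ u′ ≡ suc (κ u) → κ u′ < L → Good (x u) → Good (x u′)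
    next-good u u′ a e l g = good-flip (one-bad z others)
      where
      a′ : κ u′ ≢ 0
      a′ h = case trans (sym h) e of λ ()
      z : Dt
      z = flip (x u′)
      tz : tail z ≡ u
      tz = trans (tail-flip _) (κ-inj (suc-injective (trans (x-path a′ l) e)))
      others : ∀ d → tail d ≡ tail z → d ≢ z → Good d
      others d t≡ ne with kind d
      ... | good g′ = g′
      ... | isx p _ _ = subst Good (sym (trans p (cong x (trans t≡ tz)))) g
      ... | flx p q _ = ⊥-elim (ne (trans (sym (glue-inv d)) (cong flip (trans p (cong x (κ-inj (trans q (trans (cong (suc ∘ κ) (trans t≡ tz)) (sym e)))))))))
      ... | ise refl = ⊥-elim (<-irrefl (trans e (trans (cong (suc ∘ κ) (sym (trans t≡ tz))) e₀-tail)) l)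
      ... | fle p = ⊥-elim (a (trans (cong κ (sym (trans t≡ tz))) (trans (cong κ (trans (sym (head-flip d)) (cong head p))) e₀-head)))

    first-good : ∀ u → κ u ≡ 1 → Good e₀ → Good (x u)
    first-good u e g = good-flip (one-bad z others)
      where
      a : κ u ≢ 0
      a h = case trans (sym h) e of λ ()
      z : Dt
      z = flip (x u)
      l : κ u < L
      l = ≤-trans (≤-reflexive (cong suc e)) (<⇒≤ long)
      κz : κ (tail z) ≡ 0
      κz = trans (cong κ (tail-flip _)) (suc-injective (trans (x-path a l) e))
      others : ∀ d → tail d ≡ tail z → d ≢ z → Good d
      others d t≡ ne with kind d
      ... | good g′ = g′
      ... | isx _ b _ = ⊥-elim (b (trans (cong κ t≡) κz))
      ... | flx p q _ = ⊥-elim (ne (trans (sym (glue-inv d)) (cong flip (trans p (cong x (κ-inj (trans q (trans (cong suc (trans (cong κ t≡) κz)) (sym e)))))))))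
      ... | ise refl = g
      ... | fle p = good-flip (subst Good (sym p) g)

    -- At the end of the path the two cycle edges are its last path edge and the closing edge, and
    -- all other darts there are good.
    last-good : Good (x (tail e₀)) → Good e₀
    last-good g = one-bad e₀ others
      where
      others : ∀ d → tail d ≡ tail e₀ → d ≢ e₀ → Good d
      others d t≡ ne with kind d
      ... | good g′ = g′
      ... | isx p _ _ = subst Good (sym (trans p (cong x t≡))) g
      ... | flx p q l = ⊥-elim (<-irrefl (trans q (trans (cong (suc ∘ κ) t≡) e₀-tail)) l)
      ... | ise p = ⊥-elim (ne p)
      ... | fle p = ⊥-elim (adj-irr (head-adj e₀) (κ-inj (trans (cong κ (sym t≡)) (trans (cong κ (trans (sym (head-flip d)) (cong head p))) refl))))

    all-from : Good e₀ → ∀ i u → κ u ≡ suc i → suc i < L → Good (x u)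
    all-from g zero u e _ = first-good u e g
    all-from g (suc i) u e l with filled (<⇒≤ l)
    ... | w , q = next-good w u (λ h → case trans (sym h) q of λ ()) (trans e (cong suc (sym q))) (subst (_< L) (sym e) l)
                    (all-from g i w q (<⇒≤ l))

    all-from′ : Good e₀ → ∀ u → κ u ≢ 0 → κ u < L → Good (x u)
    all-from′ g u a l with κ u in e
    ... | zero = ⊥-elim (a refl)
    ... | suc i = all-from g i u e l

    -- Goodness of one path edge is passed along the path to its end and from there to the closing
    -- edge; `f` counts the edges still to go.
    up-to : ∀ f i → f + suc i ≡ L → i ≢ 0 → ∀ u → κ u ≡ i → Good (x u) → Good e₀
    up-to zero i e _ u q g = last-good (subst (Good ∘ x) (κ-inj (trans q (suc-injective (trans e (sym e₀-tail))))) g)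
    up-to (suc f) i e nz u q g with filled {suc i} (≤-trans (s≤s (m≤n+m (suc i) f)) (≤-reflexive e))
    ... | w , r = up-to f (suc i) (trans (+-suc f (suc i)) e) (λ ()) w r
                    (next-good u w (nz ∘ trans (sym q)) (trans r (cong suc (sym q))) (subst (_< L) (sym r) (≤-trans (s≤s (m≤n+m (suc i) f)) (≤-reflexive e))) g)

    all-good : Good e₀ → ∀ d → Good d
    all-good g d with kind d
    ... | good g′ = g′
    ... | isx p a l = subst Good (sym p) (all-from′ g (tail d) a l)
    ... | flx p q l = good-flip (subst Good (sym p) (all-from′ g (head d) (λ h → case trans (sym h) q of λ ()) l))
    ... | ise refl = g
    ... | fle p = good-flip (subst Good (sym p) g)

    -- A good closing edge would make all edges good. Then `s` would be constant around each vertex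
    -- and along each edge, hence everywhere, although it takes two values.
    e₀-bad : ¬ Good e₀
    e₀-bad g = proj₂ (proj₂ (proj₂ (proj₂ classes))) (spread (conn (tail a) (tail b)) a refl)
      where
      a b : Dt
      a = proj₁ (proj₂ (proj₂ classes))
      b = proj₁ (proj₂ (proj₂ (proj₂ classes)))
      turned : ∀ d e → tail d ≡ tail e → s d ≡ s e
      turned d e p with ρ-cycle d e p
      ... | j , refl = steps j
        where
        steps : ∀ j → s d ≡ s (iter j ρ d)
        steps zero = refl
        steps (suc j) = trans (steps j) (trans (all-good g _) (s-ρ _))
      spread : ∀ {u} → Star (Adj G) u (tail b) → ∀ d → tail d ≡ u → s d ≡ s b
      spread ε d p = turned d b p
      spread (_◅_ {u} {w} h path) d p = trans (turned d (dart u w h) (trans p (sym (tail-dart u w h))))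
        (trans (all-good g (dart u w h)) (spread path (flip (dart u w h)) (trans (tail-flip _) (head-dart u w h))))

    path-bad : ∀ u → κ u ≢ 0 → κ u < L → ¬ Good (x u)
    path-bad u a l g = e₀-bad (up-to (L ∸ suc (κ u)) (κ u) (m∸n+n≡m l) a u refl g)

-- Completing a path to a spanning tree, and the cut along a cycle.

module Cuts {n : ℕ} (G : Graph n) (quartic : Quartic G) (conn : ∀ u v → Star (Adj G) u v)
            (R : Rotation G) (planar : n + numFaces G R + numIsolated G ≡ 2 * numComponents G + numEdges G) where
  open Darts G quartic
  open System system using (glue-inv)
  open Jordan G quartic conn R planar
  open import Data.List.Membership.DecPropositional (FP._≟_ {n}) using (_∈?_)

  -- A tree built vertex by vertex, the latest vertex first; the dart stored with a vertex leads to
  -- its parent.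
  data Grown : List (Fin n) → Set where
    root : ∀ v → Grown (v ∷ [])
    grow : ∀ {w l} → w ∉ l → (d : Dt) → tail d ≡ w → head d ∈ l → Grown l → Grown (w ∷ l)

  rank : List (Fin n) → Fin n → ℕ
  rank [] u = 0
  rank (w ∷ l) u with w FP.≟ u
  ... | yes _ = length l
  ... | no _ = rank l u

  rank-here : ∀ w l → rank (w ∷ l) w ≡ length l
  rank-here w l with w FP.≟ w
  ... | yes _ = refl
  ... | no ne = ⊥-elim (ne refl)

  rank-there : ∀ w l u → w ≢ u → rank (w ∷ l) u ≡ rank l u
  rank-there w l u h with w FP.≟ u
  ... | yes e = ⊥-elim (h e)
  ... | no _ = refl

  rank-< : ∀ {l u} → u ∈ l → rank l u < length l
  rank-< {w ∷ l} {u} m∈ with w FP.≟ u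
  ... | yes _ = ≤-refl
  rank-< {w ∷ l} (here e) | no ne = ⊥-elim (ne (sym e))
  rank-< {w ∷ l} (there m∈) | no ne = m<n⇒m<1+n (rank-< m∈)

  rank-inj : ∀ {l u v} → u ∈ l → v ∈ l → rank l u ≡ rank l v → u ≡ v
  rank-inj {w ∷ l} {u} {v} a b e with w FP.≟ u | w FP.≟ v
  ... | yes refl | yes refl = refl
  rank-inj {w ∷ l} a (here p) e | yes _ | no ne = ⊥-elim (ne (sym p))
  rank-inj {w ∷ l} a (there b) e | yes _ | no ne = ⊥-elim (<-irrefl (sym e) (rank-< b))
  rank-inj {w ∷ l} (here p) b e | no ne | yes _ = ⊥-elim (ne (sym p))
  rank-inj {w ∷ l} (there a) b e | no ne | yes _ = ⊥-elim (<-irrefl e (rank-< a))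
  rank-inj {w ∷ l} (here p) b e | no ne | no _ = ⊥-elim (ne (sym p))
  rank-inj {w ∷ l} (there a) (here p) e | no _ | no ne = ⊥-elim (ne (sym p))
  rank-inj {w ∷ l} (there a) (there b) e | no _ | no _ = rank-inj a b e

  module _ (e₀ : Dt) where
    up : ∀ {l} → Grown l → Fin n → Dt
    up (root v) u = e₀
    up (grow {w} _ d _ _ g) u with w FP.≟ u
    ... | yes _ = d
    ... | no _ = up g u

    up-there : ∀ {w l u} (w∉ : w ∉ l) d t h (g : Grown l) → w ≢ u → up (grow w∉ d t h g) u ≡ up g u
    up-there {w} {l} {u} w∉ d t h g ne with w FP.≟ u
    ... | yes e = ⊥-elim (ne e)
    ... | no _ = refl

    up-zero : ∀ {l} (g : Grown l) {u} → u ∈ l → rank l u ≡ 0 → up g u ≡ e₀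
    up-zero (root v) _ _ = refl
    up-zero (grow {w} {l} w∉ d t h g) {u} m∈ e with w FP.≟ u
    up-zero (grow {w} {l} w∉ d t h g) {u} m∈ e | yes _ = ⊥-elim (nonempty h e)
      where
      nonempty : ∀ {v l} → v ∈ l → length l ≢ 0
      nonempty (here _) ()
      nonempty (there _) ()
    up-zero (grow w∉ d t h g) (here p) e | no ne = ⊥-elim (ne (sym p))
    up-zero (grow w∉ d t h g) (there m∈) e | no ne = up-zero g m∈ e

    up-parent : ∀ {l} (g : Grown l) {u} → u ∈ l → rank l u ≢ 0 →
                tail (up g u) ≡ u × head (up g u) ∈ l × rank l (head (up g u)) < rank l u
    up-parent (root v) {u} m∈ a with v FP.≟ u
    ... | yes _ = ⊥-elim (a refl)
    ... | no _ = ⊥-elim (a refl)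
    up-parent (grow {w} {l} w∉ d t h g) {u} m∈ a with w FP.≟ u
    ... | yes refl = t , there h , subst (_< length l) (sym (rank-there w l (head d) (λ { refl → w∉ h }))) (rank-< h)
    up-parent (grow w∉ d t h g) (here p) a | no ne = ⊥-elim (ne (sym p))
    up-parent (grow {w} {l} w∉ d t h g) {u} (there m∈) a | no ne with up-parent g m∈ a
    ... | t′ , h′ , lt = t′ , there h′ , subst (_< rank l u) (sym (rank-there w l (head (up g u)) (λ { refl → w∉ h′ }))) lt

    -- The tree extended to all vertices: the ranks and parents of the given part are kept, and the
    -- new vertices have higher ranks.
    record Final {l : List (Fin n)} (g : Grown l) : Set where
      field
        {l′}   : List (Fin n)
        g′     : Grown l′
        all    : ∀ u → u ∈ l′
        same-r : ∀ {u} → u ∈ l → rank l′ u ≡ rank l u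
        same-u : ∀ {u} → u ∈ l → up g′ u ≡ up g u
        above  : ∀ {u} → u ∉ l → length l ≤ rank l′ u

    distinct : ∀ {l} → Grown l → Distinct l
    distinct (root v) = (λ ()) ∷ []
    distinct (grow w∉ _ _ _ g) = w∉ ∷ distinct g

    small : ∀ {l} → Grown l → length l ≤ n
    small {l} g = ≤-trans (≤-reflexive (sym (sum-occ l))) (≤-trans (sum-mono (occ l) (λ _ → 1) (occ-distinct (distinct g)))
      (≤-reflexive (trans (sum-const {n} (λ _ → 1) 1 (λ _ → refl)) (*-identityʳ n))))

    crossing : ∀ {l u v} → Star (Adj G) u v → u ∈ l → v ∉ l → ∃[ d ] (tail d ∉ l × head d ∈ l)
    crossing ε a b = ⊥-elim (b a)
    crossing {l} (_◅_ {u} {w} h path) a b with w ∈? l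
    ... | yes w∈ = crossing path w∈ b
    ... | no w∉ = dart w u (adj-sym h) , w∉ ∘ subst (_∈ l) (tail-dart _ _ _) , subst (_∈ l) (sym (head-dart _ _ _)) a

    first : ∀ {l} → Grown l → ∃[ v ] v ∈ l
    first (root v) = v , here refl
    first (grow {w} _ _ _ _ _) = w , here refl

    -- Connectedness supplies an edge from a missing vertex to the tree; the vertices of the tree
    -- are distinct, so the process stops.
    finish : ∀ f {l} (g : Grown l) → n ≤ f + length l → Final g
    finish f {l} g le with FP.any? (λ u → notIn u)
      where
      notIn : ∀ u → Dec (u ∉ l)
      notIn u = ¬? (u ∈? l)
    ... | no none = record { g′ = g ; all = λ u → dec u (u ∈? l) ; same-r = λ _ → refl ; same-u = λ _ → refl
                           ; above = λ {u} u∉ → ⊥-elim (none (u , u∉)) }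
      where
      dec : ∀ u → Dec (u ∈ l) → u ∈ l
      dec u (yes p) = p
      dec u (no p) = ⊥-elim (none (u , p))
    ... | yes (v , v∉) with crossing (conn (proj₁ (first g)) v) (proj₂ (first g)) v∉
    ...   | d , t∉ , h∈ = enlarged f le
      where
      g₁ : Grown (tail d ∷ l)
      g₁ = grow t∉ d refl h∈ g
      enlarged : ∀ f → n ≤ f + length l → Final g
      enlarged zero le = ⊥-elim (<-irrefl refl (≤-trans (s≤s le) (small g₁)))
      enlarged (suc f) le = record
        { g′ = F.g′ ; all = F.all
        ; same-r = λ {u} u∈ → trans (F.same-r (there u∈)) (rank-there (tail d) l u (λ { refl → t∉ u∈ }))
        ; same-u = λ u∈ → trans (F.same-u (there u∈)) (up-there t∉ d refl h∈ g (λ { refl → t∉ u∈ }))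
        ; above = ab }
        where
        F : Final g₁
        F = finish f g₁ (≤-trans le (≤-reflexive (sym (+-suc f (length l)))))
        module F = Final F
        ab : ∀ {u} → u ∉ l → length l ≤ rank F.l′ u
        ab {u} u∉ with tail d FP.≟ u
        ... | yes refl = ≤-reflexive (sym (trans (F.same-r (here refl)) (rank-here (tail d) l)))
        ... | no ne = <⇒≤ (F.above λ { (here e) → ne (sym e) ; (there m∈) → u∉ m∈ })

  data Trail : List (Fin n) → Set where
    one  : ∀ v → Trail (v ∷ [])
    step : ∀ {w v l} → w ∉ v ∷ l → Adj G w v → Trail (v ∷ l) → Trail (w ∷ v ∷ l)

  links : List (Fin n) → List (Fin n × Fin n)
  links [] = []
  links (w ∷ []) = []
  links (w ∷ v ∷ l) = (w , v) ∷ links (v ∷ l)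

  grown : ∀ {l} → Trail l → Grown l
  grown (one v) = root v
  grown (step {w} {v} w∉ a p) = grow w∉ (dart w v a) (tail-dart w v a) (here (head-dart w v a)) (grown p)

  module _ (e₀ : Dt) where
    trail-up : ∀ {l} (p : Trail l) {u} → u ∈ l → rank l u ≢ 0 →
               (u , head (up e₀ (grown p) u)) ∈ links l × suc (rank l (head (up e₀ (grown p) u))) ≡ rank l u
    trail-up (one v) {u} m∈ a with v FP.≟ u
    ... | yes _ = ⊥-elim (a refl)
    ... | no _ = ⊥-elim (a refl)
    trail-up (step {w} {v} {l} w∉ ad p) {u} m∈ a with w FP.≟ u
    ... | yes refl rewrite head-dart w v ad = here refl ,
            cong suc (trans (rank-there w (v ∷ l) v (λ e → w∉ (here e))) (rank-here v l))
    trail-up (step w∉ ad p) (here e) a | no ne = ⊥-elim (ne (sym e))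
    trail-up (step {w} {v} {l} w∉ ad p) {u} (there m∈) a | no ne with trail-up p m∈ a
    ... | i , e = there i , trans (cong suc (rank-there w (v ∷ l) (head (up e₀ (grown p) u)) (λ { refl → w∉ (proj₁ (proj₂ (up-parent e₀ (grown p) m∈ a))) }))) e

    links-∈ : ∀ {l a b} → (a , b) ∈ links l → a ∈ l
    links-∈ {w ∷ v ∷ l} (here refl) = here refl
    links-∈ {w ∷ v ∷ l} (there m∈) = there (links-∈ {v ∷ l} m∈)

    links-up : ∀ {l} (p : Trail l) {a b} → (a , b) ∈ links l → rank l a ≢ 0 × head (up e₀ (grown p) a) ≡ b
    links-up (step {w} {v} {l} w∉ ad p) {a} m∈ with w FP.≟ a
    links-up (step {w} {v} {l} w∉ ad p) (here refl) | yes _ = (λ ()) , head-dart w v ad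
    links-up (step {w} {v} {l} w∉ ad p) (there m∈) | yes refl = ⊥-elim (w∉ (links-∈ {v ∷ l} m∈))
    links-up (step w∉ ad p) (here refl) | no ne = ⊥-elim (ne refl)
    links-up (step w∉ ad p) (there m∈) | no ne = links-up p m∈

  filled′ : ∀ {l} → Trail l → ∀ {i} → i < length l → ∃[ u ] (u ∈ l × rank l u ≡ i)
  filled′ (one v) {zero} _ = v , here refl , rank-here v []
  filled′ (one v) {suc i} (s≤s ())
  filled′ (step {w} {v} {l} w∉ a p) {i} h with i ≟ length (v ∷ l)
  ... | yes refl = w , here refl , rank-here w (v ∷ l)
  ... | no ne with filled′ p (≤∧≢⇒< (≤-pred h) ne)
  ...   | u , u∈ , e = u , there u∈ , trans (rank-there w (v ∷ l) u (λ { refl → w∉ u∈ })) e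

  -- The plane cut along a cycle: s tells the two sides of the cycle apart.
  record Cut (Z : List (Fin n × Fin n)) : Set where
    field
      s   : Dt → Bool
      s-ρ : ∀ d → s (flip d) ≡ s (ρ d)
      off : ∀ d → (tail d , head d) ∉ Z → (head d , tail d) ∉ Z → s d ≡ s (flip d)
      on  : ∀ d → (tail d , head d) ∈ Z → s d ≢ s (flip d)

  -- The path, listed from its end w to its root z, is extended to a spanning tree. The edge from w
  -- to z closes the cycle, and the colouring obtained in `Separate` is the cut.
  cut-along : ∀ {w v l z} (p : Trail (w ∷ v ∷ l)) → 3 ≤ length (w ∷ v ∷ l) → Adj G w z → z ∈ w ∷ v ∷ l → rank (w ∷ v ∷ l) z ≡ 0 →
        Cut ((w , z) ∷ links (w ∷ v ∷ l))
  cut-along {w} {v} {l} {z} p long′ a z∈ z0 = record { s = S.s ; s-ρ = S.s-ρ ; off = off′ ; on = on′ }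
    where
    path = w ∷ v ∷ l
    e₀ : Dt
    e₀ = dart w z a
    F : Final e₀ (grown p)
    F = finish e₀ n (grown p) (m≤m+n n _)
    module F = Final F
    κ : Fin n → ℕ
    κ = rank F.l′
    inpath : ∀ {u} → κ u < length path → u ∈ path
    inpath {u} h with u ∈? path
    ... | yes m∈ = m∈
    ... | no ne = ⊥-elim (<-irrefl refl (≤-trans h (F.above ne)))
    O : Ordering (length path) e₀
    O = record
      { κ = κ ; κ-inj = rank-inj (F.all _) (F.all _) ; bound = length F.l′ ; κ< = λ u → rank-< (F.all u)
      ; x = up e₀ F.g′
      ; x-root = up-zero e₀ F.g′ (F.all _)
      ; x-tail = λ b → proj₁ (up-parent e₀ F.g′ (F.all _) b)
      ; x-down = λ b → proj₂ (proj₂ (up-parent e₀ F.g′ (F.all _) b))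
      ; x-path = λ {u} b h → let u∈ = inpath h ; b′ = b ∘ trans (F.same-r u∈) in
          trans (cong suc (trans (cong (κ ∘ head) (F.same-u u∈)) (F.same-r (proj₁ (proj₂ (up-parent e₀ (grown p) u∈ b′))))))
            (trans (proj₂ (trail-up e₀ p u∈ b′)) (sym (F.same-r u∈)))
      ; long = long′
      ; e₀-tail = cong suc (trans (cong κ (tail-dart w z a)) (trans (F.same-r (here refl)) (rank-here w (v ∷ l))))
      ; e₀-head = trans (cong κ (head-dart w z a)) (trans (F.same-r z∈) z0)
      ; filled = λ h → let (u , u∈ , e) = filled′ p h in u , trans (F.same-r u∈) e
      }
    module S = Separate O
    Z = (w , z) ∷ links path
    e₀-Z : ∀ {d} → d ≡ e₀ → (tail d , head d) ∈ Z
    e₀-Z refl = here (cong₂ _,_ (tail-dart w z a) (head-dart w z a))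
    x-Z : ∀ {u} → κ u ≢ 0 → κ u < length path → (u , head (up e₀ F.g′ u)) ∈ Z
    x-Z {u} b h = let u∈ = inpath h in
      there (subst (λ y → (u , head y) ∈ links path) (sym (F.same-u u∈)) (proj₁ (trail-up e₀ p u∈ (b ∘ trans (F.same-r u∈)))))
    flip-Z : ∀ d → (tail (flip d) , head (flip d)) ∈ Z → (head d , tail d) ∈ Z
    flip-Z d = subst₂ (λ a b → (a , b) ∈ Z) (tail-flip d) (head-flip d)
    off′ : ∀ d → (tail d , head d) ∉ Z → (head d , tail d) ∉ Z → S.s d ≡ S.s (flip d)
    off′ d a b with S.kind d
    ... | S.good g = g
    ... | S.isx e c h = ⊥-elim (a (subst (λ y → (tail d , head y) ∈ Z) (sym e) (x-Z c h)))
    ... | S.flx e c h = ⊥-elim (b (subst (λ y → (head d , y) ∈ Z) (trans (cong head (sym e)) (head-flip d)) (x-Z (λ q → case trans (sym q) c of λ ()) h)))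
    ... | S.ise e = ⊥-elim (a (e₀-Z e))
    ... | S.fle e = ⊥-elim (b (flip-Z d (e₀-Z e)))
    on′ : ∀ d → (tail d , head d) ∈ Z → S.s d ≢ S.s (flip d)
    on′ d (here e) g = S.e₀-bad (subst S.Good (dart-ext (trans (cong proj₁ e) (sym (tail-dart w z a))) (trans (cong proj₂ e) (sym (head-dart w z a)))) g)
    on′ d (there m∈) g = S.path-bad (tail d) c h (subst S.Good d≡ g)
      where
      t∈ : tail d ∈ path
      t∈ = links-∈ e₀ {path} m∈
      c : κ (tail d) ≢ 0
      c = proj₁ (links-up e₀ p m∈) ∘ trans (sym (F.same-r t∈))
      h : κ (tail d) < length path
      h = subst (_< length path) (sym (F.same-r t∈)) (rank-< t∈)
      d≡ : d ≡ up e₀ F.g′ (tail d)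
      d≡ = dart-ext (sym (proj₁ (up-parent e₀ F.g′ (F.all _) c)))
        (trans (sym (proj₂ (links-up e₀ p m∈))) (cong head (sym (F.same-u t∈))))

  abstract
    cut : ∀ {w v l z} (p : Trail (w ∷ v ∷ l)) → 3 ≤ length (w ∷ v ∷ l) → Adj G w z → z ∈ w ∷ v ∷ l → rank (w ∷ v ∷ l) z ≡ 0 →
          Cut ((w , z) ∷ links (w ∷ v ∷ l))
    cut = cut-along

-- Rotations at vertices of degree four; K₃₃ and K₅ minus an edge are not planar.

after : Q → Q
after q0 = q1
after q1 = q2
after q2 = q3
after q3 = q0

allB? : {A : Bool → Set} → (∀ b → Dec (A b)) → Dec (∀ b → A b)
allB? A? = map′ (λ { (a , b) → λ { true → a ; false → b } }) (λ f → f true , f false) (A? true ×-dec A? false)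

quad : Bool → Bool → Bool → Bool → Q → Bool
quad a b c d q0 = a
quad a b c d q1 = b
quad a b c d q2 = c
quad a b c d q3 = d

eqB : Bool → Bool → Bool
eqB true b = b
eqB false b = not b

-- Does one meet j before k on the way round from i?
cyc : Q → Q → Q → Bool
cyc i j k = ⌊ after i ≟Q j ⌋ ∨ (not ⌊ after i ≟Q k ⌋ ∧ ⌊ after (after i) ≟Q j ⌋)

-- v jumps exactly behind the positions a and b.
Jumps : (Q → Bool) → Q → Q → Set
Jumps v a b = ∀ i → (i ≢ a → i ≢ b → v (after i) ≡ v i) × (i ≡ a → v (after i) ≢ v i) × (i ≡ b → v (after i) ≢ v i)

jumps? : ∀ v a b → Dec (Jumps v a b)
jumps? v a b = allQ? λ i → (¬? (i ≟Q a) →-dec ¬? (i ≟Q b) →-dec (v (after i) ≟B v i)) ×-dec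
  ((i ≟Q a →-dec ¬? (v (after i) ≟B v i)) ×-dec (i ≟Q b →-dec ¬? (v (after i) ≟B v i)))

-- A cycle passes the vertex through the positions a and b, and v tells on which side each position
-- lies. Positions between b and a in the rotation agree with a, the others do not; if a and b are
-- opposite, the other two positions lie on different sides.
Sides : (Q → Bool) → Q → Q → Set
Sides v a b = a ≢ b → Jumps v a b →
  v (after a) ≡ v b × (∀ c → c ≢ a → c ≢ b → eqB (v c) (v a) ≡ cyc b c a) ×
  (∀ c d → c ≢ a → c ≢ b → d ≢ a → d ≢ b → c ≢ d → after (after a) ≡ b → v c ≢ v d)

sides? : ∀ v a b → Dec (Sides v a b)
sides? v a b = ¬? (a ≟Q b) →-dec jumps? v a b →-dec
  ((v (after a) ≟B v b) ×-dec ((allQ? λ c → ¬? (c ≟Q a) →-dec ¬? (c ≟Q b) →-dec (eqB (v c) (v a) ≟B cyc b c a)) ×-dec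
  (allQ? λ c → allQ? λ d → ¬? (c ≟Q a) →-dec ¬? (c ≟Q b) →-dec ¬? (d ≟Q a) →-dec ¬? (d ≟Q b) →-dec ¬? (c ≟Q d) →-dec
    (after (after a) ≟Q b) →-dec ¬? (v c ≟B v d))))

all-sides? : Dec (∀ x y z w a b → Sides (quad x y z w) a b)
all-sides? = allB? λ x → allB? λ y → allB? λ z → allB? λ w → allQ? λ a → allQ? λ b → sides? (quad x y z w) a b

Turning : Q → Q → Q → Set
Turning i j k = i ≢ j → j ≢ k → i ≢ k → cyc j k i ≡ cyc i j k × cyc i k j ≡ not (cyc i j k)

turning? : Dec (∀ i j k → Turning i j k)
turning? = allQ? λ i → allQ? λ j → allQ? λ k → ¬? (i ≟Q j) →-dec ¬? (j ≟Q k) →-dec ¬? (i ≟Q k) →-dec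
  ((cyc j k i ≟B cyc i j k) ×-dec (cyc i k j ≟B not (cyc i j k)))

Opposite : Q → Q → Q → Q → Set
Opposite i j k l = i ≢ j → i ≢ k → i ≢ l → j ≢ k → j ≢ l → k ≢ l →
  after (after i) ≡ j ⊎ (after (after i) ≡ k ⊎ after (after i) ≡ l)

opposite? : Dec (∀ i j k l → Opposite i j k l)
opposite? = allQ? λ i → allQ? λ j → allQ? λ k → allQ? λ l → ¬? (i ≟Q j) →-dec ¬? (i ≟Q k) →-dec ¬? (i ≟Q l) →-dec
  ¬? (j ≟Q k) →-dec ¬? (j ≟Q l) →-dec ¬? (k ≟Q l) →-dec
  ((after (after i) ≟Q j) ⊎-dec ((after (after i) ≟Q k) ⊎-dec (after (after i) ≟Q l)))

Covered : Q → Q → Q → Q → Q → Set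
Covered i j k l p = i ≢ j → i ≢ k → i ≢ l → j ≢ k → j ≢ l → k ≢ l → p ≡ i ⊎ (p ≡ j ⊎ (p ≡ k ⊎ p ≡ l))

covered? : Dec (∀ i j k l p → Covered i j k l p)
covered? = allQ? λ i → allQ? λ j → allQ? λ k → allQ? λ l → allQ? λ p → ¬? (i ≟Q j) →-dec ¬? (i ≟Q k) →-dec ¬? (i ≟Q l) →-dec
  ¬? (j ≟Q k) →-dec ¬? (j ≟Q l) →-dec ¬? (k ≟Q l) →-dec
  ((p ≟Q i) ⊎-dec ((p ≟Q j) ⊎-dec ((p ≟Q k) ⊎-dec (p ≟Q l))))

abstract
  covered : ∀ (i j k l p : Q) → Covered i j k l p
  covered = toWitness {a? = covered?} _

  all-sides : ∀ (x y z w : Bool) (a b : Q) → Sides (quad x y z w) a b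
  all-sides = toWitness {a? = all-sides?} _

  turning : ∀ (i j k : Q) → Turning i j k
  turning = toWitness {a? = turning?} _

  opposite : ∀ (i j k l : Q) → Opposite i j k l
  opposite = toWitness {a? = opposite?} _

sides : ∀ (v : Q → Bool) a b → Sides v a b
sides v a b ne J with all-sides (v q0) (v q1) (v q2) (v q3) a b ne J′
  where
  w = quad (v q0) (v q1) (v q2) (v q3)
  w≡ : ∀ i → w i ≡ v i
  w≡ q0 = refl
  w≡ q1 = refl
  w≡ q2 = refl
  w≡ q3 = refl
  J′ : Jumps w a b
  J′ i = (λ x y → trans (w≡ (after i)) (trans (proj₁ (J i) x y) (sym (w≡ i)))) ,
         (λ e q → proj₁ (proj₂ (J i)) e (trans (sym (w≡ (after i))) (trans q (w≡ i)))) ,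
         (λ e q → proj₂ (proj₂ (J i)) e (trans (sym (w≡ (after i))) (trans q (w≡ i))))
... | p , q , r = trans (sym (w≡ (after a))) (trans p (w≡ b)) ,
      (λ c x y → trans (cong₂ eqB (sym (w≡ c)) (sym (w≡ a))) (q c x y)) ,
      (λ c d x y x′ y′ z o e → r c d x y x′ y′ z o (trans (w≡ c) (trans e (sym (w≡ d)))))
  where
  w≡ : ∀ i → quad (v q0) (v q1) (v q2) (v q3) i ≡ v i
  w≡ q0 = refl
  w≡ q1 = refl
  w≡ q2 = refl
  w≡ q3 = refl

not-fix : ∀ b → b ≢ not b
not-fix true ()
not-fix false ()

-- Parity; 3 will be the number of edges that leave a set of vertices of even degree.
odd-even : ∀ a b → a * 4 ≢ (b + b) + 3
odd-even a b e = absurd (a + a) (b + 1) (trans (four a) (trans e (three b)))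
  where
  four : ∀ a → (a + a) + (a + a) ≡ a * 4
  four a = trans (+-assoc a a (a + a)) (trans (cong (λ z → a + (a + (a + z))) (sym (+-identityʳ a))) (*-comm 4 a))
  three : ∀ b → (b + b) + 3 ≡ suc ((b + 1) + (b + 1))
  three b rewrite +-comm b 1 | +-suc b b | +-comm (b + b) 3 = refl
  absurd : ∀ x y → x + x ≡ suc (y + y) → ⊥
  absurd (suc x) zero p rewrite +-suc x x = case p of λ ()
  absurd (suc x) (suc y) p rewrite +-suc x x | +-suc y y = absurd x y (suc-injective (suc-injective p))

module Nonplanar {n : ℕ} (G : Graph n) (quartic : Quartic G) (conn : ∀ u v → Star (Adj G) u v)
                 (R : Rotation G) (planar : n + numFaces G R + numIsolated G ≡ 2 * numComponents G + numEdges G) where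
  open Darts G quartic
  open System system using (glue-inv)
  open Counting G quartic
  open Jordan G quartic conn R planar
  open Cuts G quartic conn R planar
  open import Data.List.Membership.DecPropositional (FP._≟_ {n}) using (_∈?_)

  ring : Fin n → ℕ → Dt
  ring u j = iter j ρ (pack u zero)

  tail-ring : ∀ u j → tail (ring u j) ≡ u
  tail-ring u zero = tail-pack u zero
  tail-ring u (suc j) = trans (tail-ρ _) (tail-ring u j)

  ring-cancel : ∀ u i j → ring u i ≡ ring u (i + j) → ring u 0 ≡ ring u j
  ring-cancel u zero j e = e
  ring-cancel u (suc i) j e = ring-cancel u i j (ρ-inj e)

  ring-all : ∀ u d → tail d ≡ u → ∃[ j ] ring u j ≡ d
  ring-all u d p = ρ-cycle (pack u zero) d (trans (tail-pack u zero) (sym p))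

  -- The rotation is cyclic, so all four darts at u appear within one period.
  short-ring : ∀ u p → ring u 0 ≡ ring u (suc p) → 4 ≤ suc p
  short-ring u p e = injective⇒≤ {f = λ i → fromℕ< (proj₁ (proj₂ (pos i)))} (λ {i} {j} → inj {i} {j})
    where
    reduce : ∀ j → ∃[ c ] (c < suc p × ring u c ≡ ring u j)
    reduce zero = 0 , s≤s z≤n , refl
    reduce (suc j) with reduce j
    ... | c , c< , q with c ≟ p
    ...   | yes refl = 0 , s≤s z≤n , trans e (cong ρ q)
    ...   | no ne = suc c , s≤s (≤∧≢⇒< (≤-pred c<) ne) , cong ρ q
    pos : ∀ (i : Fin 4) → ∃[ c ] (c < suc p × ring u c ≡ pack u i)
    pos i with ring-all u (pack u i) (tail-pack u i)
    ... | j , q with reduce j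
    ...   | c , c< , r = c , c< , trans r q
    inj : ∀ {i j} → fromℕ< (proj₁ (proj₂ (pos i))) ≡ fromℕ< (proj₁ (proj₂ (pos j))) → i ≡ j
    inj {i} {j} h = pack-inj u (trans (sym (proj₂ (proj₂ (pos i)))) (trans (cong (ring u) c≡) (proj₂ (proj₂ (pos j)))))
      where
      c≡ : proj₁ (pos i) ≡ proj₁ (pos j)
      c≡ = trans (sym (FP.toℕ-fromℕ< (proj₁ (proj₂ (pos i))))) (trans (cong toℕ h) (FP.toℕ-fromℕ< (proj₁ (proj₂ (pos j)))))

  ring-4 : ∀ u → ring u 4 ≡ ring u 0
  ring-4 u = close (FP.pigeonhole {4} {5} (n<1+n 4) (λ i → slot (ring u (toℕ i))))
    where
    close : ∃[ i ] ∃[ j ] (toℕ i < toℕ j × slot (ring u (toℕ i)) ≡ slot (ring u (toℕ j))) → ring u 4 ≡ ring u 0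
    close (i , j , i<j , e) = sym (subst (λ gap → ring u 0 ≡ ring u (suc gap)) three closed)
      where
      gap : ℕ
      gap = toℕ j ∸ suc (toℕ i)
      split : toℕ i + suc gap ≡ toℕ j
      split = trans (+-suc (toℕ i) gap) (m+[n∸m]≡n i<j)
      same : ring u (toℕ i) ≡ ring u (toℕ j)
      same = trans (sym (pack-slot (ring u (toℕ i)))) (trans (cong₂ pack (trans (tail-ring u (toℕ i)) (sym (tail-ring u (toℕ j)))) e) (pack-slot (ring u (toℕ j))))
      closed : ring u 0 ≡ ring u (suc gap)
      closed = ring-cancel u (toℕ i) (suc gap) (trans same (cong (ring u) (sym split)))
      three : gap ≡ 3
      three = ≤-antisym (≤-trans (∸-monoˡ-≤ (suc (toℕ i)) (≤-pred (FP.toℕ<n j))) (m∸n≤m 3 (toℕ i)))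
                        (≤-pred (short-ring u gap closed))

  at-pos : Fin n → Q → Dt
  at-pos u i = ring u (codeQ i)

  after-pos : ∀ u i → at-pos u (after i) ≡ ρ (at-pos u i)
  after-pos u q0 = refl
  after-pos u q1 = refl
  after-pos u q2 = refl
  after-pos u q3 = sym (ring-4 u)

  pos-all : ∀ u d → tail d ≡ u → ∃[ i ] at-pos u i ≡ d
  pos-all u d p with ring-all u d p
  ... | j , refl = go′ j
    where
    go′ : ∀ j → ∃[ i ] at-pos u i ≡ ring u j
    go′ zero = q0 , refl
    go′ (suc j) with go′ j
    ... | i , q = after i , trans (after-pos u i) (cong ρ q)

  abstract
    pos : ∀ {u v} → Adj G u v → Q
    pos {u} {v} a = proj₁ (pos-all u (dart u v a) (tail-dart u v a))

    at-pos-pos : ∀ {u v} (a : Adj G u v) → at-pos u (pos a) ≡ dart u v a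
    at-pos-pos {u} {v} a = proj₂ (pos-all u (dart u v a) (tail-dart u v a))

  pos-head : ∀ {u v} (a : Adj G u v) → head (at-pos u (pos a)) ≡ v
  pos-head {u} {v} a = trans (cong head (at-pos-pos a)) (head-dart u v a)

  pos-≢ : ∀ {u v w} (a : Adj G u v) (b : Adj G u w) → v ≢ w → pos a ≢ pos b
  pos-≢ {u} a b ne e = ne (trans (sym (pos-head a)) (trans (cong (head ∘ at-pos u) e) (pos-head b)))

  at-inj : ∀ u {i j} → at-pos u i ≡ at-pos u j → i ≡ j
  at-inj u {i} {j} e = codeQ-injective i j (codes (codeQ i) (codeQ j) (code< i) (code< j) e)
    where
    code< : ∀ i → codeQ i < 4
    code< q0 = s≤s z≤n
    code< q1 = s≤s (s≤s z≤n)
    code< q2 = s≤s (s≤s (s≤s z≤n))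
    code< q3 = ≤-refl
    lower : ∀ a b → a < b → b < 4 → ring u a ≢ ring u b
    lower a b a<b b<4 q = <-irrefl refl (≤-trans (≤-trans (s≤s (≤-trans (short-ring u (b ∸ suc a)
        (ring-cancel u a (suc (b ∸ suc a)) (trans q (cong (ring u) (sym (trans (+-suc a _) (m+[n∸m]≡n a<b)))))))
        (≤-trans (≤-reflexive (sym (+-∸-assoc 1 a<b))) (m∸n≤m b a)))) b<4) ≤-refl)
    codes : ∀ a b → a < 4 → b < 4 → ring u a ≡ ring u b → a ≡ b
    codes a b a< b< q with <-cmp a b
    ... | tri< lt _ _ = ⊥-elim (lower a b lt b< q)
    ... | tri≈ _ p _ = p
    ... | tri> _ _ gt = ⊥-elim (lower b a gt a< (sym q))

  tail-at : ∀ u i → tail (at-pos u i) ≡ u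
  tail-at u i = tail-ring u (codeQ i)

  module OnCut {Z : List (Fin n × Fin n)} (C : Cut Z) where
    open Cut C

    value : Fin n → Q → Bool
    value u i = s (at-pos u i)

    -- The dart that follows in the rotation lies on the face on the other side of the edge, so the
    -- value jumps exactly behind cycle edges.
    value-after : ∀ u i → value u (after i) ≡ s (flip (at-pos u i))
    value-after u i = trans (cong s (after-pos u i)) (sym (s-ρ _))

    Out : Fin n → Fin n → Set
    Out u v = (u , v) ∉ Z × (v , u) ∉ Z

    On : Fin n → Fin n → Set
    On u v = (u , v) ∈ Z ⊎ (v , u) ∈ Z

    out : ∀ d → Out (tail d) (head d) → s d ≡ s (flip d)
    out d (a , b) = off d a b

    on′ : ∀ d → On (tail d) (head d) → s d ≢ s (flip d)
    on′ d (inj₁ h) = on d h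
    on′ d (inj₂ h) e = on (flip d) (subst₂ (λ a b → (a , b) ∈ Z) (sym (tail-flip d)) (sym (head-flip d)) h)
                         (trans (sym e) (cong s (sym (glue-inv d))))

    jumps : ∀ {u v w} (a : Adj G u v) (b : Adj G u w) → On u v → On u w → (∀ y → y ≢ v → y ≢ w → Out u y) →
            Jumps (value u) (pos a) (pos b)
    jumps {u} {v} {w} a b ov ow others i = stay , jump a ov , jump b ow
      where
      stay : i ≢ pos a → i ≢ pos b → value u (after i) ≡ value u i
      stay na nb = trans (value-after u i) (sym (out d (subst (λ z → Out z (head d)) (sym (tail-at u i))
        (others (head d) (λ e → na (at-inj u (trans (dart-ext (trans (tail-at u i) (sym (tail-dart u v a))) (trans e (sym (head-dart u v a)))) (sym (at-pos-pos a)))))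
                         (λ e → nb (at-inj u (trans (dart-ext (trans (tail-at u i) (sym (tail-dart u w b))) (trans e (sym (head-dart u w b)))) (sym (at-pos-pos b)))))))))
        where
        d : Dt
        d = at-pos u i
      jump : ∀ {y} (c : Adj G u y) → On u y → i ≡ pos c → value u (after i) ≢ value u i
      jump {y} c oy refl e = on′ (at-pos u i) (subst₂ On (sym (tail-at u (pos c))) (sym (pos-head c)) oy)
        (trans (sym e) (value-after u i))

    const : ∀ u → (∀ y → Out u y) → ∀ d e → tail d ≡ u → tail e ≡ u → s d ≡ s e
    const u free d e p q with ρ-cycle d e (trans p (sym q))
    ... | j , refl = steps j
      where
      tails : ∀ j → tail (iter j ρ d) ≡ u
      tails zero = p
      tails (suc j) = trans (tail-ρ _) (tails j)
      steps : ∀ j → s d ≡ s (iter j ρ d)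
      steps zero = refl
      steps (suc j) = trans (steps j) (trans (out (iter j ρ d) (subst (λ z → Out z (head (iter j ρ d))) (sym (tails j)) (free _))) (s-ρ _))

    flip-dart : ∀ {u v} (a : Adj G u v) (b : Adj G v u) → flip (dart u v a) ≡ dart v u b
    flip-dart {u} {v} a b = dart-ext (trans (tail-flip _) (trans (head-dart u v a) (sym (tail-dart v u b))))
                                     (trans (head-flip _) (trans (tail-dart u v a) (sym (head-dart v u b))))

    -- Two neighbours p, q of a vertex r off the cycle look at r from the same side.
    across-r : ∀ {p q r} (a : Adj G p r) (b : Adj G q r) → (∀ y → Out r y) → s (dart p r a) ≡ s (dart q r b)
    across-r {p} {q} {r} a b free = trans (side a) (trans (const r free _ _ (tail-dart r p _) (tail-dart r q _)) (sym (side b)))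
      where
      side : ∀ {p} (a : Adj G p r) → s (dart p r a) ≡ s (dart r p (adj-sym a))
      side {p} a = trans (out (dart p r a) (subst₂ Out (sym (tail-dart p r a)) (sym (head-dart p r a)) (proj₂ (free p) , proj₁ (free p))))
                         (cong s (flip-dart a (adj-sym a)))

    value-pos : ∀ {u v} (a : Adj G u v) → value u (pos a) ≡ s (dart u v a)
    value-pos a = cong s (at-pos-pos a)

    -- The side to the left stays the same along the cycle … p → u → q ….
    pass : ∀ {p u q} (a : Adj G p u) (a′ : Adj G u p) (b : Adj G u q) → p ≢ q → On u p → On u q →
           (∀ y → y ≢ p → y ≢ q → Out u y) → s (dart p u a) ≡ s (dart u q b)
    pass {p} {u} {q} a a′ b p≢q op oq others = begin
      s (dart p u a)             ≡⟨ cong s (flip-dart a′ a) ⟨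
      s (flip (dart u p a′))     ≡⟨ cong (s ∘ flip) (at-pos-pos a′) ⟨
      s (flip (at-pos u (pos a′))) ≡⟨ value-after u (pos a′) ⟨
      value u (after (pos a′))   ≡⟨ proj₁ (sides (value u) (pos a′) (pos b) (pos-≢ a′ b p≢q) (jumps a′ b op oq others)) ⟩
      value u (pos b)            ≡⟨ value-pos b ⟩
      s (dart u q b)             ∎
      where open ≡-Reasoning

  orient : ∀ {p x y z} → Adj G p x → Adj G p y → Adj G p z → Bool
  orient a b c = cyc (pos a) (pos b) (pos c)

  -- The cycle y q x p separates the plane, and z lies on one side of it. Traversing the cycle, z is
  -- thus on the same hand at p as at q, while x and y exchange the roles of predecessor and
  -- successor.
  reverse-orient : ∀ {p q x y z} (px : Adj G p x) (py : Adj G p y) (pz : Adj G p z)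
    (qx : Adj G q x) (qy : Adj G q y) (qz : Adj G q z) →
    p ≢ q → x ≢ y → x ≢ z → y ≢ z → z ≢ p → z ≢ q → orient px py pz ≡ not (orient qx qy qz)
  reverse-orient {p} {q} {x} {y} {z} px py pz qx qy qz p≢q x≢y x≢z y≢z z≢p z≢q =
    trans (sym (proj₁ (turning _ _ _ (pos-≢ px py x≢y) (pos-≢ py pz y≢z) (pos-≢ px pz x≢z))))
      (trans (sym at-p) (trans (cong₂ eqB α β) (trans at-q (proj₂ (turning _ _ _ (pos-≢ qx qy x≢y) (pos-≢ qy qz y≢z) (pos-≢ qx qz x≢z))))))
    where
    x≢p : x ≢ p
    x≢p = adj-irr px ∘ sym
    y≢p : y ≢ p
    y≢p = adj-irr py ∘ sym
    x≢q : x ≢ q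
    x≢q = adj-irr qx ∘ sym
    y≢q : y ≢ q
    y≢q = adj-irr qy ∘ sym
    -- the cycle y q x p
    path : Trail (y ∷ q ∷ x ∷ p ∷ [])
    path = step (λ { (here e) → y≢q e ; (there (here e)) → x≢y (sym e) ; (there (there (here e))) → y≢p e }) (adj-sym qy)
      (step (λ { (here e) → x≢q (sym e) ; (there (here e)) → p≢q (sym e) }) qx
        (step (λ { (here e) → x≢p e }) (adj-sym px) (one p)))
    p0 : rank (y ∷ q ∷ x ∷ p ∷ []) p ≡ 0
    p0 = trans (rank-there y _ p y≢p) (trans (rank-there q _ p (p≢q ∘ sym)) (trans (rank-there x _ p x≢p) (rank-here p [])))
    C : Cut ((y , p) ∷ (y , q) ∷ (q , x) ∷ (x , p) ∷ [])
    C = cut path (s≤s (s≤s (s≤s z≤n))) (adj-sym py) (there (there (there (here refl)))) p0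
    open OnCut C
    open Cut C using (s)
    outside : ∀ {u v} → (u ≡ y → v ≡ p → ⊥) → (u ≡ y → v ≡ q → ⊥) → (u ≡ q → v ≡ x → ⊥) → (u ≡ x → v ≡ p → ⊥) →
              (u , v) ∉ (y , p) ∷ (y , q) ∷ (q , x) ∷ (x , p) ∷ []
    outside a b c d (here refl) = a refl refl
    outside a b c d (there (here refl)) = b refl refl
    outside a b c d (there (there (here refl))) = c refl refl
    outside a b c d (there (there (there (here refl)))) = d refl refl
    at-P : ∀ w → w ≢ x → w ≢ y → Out p w
    at-P w nx ny = outside (λ e _ → y≢p (sym e)) (λ e _ → y≢p (sym e)) (λ e _ → p≢q e) (λ e _ → x≢p (sym e)) ,
                   outside (λ e _ → ny e) (λ e _ → ny e) (λ _ e → x≢p (sym e)) (λ e _ → nx e)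
    at-Q : ∀ w → w ≢ x → w ≢ y → Out q w
    at-Q w nx ny = outside (λ e _ → y≢q (sym e)) (λ e _ → y≢q (sym e)) (λ _ e → nx e) (λ e _ → x≢q (sym e)) ,
                   outside (λ e _ → ny e) (λ e _ → ny e) (λ _ e → x≢q (sym e)) (λ e _ → nx e)
    at-X : ∀ w → w ≢ p → w ≢ q → Out x w
    at-X w np nq = outside (λ e _ → x≢y e) (λ e _ → x≢y e) (λ e _ → x≢q e) (λ _ e → np e) ,
                   outside (λ _ e → x≢p e) (λ _ e → x≢q e) (λ e _ → nq e) (λ _ e → x≢p e)
    at-Z : ∀ w → Out z w
    at-Z w = outside (λ e _ → y≢z (sym e)) (λ e _ → y≢z (sym e)) (λ e _ → z≢q e) (λ e _ → x≢z (sym e)) ,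
             outside (λ _ e → z≢p e) (λ _ e → z≢q e) (λ _ e → x≢z (sym e)) (λ _ e → z≢p e)
    on-px : On p x
    on-px = inj₂ (there (there (there (here refl))))
    on-py : On p y
    on-py = inj₂ (here refl)
    on-qx : On q x
    on-qx = inj₁ (there (there (here refl)))
    on-qy : On q y
    on-qy = inj₂ (there (here refl))
    -- The edges from p and from q to z lie on the same side, the one that contains z.
    α : value p (pos pz) ≡ value q (pos qz)
    α = trans (value-pos pz) (trans (across-r pz qz at-Z) (sym (value-pos qz)))
    -- The left side is carried along the cycle from p over x and q to y.
    β : value p (pos px) ≡ value q (pos qy)
    β = trans (value-pos px)
      (trans (pass px (adj-sym px) (adj-sym qx) p≢q (inj₁ (there (there (there (here refl))))) (inj₂ (there (there (here refl)))) at-X)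
      (trans (pass (adj-sym qx) qx qy x≢y on-qx on-qy at-Q) (sym (value-pos qy))))
    at-p : eqB (value p (pos pz)) (value p (pos px)) ≡ cyc (pos py) (pos pz) (pos px)
    at-p = proj₁ (proj₂ (sides (value p) (pos px) (pos py) (pos-≢ px py x≢y) (jumps px py on-px on-py at-P)))
             (pos pz) (pos-≢ pz px (x≢z ∘ sym)) (pos-≢ pz py (y≢z ∘ sym))
    at-q : eqB (value q (pos qz)) (value q (pos qy)) ≡ cyc (pos qx) (pos qz) (pos qy)
    at-q = proj₁ (proj₂ (sides (value q) (pos qy) (pos qx) (pos-≢ qy qx (x≢y ∘ sym)) (jumps qy qx on-qy on-qx (λ w ny nx → at-Q w nx ny))))
             (pos qz) (pos-≢ qz qy (y≢z ∘ sym)) (pos-≢ qz qx (x≢z ∘ sym))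

  -- Three vertices with three common neighbours would pairwise disagree in orientation.
  no-K₃₃ : ∀ {p q r x y z} → Adj G p x → Adj G p y → Adj G p z → Adj G q x → Adj G q y → Adj G q z →
    Adj G r x → Adj G r y → Adj G r z → p ≢ q → q ≢ r → p ≢ r → x ≢ y → x ≢ z → y ≢ z → ⊥
  no-K₃₃ px py pz qx qy qz rx ry rz p≢q q≢r p≢r x≢y x≢z y≢z = contradict (orient px py pz) (orient qx qy qz) (orient rx ry rz)
      (reverse-orient px py pz qx qy qz p≢q x≢y x≢z y≢z (adj-irr pz ∘ sym) (adj-irr qz ∘ sym))
      (reverse-orient qx qy qz rx ry rz q≢r x≢y x≢z y≢z (adj-irr qz ∘ sym) (adj-irr rz ∘ sym))
      (reverse-orient px py pz rx ry rz p≢r x≢y x≢z y≢z (adj-irr pz ∘ sym) (adj-irr rz ∘ sym))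
    where
    contradict : ∀ a b c → a ≡ not b → b ≡ not c → a ≡ not c → ⊥
    contradict true false true _ _ ()
    contradict false true false _ _ ()

  -- U is a set of vertices; its degree sum is even, being four times |U|.
  odd-boundary : ∀ (U : Fin n → Bool) (L : List Dt) → length L ≡ 3 → Distinct L →
    (∀ d → d ∈ L → U (tail d) ≡ true × U (head d) ≡ false) →
    (∀ d → U (tail d) ≡ true → U (head d) ≡ false → d ∈ L) → ⊥
  odd-boundary U L three dis inL allL = odd-even A B (begin
    A * 4                                     ≡⟨ *-comm A 4 ⟩
    4 * A                                     ≡⟨ sum-const {4} (λ _ → A) A (λ _ → refl) ⟨
    sum {4} (λ _ → A)                         ≡⟨ ∑-comm (λ (_ : Fin 4) u → bit (U u)) ⟩
    sum (λ u → sum {4} (λ _ → bit (U u)))     ≡⟨ sum-cong _ _ (λ u → sum-cong (λ (_ : Fin 4) → bit (U u)) (λ i → bit (U (tail (pack u i)))) (λ i → cong (bit ∘ U) (sym (tail-pack u i)))) ⟩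
    sum (λ u → sum (λ i → bit (U (tail (pack u i))))) ≡⟨ sum-pack (bit ∘ U ∘ tail) ⟨
    sum (bit ∘ U ∘ tail)                      ≡⟨ sum-cong (bit ∘ U ∘ tail) (λ d → (bit (within d) + bit (within (flip d))) + occ L d) pt ⟩
    sum (λ d → (bit (within d) + bit (within (flip d))) + occ L d) ≡⟨ ∑-distrib-+ (λ d → bit (within d) + bit (within (flip d))) (occ L) ⟩
    sum (λ d → bit (within d) + bit (within (flip d))) + sum (occ L) ≡⟨ cong₂ _+_ (∑-distrib-+ (bit ∘ within) (bit ∘ within ∘ flip)) (trans (sum-occ L) three) ⟩
    B + sum (bit ∘ within ∘ flip) + 3             ≡⟨ cong (λ z → B + z + 3) (sum-flip (bit ∘ within)) ⟨
    B + B + 3                                 ∎)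
    where
    open ≡-Reasoning
    within : Dt → Bool
    within d = below toℕ d ∧ (U (tail d) ∧ U (head d))
    A : ℕ
    A = sum (bit ∘ U)
    B : ℕ
    B = sum (bit ∘ within)
    U-tail-flip : ∀ d → U (tail (flip d)) ≡ U (head d)
    U-tail-flip d = cong U (tail-flip d)
    U-head-flip : ∀ d → U (head (flip d)) ≡ U (tail d)
    U-head-flip d = cong U (head-flip d)
    and-true : ∀ a {b} → b ≡ true → bit (a ∧ b) ≡ bit a
    and-true true refl = refl
    and-true false refl = refl
    and-false : ∀ a {b} → b ≡ false → bit (a ∧ b) ≡ 0
    and-false true refl = refl
    and-false false refl = refl
    swap-false : ∀ a b → a ∧ b ≡ false → b ∧ a ≡ false
    swap-false true false _ = refl
    swap-false false true _ = refl
    swap-false false false _ = refl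
    inner : ∀ d → U (tail d) ≡ true → U (head d) ≡ true → bit (within d) + bit (within (flip d)) ≡ 1
    inner d a b = trans (cong₂ _+_ (and-true (below toℕ d) (cong₂ _∧_ a b))
        (and-true (below toℕ (flip d)) (cong₂ _∧_ (trans (U-tail-flip d) b) (trans (U-head-flip d) a))))
      (below-split toℕ FP.toℕ-injective d)
    outer : ∀ d → (U (tail d) ∧ U (head d)) ≡ false → bit (within d) + bit (within (flip d)) ≡ 0
    outer d a = cong₂ _+_ (and-false (below toℕ d) a)
      (and-false (below toℕ (flip d)) (trans (cong₂ _∧_ (U-tail-flip d) (U-head-flip d)) (swap-false (U (tail d)) (U (head d)) a)))
    pt : ∀ d → bit (U (tail d)) ≡ (bit (within d) + bit (within (flip d))) + occ L d
    pt d = pt′ (U (tail d)) (U (head d)) refl refl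
      where
      absent : U (tail d) ≡ false ⊎ U (head d) ≡ true → d ∉ L
      absent (inj₁ e) m∈ = true≢false (proj₁ (inL d m∈)) e
      absent (inj₂ e) m∈ = true≢false e (proj₂ (inL d m∈))
      pt′ : ∀ a b → U (tail d) ≡ a → U (head d) ≡ b → bit (U (tail d)) ≡ (bit (within d) + bit (within (flip d))) + occ L d
      pt′ false b ea eb = trans (cong bit ea) (sym (cong₂ _+_ (outer d (cong (_∧ U (head d)) ea)) (occ-∉ (absent (inj₁ ea)))))
      pt′ true true ea eb = trans (cong bit ea) (sym (cong₂ _+_ (inner d ea eb) (occ-∉ (absent (inj₂ eb)))))
      pt′ true false ea eb = trans (cong bit ea) (sym (cong₂ _+_ (outer d (cong₂ _∧_ ea eb))
        (≤-antisym (occ-distinct dis d) (occ-∈ (allL d ea eb)))))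

  module Triangle {a b c : Fin n} (ab : Adj G a b) (bc : Adj G b c) (ac : Adj G a c) where
    a≢b : a ≢ b
    a≢b = adj-irr ab
    a≢c : a ≢ c
    a≢c = adj-irr ac
    b≢c : b ≢ c
    b≢c = adj-irr bc
    Zs : List (Fin n × Fin n)
    Zs = (a , c) ∷ (a , b) ∷ (b , c) ∷ []
    path : Trail (a ∷ b ∷ c ∷ [])
    path = step (λ { (here e) → a≢b e ; (there (here e)) → a≢c e }) ab (step (λ { (here e) → b≢c e }) bc (one c))
    the-cut : Cut Zs
    the-cut = cut path
      (s≤s (s≤s (s≤s z≤n))) ac (there (there (here refl)))
      (trans (rank-there a _ c a≢c) (trans (rank-there b _ c b≢c) (rank-here c [])))
    open Cut the-cut using (s) public
    open OnCut the-cut public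
    away : ∀ u → u ≢ a → u ≢ b → u ≢ c → ∀ y → Out u y
    away u na nb nc y = (λ { (here refl) → na refl ; (there (here refl)) → na refl ; (there (there (here refl))) → nb refl }) ,
                        (λ { (here refl) → nc refl ; (there (here refl)) → nb refl ; (there (there (here refl))) → nc refl })
    corner : Jumps (value a) (pos ab) (pos ac)
    corner = jumps ab ac (inj₁ (there (here refl))) (inj₁ (here refl))
      (λ y nb nc → (λ { (here refl) → nc refl ; (there (here refl)) → nb refl ; (there (there (here e))) → a≢b (cong proj₁ e) }) ,
                   (λ { (here e) → a≢c (cong proj₂ e) ; (there (here e)) → a≢b (cong proj₂ e) ; (there (there (here e))) → a≢c (cong proj₂ e) }))

    side : Fin n → Bool
    side u = s (pack u zero)

    side-from : ∀ {u v} (e : Adj G u v) → u ≢ a → u ≢ b → u ≢ c → s (dart u v e) ≡ side u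
    side-from {u} {v} e na nb nc = const u (away u na nb nc) _ _ (tail-dart u v e) (tail-pack u zero)

    side-to : ∀ {u v} (e : Adj G u v) → v ≢ a → v ≢ b → v ≢ c → s (dart u v e) ≡ side v
    side-to {u} {v} e na nb nc = trans (out _ (subst₂ Out (sym (tail-dart u v e)) (sym (head-dart u v e))
        (proj₂ (away v na nb nc u) , proj₁ (away v na nb nc u))))
      (trans (cong s (flip-dart e (adj-sym e))) (side-from (adj-sym e) na nb nc))

    -- If the triangle passes through a by opposite edges, the other two edges at a leave to
    -- different sides.
    opposite-sides : ∀ {x y} (ax : Adj G a x) (ay : Adj G a y) → x ≢ b → x ≢ c → y ≢ b → y ≢ c → x ≢ y →
      after (after (pos ab)) ≡ pos ac → side x ≢ side y
    opposite-sides {x} {y} ax ay x≢b x≢c y≢b y≢c x≢y o e =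
      proj₂ (proj₂ (sides (value a) (pos ab) (pos ac) (pos-≢ ab ac b≢c) corner)) (pos ax) (pos ay)
        (pos-≢ ax ab x≢b) (pos-≢ ax ac x≢c) (pos-≢ ay ab y≢b) (pos-≢ ay ac y≢c) (pos-≢ ax ay x≢y) o
        (trans (value-pos ax) (trans (side-to ax (adj-irr ax ∘ sym) x≢b x≢c)
          (trans e (sym (trans (value-pos ay) (side-to ay (adj-irr ay ∘ sym) y≢b y≢c))))))

    same-side : ∀ {x y} → Adj G x y → x ≢ a → x ≢ b → x ≢ c → y ≢ a → y ≢ b → y ≢ c → side x ≡ side y
    same-side xy xa xb xc ya yb yc = trans (sym (side-from xy xa xb xc)) (side-to xy ya yb yc)

  -- Were x opposite to b at a, the triangle abx would separate the adjacent vertices c and y.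
  not-opposite : ∀ {a b x c y} (ab : Adj G a b) → Adj G b x → (ax : Adj G a x) → Adj G a c → Adj G a y → Adj G c y →
    c ≢ b → c ≢ x → y ≢ b → y ≢ x → after (after (pos ab)) ≢ pos ax
  not-opposite ab bx ax ac ay cy c≢b c≢x y≢b y≢x o = opposite-sides ac ay c≢b c≢x y≢b y≢x (adj-irr cy) o
      (same-side cy (adj-irr ac ∘ sym) c≢b c≢x (adj-irr ay ∘ sym) y≢b y≢x)
    where open Triangle ab bx ax

  -- The triangle a b c separates x from y. All neighbours of the three corners are known, so the
  -- part on the side of x is left by exactly three edges, those from x to the corners, in
  -- contradiction to the parity of its degree sum.
  no-K₅⁻ : ∀ {x y a b c} → Adj G x a → Adj G x b → Adj G x c → Adj G y a → Adj G y b → Adj G y c →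
    Adj G a b → Adj G a c → Adj G b c → x ≢ y → ⊥
  no-K₅⁻ {x} {y} {a} {b} {c} xa xb xc ya yb yc ab ac bc x≢y =
    odd-boundary U (dart x a xa ∷ dart x b xb ∷ dart x c xc ∷ []) refl dis inL allL
    where
    ax = adj-sym xa
    ay = adj-sym ya
    xa≢ = adj-irr xa
    xb≢ = adj-irr xb
    xc≢ = adj-irr xc
    ya≢ = adj-irr ya
    yb≢ = adj-irr yb
    yc≢ = adj-irr yc
    open Triangle ab bc ac
    -- Neither x nor y can be opposite to b at a, by `not-opposite`, so c is.
    opposite-c : after (after (pos ab)) ≡ pos ac
    opposite-c with opposite (pos ab) (pos ac) (pos ax) (pos ay) (pos-≢ ab ac b≢c) (pos-≢ ab ax (xb≢ ∘ sym)) (pos-≢ ab ay (yb≢ ∘ sym))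
                      (pos-≢ ac ax (xc≢ ∘ sym)) (pos-≢ ac ay (yc≢ ∘ sym)) (pos-≢ ax ay x≢y)
    ... | inj₁ o = o
    ... | inj₂ (inj₁ o) = ⊥-elim (not-opposite ab (adj-sym xb) ax ac ay (adj-sym yc) (b≢c ∘ sym) (xc≢ ∘ sym) yb≢ (x≢y ∘ sym) o)
    ... | inj₂ (inj₂ o) = ⊥-elim (not-opposite ab (adj-sym yb) ay ac ax (adj-sym xc) (b≢c ∘ sym) (yc≢ ∘ sym) xb≢ x≢y o)
    apart : side x ≢ side y
    apart = opposite-sides ax ay xb≢ xc≢ yb≢ yc≢ x≢y opposite-c
    neighbours : ∀ {v p q r t w} → Adj G v p → Adj G v q → Adj G v r → Adj G v t → p ≢ q → p ≢ r → p ≢ t → q ≢ r → q ≢ t → r ≢ t →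
      Adj G v w → w ≡ p ⊎ (w ≡ q ⊎ (w ≡ r ⊎ w ≡ t))
    neighbours vp vq vr vt pq pr pt qr qt rt vw with covered (pos vp) (pos vq) (pos vr) (pos vt) (pos vw)
        (pos-≢ vp vq pq) (pos-≢ vp vr pr) (pos-≢ vp vt pt) (pos-≢ vq vr qr) (pos-≢ vq vt qt) (pos-≢ vr vt rt)
    ... | inj₁ e = inj₁ (same vw vp e)
      where
      same : ∀ {v p q} (vp : Adj G v p) (vq : Adj G v q) → pos vp ≡ pos vq → p ≡ q
      same {v} vp vq e = trans (sym (pos-head vp)) (trans (cong (head ∘ at-pos v) e) (pos-head vq))
    ... | inj₂ (inj₁ e) = inj₂ (inj₁ (trans (sym (pos-head vw)) (trans (cong (head ∘ at-pos _) e) (pos-head vq))))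
    ... | inj₂ (inj₂ (inj₁ e)) = inj₂ (inj₂ (inj₁ (trans (sym (pos-head vw)) (trans (cong (head ∘ at-pos _) e) (pos-head vr)))))
    ... | inj₂ (inj₂ (inj₂ e)) = inj₂ (inj₂ (inj₂ (trans (sym (pos-head vw)) (trans (cong (head ∘ at-pos _) e) (pos-head vt)))))
    corners : List (Fin n)
    corners = a ∷ b ∷ c ∷ []
    -- The vertices off the triangle that lie on the side of x.
    U : Fin n → Bool
    U u = not ⌊ u ∈? corners ⌋ ∧ ⌊ side u ≟B side x ⌋
    far : ∀ {u} → U u ≡ true → u ∉ corners × side u ≡ side x
    far {u} h with u ∈? corners | side u ≟B side x
    ... | no ne | yes e = ne , e
    U-true : ∀ {u} → u ∉ corners → side u ≡ side x → U u ≡ true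
    U-true {u} ne e with u ∈? corners | side u ≟B side x
    ... | no _ | yes _ = refl
    ... | yes m∈ | _ = ⊥-elim (ne m∈)
    ... | no _ | no ne′ = ⊥-elim (ne′ e)
    U-corner : ∀ {u} → u ∈ corners → U u ≡ false
    U-corner {u} m∈ with u ∈? corners
    ... | yes _ = refl
    ... | no ne = ⊥-elim (ne m∈)
    x∉ : x ∉ corners
    x∉ (here e) = xa≢ e
    x∉ (there (here e)) = xb≢ e
    x∉ (there (there (here e))) = xc≢ e
    distinct-heads : ∀ {v w} (p : Adj G x v) (q : Adj G x w) → v ≢ w → dart x v p ≢ dart x w q
    distinct-heads p q ne e = ne (trans (sym (head-dart x _ p)) (trans (cong head e) (head-dart x _ q)))
    dis : Distinct (dart x a xa ∷ dart x b xb ∷ dart x c xc ∷ [])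
    dis = (λ { (here e) → distinct-heads xa xb a≢b e ; (there (here e)) → distinct-heads xa xc a≢c e }) ∷
          ((λ { (here e) → distinct-heads xb xc b≢c e }) ∷ ((λ ()) ∷ []))
    leaves : ∀ {v} (p : Adj G x v) → v ∈ corners → U (tail (dart x v p)) ≡ true × U (head (dart x v p)) ≡ false
    leaves {v} p m∈ = trans (cong U (tail-dart x v p)) (U-true x∉ refl) , trans (cong U (head-dart x v p)) (U-corner m∈)
    inL : ∀ d → d ∈ dart x a xa ∷ dart x b xb ∷ dart x c xc ∷ [] → U (tail d) ≡ true × U (head d) ≡ false
    inL d (here refl) = leaves xa (here refl)
    inL d (there (here refl)) = leaves xb (there (here refl))
    inL d (there (there (here refl))) = leaves xc (there (there (here refl)))
    from-x : ∀ {v} (p : Adj G x v) d → head d ≡ v → U (tail d) ≡ true → tail d ∈ x ∷ y ∷ [] → d ≡ dart x v p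
    from-x {v} p d h t (here e) = dart-ext (trans e (sym (tail-dart x v p))) (trans h (sym (head-dart x v p)))
    from-x p d h t (there (here e)) = ⊥-elim (apart (sym (subst (λ z → side z ≡ side x) e (proj₂ (far t)))))
    -- An edge from `U` to a corner starts at x or y, since the other neighbours of a corner are
    -- corners.
    beyond : ∀ {v} d → v ∈ corners → head d ≡ v → U (tail d) ≡ true →
      (∀ {w} → Adj G v w → w ∈ a ∷ b ∷ c ∷ x ∷ y ∷ []) → tail d ∈ x ∷ y ∷ []
    beyond d m∈ refl t near with near (adj-sym (head-adj d))
    ... | here e = ⊥-elim (proj₁ (far t) (here e))
    ... | there (here e) = ⊥-elim (proj₁ (far t) (there (here e)))
    ... | there (there (here e)) = ⊥-elim (proj₁ (far t) (there (there (here e))))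
    ... | there (there (there m)) = m
    near-a : ∀ {w} → Adj G a w → w ∈ a ∷ b ∷ c ∷ x ∷ y ∷ []
    near-a aw with neighbours ab ac ax ay b≢c (xb≢ ∘ sym) (yb≢ ∘ sym) (xc≢ ∘ sym) (yc≢ ∘ sym) x≢y aw
    ... | inj₁ e = there (here e)
    ... | inj₂ (inj₁ e) = there (there (here e))
    ... | inj₂ (inj₂ (inj₁ e)) = there (there (there (here e)))
    ... | inj₂ (inj₂ (inj₂ e)) = there (there (there (there (here e))))
    near-b : ∀ {w} → Adj G b w → w ∈ a ∷ b ∷ c ∷ x ∷ y ∷ []
    near-b bw with neighbours (adj-sym ab) bc (adj-sym xb) (adj-sym yb) a≢c (xa≢ ∘ sym) (ya≢ ∘ sym) (xc≢ ∘ sym) (yc≢ ∘ sym) x≢y bw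
    ... | inj₁ e = here e
    ... | inj₂ (inj₁ e) = there (there (here e))
    ... | inj₂ (inj₂ (inj₁ e)) = there (there (there (here e)))
    ... | inj₂ (inj₂ (inj₂ e)) = there (there (there (there (here e))))
    near-c : ∀ {w} → Adj G c w → w ∈ a ∷ b ∷ c ∷ x ∷ y ∷ []
    near-c cw with neighbours (adj-sym ac) (adj-sym bc) (adj-sym xc) (adj-sym yc) a≢b (xa≢ ∘ sym) (ya≢ ∘ sym) (xb≢ ∘ sym) (yb≢ ∘ sym) x≢y cw
    ... | inj₁ e = here e
    ... | inj₂ (inj₁ e) = there (here e)
    ... | inj₂ (inj₂ (inj₁ e)) = there (there (there (here e)))
    ... | inj₂ (inj₂ (inj₂ e)) = there (there (there (there (here e))))
    allL : ∀ d → U (tail d) ≡ true → U (head d) ≡ false → d ∈ dart x a xa ∷ dart x b xb ∷ dart x c xc ∷ []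
    allL d t h = by (head d ∈? corners)
      where
      by : Dec (head d ∈ corners) → d ∈ dart x a xa ∷ dart x b xb ∷ dart x c xc ∷ []
      by (yes (here e)) = here (from-x xa d e t (beyond d (here refl) e t near-a))
      by (yes (there (here e))) = there (here (from-x xb d e t (beyond d (there (here refl)) e t near-b)))
      by (yes (there (there (here e)))) = there (there (here (from-x xc d e t (beyond d (there (there (here refl))) e t near-c))))
      by (no ne) = ⊥-elim (true≢false (U-true ne (trans (sym across) (proj₂ (far t)))) h)
        where
        t∉ = proj₁ (far t)
        across : side (tail d) ≡ side (head d)
        across = same-side (head-adj d) (t∉ ∘ here) (t∉ ∘ there ∘ here) (t∉ ∘ there ∘ there ∘ here)
                   (ne ∘ here) (ne ∘ there ∘ here) (ne ∘ there ∘ there ∘ here)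

-- Excluded patterns in a planar graph, and the equivalence.

module _ {n : ℕ} (G : Graph n) (quartic : Quartic G) (planar : Planar G) (connected : Connected G) (noF₆ : ¬ ContainsF6 G) where
  open Darts G quartic
  open Nonplanar G quartic (proj₂ connected) (proj₁ planar) (proj₂ planar)

  avoids : ∀ p → Descent.Avoiding system p
  avoids p v inj edge = exclude p inj edge
    where
    Inj : Pattern → Set
    Inj p = ∀ {i j} → i < order p → j < order p → v i ≡ v j → i ≡ j
    Edge : Pattern → Set
    Edge p = ∀ {i j} → (i , j) ∈ edges p → ∃[ d ] (tail d ≡ v i × tail (flip d) ≡ v j)
    edge-adj : ∀ p → Edge p → ∀ {i j} → (i , j) ∈ edges p → Adj G (v i) (v j)
    edge-adj p edge m with edge m
    ... | d , a , b = subst₂ (Adj G) a (trans (sym (tail-flip d)) b) (head-adj d)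
    at? : ∀ p i j {_ : T ⌊ (i , j) ∈ᵉ? edges p ⌋} → Edge p → Adj G (v i) (v j)
    at? p i j {m} edge = edge-adj p edge (toWitness m)
    lt : ∀ i k {_ : T ⌊ i <? k ⌋} → i < k
    lt i k {h} = toWitness h
    exclude : ∀ p → Inj p → Edge p → ⊥
    exclude K₃₃ inj e = no-K₃₃ (at? K₃₃ 0 3 e) (at? K₃₃ 0 4 e) (at? K₃₃ 0 5 e) (at? K₃₃ 1 3 e) (at? K₃₃ 1 4 e) (at? K₃₃ 1 5 e)
        (at? K₃₃ 2 3 e) (at? K₃₃ 2 4 e) (at? K₃₃ 2 5 e) (ne 0 1 λ ()) (ne 1 2 λ ()) (ne 0 2 λ ()) (ne 3 4 λ ()) (ne 3 5 λ ()) (ne 4 5 λ ())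
      where
      ne : ∀ i j {_ : T ⌊ i <? 6 ⌋} {_ : T ⌊ j <? 6 ⌋} → i ≢ j → v i ≢ v j
      ne i j {a} {b} i≢j q = i≢j (inj (lt i 6 {a}) (lt j 6 {b}) q)
    exclude K₅⁻ inj e = no-K₅⁻ (at? K₅⁻ 0 2 e) (at? K₅⁻ 0 3 e) (at? K₅⁻ 0 4 e) (at? K₅⁻ 1 2 e) (at? K₅⁻ 1 3 e) (at? K₅⁻ 1 4 e)
        (at? K₅⁻ 2 3 e) (at? K₅⁻ 2 4 e) (at? K₅⁻ 3 4 e) (λ q → case inj (lt 0 5) (lt 1 5) q of λ ())
    exclude F₆ inj e = noF₆ (v ∘ toℕ , (λ {i} {j} q → FP.toℕ-injective (inj (FP.toℕ<n i) (FP.toℕ<n j) q)) ,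
        λ i j h → edge-adj F₆ e (F₆-Pattern.F6-edge i j h))

theorem1 : ∀ {n : ℕ} (G : Graph n) → Quartic G → Planar G →
    (Σ (Circuit G) (λ C → Eulerian C × LocallySelfAvoiding 4 C))
      ⇔ (Connected G × ¬ ContainsF6 G)
theorem1 G quartic planar = mk⇔
  (λ { (C , euler , avoid) → FromCircuit.connected G quartic C euler avoid , no-F₆ G quartic C euler avoid })
  (λ { (connected , noF₆) → Tours.exists-tour G quartic connected (avoids G quartic planar connected noF₆) })
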